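{- Let $F=\mathbb{Q}(\sqrt D)$ with $D>1$ squarefree, $D\notin\{2,3,5\}$, and let $L$ be a totally positive definite ternary quadratic $\mathcal{O}_F$-lattice which is universal. Then $D\in\{6,7,10,13,17,21,33,41,65,77\}$, and moreover: if $D=6$, $L$ corresponds to $\varphi_1^{(6)}$, $\varepsilon_6\varphi_1^{(6)}$, $\varphi_2^{(6)}$ or $\varepsilon_6\varphi_2^{(6)}$; if $D=7$, $L$ corresponds to $\varphi^{(7)}$ or $\varepsilon_7\varphi^{(7)}$; if $D=10$, $L$ is non-free and corresponds to $\varphi^{(10)}$; if $D=13$, $L$ corresponds to $\varphi_{24}^{(13)}$, $\varphi_{12}^{(13)}$, $(\varphi_{12}^{(13)})'$, $\varphi_{\mathrm{h2}}^{(13)}$, $(\varphi_{\mathrm{h2}}^{(13)})'$, $\varphi_{\mathrm{h3}}^{(13)}$, $\varphi_{\mathrm{nm}}^{(13)}$ or $(\varphi_{\mathrm{nm}}^{(13)})'$; if $D=17$, $L$ corresponds to $\varphi_1^{(17)}$, $(\varphi_1^{(17)})'$, $\varphi_2^{(17)}$, $\varphi_3^{(17)}$, $(\varphi_3^{(17)})'$, $\varphi_{\mathrm{nm1}}^{(17)}$, $(\varphi_{\mathrm{nm1}}^{(17)})'$, $\varphi_{\mathrm{nm2}}^{(17)}$, $(\varphi_{\mathrm{nm2}}^{(17)})'$, $\varphi_{\mathrm{nm3}}^{(17)}$ or $(\varphi_{\mathrm{nm3}}^{(17)})'$; if $D=21$, $L$ corresponds to $\varphi^{(21)}$ or $\varepsilon_{21}\varphi^{(21)}$;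 if $D=33$, $L$ corresponds to $\varphi^{(33)}$ or $\varepsilon_{33}\varphi^{(33)}$; if $D=41$, $L$ corresponds to $\varphi^{(41)}$; if $D=65$, $L$ is non-free and corresponds to $\varphi^{(65)}$; if $D=77$, $L$ corresponds to $\varphi^{(77)}$ or $\varepsilon_{77}\varphi^{(77)}$.
   Context: A quadratic $\mathcal{O}_F$-lattice is a finitely generated $\mathcal{O}_F$-submodule $L$ of a quadratic space $(V,Q)$ over $F$ with $Q(L)\subseteq\mathcal{O}_F$ (not necessarily classical); universal means $Q(v)$ is totally positive for all nonzero $v\in L$ and $Q(L\setminus\{0\})$ equals the set of totally positive elements of $\mathcal{O}_F$. $\omega_D=\frac{1+\sqrt D}{2}$ if $D\equiv1\pmod4$, $\omega_D=\sqrt D$ otherwise; $'$ denotes Galois conjugation, and for a form $\varphi$, $\varphi'$ is the form with conjugated coefficients. $\varepsilon_6=5+2\sqrt6$, $\varepsilon_7=8+3\sqrt7$, $\varepsilon_{21}=(5+\sqrt{21})/2$, $\varepsilon_{33}=23+4\sqrt{33}$, $\varepsilon_{77}=(9+\sqrt{77})/2$. For $D=10$, $\mathfrak p_2^{ -1}=\mathbb{Z}\cdot1+\mathbb{Z}\cdot\frac{\sqrt{10}}{2}$; for $D=65$, $\mathfrak p_2^{ -1}=\mathbb{Z}\cdot1+\mathbb{Z}\cdot\frac{1+\omega_{65}}{2}$. A free ternary lattice $L$ corresponds to a ternary form $\varphi$ if it has an $\mathcal{O}_F$-basis $b_1,b_2,b_3$ with $Q(xb_1+yb_2+zb_3)=\varphi(x,y,z)$;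 a lattice $L=\mathcal{O}_Fb_1+\mathcal{O}_Fb_2+\mathfrak p_2^{ -1}b_3$ ($b_i$ linearly independent) corresponds to $\varphi$ if $Q(xb_1+yb_2+zb_3)=\varphi(x,y,z)$ for $x,y\in\mathcal{O}_F$, $z\in\mathfrak p_2^{ -1}$. The forms are: $\varphi_1^{(6)}=x^2+y^2+2z^2+xz+\sqrt6yz$; $\varphi_2^{(6)}=x^2+3y^2+(3+\sqrt6)z^2+xy+(2+\sqrt6)xz$; $\varphi^{(7)}=x^2+y^2+2z^2+\sqrt7yz$; $\varphi_{24}^{(13)}=x^2+y^2+2z^2+\omega_{13}xz+\omega_{13}'yz$; $\varphi_{12}^{(13)}=x^2+y^2+2z^2+xy+\omega_{13}yz$; $\varphi_{\mathrm{h2}}^{(13)}=x^2+2y^2+(3+\omega_{13})z^2+\omega_{13}xy+2xz$; $\varphi_{\mathrm{h3}}^{(13)}=x^2+y^2+(2+\omega_{13})z^2+\omega_{13}yz$; $\varphi_{\mathrm{nm}}^{(13)}=x^2+2y^2+(2+\omega_{13})z^2+\omega_{13}xz+\omega_{13}yz$; $\varphi_1^{(17)}=x^2+y^2+2z^2+xz+\omega_{17}yz$; $\varphi_2^{(17)}=x^2+2y^2+2z^2+\omega_{17}xy+\omega_{17}'xz-yz$; $\varphi_3^{(17)}=x^2+4y^2+6z^2+(1-\omega_{17})xz+(1-4\omega_{17})yz$; $\varphi_{\mathrm{nm1}}^{(17)}=x^2+y^2+2z^2+\omega_{17}yz$; $\varphi_{\mathrm{nm2}}^{(17)}=x^2+(2+\omega_{17})y^2+(6+2\omega_{17})z^2+(1+\omega_{17})xy+3xz$;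 $\varphi_{\mathrm{nm3}}^{(17)}=x^2+(2+\omega_{17})y^2+3z^2+\omega_{17}xz+2yz$; $\varphi^{(21)}=x^2+y^2+\varepsilon_{21}z^2+(1-\varepsilon_{21})yz$; $\varphi^{(33)}=x^2+y^2+2\varepsilon_{33}z^2+(7+3\omega_{33})xz+(2+\omega_{33})yz$; $\varphi^{(41)}=x^2+4y^2+(15-4\omega_{41})z^2+3xy+(4-\omega_{41})xz$; $\varphi^{(77)}=x^2+y^2+2\varepsilon_{77}z^2+(\varepsilon_{77}-1)yz$; $\varphi^{(10)}=x^2+(4+\sqrt{10})y^2+4z^2+2xz+(6+\sqrt{10})yz$ (with $z\in\mathfrak p_2^{ -1}$); $\varphi^{(65)}=x^2+2y^2+4z^2+xy+2xz+(2-\omega_{65})yz$ (with $z\in\mathfrak p_2^{ -1}$). -}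

module Defs where

open import Data.Nat as ℕ using (ℕ; suc; _%_)
open import Data.Nat.Divisibility using (_∣_)
open import Data.Integer as ℤ using (ℤ; +_; -[1+_])
open import Data.Rational as ℚ using (ℚ; 0ℚ; 1ℚ; _/_)
open import Data.Fin using (Fin; zero; suc)
open import Data.Product using (_×_; _,_; Σ; ∃; ∃-syntax)
open import Data.Sum using (_⊎_)
open import Relation.Nullary using (¬_; yes; no)
open import Relation.Binary.PropositionalEquality using (_≡_; _≢_)

SquareFree : ℕ → Set
SquareFree D = ∀ (n : ℕ) → (n ℕ.* n) ∣ D → n ≡ 1

-- Elements of F = ℚ(√D): the pair (a , b) stands for a + b√D.
-- The underlying set does not depend on D; the multiplication does.

F : Set
F = ℚ × ℚ

re im : F → ℚ
re (a , _) = a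
im (_ , b) = b

Dℚ : ℕ → ℚ
Dℚ D = + D / 1

ιℤ : ℤ → F
ιℤ n = (n / 1 , 0ℚ)

ιℚ : ℚ → F
ιℚ q = (q , 0ℚ)

0F 1F : F
0F = (0ℚ , 0ℚ)
1F = (1ℚ , 0ℚ)

√D : F
√D = (0ℚ , 1ℚ)

infixl 6 _+F_ _-F_
_+F_ : F → F → F
(a , b) +F (c , d) = (a ℚ.+ c , b ℚ.+ d)

-F_ : F → F
-F (a , b) = (ℚ.- a , ℚ.- b)

_-F_ : F → F → F
x -F y = x +F (-F y)

mulF : ℕ → F → F → F
mulF D (a , b) (c , d) = (a ℚ.* c ℚ.+ Dℚ D ℚ.* (b ℚ.* d) , a ℚ.* d ℚ.+ b ℚ.* c)

conj : F → F
conj (a , b) = (a , ℚ.- b)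

ω : ℕ → F
ω D with D % 4 ℕ.≟ 1
... | yes _ = (ℚ.½ , ℚ.½)
... | no  _ = √D

InO : ℕ → F → Set
InO D x = ∃[ m ] ∃[ n ] (x ≡ ιℤ m +F mulF D (ιℤ n) (ω D))

InZSpan : ℕ → F → F → Set
InZSpan D γ x = ∃[ m ] ∃[ n ] (x ≡ ιℤ m +F mulF D (ιℤ n) γ)

-- Real embeddings and total positivity.
-- PosEmb D a b  :⇔  the real number a + b·√D (positive root) is > 0.

PosEmb : ℕ → ℚ → ℚ → Set
PosEmb D a b =
    (0ℚ ℚ.≤ a × 0ℚ ℚ.≤ b × ¬ (a ≡ 0ℚ × b ≡ 0ℚ))
  ⊎ (0ℚ ℚ.< a × b ℚ.< 0ℚ × Dℚ D ℚ.* (b ℚ.* b) ℚ.< a ℚ.* a)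
  ⊎ (a ℚ.< 0ℚ × 0ℚ ℚ.< b × a ℚ.* a ℚ.< Dℚ D ℚ.* (b ℚ.* b))

TotPos : ℕ → F → Set
TotPos D (a , b) = PosEmb D a b × PosEmb D a (ℚ.- b)

V : Set
V = F × F × F

0V : V
0V = (0F , 0F , 0F)

infixl 6 _+V_
_+V_ : V → V → V
(x₁ , x₂ , x₃) +V (y₁ , y₂ , y₃) = (x₁ +F y₁ , x₂ +F y₂ , x₃ +F y₃)

scaleV : ℕ → F → V → V
scaleV D c (x₁ , x₂ , x₃) = (mulF D c x₁ , mulF D c x₂ , mulF D c x₃)

record Form : Set where
  constructor form
  field
    c11 c22 c33 c12 c13 c23 : F

evalForm : ℕ → Form → F → F → F → F
evalForm D (form c11 c22 c33 c12 c13 c23) x y z =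
  let _·_ = mulF D in
      (c11 · (x · x)) +F (c22 · (y · y)) +F (c33 · (z · z))
   +F (c12 · (x · y)) +F (c13 · (x · z)) +F (c23 · (y · z))

Qv : ℕ → Form → V → F
Qv D Q (x , y , z) = evalForm D Q x y z

conjForm : Form → Form
conjForm (form a b c d e f) = form (conj a) (conj b) (conj c) (conj d) (conj e) (conj f)

scaleForm : ℕ → F → Form → Form
scaleForm D ε (form a b c d e f) =
  form (mulF D ε a) (mulF D ε b) (mulF D ε c) (mulF D ε d) (mulF D ε e) (mulF D ε f)

-- Lattices: finitely generated O_F-submodules of V, given by n generators.

linComb : ℕ → (n : ℕ) → (Fin n → F) → (Fin n → V) → V
linComb D ℕ.zero    c g = 0V
linComb D (suc n) c g = scaleV D (c zero) (g zero) +V linComb D n (λ i → c (suc i)) (λ i → g (suc i))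

InLat : ℕ → (n : ℕ) → (Fin n → V) → V → Set
InLat D n g v = ∃[ c ] ((∀ i → InO D (c i)) × linComb D n c g ≡ v)

-- L is ternary: it spans the 3-dimensional space V over F (FL = V)
SpansV : ℕ → (n : ℕ) → (Fin n → V) → Set
SpansV D n g = ∀ (v : V) → ∃[ c ] (linComb D n c g ≡ v)

IntegralLat : ℕ → Form → (n : ℕ) → (Fin n → V) → Set
IntegralLat D Q n g = ∀ v → InLat D n g v → InO D (Qv D Q v)

Universal : ℕ → Form → (n : ℕ) → (Fin n → V) → Set
Universal D Q n g =
    (∀ v → InLat D n g v → v ≢ 0V → TotPos D (Qv D Q v))
  × (∀ α → InO D α → TotPos D α → ∃[ v ] (InLat D n g v × Qv D Q v ≡ α))

LinIndep : ℕ → V → V → V → Set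
LinIndep D b₁ b₂ b₃ = ∀ x y z →
  scaleV D x b₁ +V scaleV D y b₂ +V scaleV D z b₃ ≡ 0V →
  (x ≡ 0F × y ≡ 0F × z ≡ 0F)

-- L = O_F b₁ + O_F b₂ + 𝔞 b₃  where 𝔞 is described by the predicate A
HasBasisWith : ℕ → (F → Set) → (n : ℕ) → (Fin n → V) → V → V → V → Set
HasBasisWith D A n g b₁ b₂ b₃ =
    LinIndep D b₁ b₂ b₃
  × (∀ v → InLat D n g v →
        ∃[ x ] ∃[ y ] ∃[ z ] (InO D x × InO D y × A z ×
          v ≡ scaleV D x b₁ +V scaleV D y b₂ +V scaleV D z b₃))
  × (∀ x y z → InO D x → InO D y → A z →
        InLat D n g (scaleV D x b₁ +V scaleV D y b₂ +V scaleV D z b₃))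

CorrWith : ℕ → (F → Set) → Form → (n : ℕ) → (Fin n → V) → Form → Set
CorrWith D A Q n g φ = ∃[ b₁ ] ∃[ b₂ ] ∃[ b₃ ]
  ( HasBasisWith D A n g b₁ b₂ b₃
  × (∀ x y z → InO D x → InO D y → A z →
       Qv D Q (scaleV D x b₁ +V scaleV D y b₂ +V scaleV D z b₃) ≡ evalForm D φ x y z))

Corr : ℕ → Form → (n : ℕ) → (Fin n → V) → Form → Set
Corr D Q n g φ = CorrWith D (InO D) Q n g φ

-- L is free (as O_F-module; rank is 3 since L spans V)
Free : ℕ → (n : ℕ) → (Fin n → V) → Set
Free D n g = ∃[ b₁ ] ∃[ b₂ ] ∃[ b₃ ] HasBasisWith D (InO D) n g b₁ b₂ b₃

q : ℤ → (d : ℕ) → .{{_ : ℕ.NonZero d}} → ℚ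
q n d = n / d

el : ℤ → ℤ → (d : ℕ) → .{{_ : ℕ.NonZero d}} → F
el a b d = (a / d , b / d)

n : ℕ → F
n k = ιℤ (+ k)

ε6 ε7 ε21 ε33 ε77 : F
ε6  = el (+ 5) (+ 2) 1
ε7  = el (+ 8) (+ 3) 1
ε21 = el (+ 5) (+ 1) 2
ε33 = el (+ 23) (+ 4) 1
ε77 = el (+ 9) (+ 1) 2

φ1-6 φ2-6 : Form
φ1-6 = form (n 1) (n 1) (n 2) 0F (n 1) √D
φ2-6 = form (n 1) (n 3) (n 3 +F √D) (n 1) (n 2 +F √D) 0F

φ-7 : Form
φ-7 = form (n 1) (n 1) (n 2) 0F 0F √D

ω13 : F
ω13 = ω 13
φ24-13 φ12-13 φh2-13 φh3-13 φnm-13 : Form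
φ24-13 = form (n 1) (n 1) (n 2) 0F ω13 (conj ω13)
φ12-13 = form (n 1) (n 1) (n 2) (n 1) 0F ω13
φh2-13 = form (n 1) (n 2) (n 3 +F ω13) ω13 (n 2) 0F
φh3-13 = form (n 1) (n 1) (n 2 +F ω13) 0F 0F ω13
φnm-13 = form (n 1) (n 2) (n 2 +F ω13) 0F ω13 ω13

ω17 : F
ω17 = ω 17
φ1-17 φ2-17 φ3-17 φnm1-17 φnm2-17 φnm3-17 : Form
φ1-17   = form (n 1) (n 1) (n 2) 0F (n 1) ω17
φ2-17   = form (n 1) (n 2) (n 2) ω17 (conj ω17) (-F n 1)
φ3-17   = form (n 1) (n 4) (n 6) 0F (n 1 -F ω17) (n 1 -F mulF 17 (n 4) ω17)
φnm1-17 = form (n 1) (n 1) (n 2) 0F 0F ω17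
φnm2-17 = form (n 1) (n 2 +F ω17) (n 6 +F mulF 17 (n 2) ω17) (n 1 +F ω17) (n 3) 0F
φnm3-17 = form (n 1) (n 2 +F ω17) (n 3) 0F ω17 (n 2)

φ-21 : Form
φ-21 = form (n 1) (n 1) ε21 0F 0F (n 1 -F ε21)

φ-33 : Form
φ-33 = form (n 1) (n 1) (mulF 33 (n 2) ε33) 0F
            (n 7 +F mulF 33 (n 3) (ω 33)) (n 2 +F ω 33)

φ-41 : Form
φ-41 = form (n 1) (n 4) (n 15 -F mulF 41 (n 4) (ω 41)) (n 3) (n 4 -F ω 41) 0F

φ-77 : Form
φ-77 = form (n 1) (n 1) (mulF 77 (n 2) ε77) 0F 0F (ε77 -F n 1)

-- D = 10 (third variable in 𝔭₂⁻¹ = ℤ·1 + ℤ·(√10/2))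
φ-10 : Form
φ-10 = form (n 1) (n 4 +F √D) (n 4) 0F (n 2) (n 6 +F √D)

p2inv-10 : F → Set
p2inv-10 = InZSpan 10 (el (+ 0) (+ 1) 2)

-- D = 65 (third variable in 𝔭₂⁻¹ = ℤ·1 + ℤ·(1+ω₆₅)/2)
φ-65 : Form
φ-65 = form (n 1) (n 2) (n 4) (n 1) (n 2) (n 2 -F ω 65)

p2inv-65 : F → Set
p2inv-65 = InZSpan 65 (mulF 65 (ιℚ ℚ.½) (n 1 +F ω 65))

Classification : ℕ → Form → (n : ℕ) → (Fin n → V) → Set
Classification D Q k g =
    (D ≡ 6 × (C φ1-6 ⊎ C (scaleForm 6 ε6 φ1-6) ⊎ C φ2-6 ⊎ C (scaleForm 6 ε6 φ2-6)))
  ⊎ (D ≡ 7 × (C φ-7 ⊎ C (scaleForm 7 ε7 φ-7)))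
  ⊎ (D ≡ 10 × ¬ Free D k g × CorrWith D p2inv-10 Q k g φ-10)
  ⊎ (D ≡ 13 × (C φ24-13 ⊎ C φ12-13 ⊎ C (conjForm φ12-13) ⊎ C φh2-13
               ⊎ C (conjForm φh2-13) ⊎ C φh3-13 ⊎ C φnm-13 ⊎ C (conjForm φnm-13)))
  ⊎ (D ≡ 17 × (C φ1-17 ⊎ C (conjForm φ1-17) ⊎ C φ2-17 ⊎ C φ3-17 ⊎ C (conjForm φ3-17)
               ⊎ C φnm1-17 ⊎ C (conjForm φnm1-17) ⊎ C φnm2-17 ⊎ C (conjForm φnm2-17)
               ⊎ C φnm3-17 ⊎ C (conjForm φnm3-17)))
  ⊎ (D ≡ 21 × (C φ-21 ⊎ C (scaleForm 21 ε21 φ-21)))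
  ⊎ (D ≡ 33 × (C φ-33 ⊎ C (scaleForm 33 ε33 φ-33)))
  ⊎ (D ≡ 41 × C φ-41)
  ⊎ (D ≡ 65 × ¬ Free D k g × CorrWith D p2inv-65 Q k g φ-65)
  ⊎ (D ≡ 77 × (C φ-77 ⊎ C (scaleForm 77 ε77 φ-77)))
  where
    C : Form → Set
    C φ = Corr D Q k g φ

{-# OPTIONS --safe #-}
module Submission where

-- A universal lattice L represents 1, then a further totally positive α, then a β, and so on; Cauchy-Schwarz
-- leaves finitely many possible inner products at each such step (an escalation).  Once three independent
-- vectors are known, any further vector is determined by its inner products with them, so every
-- additional represented element again gives finitely many cases.  Such a search is recorded as a
-- certificate: each branch ends either in an element that cannot be represented, or in a change of basis
-- to one of the listed forms, after which the finitely many classes of L modulo that sublattice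
-- are shown to admit no further vector.  A checker for certificates is proved sound over an arbitrary
-- real quadratic order and evaluated for every squarefree D of small discriminant.  For discriminant
-- at least 961 the integers and one element of small slope cannot be represented together by a
-- ternary form.  In the fields ℚ(√10) and ℚ(√65) the prime above 2 is not principal, because its generator
-- would have norm ±2, so those lattices are not free.

import Algebra
import Data.Bool
import Data.Integer as ℤ
import Data.List.Relation.Unary.All as All
import Data.Nat as ℕ
import Data.Rational as ℚ
import Algebra.Solver.Ring
import Data.Bool.Properties
import Data.Integer.DivMod as ℤ
import Data.Integer.Properties as ℤ
import Data.List.Relation.Unary.Any as Any
import Data.Nat.DivMod as ℕ
import Data.Nat.Divisibility as ℕ
import Data.Nat.Properties as ℕ
import Data.Rational.Properties as ℚ
import Data.Rational.Unnormalised as ℚᵘ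
import Data.Rational.Unnormalised.Properties as ℚᵘ
import Function.Bundles
open import Relation.Binary.PropositionalEquality
open import Data.Bool using (Bool; true; _∧_; not)
open import Data.Bool.Properties using (T-≡)
open import Data.Empty using (⊥-elim; ⊥)
open import Data.Fin using (Fin)
open import Data.Integer using (0ℤ; -[1+_]; ∣_∣)
open import Data.List using (List; filterᵇ; upTo)
open import Data.List.Membership.Propositional using (_∈_)
open import Data.List.Membership.Propositional.Properties using (∈-map⁺)
open import Data.List.Relation.Unary.All using (All)
open import Data.List.Relation.Unary.Any using (here; there)
open import Data.Nat using (ℕ; s≤s; z≤n)
open import Data.Product using (_×_; _,_; proj₁; proj₂; ∃)
open import Data.Rational using (ℚ; 0ℚ; 1ℚ; _/_)
open import Data.Sum using (_⊎_; inj₁; inj₂)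
open import Function.Bundles using (Equivalence)
open import Relation.Nullary using (yes; no; Dec)

-- Nothing is known about a basis of L, and L may fail to be free, so the coordinates of a vector in
-- a known triple need not be integral. Its products with the triple always are, because the polar
-- form B has values in the ring of integers even for non-classical lattices. The search therefore
-- stores every vector through its three products. The adjugate of the Gram matrix, divided by the
-- determinant, turns products back into coordinates, and each test is multiplied through by the
-- determinant, so the checker computes only with pairs of integers. A certificate holds only the
-- choices: targets, new bases, decompositions. The lists of cases are recomputed by the checker,
-- and certificates answer them position by position. When a listed form is reached, the adjugate
-- modulo the determinant leaves finitely many classes of coordinates. Either every vector of L
-- falls into the integral class, or some vector enlarges the sublattice and the search continues.
-- This alternative is decided on the finitely many generators of L. The bound 961 is the square of
-- 31: it provides an integer f of the parity of the discriminant with f at least 30 and f below its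
-- root.

module QuadraticSpaces where

 -- Ternary quadratic spaces over a commutative ring.

 open import Data.Integer using (ℤ)
 open import Algebra.Structures using (IsCommutativeRing)
 open import Data.Maybe using (Maybe; just; nothing)
 open import Algebra using (CommutativeRing)
 open import Algebra.Bundles using (RawRing)
 open import Algebra.Solver.Ring.AlmostCommutativeRing using (_-Raw-AlmostCommutative⟶_; fromCommutativeRing)
 open import Level using (0ℓ)

 -- Polynomial identities are proved once and used both over the integers and over F. The map from
 -- the integers supplies the solver with coefficients whose equality is decided by evaluation.
 record Scalars : Set₁ where
   infixl 6 _+_
   infixl 7 _*_
   infix 8 -_
   field
     Carrier : Set
     _+_ _*_ : Carrier → Carrier → Carrier
     -_ : Carrier → Carrier
     0# 1# : Carrier
     isCommutativeRing : IsCommutativeRing _≡_ _+_ _*_ -_ 0# 1#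
     ⟦_⟧ : ℤ → Carrier
     ⟦⟧-+ : ∀ m n → ⟦ m ℤ.+ n ⟧ ≡ ⟦ m ⟧ + ⟦ n ⟧
     ⟦⟧-* : ∀ m n → ⟦ m ℤ.* n ⟧ ≡ ⟦ m ⟧ * ⟦ n ⟧
     ⟦⟧-neg : ∀ m → ⟦ ℤ.- m ⟧ ≡ - ⟦ m ⟧
     ⟦⟧-0 : ⟦ ℤ.+ 0 ⟧ ≡ 0#
     ⟦⟧-1 : ⟦ ℤ.+ 1 ⟧ ≡ 1#

   commutativeRing : CommutativeRing 0ℓ 0ℓ
   commutativeRing = record { isCommutativeRing = isCommutativeRing }

 module ScalarSolver (S : Scalars) where
   open Scalars S

   integers : RawRing 0ℓ 0ℓ
   integers = record { Carrier = ℤ ; _≈_ = _≡_ ; _+_ = ℤ._+_ ; _*_ = ℤ._*_ ; -_ = ℤ.-_ ; 0# = ℤ.+ 0 ; 1# = ℤ.+ 1 }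

   morphism : integers -Raw-AlmostCommutative⟶ fromCommutativeRing commutativeRing
   morphism = record { ⟦_⟧ = ⟦_⟧ ; +-homo = ⟦⟧-+ ; *-homo = ⟦⟧-* ; -‿homo = ⟦⟧-neg ; 0-homo = ⟦⟧-0 ; 1-homo = ⟦⟧-1 }

   coeff≟ : ∀ m n → Maybe (⟦ m ⟧ ≡ ⟦ n ⟧)
   coeff≟ m n with m ℤ.≟ n
   ... | yes e = just (cong ⟦_⟧ e)
   ... | no  _ = nothing

   open Algebra.Solver.Ring integers (fromCommutativeRing commutativeRing) morphism coeff≟ public
     using (Polynomial; solve; _:=_; _:+_; _:*_; _:-_; :-_; con; var)

 module QuadraticSpace (S : Scalars) where
  open Scalars S
  open ScalarSolver S
  infixl 6 _-_
  _-_ : Carrier → Carrier → Carrier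
  x - y = x + (- y)

  det : (a b c d e f g h i : Carrier) → Carrier
  det a b c d e f g h i = a * (e * i - f * h) - b * (d * i - f * g) + c * (d * h - e * g)

  :det : ∀ {k} (a b c d e f g h i : Polynomial k) → Polynomial k
  :det a b c d e f g h i = a :* (e :* i :- f :* h) :- b :* (d :* i :- f :* g) :+ c :* (d :* h :- e :* g)

  -- The left matrix is A times the transpose of X, its entries being the products of the rows a, b,
  -- c with x, y, z.
  det-* : ∀ a₁ a₂ a₃ b₁ b₂ b₃ c₁ c₂ c₃ x₁ x₂ x₃ y₁ y₂ y₃ z₁ z₂ z₃ →
    det (a₁ * x₁ + a₂ * x₂ + a₃ * x₃) (a₁ * y₁ + a₂ * y₂ + a₃ * y₃) (a₁ * z₁ + a₂ * z₂ + a₃ * z₃)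
        (b₁ * x₁ + b₂ * x₂ + b₃ * x₃) (b₁ * y₁ + b₂ * y₂ + b₃ * y₃) (b₁ * z₁ + b₂ * z₂ + b₃ * z₃)
        (c₁ * x₁ + c₂ * x₂ + c₃ * x₃) (c₁ * y₁ + c₂ * y₂ + c₃ * y₃) (c₁ * z₁ + c₂ * z₂ + c₃ * z₃)
    ≡ det a₁ a₂ a₃ b₁ b₂ b₃ c₁ c₂ c₃ * det x₁ x₂ x₃ y₁ y₂ y₃ z₁ z₂ z₃
  det-* = solve 18 (λ a₁ a₂ a₃ b₁ b₂ b₃ c₁ c₂ c₃ x₁ x₂ x₃ y₁ y₂ y₃ z₁ z₂ z₃ →
    :det (a₁ :* x₁ :+ a₂ :* x₂ :+ a₃ :* x₃) (a₁ :* y₁ :+ a₂ :* y₂ :+ a₃ :* y₃) (a₁ :* z₁ :+ a₂ :* z₂ :+ a₃ :* z₃)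
        (b₁ :* x₁ :+ b₂ :* x₂ :+ b₃ :* x₃) (b₁ :* y₁ :+ b₂ :* y₂ :+ b₃ :* y₃) (b₁ :* z₁ :+ b₂ :* z₂ :+ b₃ :* z₃)
        (c₁ :* x₁ :+ c₂ :* x₂ :+ c₃ :* x₃) (c₁ :* y₁ :+ c₂ :* y₂ :+ c₃ :* y₃) (c₁ :* z₁ :+ c₂ :* z₂ :+ c₃ :* z₃)
    := :det a₁ a₂ a₃ b₁ b₂ b₃ c₁ c₂ c₃ :* :det x₁ x₂ x₃ y₁ y₂ y₃ z₁ z₂ z₃) refl

  Vec : Set
  Vec = Carrier × Carrier × Carrier

  infixl 6 _⊕_
  infixr 7 _⊙_
  _⊕_ : Vec → Vec → Vec
  (x₁ , x₂ , x₃) ⊕ (y₁ , y₂ , y₃) = (x₁ + y₁ , x₂ + y₂ , x₃ + y₃)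

  _⊙_ : Carrier → Vec → Vec
  c ⊙ (x₁ , x₂ , x₃) = (c * x₁ , c * x₂ , c * x₃)

  𝟎 : Vec
  𝟎 = (0# , 0# , 0#)

  ≡³ : ∀ {a b c a′ b′ c′ : Carrier} → a ≡ a′ → b ≡ b′ → c ≡ c′ → (a , b , c) ≡ (a′ , b′ , c′)
  ≡³ refl refl refl = refl

  -- Gram determinant of two vectors for the polar form, whose diagonal entries are `2X` and `2Y`.
  disc₂ : (X Y b : Carrier) → Carrier
  disc₂ X Y b = ⟦ ℤ.+ 4 ⟧ * (X * Y) - b * b

  -- Half of the Gram determinant of three vectors: with diagonal `2X`, `2Y`, `2Z` the determinant
  -- is always divisible by two. The factor is restored wherever the full determinant is meant.
  disc₃ : (X Y Z a b c : Carrier) → Carrier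
  disc₃ X Y Z a b c = ⟦ ℤ.+ 4 ⟧ * (X * (Y * Z)) + a * (b * c) - X * (c * c) - Y * (b * b) - Z * (a * a)

  -- The rows of the adjugate of the Gram matrix with diagonal `2X`, `2Y`, `2Z`, applied to the
  -- column `(x, y, z)`.
  adj₁ adj₂ adj₃ : (X Y Z a b c x y z : Carrier) → Carrier
  adj₁ X Y Z a b c x y z = (⟦ ℤ.+ 4 ⟧ * (Y * Z) - c * c) * x + (b * c - ⟦ ℤ.+ 2 ⟧ * (Z * a)) * y + (a * c - ⟦ ℤ.+ 2 ⟧ * (Y * b)) * z
  adj₂ X Y Z a b c x y z = (b * c - ⟦ ℤ.+ 2 ⟧ * (Z * a)) * x + (⟦ ℤ.+ 4 ⟧ * (X * Z) - b * b) * y + (a * b - ⟦ ℤ.+ 2 ⟧ * (X * c)) * z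
  adj₃ X Y Z a b c x y z = (a * c - ⟦ ℤ.+ 2 ⟧ * (Y * b)) * x + (a * b - ⟦ ℤ.+ 2 ⟧ * (X * c)) * y + (⟦ ℤ.+ 4 ⟧ * (X * Y) - a * a) * z

  private
    :disc₃ : ∀ {k} (X Y Z a b c : Polynomial k) → Polynomial k
    :disc₃ X Y Z a b c = con (ℤ.+ 4) :* (X :* (Y :* Z)) :+ a :* (b :* c) :- X :* (c :* c) :- Y :* (b :* b) :- Z :* (a :* a)
    :adj₁ :adj₂ :adj₃ : ∀ {k} (X Y Z a b c x y z : Polynomial k) → Polynomial k
    :adj₁ X Y Z a b c x y z = (con (ℤ.+ 4) :* (Y :* Z) :- c :* c) :* x :+ (b :* c :- con (ℤ.+ 2) :* (Z :* a)) :* y :+ (a :* c :- con (ℤ.+ 2) :* (Y :* b)) :* z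
    :adj₂ X Y Z a b c x y z = (b :* c :- con (ℤ.+ 2) :* (Z :* a)) :* x :+ (con (ℤ.+ 4) :* (X :* Z) :- b :* b) :* y :+ (a :* b :- con (ℤ.+ 2) :* (X :* c)) :* z
    :adj₃ X Y Z a b c x y z = (a :* c :- con (ℤ.+ 2) :* (Y :* b)) :* x :+ (a :* b :- con (ℤ.+ 2) :* (X :* c)) :* y :+ (con (ℤ.+ 4) :* (X :* Y) :- a :* a) :* z

  gram-adj₁ : ∀ X Y Z a b c x y z → (X + X) * adj₁ X Y Z a b c x y z + a * adj₂ X Y Z a b c x y z + b * adj₃ X Y Z a b c x y z
    ≡ (⟦ ℤ.+ 2 ⟧ * disc₃ X Y Z a b c) * x
  gram-adj₁ = solve 9 (λ X Y Z a b c x y z → (X :+ X) :* :adj₁ X Y Z a b c x y z :+ a :* :adj₂ X Y Z a b c x y z :+ b :* :adj₃ X Y Z a b c x y z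
    := (con (ℤ.+ 2) :* :disc₃ X Y Z a b c) :* x) refl

  gram-adj₂ : ∀ X Y Z a b c x y z → a * adj₁ X Y Z a b c x y z + (Y + Y) * adj₂ X Y Z a b c x y z + c * adj₃ X Y Z a b c x y z
    ≡ (⟦ ℤ.+ 2 ⟧ * disc₃ X Y Z a b c) * y
  gram-adj₂ = solve 9 (λ X Y Z a b c x y z → a :* :adj₁ X Y Z a b c x y z :+ (Y :+ Y) :* :adj₂ X Y Z a b c x y z :+ c :* :adj₃ X Y Z a b c x y z
    := (con (ℤ.+ 2) :* :disc₃ X Y Z a b c) :* y) refl

  gram-adj₃ : ∀ X Y Z a b c x y z → b * adj₁ X Y Z a b c x y z + c * adj₂ X Y Z a b c x y z + (Z + Z) * adj₃ X Y Z a b c x y z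
    ≡ (⟦ ℤ.+ 2 ⟧ * disc₃ X Y Z a b c) * z
  gram-adj₃ = solve 9 (λ X Y Z a b c x y z → b :* :adj₁ X Y Z a b c x y z :+ c :* :adj₂ X Y Z a b c x y z :+ (Z :+ Z) :* :adj₃ X Y Z a b c x y z
    := (con (ℤ.+ 2) :* :disc₃ X Y Z a b c) :* z) refl

  adj-gram₁ : ∀ X Y Z a b c x y z → adj₁ X Y Z a b c ((X + X) * x + a * y + b * z) (a * x + (Y + Y) * y + c * z) (b * x + c * y + (Z + Z) * z)
    ≡ (⟦ ℤ.+ 2 ⟧ * disc₃ X Y Z a b c) * x
  adj-gram₁ = solve 9 (λ X Y Z a b c x y z → :adj₁ X Y Z a b c ((X :+ X) :* x :+ a :* y :+ b :* z) (a :* x :+ (Y :+ Y) :* y :+ c :* z) (b :* x :+ c :* y :+ (Z :+ Z) :* z)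
    := (con (ℤ.+ 2) :* :disc₃ X Y Z a b c) :* x) refl

  adj-gram₂ : ∀ X Y Z a b c x y z → adj₂ X Y Z a b c ((X + X) * x + a * y + b * z) (a * x + (Y + Y) * y + c * z) (b * x + c * y + (Z + Z) * z)
    ≡ (⟦ ℤ.+ 2 ⟧ * disc₃ X Y Z a b c) * y
  adj-gram₂ = solve 9 (λ X Y Z a b c x y z → :adj₂ X Y Z a b c ((X :+ X) :* x :+ a :* y :+ b :* z) (a :* x :+ (Y :+ Y) :* y :+ c :* z) (b :* x :+ c :* y :+ (Z :+ Z) :* z)
    := (con (ℤ.+ 2) :* :disc₃ X Y Z a b c) :* y) refl

  adj-gram₃ : ∀ X Y Z a b c x y z → adj₃ X Y Z a b c ((X + X) * x + a * y + b * z) (a * x + (Y + Y) * y + c * z) (b * x + c * y + (Z + Z) * z)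
    ≡ (⟦ ℤ.+ 2 ⟧ * disc₃ X Y Z a b c) * z
  adj-gram₃ = solve 9 (λ X Y Z a b c x y z → :adj₃ X Y Z a b c ((X :+ X) :* x :+ a :* y :+ b :* z) (a :* x :+ (Y :+ Y) :* y :+ c :* z) (b :* x :+ c :* y :+ (Z :+ Z) :* z)
    := (con (ℤ.+ 2) :* :disc₃ X Y Z a b c) :* z) refl

  -- The solver knows only constants that come from integers. The identity is proved for the image
  -- of the integer zero and transported along `⟦⟧-0`; the same device recurs below for `0#` and
  -- `1#`.
  zero-sum : ∀ x y z → x * 0# + y * 0# + z * 0# ≡ 0#
  zero-sum x y z = subst (λ o → x * o + y * o + z * o ≡ o) ⟦⟧-0
      (solve 3 (λ x y z → x :* con (ℤ.+ 0) :+ y :* con (ℤ.+ 0) :+ z :* con (ℤ.+ 0) := con (ℤ.+ 0)) refl x y z)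

  module TernaryForm (h₁ h₂ h₃ h₁₂ h₁₃ h₂₃ : Carrier) where

   Q : Vec → Carrier
   Q (x , y , z) = h₁ * (x * x) + h₂ * (y * y) + h₃ * (z * z) + h₁₂ * (x * y) + h₁₃ * (x * z) + h₂₃ * (y * z)

   -- The polar form without the factor one half, so that B(u,u) = 2Q(u) and B is integral wherever
   -- Q is.
   B : Vec → Vec → Carrier
   B (x , y , z) (x′ , y′ , z′) =
     (h₁ + h₁) * (x * x′) + (h₂ + h₂) * (y * y′) + (h₃ + h₃) * (z * z′)
     + h₁₂ * (x * y′ + x′ * y) + h₁₃ * (x * z′ + x′ * z) + h₂₃ * (y * z′ + y′ * z)

   Q-⊕ : ∀ u v → Q (u ⊕ v) ≡ Q u + Q v + B u v
   Q-⊕ (x , y , z) (x′ , y′ , z′) = solve 12 (λ h₁ h₂ h₃ h₁₂ h₁₃ h₂₃ x y z x′ y′ z′ →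
       (h₁ :* ((x :+ x′) :* (x :+ x′)) :+ h₂ :* ((y :+ y′) :* (y :+ y′)) :+ h₃ :* ((z :+ z′) :* (z :+ z′))
        :+ h₁₂ :* ((x :+ x′) :* (y :+ y′)) :+ h₁₃ :* ((x :+ x′) :* (z :+ z′)) :+ h₂₃ :* ((y :+ y′) :* (z :+ z′)))
       := (h₁ :* (x :* x) :+ h₂ :* (y :* y) :+ h₃ :* (z :* z) :+ h₁₂ :* (x :* y) :+ h₁₃ :* (x :* z) :+ h₂₃ :* (y :* z))
          :+ (h₁ :* (x′ :* x′) :+ h₂ :* (y′ :* y′) :+ h₃ :* (z′ :* z′) :+ h₁₂ :* (x′ :* y′) :+ h₁₃ :* (x′ :* z′) :+ h₂₃ :* (y′ :* z′))
          :+ ((h₁ :+ h₁) :* (x :* x′) :+ (h₂ :+ h₂) :* (y :* y′) :+ (h₃ :+ h₃) :* (z :* z′)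
              :+ h₁₂ :* (x :* y′ :+ x′ :* y) :+ h₁₃ :* (x :* z′ :+ x′ :* z) :+ h₂₃ :* (y :* z′ :+ y′ :* z)))
     refl h₁ h₂ h₃ h₁₂ h₁₃ h₂₃ x y z x′ y′ z′

   Q-⊙ : ∀ c u → Q (c ⊙ u) ≡ c * c * Q u
   Q-⊙ c (x , y , z) = solve 10 (λ h₁ h₂ h₃ h₁₂ h₁₃ h₂₃ c x y z →
       h₁ :* ((c :* x) :* (c :* x)) :+ h₂ :* ((c :* y) :* (c :* y)) :+ h₃ :* ((c :* z) :* (c :* z))
        :+ h₁₂ :* ((c :* x) :* (c :* y)) :+ h₁₃ :* ((c :* x) :* (c :* z)) :+ h₂₃ :* ((c :* y) :* (c :* z))
       := c :* c :* (h₁ :* (x :* x) :+ h₂ :* (y :* y) :+ h₃ :* (z :* z) :+ h₁₂ :* (x :* y) :+ h₁₃ :* (x :* z) :+ h₂₃ :* (y :* z)))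
     refl h₁ h₂ h₃ h₁₂ h₁₃ h₂₃ c x y z

   B-⊕ : ∀ u v w → B (u ⊕ v) w ≡ B u w + B v w
   B-⊕ (x , y , z) (x′ , y′ , z′) (a , b , c) = solve 15 (λ h₁ h₂ h₃ h₁₂ h₁₃ h₂₃ x y z x′ y′ z′ a b c →
       (h₁ :+ h₁) :* ((x :+ x′) :* a) :+ (h₂ :+ h₂) :* ((y :+ y′) :* b) :+ (h₃ :+ h₃) :* ((z :+ z′) :* c)
         :+ h₁₂ :* ((x :+ x′) :* b :+ a :* (y :+ y′)) :+ h₁₃ :* ((x :+ x′) :* c :+ a :* (z :+ z′)) :+ h₂₃ :* ((y :+ y′) :* c :+ b :* (z :+ z′))
       := ((h₁ :+ h₁) :* (x :* a) :+ (h₂ :+ h₂) :* (y :* b) :+ (h₃ :+ h₃) :* (z :* c)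
           :+ h₁₂ :* (x :* b :+ a :* y) :+ h₁₃ :* (x :* c :+ a :* z) :+ h₂₃ :* (y :* c :+ b :* z))
          :+ ((h₁ :+ h₁) :* (x′ :* a) :+ (h₂ :+ h₂) :* (y′ :* b) :+ (h₃ :+ h₃) :* (z′ :* c)
           :+ h₁₂ :* (x′ :* b :+ a :* y′) :+ h₁₃ :* (x′ :* c :+ a :* z′) :+ h₂₃ :* (y′ :* c :+ b :* z′)))
     refl h₁ h₂ h₃ h₁₂ h₁₃ h₂₃ x y z x′ y′ z′ a b c

   B-⊙ : ∀ k u w → B (k ⊙ u) w ≡ k * B u w
   B-⊙ k (x , y , z) (a , b , c) = solve 13 (λ h₁ h₂ h₃ h₁₂ h₁₃ h₂₃ k x y z a b c →
       (h₁ :+ h₁) :* ((k :* x) :* a) :+ (h₂ :+ h₂) :* ((k :* y) :* b) :+ (h₃ :+ h₃) :* ((k :* z) :* c)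
         :+ h₁₂ :* ((k :* x) :* b :+ a :* (k :* y)) :+ h₁₃ :* ((k :* x) :* c :+ a :* (k :* z)) :+ h₂₃ :* ((k :* y) :* c :+ b :* (k :* z))
       := k :* ((h₁ :+ h₁) :* (x :* a) :+ (h₂ :+ h₂) :* (y :* b) :+ (h₃ :+ h₃) :* (z :* c)
           :+ h₁₂ :* (x :* b :+ a :* y) :+ h₁₃ :* (x :* c :+ a :* z) :+ h₂₃ :* (y :* c :+ b :* z)))
     refl h₁ h₂ h₃ h₁₂ h₁₃ h₂₃ k x y z a b c

   B-sym : ∀ u v → B u v ≡ B v u
   B-sym (x , y , z) (a , b , c) = solve 12 (λ h₁ h₂ h₃ h₁₂ h₁₃ h₂₃ x y z a b c →
       (h₁ :+ h₁) :* (x :* a) :+ (h₂ :+ h₂) :* (y :* b) :+ (h₃ :+ h₃) :* (z :* c)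
           :+ h₁₂ :* (x :* b :+ a :* y) :+ h₁₃ :* (x :* c :+ a :* z) :+ h₂₃ :* (y :* c :+ b :* z)
       := (h₁ :+ h₁) :* (a :* x) :+ (h₂ :+ h₂) :* (b :* y) :+ (h₃ :+ h₃) :* (c :* z)
           :+ h₁₂ :* (a :* y :+ x :* b) :+ h₁₃ :* (a :* z :+ x :* c) :+ h₂₃ :* (b :* z :+ y :* c))
     refl h₁ h₂ h₃ h₁₂ h₁₃ h₂₃ x y z a b c

   B-self : ∀ u → B u u ≡ Q u + Q u
   B-self (x , y , z) = solve 9 (λ h₁ h₂ h₃ h₁₂ h₁₃ h₂₃ x y z →
       (h₁ :+ h₁) :* (x :* x) :+ (h₂ :+ h₂) :* (y :* y) :+ (h₃ :+ h₃) :* (z :* z)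
           :+ h₁₂ :* (x :* y :+ x :* y) :+ h₁₃ :* (x :* z :+ x :* z) :+ h₂₃ :* (y :* z :+ y :* z)
       := (h₁ :* (x :* x) :+ h₂ :* (y :* y) :+ h₃ :* (z :* z) :+ h₁₂ :* (x :* y) :+ h₁₃ :* (x :* z) :+ h₂₃ :* (y :* z))
        :+ (h₁ :* (x :* x) :+ h₂ :* (y :* y) :+ h₃ :* (z :* z) :+ h₁₂ :* (x :* y) :+ h₁₃ :* (x :* z) :+ h₂₃ :* (y :* z)))
     refl h₁ h₂ h₃ h₁₂ h₁₃ h₂₃ x y z

   vol : Vec → Vec → Vec → Carrier
   vol (x₁ , x₂ , x₃) (y₁ , y₂ , y₃) (z₁ , z₂ , z₃) = det x₁ x₂ x₃ y₁ y₂ y₃ z₁ z₂ z₃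

   discr : Carrier
   discr = det (h₁ + h₁) h₁₂ h₁₃ h₁₂ (h₂ + h₂) h₂₃ h₁₃ h₂₃ (h₃ + h₃)

   -- Four vectors in a space of rank three are dependent, with volumes as coefficients.
   cramer : ∀ u v w t → vol u v w ⊙ t ≡ vol t v w ⊙ u ⊕ vol u t w ⊙ v ⊕ vol u v t ⊙ w
   cramer (x₁ , x₂ , x₃) (y₁ , y₂ , y₃) (z₁ , z₂ , z₃) (t₁ , t₂ , t₃) =
     ≡³ (solve 12 (λ x₁ x₂ x₃ y₁ y₂ y₃ z₁ z₂ z₃ t₁ t₂ t₃ → D x₁ x₂ x₃ y₁ y₂ y₃ z₁ z₂ z₃ :* t₁
          := D t₁ t₂ t₃ y₁ y₂ y₃ z₁ z₂ z₃ :* x₁ :+ D x₁ x₂ x₃ t₁ t₂ t₃ z₁ z₂ z₃ :* y₁ :+ D x₁ x₂ x₃ y₁ y₂ y₃ t₁ t₂ t₃ :* z₁)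
           refl x₁ x₂ x₃ y₁ y₂ y₃ z₁ z₂ z₃ t₁ t₂ t₃)
        (solve 12 (λ x₁ x₂ x₃ y₁ y₂ y₃ z₁ z₂ z₃ t₁ t₂ t₃ → D x₁ x₂ x₃ y₁ y₂ y₃ z₁ z₂ z₃ :* t₂
          := D t₁ t₂ t₃ y₁ y₂ y₃ z₁ z₂ z₃ :* x₂ :+ D x₁ x₂ x₃ t₁ t₂ t₃ z₁ z₂ z₃ :* y₂ :+ D x₁ x₂ x₃ y₁ y₂ y₃ t₁ t₂ t₃ :* z₂)
           refl x₁ x₂ x₃ y₁ y₂ y₃ z₁ z₂ z₃ t₁ t₂ t₃)
        (solve 12 (λ x₁ x₂ x₃ y₁ y₂ y₃ z₁ z₂ z₃ t₁ t₂ t₃ → D x₁ x₂ x₃ y₁ y₂ y₃ z₁ z₂ z₃ :* t₃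
          := D t₁ t₂ t₃ y₁ y₂ y₃ z₁ z₂ z₃ :* x₃ :+ D x₁ x₂ x₃ t₁ t₂ t₃ z₁ z₂ z₃ :* y₃ :+ D x₁ x₂ x₃ y₁ y₂ y₃ t₁ t₂ t₃ :* z₃)
           refl x₁ x₂ x₃ y₁ y₂ y₃ z₁ z₂ z₃ t₁ t₂ t₃)
     where D = :det

   -- The Gram matrix factors as U H Uᵀ, where the rows of U are the three vectors and H is the Gram
   -- matrix of the coordinate basis. The functions `r₁`, `r₂`, `r₃` are the entries of H applied to
   -- a vector.
   gram-det : ∀ u v w → det (B u u) (B u v) (B u w) (B v u) (B v v) (B v w) (B w u) (B w v) (B w w)
              ≡ vol u v w * (vol u v w * discr)
   gram-det u@(x₁ , x₂ , x₃) v@(y₁ , y₂ , y₃) w@(z₁ , z₂ , z₃) = begin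
     det (B u u) (B u v) (B u w) (B v u) (B v v) (B v w) (B w u) (B w v) (B w w)
       ≡⟨ cong-det (step u u) (step u v) (step u w) (step v u) (step v v) (step v w) (step w u) (step w v) (step w w) ⟩
     _ ≡⟨ det-* x₁ x₂ x₃ y₁ y₂ y₃ z₁ z₂ z₃ (r₁ u) (r₂ u) (r₃ u) (r₁ v) (r₂ v) (r₃ v) (r₁ w) (r₂ w) (r₃ w) ⟩
     vol u v w * det (r₁ u) (r₂ u) (r₃ u) (r₁ v) (r₂ v) (r₃ v) (r₁ w) (r₂ w) (r₃ w)
       ≡⟨ cong (vol u v w *_) (det-* x₁ x₂ x₃ y₁ y₂ y₃ z₁ z₂ z₃ (h₁ + h₁) h₁₂ h₁₃ h₁₂ (h₂ + h₂) h₂₃ h₁₃ h₂₃ (h₃ + h₃)) ⟩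
     vol u v w * (vol u v w * discr) ∎
     where
     open ≡-Reasoning
     r₁ r₂ r₃ : Vec → Carrier
     r₁ (x , y , z) = x * (h₁ + h₁) + y * h₁₂ + z * h₁₃
     r₂ (x , y , z) = x * h₁₂ + y * (h₂ + h₂) + z * h₂₃
     r₃ (x , y , z) = x * h₁₃ + y * h₂₃ + z * (h₃ + h₃)
     step : ∀ s t → B s t ≡ proj₁ s * r₁ t + proj₁ (proj₂ s) * r₂ t + proj₂ (proj₂ s) * r₃ t
     step (x , y , z) (a , b , c) = solve 12 (λ h₁ h₂ h₃ h₁₂ h₁₃ h₂₃ x y z a b c →
       (h₁ :+ h₁) :* (x :* a) :+ (h₂ :+ h₂) :* (y :* b) :+ (h₃ :+ h₃) :* (z :* c)
           :+ h₁₂ :* (x :* b :+ a :* y) :+ h₁₃ :* (x :* c :+ a :* z) :+ h₂₃ :* (y :* c :+ b :* z)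
       := x :* (a :* (h₁ :+ h₁) :+ b :* h₁₂ :+ c :* h₁₃) :+ y :* (a :* h₁₂ :+ b :* (h₂ :+ h₂) :+ c :* h₂₃)
          :+ z :* (a :* h₁₃ :+ b :* h₂₃ :+ c :* (h₃ :+ h₃))) refl h₁ h₂ h₃ h₁₂ h₁₃ h₂₃ x y z a b c
     cong-det : ∀ {a b c d e f g h i a′ b′ c′ d′ e′ f′ g′ h′ i′} → a ≡ a′ → b ≡ b′ → c ≡ c′ → d ≡ d′ → e ≡ e′ → f ≡ f′
       → g ≡ g′ → h ≡ h′ → i ≡ i′ → det a b c d e f g h i ≡ det a′ b′ c′ d′ e′ f′ g′ h′ i′
     cong-det refl refl refl refl refl refl refl refl refl = refl

   B-sum : ∀ x y z u v t s → B (x ⊙ u ⊕ y ⊙ v ⊕ z ⊙ t) s ≡ x * B u s + y * B v s + z * B t s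
   B-sum x y z u v t s = trans (B-⊕ _ _ s) (cong₂ _+_ (trans (B-⊕ _ _ s) (cong₂ _+_ (B-⊙ x u s) (B-⊙ y v s))) (B-⊙ z t s))

   private
     :det-gram : ∀ X Y Z a b c → det (X + X) a b a (Y + Y) c b c (Z + Z) ≡ ⟦ ℤ.+ 2 ⟧ * disc₃ X Y Z a b c
     :det-gram = solve 6 (λ X Y Z a b c → :det (X :+ X) a b a (Y :+ Y) c b c (Z :+ Z) := con (ℤ.+ 2) :* :disc₃ X Y Z a b c) refl

   -- Besides its use for orthogonal vectors, this shows that the volume of a triple with
   -- cancellable discriminant is itself cancellable.
   volume-discriminant : ∀ u v w → ⟦ ℤ.+ 2 ⟧ * disc₃ (Q u) (Q v) (Q w) (B u v) (B u w) (B v w) ≡ vol u v w * (vol u v w * discr)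
   volume-discriminant u v w = trans (sym (:det-gram _ _ _ _ _ _)) (trans (sym same) (gram-det u v w))
     where
     cong-det : ∀ {a b c d e f g h i a′ b′ c′ d′ e′ f′ g′ h′ i′} → a ≡ a′ → b ≡ b′ → c ≡ c′ → d ≡ d′ → e ≡ e′ → f ≡ f′
       → g ≡ g′ → h ≡ h′ → i ≡ i′ → det a b c d e f g h i ≡ det a′ b′ c′ d′ e′ f′ g′ h′ i′
     cong-det refl refl refl refl refl refl refl refl refl = refl
     same : det (B u u) (B u v) (B u w) (B v u) (B v v) (B v w) (B w u) (B w v) (B w w)
          ≡ det (Q u + Q u) (B u v) (B u w) (B u v) (Q v + Q v) (B v w) (B u w) (B v w) (Q w + Q w)
     same = cong-det (B-self u) refl refl (B-sym v u) (B-self v) refl (B-sym w u) (B-sym w v) (B-self w)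

   -- A vector t orthogonal to u, v, w satisfies vol(u,v,w) B(t,t) = 0 by Cramer's rule, and vol² divides the Gram determinant.
   orthogonal-isotropic : ∀ u v w t → B u t ≡ 0# → B v t ≡ 0# → B w t ≡ 0# →
     (⟦ ℤ.+ 2 ⟧ * disc₃ (Q u) (Q v) (Q w) (B u v) (B u w) (B v w)) * (Q t + Q t) ≡ 0#
   orthogonal-isotropic u v w t ut vt wt = begin
     (⟦ ℤ.+ 2 ⟧ * disc₃ (Q u) (Q v) (Q w) (B u v) (B u w) (B v w)) * (Q t + Q t)
       ≡⟨ cong₂ _*_ (volume-discriminant u v w) (sym (B-self t)) ⟩
     V * (V * discr) * B t t
       ≡⟨ solve 3 (λ V d q → V :* (V :* d) :* q := V :* d :* (V :* q)) refl V discr (B t t) ⟩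
     V * discr * (V * B t t) ≡⟨ cong (V * discr *_) V*Btt ⟩
     V * discr * 0# ≡⟨ trans (sym (0+0 _)) (zero-sum (V * discr) 0# 0#) ⟩
     0# ∎
     where
     open ≡-Reasoning
     V = vol u v w
     0+0 : ∀ x → x * 0# + 0# * 0# + 0# * 0# ≡ x * 0#
     0+0 x = subst (λ o → x * o + o * o + o * o ≡ x * o) ⟦⟧-0
       (solve 1 (λ x → x :* con (ℤ.+ 0) :+ con (ℤ.+ 0) :* con (ℤ.+ 0) :+ con (ℤ.+ 0) :* con (ℤ.+ 0) := x :* con (ℤ.+ 0)) refl x)
     V*Btt : V * B t t ≡ 0#
     V*Btt = begin
       V * B t t                          ≡⟨ sym (B-⊙ V t t) ⟩
       B (V ⊙ t) t                        ≡⟨ cong (λ z → B z t) (cramer u v w t) ⟩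
       B (vol t v w ⊙ u ⊕ vol u t w ⊙ v ⊕ vol u v t ⊙ w) t ≡⟨ B-sum _ _ _ u v w t ⟩
       vol t v w * B u t + vol u t w * B v t + vol u v t * B w t
         ≡⟨ cong₂ _+_ (cong₂ _+_ (cong (vol t v w *_) ut) (cong (vol u t w *_) vt)) (cong (vol u v t *_) wt) ⟩
       vol t v w * 0# + vol u t w * 0# + vol u v t * 0# ≡⟨ zero-sum _ _ _ ⟩
       0# ∎

  -- The later argument sees Q and B only through these laws and never unfolds the polynomials. Rank
  -- three enters through the last field alone.
  record QuadraticForm : Set where
   field
    Q : Vec → Carrier
    B : Vec → Vec → Carrier
    Q-⊕ : ∀ u v → Q (u ⊕ v) ≡ Q u + Q v + B u v
    Q-⊙ : ∀ c u → Q (c ⊙ u) ≡ c * c * Q u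
    B-⊕ : ∀ u v w → B (u ⊕ v) w ≡ B u w + B v w
    B-⊙ : ∀ k u w → B (k ⊙ u) w ≡ k * B u w
    B-sym : ∀ u v → B u v ≡ B v u
    B-self : ∀ u → B u u ≡ Q u + Q u
    orthogonal-isotropic : ∀ u v w t → B u t ≡ 0# → B v t ≡ 0# → B w t ≡ 0# →
      (⟦ ℤ.+ 2 ⟧ * disc₃ (Q u) (Q v) (Q w) (B u v) (B u w) (B v w)) * (Q t + Q t) ≡ 0#

   B-⊙ʳ : ∀ k u w → B w (k ⊙ u) ≡ k * B w u
   B-⊙ʳ k u w = trans (B-sym w (k ⊙ u)) (trans (B-⊙ k u w) (cong (k *_) (B-sym u w)))

   B-sum : ∀ x y z u v t s → B (x ⊙ u ⊕ y ⊙ v ⊕ z ⊙ t) s ≡ x * B u s + y * B v s + z * B t s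
   B-sum x y z u v t s = trans (B-⊕ _ _ s) (cong₂ _+_ (trans (B-⊕ _ _ s) (cong₂ _+_ (B-⊙ x u s) (B-⊙ y v s))) (B-⊙ z t s))

   Q-2 : ∀ x y u v → Q (x ⊙ u ⊕ y ⊙ v) ≡ x * x * Q u + y * y * Q v + x * (y * B u v)
   Q-2 x y u v = trans (Q-⊕ _ _) (cong₂ _+_ (cong₂ _+_ (Q-⊙ x u) (Q-⊙ y v)) (trans (B-⊙ x u (y ⊙ v)) (cong (x *_) (B-⊙ʳ y v u))))

   Q-3 : ∀ x y z u v t → Q (x ⊙ u ⊕ y ⊙ v ⊕ z ⊙ t)
         ≡ x * x * Q u + y * y * Q v + x * (y * B u v) + z * z * Q t + z * (x * B u t + y * B v t)
   Q-3 x y z u v t = trans (Q-⊕ _ _) (cong₂ _+_ (cong₂ _+_ (Q-2 x y u v) (Q-⊙ z t))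
     (trans (B-⊙ʳ z t _) (cong (z *_) (trans (B-⊕ _ _ t) (cong₂ _+_ (B-⊙ x u t) (B-⊙ y v t))))))
   -- The argument of Q is `2Q(u)` times the component of `v` orthogonal to `u`. Its value contains
   -- the Cauchy-Schwarz expression as a factor, and no division occurs.
   project₂ : ∀ u v → Q ((Q u + Q u) ⊙ v ⊕ (- B u v) ⊙ u) ≡ Q u * disc₂ (Q u) (Q v) (B u v)
   project₂ u v = trans (Q-2 _ _ v u) (trans (cong (λ z → (Q u + Q u) * (Q u + Q u) * Q v + (- B u v) * (- B u v) * Q u + (Q u + Q u) * ((- B u v) * z)) (B-sym v u)) (lemma (Q u) (Q v) (B u v)))
     where
     lemma : ∀ X Y b → (X + X) * (X + X) * Y + (- b) * (- b) * X + (X + X) * ((- b) * b) ≡ X * disc₂ X Y b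
     lemma = solve 3 (λ X Y b → (X :+ X) :* (X :+ X) :* Y :+ (:- b) :* (:- b) :* X :+ (X :+ X) :* ((:- b) :* b)
       := X :* (con (ℤ.+ 4) :* (X :* Y) :- b :* b)) refl

   -- The argument of Q is the component of `t` orthogonal to `u` and `v`, cleared of denominators
   -- by `disc₂`.
   project₃ : ∀ u v t → let X = Q u ; Y = Q v ; a = B u v ; b = B u t ; c = B v t in
     Q ((a * c - (Y + Y) * b) ⊙ u ⊕ (a * b - (X + X) * c) ⊙ v ⊕ disc₂ X Y a ⊙ t) ≡ disc₂ X Y a * disc₃ X Y (Q t) a b c
   project₃ u v t = trans (Q-3 _ _ _ u v t) (lemma (Q u) (Q v) (Q t) (B u v) (B u t) (B v t))
     where
     lemma : ∀ X Y Z a b c → let x = a * c - (Y + Y) * b ; y = a * b - (X + X) * c ; z = disc₂ X Y a in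
       x * x * X + y * y * Y + x * (y * a) + z * z * Z + z * (x * b + y * c) ≡ z * disc₃ X Y Z a b c
     lemma = solve 6 (λ X Y Z a b c → let x = a :* c :- (Y :+ Y) :* b ; y = a :* b :- (X :+ X) :* c ; z = con (ℤ.+ 4) :* (X :* Y) :- a :* a in
       x :* x :* X :+ y :* y :* Y :+ x :* (y :* a) :+ z :* z :* Z :+ z :* (x :* b :+ y :* c)
       := z :* (con (ℤ.+ 4) :* (X :* (Y :* Z)) :+ a :* (b :* c) :- X :* (c :* c) :- Y :* (b :* b) :- Z :* (a :* a))) refl


  ternaryForm : (h₁ h₂ h₃ h₁₂ h₁₃ h₂₃ : Carrier) → QuadraticForm
  ternaryForm h₁ h₂ h₃ h₁₂ h₁₃ h₂₃ = record { TernaryForm h₁ h₂ h₃ h₁₂ h₁₃ h₂₃ }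

-- Module laws for coordinate triples.

module Vectors where
 open QuadraticSpaces
 open import Data.Integer using (ℤ)

 module VectorLaws (S : Scalars) where
   open Scalars S
   open QuadraticSpace S
   open ScalarSolver S

   0-left : ∀ x → 0# * x ≡ 0#
   0-left x = subst (λ o → o * x ≡ o) ⟦⟧-0 (solve 1 (λ x → con 0ℤ :* x := con 0ℤ) refl x)

   0-right : ∀ x → x * 0# ≡ 0#
   0-right x = subst (λ o → x * o ≡ o) ⟦⟧-0 (solve 1 (λ x → x :* con 0ℤ := con 0ℤ) refl x)

   0+ : ∀ x → 0# + x ≡ x
   0+ x = subst (λ o → o + x ≡ x) ⟦⟧-0 (solve 1 (λ x → con 0ℤ :+ x := x) refl x)

   +0 : ∀ x → x + 0# ≡ x
   +0 x = subst (λ o → x + o ≡ x) ⟦⟧-0 (solve 1 (λ x → x :+ con 0ℤ := x) refl x)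

   1* : ∀ x → 1# * x ≡ x
   1* x = subst (λ o → o * x ≡ x) ⟦⟧-1 (solve 1 (λ x → con (ℤ.+ 1) :* x := x) refl x)

   ⊕-assoc : ∀ u v t → (u ⊕ v) ⊕ t ≡ u ⊕ (v ⊕ t)
   ⊕-assoc _ _ _ = ≡³ (l _ _ _) (l _ _ _) (l _ _ _)
     where l : ∀ a b c → (a + b) + c ≡ a + (b + c)
           l = solve 3 (λ a b c → (a :+ b) :+ c := a :+ (b :+ c)) refl

   ⊕-swap : ∀ u v t s → (u ⊕ v) ⊕ (t ⊕ s) ≡ (u ⊕ t) ⊕ (v ⊕ s)
   ⊕-swap _ _ _ _ = ≡³ (l _ _ _ _) (l _ _ _ _) (l _ _ _ _)
     where l : ∀ a b c d → (a + b) + (c + d) ≡ (a + c) + (b + d)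
           l = solve 4 (λ a b c d → (a :+ b) :+ (c :+ d) := (a :+ c) :+ (b :+ d)) refl

   ⊙-+ : ∀ x y u → (x + y) ⊙ u ≡ x ⊙ u ⊕ y ⊙ u
   ⊙-+ x y _ = ≡³ (l _) (l _) (l _)
     where l : ∀ a → (x + y) * a ≡ x * a + y * a
           l a = solve 3 (λ x y a → (x :+ y) :* a := x :* a :+ y :* a) refl x y a

   ⊙-⊕ : ∀ x u v → x ⊙ (u ⊕ v) ≡ x ⊙ u ⊕ x ⊙ v
   ⊙-⊕ x _ _ = ≡³ (l _ _) (l _ _) (l _ _)
     where l : ∀ a b → x * (a + b) ≡ x * a + x * b
           l a b = solve 3 (λ x a b → x :* (a :+ b) := x :* a :+ x :* b) refl x a b

   ⊙-* : ∀ x y u → (x * y) ⊙ u ≡ x ⊙ (y ⊙ u)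
   ⊙-* x y _ = ≡³ (l _) (l _) (l _)
     where l : ∀ a → (x * y) * a ≡ x * (y * a)
           l a = solve 3 (λ x y a → (x :* y) :* a := x :* (y :* a)) refl x y a

   ⊙-𝟎 : ∀ x → x ⊙ 𝟎 ≡ 𝟎
   ⊙-𝟎 x = ≡³ (0-right x) (0-right x) (0-right x)

   0-⊙ : ∀ u → 0# ⊙ u ≡ 𝟎
   0-⊙ _ = ≡³ (0-left _) (0-left _) (0-left _)

   1-⊙ : ∀ u → 1# ⊙ u ≡ u
   1-⊙ _ = ≡³ (1* _) (1* _) (1* _)

   𝟎-⊕ : ∀ u → 𝟎 ⊕ u ≡ u
   𝟎-⊕ _ = ≡³ (0+ _) (0+ _) (0+ _)

   ⊕-𝟎 : ∀ u → u ⊕ 𝟎 ≡ u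
   ⊕-𝟎 _ = ≡³ (+0 _) (+0 _) (+0 _)


   rearrange : ∀ v d y → v * (v * d) * y ≡ v * d * (v * y)
   rearrange = solve 3 (λ v d y → v :* (v :* d) :* y := v :* d :* (v :* y)) refl

   first : ∀ u v t → 1# ⊙ u ⊕ 0# ⊙ v ⊕ 0# ⊙ t ≡ u
   first u v t = trans (cong₂ _⊕_ (trans (cong₂ _⊕_ (1-⊙ u) (0-⊙ v)) (⊕-𝟎 u)) (0-⊙ t)) (⊕-𝟎 u)

   second : ∀ u v t → 0# ⊙ u ⊕ 1# ⊙ v ⊕ 0# ⊙ t ≡ v
   second u v t = trans (cong₂ _⊕_ (trans (cong₂ _⊕_ (0-⊙ u) (1-⊙ v)) (𝟎-⊕ v)) (0-⊙ t)) (⊕-𝟎 v)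

   third : ∀ u v t → 0# ⊙ u ⊕ 0# ⊙ v ⊕ 1# ⊙ t ≡ t
   third u v t = trans (cong₂ _⊕_ (trans (cong₂ _⊕_ (0-⊙ u) (0-⊙ v)) (⊕-𝟎 𝟎)) (1-⊙ t)) (𝟎-⊕ t)

-- Comparison of volumes, for the lattices that are not free.

module BasisChange where
 open QuadraticSpaces
 open Vectors
 open import Data.Integer using (ℤ)

 module ChangeOfBasis (S : Scalars) where
   open Scalars S
   open QuadraticSpace S
   open VectorLaws S
   open ScalarSolver S

   volume : Vec → Vec → Vec → Carrier
   volume (x₁ , x₂ , x₃) (y₁ , y₂ , y₃) (z₁ , z₂ , z₃) = det x₁ x₂ x₃ y₁ y₂ y₃ z₁ z₂ z₃

   span³ : Vec → Vec → Vec → Vec → Vec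
   span³ e₁ e₂ e₃ (x , y , z) = x ⊙ e₁ ⊕ y ⊙ e₂ ⊕ z ⊙ e₃

   volume-span³ : ∀ e₁ e₂ e₃ r s t → volume (span³ e₁ e₂ e₃ r) (span³ e₁ e₂ e₃ s) (span³ e₁ e₂ e₃ t) ≡ volume r s t * volume e₁ e₂ e₃
   volume-span³ (x₁ , y₁ , z₁) (x₂ , y₂ , z₂) (x₃ , y₃ , z₃) (a₁ , a₂ , a₃) (b₁ , b₂ , b₃) (c₁ , c₂ , c₃) =
     trans (det-* a₁ a₂ a₃ b₁ b₂ b₃ c₁ c₂ c₃ x₁ x₂ x₃ y₁ y₂ y₃ z₁ z₂ z₃)
       (cong (det a₁ a₂ a₃ b₁ b₂ b₃ c₁ c₂ c₃ *_) (transpose x₁ x₂ x₃ y₁ y₂ y₃ z₁ z₂ z₃))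
     where
     transpose : ∀ x₁ x₂ x₃ y₁ y₂ y₃ z₁ z₂ z₃ → det x₁ x₂ x₃ y₁ y₂ y₃ z₁ z₂ z₃ ≡ det x₁ y₁ z₁ x₂ y₂ z₂ x₃ y₃ z₃
     transpose = solve 9 (λ x₁ x₂ x₃ y₁ y₂ y₃ z₁ z₂ z₃ → :det x₁ x₂ x₃ y₁ y₂ y₃ z₁ z₂ z₃ := :det x₁ y₁ z₁ x₂ y₂ z₂ x₃ y₃ z₃) refl

   volume-⊙₃ : ∀ γ u v t → volume u v (γ ⊙ t) ≡ γ * volume u v t
   volume-⊙₃ γ (x₁ , x₂ , x₃) (y₁ , y₂ , y₃) (z₁ , z₂ , z₃) = solve 10 (λ γ x₁ x₂ x₃ y₁ y₂ y₃ z₁ z₂ z₃ →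
     :det x₁ x₂ x₃ y₁ y₂ y₃ (γ :* z₁) (γ :* z₂) (γ :* z₃) := γ :* :det x₁ x₂ x₃ y₁ y₂ y₃ z₁ z₂ z₃) refl γ x₁ x₂ x₃ y₁ y₂ y₃ z₁ z₂ z₃

   volume-double : ∀ u v t → volume (⟦ ℤ.+ 2 ⟧ ⊙ u) (⟦ ℤ.+ 2 ⟧ ⊙ v) (⟦ ℤ.+ 2 ⟧ ⊙ t) ≡ ⟦ ℤ.+ 4 ⟧ * (⟦ ℤ.+ 2 ⟧ * volume u v t)
   volume-double (x₁ , x₂ , x₃) (y₁ , y₂ , y₃) (z₁ , z₂ , z₃) = solve 9 (λ x₁ x₂ x₃ y₁ y₂ y₃ z₁ z₂ z₃ →
     let d = con (ℤ.+ 2) in :det (d :* x₁) (d :* x₂) (d :* x₃) (d :* y₁) (d :* y₂) (d :* y₃) (d :* z₁) (d :* z₂) (d :* z₃)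
     := con (ℤ.+ 4) :* (d :* :det x₁ x₂ x₃ y₁ y₂ y₃ z₁ z₂ z₃)) refl x₁ x₂ x₃ y₁ y₂ y₃ z₁ z₂ z₃

   cofactor : (p q r s : Carrier) → Carrier
   cofactor p q r s = p * s - q * r

   -- Doubling a vector of the lattice doubles two integral coordinates, while the third one becomes
   -- an element of an ideal. Expansion along the third column exhibits the volume as four times an
   -- element of that ideal.
   volume-third-column : ∀ x₁ y₁ z₁ x₂ y₂ z₂ x₃ y₃ z₃ → let d = ⟦ ℤ.+ 2 ⟧ in
     volume (d * x₁ , d * y₁ , z₁) (d * x₂ , d * y₂ , z₂) (d * x₃ , d * y₃ , z₃)
     ≡ ⟦ ℤ.+ 4 ⟧ * (cofactor x₂ y₂ x₃ y₃ * z₁ + cofactor x₃ y₃ x₁ y₁ * z₂ + cofactor x₁ y₁ x₂ y₂ * z₃)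
   volume-third-column = solve 9 (λ x₁ y₁ z₁ x₂ y₂ z₂ x₃ y₃ z₃ → let d = con (ℤ.+ 2) ; c = λ p q r s → p :* s :- q :* r in
     :det (d :* x₁) (d :* y₁) z₁ (d :* x₂) (d :* y₂) z₂ (d :* x₃) (d :* y₃) z₃
     := con (ℤ.+ 4) :* (c x₂ y₂ x₃ y₃ :* z₁ :+ c x₃ y₃ x₁ y₁ :* z₂ :+ c x₁ y₁ x₂ y₂ :* z₃)) refl

   -- Comparison of a basis e with generators v₁, v₂, v₃, γv₃ of the same module, where 2γ = g.
   module Compare (e₁ e₂ e₃ v₁ v₂ v₃ : Vec) (γ g : Carrier) (2γ : ⟦ ℤ.+ 2 ⟧ * γ ≡ g)
     (regular : ∀ {y} → volume v₁ v₂ v₃ * y ≡ 0# → y ≡ 0#) (4-regular : ∀ {y} → ⟦ ℤ.+ 4 ⟧ * y ≡ 0# → y ≡ 0#)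
     (r s t t′ : Vec) (e-r : v₁ ≡ span³ e₁ e₂ e₃ r) (e-s : v₂ ≡ span³ e₁ e₂ e₃ s) (e-t : v₃ ≡ span³ e₁ e₂ e₃ t) (e-t′ : γ ⊙ v₃ ≡ span³ e₁ e₂ e₃ t′)
     (x₁ y₁ z₁ x₂ y₂ z₂ x₃ y₃ z₃ : Carrier)
     (f₁ : ⟦ ℤ.+ 2 ⟧ ⊙ e₁ ≡ span³ v₁ v₂ v₃ (⟦ ℤ.+ 2 ⟧ * x₁ , ⟦ ℤ.+ 2 ⟧ * y₁ , z₁))
     (f₂ : ⟦ ℤ.+ 2 ⟧ ⊙ e₂ ≡ span³ v₁ v₂ v₃ (⟦ ℤ.+ 2 ⟧ * x₂ , ⟦ ℤ.+ 2 ⟧ * y₂ , z₂))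
     (f₃ : ⟦ ℤ.+ 2 ⟧ ⊙ e₃ ≡ span³ v₁ v₂ v₃ (⟦ ℤ.+ 2 ⟧ * x₃ , ⟦ ℤ.+ 2 ⟧ * y₃ , z₃)) where

     β η T T′ C : Carrier
     β = volume v₁ v₂ v₃
     η = volume e₁ e₂ e₃
     T = volume r s t
     T′ = volume r s t′
     C = cofactor x₂ y₂ x₃ y₃ * z₁ + cofactor x₃ y₃ x₁ y₁ * z₂ + cofactor x₁ y₁ x₂ y₂ * z₃

     volume-cong : ∀ {a b c a′ b′ c′} → a ≡ a′ → b ≡ b′ → c ≡ c′ → volume a b c ≡ volume a′ b′ c′
     volume-cong refl refl refl = refl

     β≡ : β ≡ T * η
     β≡ = trans (volume-cong e-r e-s e-t) (volume-span³ e₁ e₂ e₃ r s t)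

     γβ≡ : γ * β ≡ T′ * η
     γβ≡ = trans (sym (volume-⊙₃ γ v₁ v₂ v₃)) (trans (volume-cong e-r e-s e-t′) (volume-span³ e₁ e₂ e₃ r s t′))

     -- No inverses are available in this setting; elements that annihilate only zero take their
     -- place.
     cancel-difference : ∀ {d} → (∀ {y} → d * y ≡ 0# → y ≡ 0#) → ∀ {a b} → d * a ≡ d * b → a ≡ b
     cancel-difference {d} reg {a} {b} e = trans (solve 2 (λ a b → a := (a :- b) :+ b) refl a b) (trans (cong (_+ b) (reg
       (trans (solve 3 (λ d a b → d :* (a :- b) := d :* a :- d :* b) refl d a b) (trans (cong (_- d * b) e) (self (d * b)))))) (0+ b))
       where
       self : ∀ x → x - x ≡ 0#
       self x = subst (x - x ≡_) ⟦⟧-0 (solve 1 (λ x → x :- x := con 0ℤ) refl x)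

     -- Both sides become the volume of the doubled basis after multiplication by four: eight times
     -- η on one side, the expansion along the third column on the other.
     2η≡ : ⟦ ℤ.+ 2 ⟧ * η ≡ C * β
     2η≡ = cancel-difference 4-regular (trans (sym (volume-double e₁ e₂ e₃)) (trans (volume-cong f₁ f₂ f₃)
       (trans (volume-span³ v₁ v₂ v₃ _ _ _) (trans (cong (_* β) (volume-third-column x₁ y₁ z₁ x₂ y₂ z₂ x₃ y₃ z₃))
         (solve 3 (λ f c b → f :* c :* b := f :* (c :* b)) refl ⟦ ℤ.+ 4 ⟧ C β)))))

     η-regular : ∀ {y} → η * y ≡ 0# → y ≡ 0#
     η-regular {y} e = regular (trans (cong (_* y) β≡) (trans (solve 3 (λ t n y → t :* n :* y := t :* (n :* y)) refl T η y) (trans (cong (T *_) e) (0-right T))))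

     -- The two base changes compose to the identity, so their determinants multiply to one, here
     -- doubled. The factor `C` is a combination of the third coordinates `z₁`, `z₂`, `z₃` and lies
     -- in any ideal that contains them.
     unit-relation : ⟦ ℤ.+ 2 ⟧ ≡ C * T
     unit-relation = cancel-difference η-regular (trans (solve 2 (λ n d → n :* d := d :* n) refl η ⟦ ℤ.+ 2 ⟧)
       (trans 2η≡ (trans (cong (C *_) β≡) (solve 3 (λ c t n → c :* (t :* n) := n :* (c :* t)) refl C T η))))

     -- The vector `γ ⊙ v₃` also has integral coordinates in `e`. Hence γ times `T` is integral,
     -- which places `T` in a proper ideal when γ is not integral.
     ideal-relation : g * T ≡ ⟦ ℤ.+ 2 ⟧ * T′
     ideal-relation = cancel-difference η-regular (trans (cong (λ z → η * (z * T)) (sym 2γ))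
       (trans (solve 4 (λ d γ t n → n :* (d :* γ :* t) := d :* (γ :* (t :* n))) refl ⟦ ℤ.+ 2 ⟧ γ T η)
       (trans (cong (λ z → ⟦ ℤ.+ 2 ⟧ * (γ * z)) (sym β≡)) (trans (cong (⟦ ℤ.+ 2 ⟧ *_) γβ≡) (solve 3 (λ d t n → d :* (t :* n) := n :* (d :* t)) refl ⟦ ℤ.+ 2 ⟧ T′ η)))))

-- The field F as a commutative ring.

module FieldLaws where
 open import Defs
 open import Data.Integer using (ℤ; +_)
 open import Data.Rational using (toℚᵘ)
 open import Data.Rational.Solver using (module +-*-Solver)
 open import Algebra using (CommutativeRing; IsCommutativeRing)
 open import Algebra.Structures using (IsCommutativeRing)
 open import Level using (0ℓ)

 -- Rationals are stored in lowest terms. In the unnormalised rationals the numerator of `m / 1` is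
 -- visible, and the laws below become laws of integers.
 /1-toℚᵘ : ∀ m → toℚᵘ (m / 1) ℚᵘ.≃ ℚᵘ.mkℚᵘ m 0
 /1-toℚᵘ m = ℚ.toℚᵘ-fromℚᵘ (ℚᵘ.mkℚᵘ m 0)

 /1-+ : ∀ m n → (m ℤ.+ n) / 1 ≡ m / 1 ℚ.+ n / 1
 /1-+ m n = ℚ.toℚᵘ-injective (begin
   toℚᵘ ((m ℤ.+ n) / 1)                     ≈⟨ /1-toℚᵘ (m ℤ.+ n) ⟩
   ℚᵘ.mkℚᵘ (m ℤ.+ n) 0                      ≈⟨ ℚᵘ.*≡* (cong (ℤ._* + 1) (sym (cong₂ ℤ._+_ (ℤ.*-identityʳ m) (ℤ.*-identityʳ n)))) ⟩
   ℚᵘ.mkℚᵘ m 0 ℚᵘ.+ ℚᵘ.mkℚᵘ n 0             ≈⟨ ℚᵘ.≃-sym (ℚᵘ.+-cong (/1-toℚᵘ m) (/1-toℚᵘ n)) ⟩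
   toℚᵘ (m / 1) ℚᵘ.+ toℚᵘ (n / 1)           ≈⟨ ℚᵘ.≃-sym (ℚ.toℚᵘ-homo-+ (m / 1) (n / 1)) ⟩
   toℚᵘ (m / 1 ℚ.+ n / 1)                   ∎)
   where open import Relation.Binary.Reasoning.Setoid ℚᵘ.≃-setoid

 /1-* : ∀ m n → (m ℤ.* n) / 1 ≡ m / 1 ℚ.* (n / 1)
 /1-* m n = ℚ.toℚᵘ-injective (begin
   toℚᵘ ((m ℤ.* n) / 1)                     ≈⟨ /1-toℚᵘ (m ℤ.* n) ⟩
   ℚᵘ.mkℚᵘ m 0 ℚᵘ.* ℚᵘ.mkℚᵘ n 0             ≈⟨ ℚᵘ.≃-sym (ℚᵘ.*-cong (/1-toℚᵘ m) (/1-toℚᵘ n)) ⟩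
   toℚᵘ (m / 1) ℚᵘ.* toℚᵘ (n / 1)           ≈⟨ ℚᵘ.≃-sym (ℚ.toℚᵘ-homo-* (m / 1) (n / 1)) ⟩
   toℚᵘ (m / 1 ℚ.* (n / 1))                 ∎)
   where open import Relation.Binary.Reasoning.Setoid ℚᵘ.≃-setoid

 /1-neg : ∀ m → (ℤ.- m) / 1 ≡ ℚ.- (m / 1)
 /1-neg m = ℚ.toℚᵘ-injective (begin
   toℚᵘ ((ℤ.- m) / 1)         ≈⟨ /1-toℚᵘ (ℤ.- m) ⟩
   ℚᵘ.- ℚᵘ.mkℚᵘ m 0           ≈⟨ ℚᵘ.≃-sym (ℚᵘ.-‿cong (/1-toℚᵘ m)) ⟩
   ℚᵘ.- toℚᵘ (m / 1)          ≈⟨ ℚᵘ.≃-sym (ℚ.toℚᵘ-homo‿- (m / 1)) ⟩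
   toℚᵘ (ℚ.- (m / 1))         ∎)
   where open import Relation.Binary.Reasoning.Setoid ℚᵘ.≃-setoid

 /1-injective : ∀ m n → m / 1 ≡ n / 1 → m ≡ n
 /1-injective m n eq with ℚᵘ.≃-trans (ℚᵘ.≃-sym (/1-toℚᵘ m)) (ℚᵘ.≃-trans (ℚᵘ.≃-reflexive (cong toℚᵘ eq)) (/1-toℚᵘ n))
 ... | ℚᵘ.*≡* e = trans (sym (ℤ.*-identityʳ m)) (trans e (ℤ.*-identityʳ n))

 /1-mono-≤ : ∀ {m n} → m ℤ.≤ n → m / 1 ℚ.≤ n / 1
 /1-mono-≤ {m} {n} h = ℚ.toℚᵘ-cancel-≤ (ℚᵘ.≤-respˡ-≃ (ℚᵘ.≃-sym (/1-toℚᵘ m)) (ℚᵘ.≤-respʳ-≃ (ℚᵘ.≃-sym (/1-toℚᵘ n))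
   (ℚᵘ.*≤* (subst₂ ℤ._≤_ (sym (ℤ.*-identityʳ m)) (sym (ℤ.*-identityʳ n)) h))))

 /1-cancel-≤ : ∀ {m n} → m / 1 ℚ.≤ n / 1 → m ℤ.≤ n
 /1-cancel-≤ {m} {n} h with ℚᵘ.≤-respˡ-≃ (/1-toℚᵘ m) (ℚᵘ.≤-respʳ-≃ (/1-toℚᵘ n) (ℚ.toℚᵘ-mono-≤ h))
 ... | ℚᵘ.*≤* e = subst₂ ℤ._≤_ (ℤ.*-identityʳ m) (ℤ.*-identityʳ n) e

 /1-cancel-< : ∀ {m n} → m / 1 ℚ.< n / 1 → m ℤ.< n
 /1-cancel-< {m} {n} h = ℤ.≰⇒> λ n≤m → ℚ.<-irrefl refl (ℚ.<-≤-trans h (/1-mono-≤ n≤m))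

 /1-mono-< : ∀ {m n} → m ℤ.< n → m / 1 ℚ.< n / 1
 /1-mono-< {m} {n} h = ℚ.≰⇒> λ n≤m → ℤ.<⇒≱ h (/1-cancel-≤ n≤m)

 module FieldRing (D : ℕ) where
   open +-*-Solver

   infixl 7 _*F_
   _*F_ : F → F → F
   _*F_ = mulF D

   *F-comm : ∀ x y → x *F y ≡ y *F x
   *F-comm (a , b) (c , d) = cong₂ _,_
     (solve 5 (λ a b c d e → a :* c :+ e :* (b :* d) := c :* a :+ e :* (d :* b)) refl a b c d (Dℚ D))
     (solve 4 (λ a b c d → a :* d :+ b :* c := c :* b :+ d :* a) refl a b c d)

   *F-assoc : ∀ x y z → (x *F y) *F z ≡ x *F (y *F z)
   *F-assoc (a , b) (c , d) (u , v) = cong₂ _,_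
     (solve 7 (λ a b c d u v e → (a :* c :+ e :* (b :* d)) :* u :+ e :* ((a :* d :+ b :* c) :* v)
         := a :* (c :* u :+ e :* (d :* v)) :+ e :* (b :* (c :* v :+ d :* u))) refl a b c d u v (Dℚ D))
     (solve 7 (λ a b c d u v e → (a :* c :+ e :* (b :* d)) :* v :+ (a :* d :+ b :* c) :* u
         := a :* (c :* v :+ d :* u) :+ b :* (c :* u :+ e :* (d :* v))) refl a b c d u v (Dℚ D))

   *F-identityˡ : ∀ x → 1F *F x ≡ x
   *F-identityˡ (a , b) = cong₂ _,_
     (solve 3 (λ a b e → con 1ℚ :* a :+ e :* (con 0ℚ :* b) := a) refl a b (Dℚ D))
     (solve 2 (λ a b → con 1ℚ :* b :+ con 0ℚ :* a := b) refl a b)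

   *F-distribˡ : ∀ x y z → x *F (y +F z) ≡ (x *F y) +F (x *F z)
   *F-distribˡ (a , b) (c , d) (u , v) = cong₂ _,_
     (solve 7 (λ a b c d u v e → a :* (c :+ u) :+ e :* (b :* (d :+ v)) := (a :* c :+ e :* (b :* d)) :+ (a :* u :+ e :* (b :* v))) refl a b c d u v (Dℚ D))
     (solve 6 (λ a b c d u v → a :* (d :+ v) :+ b :* (c :+ u) := (a :* d :+ b :* c) :+ (a :* v :+ b :* u)) refl a b c d u v)

   isCommutativeRing : IsCommutativeRing _≡_ _+F_ _*F_ -F_ 0F 1F
   isCommutativeRing = record
     { isRing = record
       { +-isAbelianGroup = record
         { isGroup = record
           { isMonoid = record
             { isSemigroup = record
               { isMagma = record { isEquivalence = isEquivalence ; ∙-cong = cong₂ _+F_ }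
               ; assoc = λ (a , b) (c , d) (u , v) → cong₂ _,_ (ℚ.+-assoc a c u) (ℚ.+-assoc b d v) }
             ; identity = (λ (a , b) → cong₂ _,_ (ℚ.+-identityˡ a) (ℚ.+-identityˡ b))
                        , (λ (a , b) → cong₂ _,_ (ℚ.+-identityʳ a) (ℚ.+-identityʳ b)) }
           ; inverse = (λ (a , b) → cong₂ _,_ (ℚ.+-inverseˡ a) (ℚ.+-inverseˡ b))
                     , (λ (a , b) → cong₂ _,_ (ℚ.+-inverseʳ a) (ℚ.+-inverseʳ b))
           ; ⁻¹-cong = cong (-F_) }
         ; comm = λ (a , b) (c , d) → cong₂ _,_ (ℚ.+-comm a c) (ℚ.+-comm b d) }
       ; *-cong = cong₂ _*F_
       ; *-assoc = *F-assoc
       ; *-identity = *F-identityˡ , (λ x → trans (*F-comm x 1F) (*F-identityˡ x))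
       ; distrib = *F-distribˡ , (λ x y z → trans (*F-comm (y +F z) x)
                     (trans (*F-distribˡ x y z) (cong₂ _+F_ (*F-comm x y) (*F-comm x z)))) }
     ; *-comm = *F-comm }

   commutativeRing : CommutativeRing 0ℓ 0ℓ
   commutativeRing = record { isCommutativeRing = isCommutativeRing }

   ιℤ-* : ∀ m n → ιℤ (m ℤ.* n) ≡ ιℤ m *F ιℤ n
   ιℤ-* m n = cong₂ _,_
     (trans (/1-* m n) (solve 3 (λ a b e → a :* b := a :* b :+ e :* (con 0ℚ :* con 0ℚ)) refl (m / 1) (n / 1) (Dℚ D)))
     (solve 2 (λ a b → con 0ℚ := a :* con 0ℚ :+ con 0ℚ :* b) refl (m / 1) (n / 1))

   ιℤ-+ : ∀ m n → ιℤ (m ℤ.+ n) ≡ ιℤ m +F ιℤ n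
   ιℤ-+ m n = cong₂ _,_ (/1-+ m n) refl

   ιℤ-neg : ∀ m → ιℤ (ℤ.- m) ≡ -F (ιℤ m)
   ιℤ-neg m = cong₂ _,_ (/1-neg m) refl

-- Certificates and their checker.

module Certificates where
 open import Data.Nat using (zero; suc)
 open import Data.Integer using (ℤ; +_)
 open import Data.Bool using (false; if_then_else_)
 open import Data.List using ([]; _∷_; map; concatMap)
 open import Data.Bool.ListAction using (all)

 infix 5 _∶_
 infix 4 _==O_ _==³_
 -- The pair `a ∶ b` stands for a + bω. Elements are bare pairs of integers, so that evaluating the
 -- checker never touches rational numbers.
 data O : Set where
   _∶_ : ℤ → ℤ → O

 0O : O
 0O = + 0 ∶ + 0

 infixl 6 _⊕_ _⊝_
 _⊕_ _⊝_ : O → O → O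
 (a ∶ b) ⊕ (c ∶ d) = (a ℤ.+ c) ∶ (b ℤ.+ d)
 (a ∶ b) ⊝ (c ∶ d) = (a ℤ.- c) ∶ (b ℤ.- d)

 isZero : ℤ → Bool
 isZero (+ zero) = true
 isZero _ = false

 _==O_ : O → O → Bool
 (a ∶ b) ==O (c ∶ d) = isZero (a ℤ.- c) ∧ isZero (b ℤ.- d)

 infixr 7 _·_
 _·_ : ℕ → O → O
 k · (a ∶ b) = (+ k ℤ.* a) ∶ (+ k ℤ.* b)

 -- The order of this list fixes the order of all candidate lists, and thereby the order in which a
 -- certificate has to list its branches.
 ints : ℕ → List ℤ
 ints zero    = + 0 ∷ []
 ints (suc k) = + suc k ∷ -[1+ k ] ∷ ints k

 -- least r ≥ r₀ with d (r+1)² > x, searched within the fuel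
 rootFrom : ℕ → ℕ → ℕ → ℕ → ℕ
 rootFrom zero    d x r = r
 rootFrom (suc f) d x r = if x ℕ.<ᵇ d ℕ.* (suc r ℕ.* suc r) then r else rootFrom f d x (suc r)

 root : ℕ → ℕ → ℕ
 root d x = rootFrom x d x 0

 divℤ : ℕ → ℤ → Bool
 divℤ zero    x = isZero x
 divℤ (suc k) x = (∣ x ∣ ℕ.% suc k) ℕ.≡ᵇ 0

 -- Meaningful only for exact division by a non-zero number, which `divℤ` tests; the value at
 -- divisor zero is a filler.
 quotℤ : ℕ → ℤ → ℤ
 quotℤ zero    x = + 0
 quotℤ (suc k) (+ m)    = + (m ℕ./ suc k)
 quotℤ (suc k) -[1+ m ] = ℤ.- (+ (suc m ℕ./ suc k))

 -- Values of Q on the diagonal, values of B off it. The actual Gram matrix of B doubles the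
 -- diagonal, which is what `bil` does; `adj` reuses the same type for an ordinary symmetric matrix.
 data Gram : Set where
   gram : (q₁ q₂ q₃ b₁₂ b₁₃ b₂₃ : O) → Gram

 data O³ : Set where
   tri : O → O → O → O³

 _==³_ : O³ → O³ → Bool
 tri a b c ==³ tri d e f = (a ==O d) ∧ (b ==O e) ∧ (c ==O f)

 _⊕³_ : O³ → O³ → O³
 tri a b c ⊕³ tri d e f = tri (a ⊕ d) (b ⊕ e) (c ⊕ f)

 -- A choice of sign with no arithmetic meaning: of x and -x at least one passes, and zero passes.
 lexNonneg : O → Bool
 lexNonneg (+ zero ∶ -[1+ _ ]) = false
 lexNonneg (+ _ ∶ _) = true
 lexNonneg (-[1+ _ ] ∶ _) = false

 zeroO : O → Bool
 zeroO (a ∶ b) = isZero a ∧ isZero b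

 -- A vector and its negative represent the same element, so only one of two opposite triples of
 -- products has to be examined.
 normalized : O³ → Bool
 normalized (tri a b c) = if zeroO a then (if zeroO b then lexNonneg c else lexNonneg b) else lexNonneg a

 -- Coefficients on the three basis vectors of the state, followed by coefficients on the extra
 -- vectors found so far.
 data Combo : Set where
   combo : O³ → List O → Combo

 -- e₁ and k + e₂ω generate an ideal; m + nω with m < e₁, n < e₂ represent the residues modulo it
 data Residue : Set where
   residue : (e₁ e₂ : ℕ) (k : ℤ) → Residue

 -- One term `w τᵀ` of the adjugate modulo the determinant. The residue describes multipliers that
 -- make `w` divisible by the determinant, so only the class of the pairing with `τ` matters.
 data Part : Set where
   part : (w τ : O³) → Residue → Part

 -- A state consists of a basis with its Gram data and of further vectors of L known by their
 -- products. `target` forces a represented element, `rebase` passes to another triple inside L, and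
 -- `final` claims form number i. The certificates under `final` treat vectors that would still
 -- enlarge the sublattice.
 data Cert : Set where
   target : O → List Cert → Cert
   rebase : Combo → Combo → Combo → List Combo → Gram → List O³ → Cert → Cert
   final  : ℕ → List Part → List Cert → Cert

 -- The stages with two vectors and with one vector, where only products among the vectors found so
 -- far are branched on and no adjugate exists yet.
 data Cert₂ : Set where
   target₂ : O → List Cert → Cert₂

 data Cert₁ : Set where
   target₁ : O → List Cert₂ → Cert₁

 -- In `half g mem` the third coordinate runs through the fractional ideal generated by 1 and g/2,
 -- and `mem` decides membership in twice that ideal.
 data Kind : Set where
   free : Kind
   half : O → (O → Bool) → Kind

 -- The parameters mean ω² = p + sω and Δ = s² + 4p. The last relation is assumed only where
 -- soundness is proved.
 module Arithmetic (s p : ℤ) (Δ : ℕ) where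

   infixl 7 _⊗_
   _⊗_ : O → O → O
   (a ∶ b) ⊗ (c ∶ d) = (a ℤ.* c ℤ.+ p ℤ.* (b ℤ.* d)) ∶ (a ℤ.* d ℤ.+ b ℤ.* c ℤ.+ s ℤ.* (b ℤ.* d))

   trace : O → ℤ
   trace (a ∶ b) = (+ 2 ℤ.* a) ℤ.+ s ℤ.* b

   -- With t the trace, the element is (t + b√Δ)/2. Both conjugates are non-negative exactly when t
   -- is non-negative and Δb² does not exceed t².
   psd tp : O → Bool
   psdAux tpAux : ℤ → ℤ → Bool
   psdAux (+ t) b = Δ ℕ.* (∣ b ∣ ℕ.* ∣ b ∣) ℕ.≤ᵇ t ℕ.* t
   psdAux -[1+ _ ] b = false
   psd (a ∶ b) = psdAux (trace (a ∶ b)) b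
   tpAux (+ t) b = Δ ℕ.* (∣ b ∣ ℕ.* ∣ b ∣) ℕ.<ᵇ t ℕ.* t
   tpAux -[1+ _ ] b = false
   tp (a ∶ b) = tpAux (trace (a ∶ b)) b

   -- `M` bounds the trace t and `N` bounds n. As 2m = t - sn with s at most one in absolute value,
   -- m is bounded by half of `M + N`.
   candsBox : O → ℕ → ℕ → List O
   candsBox c M N =
     filterᵇ (λ b → psd (c ⊝ b ⊗ b))
       (concatMap (λ n → map (λ m → m ∶ n) (ints ((M ℕ.+ N) ℕ./ 2))) (ints N))

   -- If c - b² is totally non-negative then the trace of b² is at most that of c, and twice the
   -- trace of b² equals t² + Δn². Hence both t² and Δn² are at most `K`.
   cands : O → List O
   cands c = candsBox c (root 1 K) (root Δ K)
     where K = 2 ℕ.* ∣ trace c ∣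

   conjO : O → O
   conjO (a ∶ b) = (a ℤ.+ s ℤ.* b) ∶ (ℤ.- b)

   normO : O → ℤ
   normO (a ∶ b) = a ℤ.* a ℤ.+ s ℤ.* (a ℤ.* b) ℤ.- p ℤ.* (b ℤ.* b)

   -- The quotient x/d equals x times the conjugate of d divided by the norm of d, so divisibility
   -- reduces to that of two integers by the norm.
   divO : O → O → Bool
   divO d x = go (∣ normO d ∣) (x ⊗ conjO d)
     where
     go : ℕ → O → Bool
     go N (u ∶ v) = divℤ N u ∧ divℤ N v

   δ₃ : Gram → O
   δ₃ (gram q₁ q₂ q₃ a b c) =
     4 · (q₁ ⊗ (q₂ ⊗ q₃)) ⊕ a ⊗ (b ⊗ c) ⊝ q₁ ⊗ (c ⊗ c) ⊝ q₂ ⊗ (b ⊗ b) ⊝ q₃ ⊗ (a ⊗ a)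

   -- the adjugate, as a symmetric matrix with entries listed as in gram
   adj : Gram → Gram
   adj (gram q₁ q₂ q₃ a b c) = gram
     (4 · (q₂ ⊗ q₃) ⊝ c ⊗ c) (4 · (q₁ ⊗ q₃) ⊝ b ⊗ b) (4 · (q₁ ⊗ q₂) ⊝ a ⊗ a)
     (b ⊗ c ⊝ 2 · (q₃ ⊗ a)) (a ⊗ c ⊝ 2 · (q₂ ⊗ b)) (a ⊗ b ⊝ 2 · (q₁ ⊗ c))

   infixl 7 _⊡_
   _⊡_ : O³ → O³ → O
   tri a b c ⊡ tri d e f = a ⊗ d ⊕ b ⊗ e ⊕ c ⊗ f

   app : Gram → O³ → O³
   app (gram a₁ a₂ a₃ a b c) (tri x y z) =
     tri (a₁ ⊗ x ⊕ a ⊗ y ⊕ b ⊗ z) (a ⊗ x ⊕ a₂ ⊗ y ⊕ c ⊗ z) (b ⊗ x ⊕ c ⊗ y ⊕ a₃ ⊗ z)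

   bil : Gram → Gram
   bil (gram q₁ q₂ q₃ a b c) = gram (2 · q₁) (2 · q₂) (2 · q₃) a b c

   scale³ : O → O³ → O³
   scale³ t (tri a b c) = tri (t ⊗ a) (t ⊗ b) (t ⊗ c)

   -- Triples β of products of a vector `v` with the basis, where Q(v) = α. The adjugate over the
   -- determinant inverts the Gram matrix and B(v,v) = 2α, so β must satisfy β adj β = 2 det α.
   -- Pairings with the extra vectors must be integral as well.
   survivors : Gram → Gram → O → List O³ → O → List O³
   survivors (gram q₁ q₂ q₃ a b c) (gram A₁ A₂ A₃ A₁₂ A₁₃ A₂₃) det axs α =
     go (filterᵇ lexNonneg (cands (4 · (q₁ ⊗ α)))) (cands (4 · (q₂ ⊗ α))) (cands (4 · (q₃ ⊗ α))) (2 · (det ⊗ α))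
     where
     inner : O → O → O → O → O → Bool
     inner base lin x y z =
       -- The equation is written as a quadratic polynomial in z, so the part depending on x and y
       -- alone can be passed in.
       zeroO (base ⊕ (lin ⊕ A₃ ⊗ z) ⊗ z)
       ∧ (all (λ ax → divO det (ax ⊡ tri x y z)) axs ∧ normalized (tri x y z))
     mid : List O → O → O → O → List O³
     mid c₃ rhs x y =
       -- Pruning: the first two basis vectors and the sought vector span a subspace on which the
       -- form is non-negative.
       if psd (δ₃ (gram q₁ q₂ α a x y))
       then map (tri x y)
              (filterᵇ (inner (A₁ ⊗ (x ⊗ x) ⊕ A₂ ⊗ (y ⊗ y) ⊕ 2 · (A₁₂ ⊗ (x ⊗ y)) ⊝ rhs) (2 · (A₁₃ ⊗ x ⊕ A₂₃ ⊗ y)) x y) c₃)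
       else []
     go : List O → List O → List O → O → List O³
     go c₁ c₂ c₃ rhs = concatMap (λ x → concatMap (λ y → mid c₃ rhs x y) c₂) c₁

   lin : List O → List O³ → O³
   lin (y ∷ ys) (b ∷ bs) = scale³ y b ⊕³ lin ys bs
   lin _ _ = tri 0O 0O 0O

   -- B(u, vᵢ) for a combination u of the vectors of the state
   dual : Gram → List O³ → Combo → O³
   dual G bs (combo x ys) = app (bil G) x ⊕³ lin ys bs

   -- Products of vectors known only by their dual triples are read off through the adjugate, and
   -- the claimed values are compared after multiplication by the determinant.
   checkGram : Gram → O → O³ → O³ → O³ → Gram → Bool
   checkGram A det u₁ u₂ u₃ (gram q₁ q₂ q₃ a b c) =
     (app A u₁ ⊡ u₁ ==O 2 · (det ⊗ q₁)) ∧ (app A u₂ ⊡ u₂ ==O 2 · (det ⊗ q₂)) ∧ (app A u₃ ⊡ u₃ ==O 2 · (det ⊗ q₃))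
     ∧ (app A u₁ ⊡ u₂ ==O det ⊗ a) ∧ (app A u₁ ⊡ u₃ ==O det ⊗ b) ∧ (app A u₂ ⊡ u₃ ==O det ⊗ c)

   checkExts : Gram → O → O³ → O³ → O³ → List O³ → List O³ → Bool
   checkExts A det u₁ u₂ u₃ [] [] = true
   checkExts A det u₁ u₂ u₃ (w ∷ ws) (tri x y z ∷ es) =
     (app A w ⊡ u₁ ==O det ⊗ x) ∧ (app A w ⊡ u₂ ==O det ⊗ y) ∧ (app A w ⊡ u₃ ==O det ⊗ z)
     ∧ checkExts A det u₁ u₂ u₃ ws es
   checkExts _ _ _ _ _ _ _ = false

   infix 4 _==G_
   _==G_ : Gram → Gram → Bool
   gram a b c d e f ==G gram a' b' c' d' e' f' =
     (a ==O a') ∧ (b ==O b') ∧ (c ==O c') ∧ (d ==O d') ∧ (e ==O e') ∧ (f ==O f')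

   divCol : O → O → O → O → List (O × O³) → Bool
   divCol det a b c [] = divO det a ∧ divO det b ∧ divO det c
   divCol det a b c ((w , tri t₁ t₂ t₃) ∷ l) = divCol det (a ⊝ w ⊗ t₁) (b ⊝ w ⊗ t₂) (c ⊝ w ⊗ t₃) l

   pr₁ pr₂ pr₃ : O³ → O
   pr₁ (tri a b c) = a
   pr₂ (tri a b c) = b
   pr₃ (tri a b c) = c

   -- adj ≡ Σ W τᵀ modulo det
   column : (O³ → O) → List Part → List (O × O³)
   column pr [] = []
   column pr (part w τ _ ∷ l) = (pr w , τ) ∷ column pr l

   splitOK : O → Gram → List Part → Bool
   splitOK det (gram A₁ A₂ A₃ a b c) l =
     divCol det A₁ a b (column pr₁ l) ∧ (divCol det a A₂ c (column pr₂ l) ∧ divCol det b c A₃ (column pr₃ l))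

   quotO : O → O → O
   quotO d x = go (normO d) (x ⊗ conjO d)
     where
     go : ℤ → O → O
     go N (u ∶ v) = (quotℤ (∣ N ∣) u) ∶ (quotℤ (∣ N ∣) v)

   quot³ : O → O³ → O³
   quot³ d (tri a b c) = tri (quotO d a) (quotO d b) (quotO d c)

   evalG : Gram → O³ → O
   evalG (gram q₁ q₂ q₃ a b c) (tri x y z) =
     q₁ ⊗ (x ⊗ x) ⊕ q₂ ⊗ (y ⊗ y) ⊕ q₃ ⊗ (z ⊗ z) ⊕ a ⊗ (x ⊗ y) ⊕ b ⊗ (x ⊗ z) ⊕ c ⊗ (y ⊗ z)

   -- Here the triple holds numerators: it stands for the vector whose coordinates are its entries
   -- divided by `det`.
   inLattice : Kind → O → O³ → Bool
   inLattice free         det (tri a b c) = divO det a ∧ divO det b ∧ divO det c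
   inLattice (half γ mem) det (tri a b c) =
     divO det a ∧ divO det b ∧ divO det (2 · c) ∧ mem (quotO det (2 · c))

   div³ : O → O³ → Bool
   div³ d (tri a b c) = divO d a ∧ divO d b ∧ divO d c

   -- Both generators carry `w` into multiples of the determinant. Empty ranges of representatives
   -- are rejected.
   residueOK : O → O³ → Residue → Bool
   residueOK det w (residue zero    _       k) = false
   residueOK det w (residue (suc _) zero    k) = false
   residueOK det w (residue (suc m) (suc n) k) = div³ det (scale³ (+ suc m ∶ + 0) w) ∧ div³ det (scale³ (k ∶ + suc n) w)

   residuesOK : O → List Part → Bool
   residuesOK det [] = true
   residuesOK det (part w _ r ∷ l) = residueOK det w r ∧ residuesOK det l

   residues : Residue → List O
   residues (residue e₁ e₂ _) = concatMap (λ m → map (λ n → + m ∶ + n) (upTo e₂)) (upTo e₁)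

   span : List Part → List O³
   span [] = tri 0O 0O 0O ∷ []
   span (part w _ r ∷ l) = concatMap (λ x → map (λ t → scale³ t w ⊕³ x) (residues r)) (span l)

   -- Candidates for genuine enlargements: coordinates outside the claimed lattice for which the
   -- value of Q and all products with known vectors are integral. They are returned as dual
   -- triples, ready to be added to the state.
   remaining : Gram → Kind → O → List O³ → List Part → List O³
   remaining G k det axs l = map (λ x → quot³ det (app (bil G) x)) (filterᵇ keep (span l))
     where
     keep : O³ → Bool
     keep x = not (inLattice k det x)
            ∧ (divO (det ⊗ det) (evalG G x)
            ∧ (div³ det (app (bil G) x)
            ∧ all (λ ax → divO det (ax ⊡ quot³ det (app (bil G) x))) axs))

   -- the only extra vector of the state is half of g times the third basis vector
   kindOK : O → Gram → O → List O³ → Bool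
   kindOK g A det (u ∷ []) =
     tri (2 · pr₁ (app A u)) (2 · pr₂ (app A u)) (2 · pr₃ (app A u)) ==³ tri 0O 0O (det ⊗ g)
   kindOK g A det _ = false

   -- For an adjugate this entry is the Gram determinant of the first two basis vectors.
   minor : Gram → O
   minor (gram _ _ A₃ _ _ _) = A₃

   isEmpty : List O³ → Bool
   isEmpty [] = true
   isEmpty _  = false

 module Checker (s p : ℤ) (Δ : ℕ) (forms : ℕ → Gram × Kind) where
   open Arithmetic s p Δ

   -- The arguments after the Gram data are its adjugate and twice `δ₃`. They are passed along so
   -- that a sequence of targets shares them.
   check : Gram → Gram → O → List O³ → Cert → Bool
   checkForm : Gram → Gram → O → List O³ → List Part → List Cert → Gram × Kind → Bool
   checkKind : Gram → Gram → O → List O³ → List Part → List Cert → Kind → Bool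
   checkAll : Gram → Gram → O → List O³ → List O³ → List Cert → Bool

   checkAll G A det bs []       []       = true
   checkAll G A det bs (u ∷ us) (c ∷ cs) = check G A det (u ∷ bs) c ∧ checkAll G A det bs us cs
   checkAll G A det bs _ _ = false

   check G A det bs (target α cs) =
     tp α ∧ (tp (minor A) ∧ checkAll G A det bs (survivors G A det (map (app A) bs) α) cs)
   check G A det bs (rebase u₁ u₂ u₃ us G' bs' c) =
     checkGram A det (dual G bs u₁) (dual G bs u₂) (dual G bs u₃) G'
     ∧ (checkExts A det (dual G bs u₁) (dual G bs u₂) (dual G bs u₃) (map (dual G bs) us) bs'
     ∧ (tp (2 · δ₃ G') ∧ check G' (adj G') (2 · δ₃ G') bs' c))
   check G A det bs (final i l cs) = checkForm G A det bs l cs (forms i)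

   checkForm G A det bs l cs (φ , k) =
     -- Integrality of Q on x/det is divisibility by the square of the determinant, and the division
     -- test is justified for totally positive divisors.
     (G ==G φ) ∧ (tp (det ⊗ det) ∧ (splitOK det A l ∧ (residuesOK det l ∧ checkKind G A det bs l cs k)))

   checkKind G A det bs l cs free         = checkAll G A det bs (remaining G free det (map (app A) bs) l) cs
   -- The extra generator must already have been found as a vector of L, and no enlargement at all
   -- may remain.
   checkKind G A det bs l cs (half g mem) = kindOK g A det bs ∧ isEmpty (remaining G (half g mem) det (map (app A) bs) l)

   check₃ : Gram → Cert → Bool
   check₃ G c = tp (2 · δ₃ G) ∧ check G (adj G) (2 · δ₃ G) [] c

   check₃All : (q₂ q₃ a : O) → List (O × O) → List Cert → Bool
   check₃All q₂ q₃ a [] [] = true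
   check₃All q₂ q₃ a ((x , y) ∷ l) (c ∷ cs) = check₃ (gram (+ 1 ∶ + 0) q₂ q₃ a x y) c ∧ check₃All q₂ q₃ a l cs
   check₃All q₂ q₃ a _ _ = false

   -- Possible products of a vector of value β with the first two vectors. A zero third entry lets
   -- the sign convention for triples serve for pairs.
   pairs : (q₂ a β : O) → List O → List O → List (O × O)
   pairs q₂ a β c₁ c₂ = concatMap (λ x → map (x ,_)
      (filterᵇ (λ y → psd (δ₃ (gram (+ 1 ∶ + 0) q₂ β a x y)) ∧ normalized (tri x y 0O)) c₂)) (filterᵇ lexNonneg c₁)

   check₂ : (q₂ a : O) → Cert₂ → Bool
   check₂ q₂ a (target₂ β cs) =
     tp (4 · ((+ 1 ∶ + 0) ⊗ q₂) ⊝ a ⊗ a) ∧ (tp β ∧ check₃All q₂ β a (pairs q₂ a β (cands (4 · ((+ 1 ∶ + 0) ⊗ β))) (cands (4 · (q₂ ⊗ β)))) cs)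

   check₂All : O → List O → List Cert₂ → Bool
   check₂All q₂ [] [] = true
   check₂All q₂ (a ∷ l) (c ∷ cs) = check₂ q₂ a c ∧ check₂All q₂ l cs
   check₂All q₂ _ _ = false

   check₁ : Cert₁ → Bool
   check₁ (target₁ α cs) = tp (+ 1 ∶ + 0) ∧ (tp α ∧ check₂All α (filterᵇ lexNonneg (cands (4 · ((+ 1 ∶ + 0) ⊗ α)))) cs)

-- Total positivity through the trace and the coefficient of √Δ.

module TraceOrder where
 open import Data.Nat using (zero; suc)
 open QuadraticSpaces

 module TraceNorm (S : Scalars) where
   open Scalars S using (Carrier) renaming (_+_ to _⊹_; _*_ to _⋆_; -_ to ~_)
   open ScalarSolver S
   private
     infixl 6 _∸_
     _∸_ : Carrier → Carrier → Carrier
     x ∸ y = x ⊹ (~ y)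

   diff-squares : ∀ x y → (y ⊹ x) ⋆ (y ∸ x) ≡ y ⋆ y ∸ x ⋆ x
   diff-squares = solve 2 (λ x y → (y :+ x) :* (y :- x) := y :* y :- x :* x) refl

   double-minus : ∀ x y → (y ⊹ y) ∸ (y ⊹ x) ≡ y ∸ x
   double-minus = solve 2 (λ x y → (y :+ y) :- (y :+ x) := y :- x) refl

   swap-squares : ∀ d b b′ → (d ⋆ (b ⋆ b)) ⋆ (d ⋆ (b′ ⋆ b′)) ≡ (d ⋆ (b ⋆ b′)) ⋆ (d ⋆ (b ⋆ b′))
   swap-squares = solve 3 (λ d b b′ → (d :* (b :* b)) :* (d :* (b′ :* b′)) := (d :* (b :* b′)) :* (d :* (b :* b′))) refl

   square-* : ∀ T T′ → (T ⋆ T) ⋆ (T′ ⋆ T′) ≡ (T ⋆ T′) ⋆ (T ⋆ T′)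
   square-* = solve 2 (λ T T′ → (T :* T) :* (T′ :* T′) := (T :* T′) :* (T :* T′)) refl

   neg-square : ∀ b → b ⋆ b ≡ (~ b) ⋆ (~ b)
   neg-square = solve 1 (λ b → b :* b := (:- b) :* (:- b)) refl

   norm-* : ∀ d T b T′ b′ → (T ⋆ T ∸ d ⋆ (b ⋆ b)) ⋆ (T′ ⋆ T′ ∸ d ⋆ (b′ ⋆ b′))
     ≡ (T ⋆ T′ ⊹ d ⋆ (b ⋆ b′)) ⋆ (T ⋆ T′ ⊹ d ⋆ (b ⋆ b′)) ∸ d ⋆ ((T ⋆ b′ ⊹ T′ ⋆ b) ⋆ (T ⋆ b′ ⊹ T′ ⋆ b))
   norm-* = solve 5 (λ d T b T′ b′ → (T :* T :- d :* (b :* b)) :* (T′ :* T′ :- d :* (b′ :* b′))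
     := (T :* T′ :+ d :* (b :* b′)) :* (T :* T′ :+ d :* (b :* b′)) :- d :* ((T :* b′ :+ T′ :* b) :* (T :* b′ :+ T′ :* b))) refl

   diff-* : ∀ a b c d → (b ∸ a) ⋆ d ⊹ a ⋆ (d ∸ c) ≡ b ⋆ d ∸ a ⋆ c
   diff-* = solve 4 (λ a b c d → (b :- a) :* d :+ a :* (d :- c) := b :* d :- a :* c) refl

   conj-trace : ∀ d T b T′ b′ → T ⋆ (T ⋆ T′ ⊹ d ⋆ (b ⋆ b′)) ⊹ d ⋆ ((~ b) ⋆ (T ⋆ b′ ⊹ T′ ⋆ b)) ≡ (T ⋆ T ∸ d ⋆ (b ⋆ b)) ⋆ T′
   conj-trace = solve 5 (λ d T b T′ b′ → T :* (T :* T′ :+ d :* (b :* b′)) :+ d :* ((:- b) :* (T :* b′ :+ T′ :* b)) := (T :* T :- d :* (b :* b)) :* T′) refl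


 module TotalOrder (S : Scalars)
   (_≤_ _<_ : Scalars.Carrier S → Scalars.Carrier S → Set)
   (<⇒≤ : ∀ {x y} → x < y → x ≤ y) (≤-trans : ∀ {x y z} → x ≤ y → y ≤ z → x ≤ z)
   (0≤-+ : ∀ x y → Scalars.0# S ≤ x → Scalars.0# S ≤ y → Scalars.0# S ≤ (Scalars._+_ S x y))
   (0≤-* : ∀ x y → Scalars.0# S ≤ x → Scalars.0# S ≤ y → Scalars.0# S ≤ (Scalars._*_ S x y))
   (0≤-sq : ∀ x → Scalars.0# S ≤ (Scalars._*_ S x x))
   (cancel-0≤ : ∀ x y → Scalars.0# S < x → Scalars.0# S ≤ (Scalars._*_ S x y) → Scalars.0# S ≤ y)
   (diff-≥0 : ∀ x y → x ≤ y → Scalars.0# S ≤ (Scalars._+_ S y (Scalars.-_ S x))) (diff-≥0⁻ : ∀ x y → Scalars.0# S ≤ (Scalars._+_ S y (Scalars.-_ S x)) → x ≤ y)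
   (diff->0 : ∀ x y → x < y → Scalars.0# S < (Scalars._+_ S y (Scalars.-_ S x)))
   (sq-≤⇒0≤+ : ∀ x y → (Scalars._*_ S x x) ≤ (Scalars._*_ S y y) → Scalars.0# S ≤ y → Scalars.0# S ≤ (Scalars._+_ S y x))
   (d : Scalars.Carrier S) (0≤d : Scalars.0# S ≤ d)
   where
   open Scalars S
   open TraceNorm S

   -- The element (T + b√d)/2 is totally non-negative (resp. totally positive).
   TotNonneg TotPositive : Carrier → Carrier → Set
   TotNonneg T b = (0# ≤ T) × ((d * (b * b)) ≤ (T * T))
   TotPositive T b = (0# < T) × ((d * (b * b)) < (T * T))

   TotPositive⇒TotNonneg : ∀ {T b} → TotPositive T b → TotNonneg T b
   TotPositive⇒TotNonneg (p , q) = <⇒≤ p , <⇒≤ q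

   -- The pair in the conclusion is the product of T + b√d and T′ + b′√d, that is, twice the product
   -- in halved coordinates. Its norm condition is multiplicativity of the norm. Its sign follows
   -- from comparing the square of `d * (b * b′)` with that of `T * T′`.
   TotNonneg-* : ∀ T b T′ b′ → TotNonneg T b → TotNonneg T′ b′ → TotNonneg (T * T′ + d * (b * b′)) (T * b′ + T′ * b)
   TotNonneg-* T b T′ b′ (p , q) (p′ , q′) =
     sq-≤⇒0≤+ (d * (b * b′)) (T * T′)
       (subst₂ _≤_ (swap-squares d b b′) (square-* T T′)
          (diff-≥0⁻ _ _ (subst (0# ≤_) (diff-* _ _ _ _)
            (0≤-+ _ _ (0≤-* _ _ (diff-≥0 _ _ q) (≤-trans (0≤-* _ _ 0≤d (0≤-sq b′)) q′))
                      (0≤-* _ _ (0≤-* _ _ 0≤d (0≤-sq b)) (diff-≥0 _ _ q′))))))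
       (0≤-* _ _ p p′)
     , diff-≥0⁻ _ _ (subst (0# ≤_) (norm-* d T b T′ b′) (0≤-* _ _ (diff-≥0 _ _ q) (diff-≥0 _ _ q′)))

   -- Multiplying the product by the conjugate of the first factor leaves the second factor times a
   -- positive norm, which can be cancelled.
   TotNonneg-cancel : ∀ T b T′ b′ → TotPositive T b → TotNonneg (T * T′ + d * (b * b′)) (T * b′ + T′ * b) → TotNonneg T′ b′
   TotNonneg-cancel T b T′ b′ (p , q) h =
       cancel-0≤ _ _ N>0 (subst (0# ≤_) (conj-trace d T b T′ b′) (proj₁ (TotNonneg-* T (- b) _ _ conj-nonneg h)))
     , diff-≥0⁻ _ _ (cancel-0≤ _ _ N>0 (subst (0# ≤_) (sym (norm-* d T b T′ b′)) (diff-≥0 _ _ (proj₂ h))))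
     where
     N>0 = diff->0 _ _ q
     conj-nonneg : TotNonneg T (- b)
     conj-nonneg = <⇒≤ p , subst (λ z → (d * z) ≤ (T * T)) (neg-square b) (<⇒≤ q)

 open import Data.Integer as ℤ hiding (suc)
 open import Data.Integer.Properties
 open import Data.Integer.Properties using () renaming (+-*-isCommutativeRing to ℤ-isCommutativeRing)

 ℤ-scalars : Scalars
 ℤ-scalars = record
   { isCommutativeRing = ℤ-isCommutativeRing ; ⟦_⟧ = λ m → m
   ; ⟦⟧-+ = λ _ _ → refl ; ⟦⟧-* = λ _ _ → refl ; ⟦⟧-neg = λ _ → refl ; ⟦⟧-0 = refl ; ⟦⟧-1 = refl }

 open TraceNorm ℤ-scalars

 0≤-* : ∀ {i j} → 0ℤ ≤ i → 0ℤ ≤ j → 0ℤ ≤ i * j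
 0≤-* {+ m} {+ n} _ _ = subst (0ℤ ≤_) (pos-* m n) (+≤+ ℕ.z≤n)

 0<-* : ∀ {i j} → 0ℤ < i → 0ℤ < j → 0ℤ < i * j
 0<-* {+ suc m} {+ suc n} _ _ = +<+ (ℕ.s≤s ℕ.z≤n)
 0<-* {+ zero} (+<+ ())
 0<-* {+ suc m} {+ zero} _ (+<+ ())

 0≤-sq : ∀ i → 0ℤ ≤ i * i
 0≤-sq (+ n) = 0≤-* {+ n} {+ n} (+≤+ ℕ.z≤n) (+≤+ ℕ.z≤n)
 0≤-sq -[1+ n ] = +≤+ ℕ.z≤n

 neg*pos : ∀ {i j} → i < 0ℤ → 0ℤ < j → i * j < 0ℤ
 neg*pos { -[1+ m ]} {+ suc n} _ _ = -<+
 neg*pos { -[1+ m ]} {+ zero} _ (+<+ ())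
 neg*pos {+ m} (+<+ ())

 cancel-0≤ : ∀ {i j} → 0ℤ < i → 0ℤ ≤ i * j → 0ℤ ≤ j
 cancel-0≤ {i} {j} pi pij = ≮⇒≥ λ nj → <⇒≱ (subst (_< 0ℤ) (*-comm j i) (neg*pos nj pi)) pij

 cancel-0< : ∀ {i j} → 0ℤ ≤ i → 0ℤ < i * j → 0ℤ < j
 cancel-0< {i} {j} pi pij = ≰⇒> λ nj → <⇒≱ pij
   (subst (_≤ 0ℤ) (neg-involutive _) (neg-mono-≤ (subst (0ℤ ≤_) (sym (neg-distribʳ-* i j)) (0≤-* pi (neg-mono-≤ nj)))))

 -- If y + x were negative, then y - x = 2y - (y + x) would be positive and y² - x² negative.
 sq-≤⇒0≤+ : ∀ {x y} → x * x ≤ y * y → 0ℤ ≤ y → 0ℤ ≤ y + x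
 sq-≤⇒0≤+ {x} {y} le py = ≮⇒≥ λ h →
   <⇒≱ (subst (_< 0ℤ) (diff-squares x y)
          (neg*pos {y + x} {y - x} h (subst (0ℤ <_) (double-minus x y)
             (+-mono-≤-< (+-mono-≤ py py) (neg-mono-< h)))))
       (i≤j⇒0≤j-i le)


 module Positivity (Δ : ℕ) = TotalOrder ℤ-scalars _≤_ _<_ <⇒≤ ≤-trans
   (λ x y → +-mono-≤ {0ℤ} {x} {0ℤ} {y}) (λ x y → 0≤-* {x} {y}) 0≤-sq (λ x y → cancel-0≤ {x} {y})
   (λ x y → i≤j⇒0≤j-i {x} {y}) (λ x y → 0≤i-j⇒j≤i {y} {x})
   (λ x y x<y → subst (_< y - x) (+-inverseʳ x) (+-monoˡ-< (- x) x<y))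
   (λ x y → sq-≤⇒0≤+ {x} {y}) (+ Δ) (+≤+ ℕ.z≤n)

-- Evaluation of integral elements in the field.

module QuadraticIntegers where
 open Certificates
 open QuadraticSpaces
 open import Data.Integer using (ℤ)

 module QuadInt (S : Scalars) (s p : ℤ) (Δ : ℕ) (w : Scalars.Carrier S)
   (w² : Scalars._*_ S w w ≡ Scalars._+_ S (Scalars.⟦_⟧ S p) (Scalars._*_ S (Scalars.⟦_⟧ S s) w)) where
   open Scalars S
   open ScalarSolver S
   open Arithmetic s p Δ
   open QuadraticSpace S using (_-_)

   ι : O → Carrier
   ι (a ∶ b) = ⟦ a ⟧ + ⟦ b ⟧ * w

   ι-⊕ : ∀ {x y X Y} → ι x ≡ X → ι y ≡ Y → ι (x ⊕ y) ≡ X + Y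
   ι-⊕ {a ∶ b} {c ∶ d} refl refl rewrite ⟦⟧-+ a c | ⟦⟧-+ b d =
     solve 5 (λ a b c d w → a :+ c :+ (b :+ d) :* w := a :+ b :* w :+ (c :+ d :* w)) refl ⟦ a ⟧ ⟦ b ⟧ ⟦ c ⟧ ⟦ d ⟧ w

   ι-⊝ : ∀ {x y X Y} → ι x ≡ X → ι y ≡ Y → ι (x ⊝ y) ≡ X - Y
   ι-⊝ {a ∶ b} {c ∶ d} refl refl rewrite ⟦⟧-+ a (ℤ.- c) | ⟦⟧-+ b (ℤ.- d) | ⟦⟧-neg c | ⟦⟧-neg d =
     solve 5 (λ a b c d w → a :- c :+ (b :- d) :* w := a :+ b :* w :- (c :+ d :* w)) refl ⟦ a ⟧ ⟦ b ⟧ ⟦ c ⟧ ⟦ d ⟧ w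

   ι-· : ∀ k {x X} → ι x ≡ X → ι (k · x) ≡ ⟦ ℤ.+ k ⟧ * X
   ι-· k {a ∶ b} refl rewrite ⟦⟧-* (ℤ.+ k) a | ⟦⟧-* (ℤ.+ k) b =
     solve 4 (λ a b k w → k :* a :+ (k :* b) :* w := k :* (a :+ b :* w)) refl ⟦ a ⟧ ⟦ b ⟧ ⟦ ℤ.+ k ⟧ w

   ι-⊗ : ∀ {x y X Y} → ι x ≡ X → ι y ≡ Y → ι (x ⊗ y) ≡ X * Y
   ι-⊗ {a ∶ b} {c ∶ d} refl refl
     rewrite ⟦⟧-+ (a ℤ.* c) (p ℤ.* (b ℤ.* d)) | ⟦⟧-+ (a ℤ.* d ℤ.+ b ℤ.* c) (s ℤ.* (b ℤ.* d)) | ⟦⟧-+ (a ℤ.* d) (b ℤ.* c)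
           | ⟦⟧-* a c | ⟦⟧-* p (b ℤ.* d) | ⟦⟧-* s (b ℤ.* d) | ⟦⟧-* b d | ⟦⟧-* a d | ⟦⟧-* b c = begin
     A * C + P * (B * E) + (A * E + B * C + T * (B * E)) * w
       ≡⟨ solve 7 (λ A B C E P T w → A :* C :+ P :* (B :* E) :+ (A :* E :+ B :* C :+ T :* (B :* E)) :* w
            := A :* C :+ (A :* E :+ B :* C) :* w :+ B :* E :* (P :+ T :* w)) refl A B C E P T w ⟩
     A * C + (A * E + B * C) * w + B * E * (P + T * w)
       ≡⟨ cong (λ z → A * C + (A * E + B * C) * w + B * E * z) (sym w²) ⟩
     A * C + (A * E + B * C) * w + B * E * (w * w)
       ≡⟨ solve 5 (λ A B C E w → A :* C :+ (A :* E :+ B :* C) :* w :+ B :* E :* (w :* w) := (A :+ B :* w) :* (C :+ E :* w)) refl A B C E w ⟩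
     (A + B * w) * (C + E * w) ∎
     where
     open ≡-Reasoning
     A = ⟦ a ⟧ ; B = ⟦ b ⟧ ; C = ⟦ c ⟧ ; E = ⟦ d ⟧ ; P = ⟦ p ⟧ ; T = ⟦ s ⟧

   ι-ℤ : ∀ m → ι (m ∶ ℤ.+ 0) ≡ ⟦ m ⟧
   ι-ℤ m = trans (cong (λ z → ⟦ m ⟧ + z * w) ⟦⟧-0)
     (trans (cong (λ z → ⟦ m ⟧ + z * w) (sym ⟦⟧-0)) (solve 2 (λ m w → m :+ con (ℤ.+ 0) :* w := m) refl ⟦ m ⟧ w))

   ι-conjO : ∀ x → ι x * ι (conjO x) ≡ ⟦ normO x ⟧
   ι-conjO (a ∶ b)
     rewrite ⟦⟧-+ (a ℤ.* a ℤ.+ s ℤ.* (a ℤ.* b)) (ℤ.- (p ℤ.* (b ℤ.* b))) | ⟦⟧-+ (a ℤ.* a) (s ℤ.* (a ℤ.* b)) | ⟦⟧-neg (p ℤ.* (b ℤ.* b))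
           | ⟦⟧-* p (b ℤ.* b) | ⟦⟧-* s (a ℤ.* b) | ⟦⟧-* a b | ⟦⟧-* b b | ⟦⟧-* a a
           | ⟦⟧-+ a (s ℤ.* b) | ⟦⟧-* s b | ⟦⟧-neg b = begin
     (A + B * w) * (A + T * B + (- B) * w)
       ≡⟨ solve 4 (λ A B T w → (A :+ B :* w) :* (A :+ T :* B :+ (:- B) :* w) := A :* A :+ T :* (A :* B) :+ T :* B :* B :* w :- B :* B :* (w :* w)) refl A B T w ⟩
     A * A + T * (A * B) + T * B * B * w - B * B * (w * w)
       ≡⟨ cong (λ z → A * A + T * (A * B) + T * B * B * w - B * B * z) w² ⟩
     A * A + T * (A * B) + T * B * B * w - B * B * (P + T * w)
       ≡⟨ solve 5 (λ A B T P w → A :* A :+ T :* (A :* B) :+ T :* B :* B :* w :- B :* B :* (P :+ T :* w) := A :* A :+ T :* (A :* B) :- P :* (B :* B)) refl A B T P w ⟩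
     A * A + T * (A * B) - P * (B * B) ∎
     where
     open ≡-Reasoning
     A = ⟦ a ⟧ ; B = ⟦ b ⟧ ; P = ⟦ p ⟧ ; T = ⟦ s ⟧

   infix 4 _↦_
   -- Syntax x whose value is X. The combinators below build the value in step with the syntax
   -- computed by the checker; the record keeps x and X recoverable from the type, which the bare
   -- equation would not.
   record _↦_ (x : O) (X : Carrier) : Set where
     constructor is
     field val : ι x ≡ X
   open _↦_ public

   itself : ∀ {x} → x ↦ ι x
   itself = is refl

   infixl 6 _↦+_ _↦-_
   infixl 7 _↦*_
   _↦+_ : ∀ {x y X Y} → x ↦ X → y ↦ Y → x ⊕ y ↦ X + Y
   _↦+_ {x} {y} (is e) (is f) = is (ι-⊕ {x} {y} e f)
   _↦-_ : ∀ {x y X Y} → x ↦ X → y ↦ Y → x ⊝ y ↦ X - Y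
   _↦-_ {x} {y} (is e) (is f) = is (ι-⊝ {x} {y} e f)
   _↦*_ : ∀ {x y X Y} → x ↦ X → y ↦ Y → x ⊗ y ↦ X * Y
   _↦*_ {x} {y} (is e) (is f) = is (ι-⊗ {x} {y} e f)
   ↦· : ∀ k {x X} → x ↦ X → k · x ↦ ⟦ ℤ.+ k ⟧ * X
   ↦· k {x} (is e) = is (ι-· k {x} e)

-- Completeness of the candidate lists.

module Completeness where
 open Certificates
 open QuadraticSpaces
 open TraceOrder
 open import Data.Nat using (zero; suc)
 open import Data.Integer using (ℤ; +_)
 open import Data.Bool using (false; T)
 open import Data.List using (_∷_; map; concatMap)
 open import Data.List.Membership.Propositional.Properties using (∈-concatMap⁺)

 ∧-true : ∀ {a b} → a ∧ b ≡ true → a ≡ true × b ≡ true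
 ∧-true {true} {true} _ = refl , refl

 ∈-filterᵇ : ∀ {A : Set} (f : A → Bool) {x xs} → x ∈ xs → f x ≡ true → x ∈ filterᵇ f xs
 ∈-filterᵇ f {x} {y ∷ xs} (here refl) e rewrite e = here refl
 ∈-filterᵇ f {x} {y ∷ xs} (there i) e with f y
 ... | true  = there (∈-filterᵇ f i e)
 ... | false = ∈-filterᵇ f i e

 ∈-concatMap : ∀ {A B : Set} (f : A → List B) {x y xs} → x ∈ xs → y ∈ f x → y ∈ concatMap f xs
 ∈-concatMap f i j = ∈-concatMap⁺ f (Any.map (λ { refl → j }) i)

 ≤⇒≤ᵇ : ∀ {m n} → m ℕ.≤ n → (m ℕ.≤ᵇ n) ≡ true
 ≤⇒≤ᵇ h = Equivalence.to T-≡ (ℕ.≤⇒≤ᵇ h)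

 <ᵇ⇒< : ∀ m n → (m ℕ.<ᵇ n) ≡ true → m ℕ.< n
 <ᵇ⇒< m n h = ℕ.<ᵇ⇒< m n (Equivalence.from T-≡ h)

 ∈-ints : ∀ {k z} → ∣ z ∣ ℕ.≤ k → z ∈ ints k
 ∈-ints {zero} {+ zero} _ = here refl
 ∈-ints {suc k} {z} h with ∣ z ∣ ℕ.≤? k
 ... | yes l = there (there (∈-ints l))
 ∈-ints {suc k} {+ n} h | no l with ℕ.≤-antisym h (ℕ.≰⇒> l)
 ... | refl = here refl
 ∈-ints {suc k} { -[1+ n ]} h | no l with ℕ.≤-antisym h (ℕ.≰⇒> l)
 ... | refl = there (here refl)

 -- The invariant is x ≤ f + r. When the fuel is exhausted, n ≤ dn² ≤ x ≤ r, so stopping early loses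
 -- nothing.
 rootFrom-bound : ∀ f d x r n → 1 ℕ.≤ d → x ℕ.≤ f ℕ.+ r → d ℕ.* (n ℕ.* n) ℕ.≤ x → n ℕ.≤ rootFrom f d x r
 rootFrom-bound zero d x r n 1≤d fr h = ℕ.≤-trans (n≤ n) (ℕ.≤-trans h fr)
   where
   n≤ : ∀ n → n ℕ.≤ d ℕ.* (n ℕ.* n)
   n≤ zero = z≤n
   n≤ (suc k) = ℕ.≤-trans (ℕ.m≤m*n (suc k) (suc k)) (ℕ.≤-trans (ℕ.≤-reflexive (sym (ℕ.*-identityˡ _))) (ℕ.*-monoˡ-≤ (suc k ℕ.* suc k) 1≤d))
 rootFrom-bound (suc f) d x r n 1≤d fr h with x ℕ.<ᵇ d ℕ.* (suc r ℕ.* suc r) in eq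
 ... | false = rootFrom-bound f d x (suc r) n 1≤d (ℕ.≤-trans fr (ℕ.≤-reflexive (sym (ℕ.+-suc f r)))) h
 ... | true with n ℕ.≤? r
 ...   | yes l = l
 ...   | no l = ⊥-elim (ℕ.<-irrefl refl (ℕ.<-≤-trans (<ᵇ⇒< _ _ eq)
                 (ℕ.≤-trans (ℕ.*-monoʳ-≤ d (ℕ.*-mono-≤ (ℕ.≰⇒> l) (ℕ.≰⇒> l))) h)))

 root-bound : ∀ d x n → 1 ℕ.≤ d → d ℕ.* (n ℕ.* n) ℕ.≤ x → n ℕ.≤ root d x
 root-bound d x n 1≤d = rootFrom-bound x d x 0 n 1≤d (ℕ.≤-reflexive (sym (ℕ.+-identityʳ x)))

 module TraceIdentities (S : Scalars) where
   open Scalars S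
   open ScalarSolver S

   -- With T and T′ the traces of the factors, TT′ + Δbb′ is twice the trace of the product. This
   -- links the halved coordinates of `TotNonneg` with multiplication of pairs.
   trace-⊗ : ∀ a b c d s p Δ → Δ ≡ s * s + ⟦ + 4 ⟧ * p →
     (⟦ + 2 ⟧ * a + s * b) * (⟦ + 2 ⟧ * c + s * d) + Δ * (b * d) ≡ ⟦ + 2 ⟧ * (⟦ + 2 ⟧ * (a * c + p * (b * d)) + s * (a * d + b * c + s * (b * d)))
   trace-⊗ a b c d s p _ refl = solve 6 (λ a b c d s p →
     (con (+ 2) :* a :+ s :* b) :* (con (+ 2) :* c :+ s :* d) :+ (s :* s :+ con (+ 4) :* p) :* (b :* d)
     := con (+ 2) :* (con (+ 2) :* (a :* c :+ p :* (b :* d)) :+ s :* (a :* d :+ b :* c :+ s :* (b :* d)))) refl a b c d s p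

   im-⊗ : ∀ a b c d s → (⟦ + 2 ⟧ * a + s * b) * d + (⟦ + 2 ⟧ * c + s * d) * b ≡ ⟦ + 2 ⟧ * (a * d + b * c + s * (b * d))
   im-⊗ = solve 5 (λ a b c d s → (con (+ 2) :* a :+ s :* b) :* d :+ (con (+ 2) :* c :+ s :* d) :* b
     := con (+ 2) :* (a :* d :+ b :* c :+ s :* (b :* d))) refl

   scaled-square : ∀ Δ b → Δ * ((⟦ + 2 ⟧ * b) * (⟦ + 2 ⟧ * b)) ≡ ⟦ + 4 ⟧ * (Δ * (b * b))
   scaled-square = solve 2 (λ Δ b → Δ :* ((con (+ 2) :* b) :* (con (+ 2) :* b)) := con (+ 4) :* (Δ :* (b :* b))) refl

   square-double : ∀ b → (⟦ + 2 ⟧ * b) * (⟦ + 2 ⟧ * b) ≡ ⟦ + 4 ⟧ * (b * b)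
   square-double = solve 1 (λ b → (con (+ 2) :* b) :* (con (+ 2) :* b) := con (+ 4) :* (b :* b)) refl

   trace-⊝ : ∀ a b c d s → ⟦ + 2 ⟧ * (⟦ + 2 ⟧ * (a + - c) + s * (b + - d)) + ⟦ + 2 ⟧ * (⟦ + 2 ⟧ * c + s * d) ≡ ⟦ + 2 ⟧ * (⟦ + 2 ⟧ * a + s * b)
   trace-⊝ = solve 5 (λ a b c d s → con (+ 2) :* (con (+ 2) :* (a :- c) :+ s :* (b :- d)) :+ con (+ 2) :* (con (+ 2) :* c :+ s :* d)
     := con (+ 2) :* (con (+ 2) :* a :+ s :* b)) refl

   2m : ∀ m n s → ⟦ + 2 ⟧ * m ≡ (⟦ + 2 ⟧ * m + s * n) + - (s * n)
   2m = solve 3 (λ m n s → con (+ 2) :* m := (con (+ 2) :* m :+ s :* n) :- s :* n) refl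

   norm-trace : ∀ a b s p Δ → Δ ≡ s * s + ⟦ + 4 ⟧ * p →
     (⟦ + 2 ⟧ * a + s * b) * (⟦ + 2 ⟧ * a + s * b) + - (Δ * (b * b)) ≡ ⟦ + 4 ⟧ * (a * a + s * (a * b) + - (p * (b * b)))
   norm-trace a b s p _ refl = solve 4 (λ a b s p →
     (con (+ 2) :* a :+ s :* b) :* (con (+ 2) :* a :+ s :* b) :- (s :* s :+ con (+ 4) :* p) :* (b :* b)
     := con (+ 4) :* (a :* a :+ s :* (a :* b) :- p :* (b :* b))) refl a b s p

 private module ℤ-id = TraceIdentities ℤ-scalars

 module Enumeration (s p : ℤ) (Δ : ℕ) (Δ≡ : + Δ ≡ s ℤ.* s ℤ.+ + 4 ℤ.* p) (s≤1 : ∣ s ∣ ℕ.≤ 1) (1≤Δ : 1 ℕ.≤ Δ) where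
   open Arithmetic s p Δ
   open Positivity Δ

   imO : O → ℤ
   imO (a ∶ b) = b

   Nonneg Pos : O → Set
   Nonneg x = TotNonneg (trace x) (imO x)
   Pos x = TotPositive (trace x) (imO x)

   sq-abs : ∀ b → + (Δ ℕ.* (∣ b ∣ ℕ.* ∣ b ∣)) ≡ + Δ ℤ.* (b ℤ.* b)
   sq-abs b = trans (ℤ.pos-* Δ _) (cong (+ Δ ℤ.*_) (abs b))
     where
     abs : ∀ b → + (∣ b ∣ ℕ.* ∣ b ∣) ≡ b ℤ.* b
     abs (+ n) = ℤ.pos-* n n
     abs -[1+ n ] = refl

   psdAux-complete : ∀ t b → TotNonneg t b → psdAux t b ≡ true
   psdAux-complete (+ t) b (_ , h) = ≤⇒≤ᵇ (ℤ.drop‿+≤+ (subst₂ ℤ._≤_ (sym (sq-abs b)) (sym (ℤ.pos-* t t)) h))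

   psd-complete : ∀ x → Nonneg x → psd x ≡ true
   psd-complete x@(a ∶ b) = psdAux-complete (trace x) b

   psd-sound : ∀ x → psd x ≡ true → Nonneg x
   psd-sound x@(a ∶ b) = go (trace x)
     where
     go : ∀ t → psdAux t b ≡ true → TotNonneg t b
     go (+ t) h = ℤ.+≤+ z≤n , subst₂ ℤ._≤_ (sq-abs b) (ℤ.pos-* t t) (ℤ.+≤+ (ℕ.≤ᵇ⇒≤ _ _ (Equivalence.from T-≡ h)))

   tp-sound : ∀ x → tp x ≡ true → Pos x
   tp-sound x@(a ∶ b) = go (trace x)
     where
     go : ∀ t → tpAux t b ≡ true → TotPositive t b
     go (+ suc t) h = ℤ.+<+ (s≤s z≤n) , subst₂ ℤ._<_ (sq-abs b) (ℤ.pos-* (suc t) (suc t)) (ℤ.+<+ (<ᵇ⇒< _ _ h))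
     go (+ zero) ()

   Nonneg-double : ∀ T b → TotNonneg T b → TotNonneg (+ 2 ℤ.* T) (+ 2 ℤ.* b)
   Nonneg-double T b (h , k) = ℤ.*-monoˡ-≤-nonNeg (+ 2) h
     , subst₂ ℤ._≤_ (sym (ℤ-id.scaled-square (+ Δ) b)) (sym (ℤ-id.square-double T)) (ℤ.*-monoˡ-≤-nonNeg (+ 4) k)

   -- The cancellation law for halved coordinates produces the doubled product, hence the detour
   -- through `Nonneg-double`.
   Nonneg-⊗-cancel : ∀ x y → Pos x → Nonneg (x ⊗ y) → Nonneg y
   Nonneg-⊗-cancel x@(a ∶ b) y@(c ∶ d) px h = TotNonneg-cancel (trace x) b (trace y) d px
     (subst₂ TotNonneg (sym (ℤ-id.trace-⊗ a b c d s p (+ Δ) Δ≡)) (sym (ℤ-id.im-⊗ a b c d s)) (Nonneg-double (trace (x ⊗ y)) (imO (x ⊗ y)) h))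

   private
     sum-sq : ∀ t n K → t ℤ.* t ℤ.+ + Δ ℤ.* (n ℤ.* n) ℤ.≤ K → ∣ t ∣ ℕ.* ∣ t ∣ ℕ.≤ ∣ K ∣ × Δ ℕ.* (∣ n ∣ ℕ.* ∣ n ∣) ℕ.≤ ∣ K ∣
     sum-sq t n K h = ℕ.≤-trans (ℕ.m≤m+n _ _) le , ℕ.≤-trans (ℕ.m≤n+m _ _) le
       where
       abs : ∀ b → + (∣ b ∣ ℕ.* ∣ b ∣) ≡ b ℤ.* b
       abs (+ n) = ℤ.pos-* n n
       abs -[1+ n ] = refl
       toℕ : ∀ {m K} → + m ℤ.≤ K → m ℕ.≤ ∣ K ∣
       toℕ (ℤ.+≤+ h) = h
       le : ∣ t ∣ ℕ.* ∣ t ∣ ℕ.+ Δ ℕ.* (∣ n ∣ ℕ.* ∣ n ∣) ℕ.≤ ∣ K ∣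
       le = toℕ (subst (ℤ._≤ K) (sym (trans (ℤ.pos-+ (∣ t ∣ ℕ.* ∣ t ∣) _) (cong₂ ℤ._+_ (abs t) (sq-abs n)))) h)


   -- The left side is twice the trace of b², and a totally non-negative difference has non-negative
   -- trace.
   square-trace : ∀ c b → Nonneg (c ⊝ b ⊗ b) → trace b ℤ.* trace b ℤ.+ + Δ ℤ.* (imO b ℤ.* imO b) ℤ.≤ + 2 ℤ.* trace c
   square-trace (c ∶ d) (m ∶ n) (h , _) =
     subst (ℤ._≤ + 2 ℤ.* trace (c ∶ d)) (sym (ℤ-id.trace-⊗ m n m n s p (+ Δ) Δ≡))
       (from-sum (+ 2 ℤ.* trace ((c ∶ d) ⊝ bb)) (+ 2 ℤ.* trace bb) (+ 2 ℤ.* trace (c ∶ d)) (ℤ.*-monoˡ-≤-nonNeg (+ 2) h)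
         (ℤ-id.trace-⊝ c d (m ℤ.* m ℤ.+ p ℤ.* (n ℤ.* n)) (m ℤ.* n ℤ.+ n ℤ.* m ℤ.+ s ℤ.* (n ℤ.* n)) s))
     where
     bb = (m ∶ n) ⊗ (m ∶ n)
     from-sum : ∀ x y z → 0ℤ ℤ.≤ x → x ℤ.+ y ≡ z → y ℤ.≤ z
     from-sum x y z 0≤x e = subst₂ ℤ._≤_ (ℤ.+-identityˡ y) e (ℤ.+-monoˡ-≤ y 0≤x)

   cands-complete : ∀ c b → psd (c ⊝ b ⊗ b) ≡ true → b ∈ cands c
   cands-complete c b@(m ∶ n) h = ∈-filterᵇ _ (∈-concatMap _ (∈-ints N-bound) (∈-map⁺ (_∶ n) (∈-ints M-bound))) h
     where
     K = 2 ℕ.* ∣ trace c ∣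
     bounds = sum-sq (trace b) n (+ 2 ℤ.* trace c) (square-trace c b (psd-sound (c ⊝ b ⊗ b) h))
     K≡ : ∣ + 2 ℤ.* trace c ∣ ≡ K
     K≡ = ℤ.abs-* (+ 2) (trace c)
     N-bound : ∣ n ∣ ℕ.≤ root Δ K
     N-bound = root-bound Δ K (∣ n ∣) 1≤Δ (subst (_ ℕ.≤_) K≡ (proj₂ bounds))
     t-bound : ∣ trace b ∣ ℕ.≤ root 1 K
     t-bound = root-bound 1 K (∣ trace b ∣) (s≤s z≤n) (subst₂ ℕ._≤_ (sym (ℕ.*-identityˡ _)) K≡ (proj₁ bounds))
     sn : ∣ s ℤ.* n ∣ ℕ.≤ root Δ K
     sn = ℕ.≤-trans (ℕ.≤-reflexive (ℤ.abs-* s n)) (ℕ.≤-trans (ℕ.*-monoˡ-≤ (∣ n ∣) s≤1) (ℕ.≤-trans (ℕ.≤-reflexive (ℕ.*-identityˡ _)) N-bound))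
     -- From 2m = t - sn and the bound on s.
     2m-bound : 2 ℕ.* ∣ m ∣ ℕ.≤ root 1 K ℕ.+ root Δ K
     2m-bound = begin
       2 ℕ.* ∣ m ∣                              ≡⟨ sym (ℤ.abs-* (+ 2) m) ⟩
       ∣ + 2 ℤ.* m ∣                            ≡⟨ cong ∣_∣ (ℤ-id.2m m n s) ⟩
       ∣ trace b ℤ.+ ℤ.- (s ℤ.* n) ∣            ≤⟨ ℤ.∣i+j∣≤∣i∣+∣j∣ (trace b) (ℤ.- (s ℤ.* n)) ⟩
       ∣ trace b ∣ ℕ.+ ∣ ℤ.- (s ℤ.* n) ∣        ≡⟨ cong (∣ trace b ∣ ℕ.+_) (ℤ.∣-i∣≡∣i∣ (s ℤ.* n)) ⟩
       ∣ trace b ∣ ℕ.+ ∣ s ℤ.* n ∣              ≤⟨ ℕ.+-mono-≤ t-bound sn ⟩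
       root 1 K ℕ.+ root Δ K                    ∎
       where open ℕ.≤-Reasoning
     M-bound : ∣ m ∣ ℕ.≤ (root 1 K ℕ.+ root Δ K) ℕ./ 2
     M-bound = ℕ.≤-trans (ℕ.≤-reflexive (trans (sym (ℕ.m*n/n≡m (∣ m ∣) 2)) (cong (ℕ._/ 2) (ℕ.*-comm (∣ m ∣) 2)))) (ℕ./-monoˡ-≤ 2 2m-bound)

   -- Four times the norm is t² - Δb². The successor form excludes a zero divisor in `quotℤ`.
   norm-positive : ∀ x → tp x ≡ true → ∃ λ N → normO x ≡ + suc N
   norm-positive x@(a ∶ b) h = positive (normO x) (cancel-0< {+ 4} {normO x} (ℤ.+≤+ z≤n) (subst (0ℤ ℤ.<_)
       (ℤ-id.norm-trace a b s p (+ Δ) Δ≡) (0<-diff (+ Δ ℤ.* (b ℤ.* b)) (trace x ℤ.* trace x) (proj₂ (tp-sound x h)))))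
     where
     0<-diff : ∀ i j → i ℤ.< j → 0ℤ ℤ.< j ℤ.- i
     0<-diff i j i<j = subst (ℤ._< j ℤ.- i) (ℤ.+-inverseʳ i) (ℤ.+-monoˡ-< (ℤ.- i) i<j)
     positive : ∀ z → 0ℤ ℤ.< z → ∃ λ N → z ≡ + suc N
     positive (+ suc N) _ = N , refl
     positive (+ zero) (ℤ.+<+ ())

   0-nonneg : Nonneg 0O
   0-nonneg = subst (λ t → TotNonneg t 0ℤ) (sym (trans (ℤ.+-identityˡ (s ℤ.* 0ℤ)) (ℤ.*-zeroʳ s)))
     (ℤ.+≤+ z≤n , ℤ.≤-reflexive (ℤ.*-zeroʳ (+ Δ)))

-- Divisibility and cancellation.

module IntegralDivision where
 open Certificates
 open QuadraticSpaces
 open TraceOrder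
 open QuadraticIntegers
 open Completeness
 open import Data.Nat using (zero; suc)
 open import Data.Integer using (ℤ)
 open import Data.Bool.ListAction using (all)
 open import Data.List using ([]; _∷_)
 open import Data.List.Relation.Unary.All using ([]; _∷_)

 isZero-sound : ∀ z → isZero z ≡ true → z ≡ 0ℤ
 isZero-sound (ℤ.+ zero) _ = refl

 ==O-sound : ∀ x y → (x ==O y) ≡ true → x ≡ y
 ==O-sound (a ∶ b) (c ∶ d) h with ∧-true h
 ... | h₁ , h₂ = cong₂ _∶_ (ℤ.i-j≡0⇒i≡j a c (isZero-sound _ h₁)) (ℤ.i-j≡0⇒i≡j b d (isZero-sound _ h₂))

 divℤ-complete : ∀ N k → divℤ N (ℤ.+ N ℤ.* k) ≡ true
 divℤ-complete zero k = refl
 divℤ-complete (suc N) k = Equivalence.to T-≡ (ℕ.≡⇒≡ᵇ _ 0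
   (trans (cong (ℕ._% suc N) (trans (ℤ.abs-* (ℤ.+ suc N) k) (ℕ.*-comm (suc N) (∣ k ∣)))) (ℕ.m*n%n≡0 (∣ k ∣) (suc N))))

 divℤ-sound : ∀ N x → 0 ℕ.< N → divℤ N x ≡ true → ℤ.+ N ℤ.* quotℤ N x ≡ x
 divℤ-sound (suc N) x _ h = go x (ℕ.≡ᵇ⇒≡ _ 0 (Equivalence.from T-≡ h))
   where
   exact : ∀ m → m ℕ.% suc N ≡ 0 → suc N ℕ.* (m ℕ./ suc N) ≡ m
   exact m e = trans (ℕ.*-comm (suc N) _) (trans (cong (ℕ._+ m ℕ./ suc N ℕ.* suc N) (sym e)) (sym (ℕ.m≡m%n+[m/n]*n m (suc N))))
   go : ∀ x → ∣ x ∣ ℕ.% suc N ≡ 0 → ℤ.+ suc N ℤ.* quotℤ (suc N) x ≡ x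
   go (ℤ.+ m) e = trans (sym (ℤ.pos-* (suc N) _)) (cong ℤ.+_ (exact m e))
   go -[1+ m ] e = trans (sym (ℤ.neg-distribʳ-* (ℤ.+ suc N) (ℤ.+ (suc m ℕ./ suc N))))
     (trans (cong ℤ.-_ (sym (ℤ.pos-* (suc N) _))) (cong (λ z → ℤ.- (ℤ.+ z)) (exact (suc m) e)))

 all-complete : ∀ {A : Set} (f : A → Bool) xs → (∀ {x} → x ∈ xs → f x ≡ true) → all f xs ≡ true
 all-complete f [] h = refl
 all-complete f (x ∷ xs) h rewrite h (here refl) = all-complete f xs (λ i → h (there i))

 -- All that the certificate argument uses of F: a ring containing ω, with 1 and ω independent over
 -- the integers, in which positive integers cancel.
 record Ambient : Set₁ where
   field
     S : Scalars
   open Scalars S public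
   open QuadraticSpace S public hiding (_⊕_)
   open QuadraticSpace S public using () renaming (_⊕_ to _⊕ᵛ_)
   field
     s p : ℤ
     Δ : ℕ
     Δ≡ : ℤ.+ Δ ≡ s ℤ.* s ℤ.+ ℤ.+ 4 ℤ.* p
     s≤1 : ∣ s ∣ ℕ.≤ 1
     1≤Δ : 1 ℕ.≤ Δ
     w : Carrier
     w² : w * w ≡ ⟦ p ⟧ + ⟦ s ⟧ * w
   open Arithmetic s p Δ public
   open QuadInt S s p Δ w w² public
   open Enumeration s p Δ Δ≡ s≤1 1≤Δ public
   field
     ι-injective : ∀ {x y} → ι x ≡ ι y → x ≡ y
     ℤ-regular : ∀ N {y} → ⟦ ℤ.+ suc N ⟧ * y ≡ 0# → y ≡ 0#

 module Divisibility (A : Ambient) where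
   open Ambient A
   open ScalarSolver S

   regular-cancel : ∀ d → (∀ {y} → d * y ≡ 0# → y ≡ 0#) → ∀ a b → d * a ≡ d * b → a ≡ b
   regular-cancel d reg a b e = trans (expand a b) (trans (cong (_+ b) (reg
     (trans (distr d a b) (trans (cong (_- d * b) e) (self (d * b)))))) (zeroˡ b))
     where
     expand : ∀ a b → a ≡ (a - b) + b
     expand = solve 2 (λ a b → a := (a :- b) :+ b) refl
     distr : ∀ d a b → d * (a - b) ≡ d * a - d * b
     distr = solve 3 (λ d a b → d :* (a :- b) := d :* a :- d :* b) refl
     self : ∀ x → x - x ≡ 0#
     self x = subst (x - x ≡_) ⟦⟧-0 (solve 1 (λ x → x :- x := con 0ℤ) refl x)
     zeroˡ : ∀ b → 0# + b ≡ b
     zeroˡ b = subst (λ o → o + b ≡ b) ⟦⟧-0 (solve 1 (λ b → con 0ℤ :+ b := b) refl b)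

   *-zeroʳ : ∀ x → x * 0# ≡ 0#
   *-zeroʳ x = subst (λ o → x * o ≡ o) ⟦⟧-0 (solve 1 (λ x → x :* con 0ℤ := con 0ℤ) refl x)

   norm-regular : ∀ x {y} → tp x ≡ true → ⟦ normO x ⟧ * y ≡ 0# → y ≡ 0#
   norm-regular x tx e with norm-positive x tx
   ... | N , eN rewrite eN = ℤ-regular N e

   -- Multiplication by the conjugate replaces x by its norm, a positive integer.
   tp-regular : ∀ x {y} → tp x ≡ true → ι x * y ≡ 0# → y ≡ 0#
   tp-regular x {y} tx e = norm-regular x tx (trans (cong (_* y) (sym (ι-conjO x)))
     (trans (solve 3 (λ d c y → d :* c :* y := c :* (d :* y)) refl (ι x) (ι (conjO x)) y) (trans (cong (ι (conjO x) *_) e) (*-zeroʳ (ι (conjO x))))))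

   scaleℤ : ℤ → O → O
   scaleℤ N (a ∶ b) = (N ℤ.* a) ∶ (N ℤ.* b)

   ι-scaleℤ : ∀ N x → ι (scaleℤ N x) ≡ ⟦ N ⟧ * ι x
   ι-scaleℤ N (a ∶ b) rewrite ⟦⟧-* N a | ⟦⟧-* N b =
     solve 4 (λ n a b w → n :* a :+ n :* b :* w := n :* (a :+ b :* w)) refl ⟦ N ⟧ ⟦ a ⟧ ⟦ b ⟧ w

   private
     conj-multiple : ∀ d y x → ι d * ι y ≡ ι x → x ⊗ conjO d ≡ scaleℤ (normO d) y
     conj-multiple d y x e = ι-injective (begin
       ι (x ⊗ conjO d)              ≡⟨ val (itself {x} ↦* itself {conjO d}) ⟩
       ι x * ι (conjO d)            ≡⟨ cong (_* ι (conjO d)) (sym e) ⟩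
       ι d * ι y * ι (conjO d)      ≡⟨ solve 3 (λ d y c → d :* y :* c := d :* c :* y) refl (ι d) (ι y) (ι (conjO d)) ⟩
       ι d * ι (conjO d) * ι y      ≡⟨ cong (_* ι y) (ι-conjO d) ⟩
       ⟦ normO d ⟧ * ι y            ≡⟨ sym (ι-scaleℤ (normO d) y) ⟩
       ι (scaleℤ (normO d) y)       ∎)
       where open ≡-Reasoning

   -- If x = dy, then x times the conjugate of d is the norm of d times y; injectivity of `ι` makes
   -- this an identity of integer pairs.
   divO-complete : ∀ d y x → tp d ≡ true → ι d * ι y ≡ ι x → divO d x ≡ true
   divO-complete d y@(a ∶ b) x td e with norm-positive d td
   ... | N , eN rewrite conj-multiple d y x e | eN | divℤ-complete (suc N) a = divℤ-complete (suc N) b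

   quotO-sound : ∀ d x → tp d ≡ true → divO d x ≡ true → ι d * ι (quotO d x) ≡ ι x
   quotO-sound d x td h with norm-positive d td
   ... | N , eN = regular-cancel (ι (conjO d)) conj-regular _ _ (begin
       ι (conjO d) * (ι d * ι (quotO d x))  ≡⟨ solve 3 (λ c d q → c :* (d :* q) := d :* c :* q) refl (ι (conjO d)) (ι d) (ι (quotO d x)) ⟩
       ι d * ι (conjO d) * ι (quotO d x)    ≡⟨ cong (_* ι (quotO d x)) (ι-conjO d) ⟩
       ⟦ normO d ⟧ * ι (quotO d x)          ≡⟨ sym (ι-scaleℤ (normO d) (quotO d x)) ⟩
       ι (scaleℤ (normO d) (quotO d x))     ≡⟨ cong ι (exact (x ⊗ conjO d) refl) ⟩
       ι (x ⊗ conjO d)                      ≡⟨ val (itself {x} ↦* itself {conjO d}) ⟩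
       ι x * ι (conjO d)                    ≡⟨ solve 2 (λ x c → x :* c := c :* x) refl (ι x) (ι (conjO d)) ⟩
       ι (conjO d) * ι x                    ∎)
     where
     open ≡-Reasoning
     -- The conjugate of d divides the same positive norm, so it cancels as well.
     conj-regular : ∀ {y} → ι (conjO d) * y ≡ 0# → y ≡ 0#
     conj-regular {y} e = norm-regular d td (trans (cong (_* y) (sym (ι-conjO d)))
       (trans (solve 3 (λ d c y → d :* c :* y := d :* (c :* y)) refl (ι d) (ι (conjO d)) y) (trans (cong (ι d *_) e) (*-zeroʳ (ι d)))))
     exact : ∀ t → t ≡ x ⊗ conjO d → scaleℤ (normO d) (quotO d x) ≡ t
     exact (u ∶ v) e rewrite sym e | eN with ∧-true h
     ... | h₁ , h₂ = cong₂ _∶_ (divℤ-sound (suc N) u (s≤s z≤n) h₁) (divℤ-sound (suc N) v (s≤s z≤n) h₂)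

-- Universal lattices and frames of three vectors.

module Lattices where
 open Certificates
 open QuadraticSpaces
 open TraceOrder
 open QuadraticIntegers
 open Completeness
 open IntegralDivision
 open import Data.Integer using (ℤ)

 -- Positive definiteness is split into total non-negativity of all values and the absence of
 -- non-zero isotropic vectors; the former prunes the search and the latter proves vectors equal.
 record UniversalLattice (A : Ambient) : Set₁ where
   open Ambient A
   field
     quadraticForm : QuadraticForm
   open QuadraticForm quadraticForm public
   field
     L : Vec → Set
     L-⊕ : ∀ {u v} → L u → L v → L (u ⊕ᵛ v)
     L-⊙ : ∀ x {u} → L u → L (ι x ⊙ u)
     Q-integral : ∀ {u} → L u → ∃ λ x → x ↦ Q u
     Q-nonneg : ∀ x {u} → L u → x ↦ Q u → Nonneg x
     Q-aniso : ∀ {u} → L u → Q u ≡ 0# → u ≡ 𝟎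
     universal : ∀ x → tp x ≡ true → ∃ λ u → L u × x ↦ Q u
     -- decidability of a property of all vectors of L; it comes from finite generation
     dichotomy : ∀ (P : Vec → Set) (G : Set) → P 𝟎 → (∀ {u v} → P u → P v → P (u ⊕ᵛ v)) → (∀ x {u} → P u → P (ι x ⊙ u)) →
       (∀ {v} → L v → P v ⊎ G) → (∀ {v} → L v → P v) ⊎ G

 module Lattice (A : Ambient) (U : UniversalLattice A) where
   open Ambient A
   open UniversalLattice U
   open Divisibility A
   open ScalarSolver S

   cancel : ∀ d → tp d ≡ true → ∀ {a b} → ι d * a ≡ ι d * b → a ≡ b
   cancel d td {a} {b} = regular-cancel (ι d) (tp-regular d td) a b

   2-cancel : ∀ {a b} → ⟦ ℤ.+ 2 ⟧ * a ≡ ⟦ ℤ.+ 2 ⟧ * b → a ≡ b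
   2-cancel {a} {b} = regular-cancel ⟦ ℤ.+ 2 ⟧ (ℤ-regular 1) a b

   twice : ∀ x → x + x ≡ ⟦ ℤ.+ 2 ⟧ * x
   twice = solve 1 (λ x → x :+ x := con (ℤ.+ 2) :* x) refl

   B-integral : ∀ {u v} → L u → L v → ∃ λ b → b ↦ B u v
   B-integral {u} {v} lu lv with Q-integral lu | Q-integral lv | Q-integral (L-⊕ lu lv)
   ... | x , ex | y , ey | z , ez = z ⊝ x ⊝ y , is (trans (val (ez ↦- ex ↦- ey))
     (trans (cong (λ t → t - Q u - Q v) (Q-⊕ u v)) (solve 3 (λ x y b → x :+ y :+ b :- x :- y := b) refl (Q u) (Q v) (B u v))))

   0O↦ : 0O ↦ 0#
   0O↦ = is (trans (ι-ℤ 0ℤ) ⟦⟧-0)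

   neg↦ : ∀ {x X} → x ↦ X → (0O ⊝ x) ↦ - X
   neg↦ {x} {X} e = is (trans (val (0O↦ ↦- e)) (subst (λ o → o - X ≡ - X) ⟦⟧-0 (solve 1 (λ x → con 0ℤ :- x := :- x) refl X)))

   L-⊙′ : ∀ {x X u} → x ↦ X → L u → L (X ⊙ u)
   L-⊙′ {x} (is e) l = subst (λ t → L (t ⊙ _)) e (L-⊙ x l)

   -- The vector of `project₂` lies in L, so its value is totally non-negative; the totally positive
   -- factor Q(u) is cancelled.
   cauchy-schwarz : ∀ {u v x y b} → L u → L v → tp x ≡ true → x ↦ Q u → y ↦ Q v → b ↦ B u v → psd (4 · (y ⊗ x) ⊝ b ⊗ b) ≡ true
   cauchy-schwarz {u} {v} {x} {y} {b} lu lv tx ex ey eb =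
     psd-complete e (Nonneg-⊗-cancel x e (tp-sound x tx)
       (Q-nonneg (x ⊗ e) (L-⊕ (L-⊙′ (ex ↦+ ex) lv) (L-⊙′ (neg↦ eb) lu)) (is (trans (val (ex ↦* (↦· 4 (ey ↦* ex) ↦- eb ↦* eb)))
          (trans (cong (λ t → Q u * (⟦ ℤ.+ 4 ⟧ * t - B u v * B u v)) (solve 2 (λ x y → x :* y := y :* x) refl (Q v) (Q u))) (sym (project₂ u v)))))))
     where e = 4 · (y ⊗ x) ⊝ b ⊗ b

   -- The same argument for `project₃`, whose value is the product of the binary and the ternary
   -- discriminant.
   gram-nonneg : ∀ {u v t x y z a b c} → L u → L v → L t → x ↦ Q u → y ↦ Q v → z ↦ Q t → a ↦ B u v → b ↦ B u t → c ↦ B v t →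
     tp (4 · (x ⊗ y) ⊝ a ⊗ a) ≡ true → psd (δ₃ (gram x y z a b c)) ≡ true
   gram-nonneg {u} {v} {t} {x} {y} {z} {a} {b} {c} lu lv lt ex ey ez ea eb ec te =
     psd-complete δ (Nonneg-⊗-cancel e δ (tp-sound e te)
       (Q-nonneg (e ⊗ δ) (L-⊕ (L-⊕ (L-⊙′ (ea ↦* ec ↦- (ey ↦+ ey) ↦* eb) lu) (L-⊙′ (ea ↦* eb ↦- (ex ↦+ ex) ↦* ec) lv)) (L-⊙′ e↦ lt))
         (is (trans (val (e↦ ↦* δ↦)) (sym (project₃ u v t))))))
     where
     e = 4 · (x ⊗ y) ⊝ a ⊗ a
     δ = δ₃ (gram x y z a b c)
     e↦ = ↦· 4 (ex ↦* ey) ↦- ea ↦* ea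
     δ↦ = ↦· 4 (ex ↦* (ey ↦* ez)) ↦+ ea ↦* (eb ↦* ec) ↦- ex ↦* (ec ↦* ec) ↦- ey ↦* (eb ↦* eb) ↦- ez ↦* (ea ↦* ea)

   -- Positivity of the determinant is what makes the triple independent and allows cancellation of
   -- the determinant.
   record Base (q₁ q₂ q₃ a b c : O) : Set where
     field
       v₁ v₂ v₃ : Vec
       l₁ : L v₁
       l₂ : L v₂
       l₃ : L v₃
       e₁ : q₁ ↦ Q v₁
       e₂ : q₂ ↦ Q v₂
       e₃ : q₃ ↦ Q v₃
       e₁₂ : a ↦ B v₁ v₂
       e₁₃ : b ↦ B v₁ v₃
       e₂₃ : c ↦ B v₂ v₃
       definite : tp (2 · δ₃ (gram q₁ q₂ q₃ a b c)) ≡ true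

     Dual : O³ → Vec → Set
     Dual (tri x y z) v = x ↦ B v v₁ × y ↦ B v v₂ × z ↦ B v v₃

     -- The vector itself is kept only existentially; the checker works with its products alone.
     Ext : O³ → Set
     Ext β = ∃ λ v → L v × Dual β v

     comb : (x y z : Carrier) → Vec
     comb x y z = x ⊙ v₁ ⊕ᵛ y ⊙ v₂ ⊕ᵛ z ⊙ v₃

   module Frame {q₁ q₂ q₃ a b c} (base : Base q₁ q₂ q₃ a b c) where
     open Base base public
     G = gram q₁ q₂ q₃ a b c
     δ = δ₃ G
     det↦ = ↦· 4 (e₁ ↦* (e₂ ↦* e₃)) ↦+ e₁₂ ↦* (e₁₃ ↦* e₂₃) ↦- e₁ ↦* (e₂₃ ↦* e₂₃) ↦- e₂ ↦* (e₁₃ ↦* e₁₃) ↦- e₃ ↦* (e₁₂ ↦* e₁₂)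

     D : Carrier
     D = ⟦ ℤ.+ 2 ⟧ * disc₃ (Q v₁) (Q v₂) (Q v₃) (B v₁ v₂) (B v₁ v₃) (B v₂ v₃)

     D↦ : 2 · δ ↦ D
     D↦ = ↦· 2 det↦

     D-cancel : ∀ {x y} → D * x ≡ D * y → x ≡ y
     D-cancel {x} {y} e = cancel (2 · δ) definite (trans (cong (_* x) (val D↦)) (trans e (cong (_* y) (sym (val D↦)))))

     dual-of : ∀ {v} → L v → ∃ λ β → Dual β v
     dual-of lv with B-integral lv l₁ | B-integral lv l₂ | B-integral lv l₃
     ... | x , ex | y , ey | z , ez = tri x y z , ex , ey , ez

     α₁ α₂ α₃ : Vec → Carrier
     α₁ v = adj₁ (Q v₁) (Q v₂) (Q v₃) (B v₁ v₂) (B v₁ v₃) (B v₂ v₃) (B v v₁) (B v v₂) (B v v₃)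
     α₂ v = adj₂ (Q v₁) (Q v₂) (Q v₃) (B v₁ v₂) (B v₁ v₃) (B v₂ v₃) (B v v₁) (B v v₂) (B v v₃)
     α₃ v = adj₃ (Q v₁) (Q v₂) (Q v₃) (B v₁ v₂) (B v₁ v₃) (B v₂ v₃) (B v v₁) (B v v₂) (B v v₃)

     A₁↦ = ↦· 4 (e₂ ↦* e₃) ↦- e₂₃ ↦* e₂₃
     A₂↦ = ↦· 4 (e₁ ↦* e₃) ↦- e₁₃ ↦* e₁₃
     A₃↦ = ↦· 4 (e₁ ↦* e₂) ↦- e₁₂ ↦* e₁₂
     A₁₂↦ = e₁₃ ↦* e₂₃ ↦- ↦· 2 (e₃ ↦* e₁₂)
     A₁₃↦ = e₁₂ ↦* e₂₃ ↦- ↦· 2 (e₂ ↦* e₁₃)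
     A₂₃↦ = e₁₂ ↦* e₁₃ ↦- ↦· 2 (e₁ ↦* e₂₃)

     α↦ : ∀ {v} β → Dual β v → pr₁ (app (adj G) β) ↦ α₁ v × pr₂ (app (adj G) β) ↦ α₂ v × pr₃ (app (adj G) β) ↦ α₃ v
     α↦ (tri x y z) (ex , ey , ez) =
         (A₁↦ ↦* ex ↦+ A₁₂↦ ↦* ey ↦+ A₁₃↦ ↦* ez)
       , (A₁₂↦ ↦* ex ↦+ A₂↦ ↦* ey ↦+ A₂₃↦ ↦* ez)
       , (A₁₃↦ ↦* ex ↦+ A₂₃↦ ↦* ey ↦+ A₃↦ ↦* ez)

     -- D v and Σ αᵢ vᵢ have the same products with every vᵢ.
     expand : ∀ {v} → L v → D ⊙ v ≡ comb (α₁ v) (α₂ v) (α₃ v)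
     expand {v} lv with dual-of lv
     ... | β , eβ with α↦ β eβ
     ... | a₁ , a₂ , a₃ = ≡³ (component _ _ _ _ _ _ _ (cong proj₁ w≡0)) (component _ _ _ _ _ _ _ (cong (λ t → proj₁ (proj₂ t)) w≡0))
                             (component _ _ _ _ _ _ _ (cong (λ t → proj₂ (proj₂ t)) w≡0))
       where
       r : Vec
       r = comb (- α₁ v) (- α₂ v) (- α₃ v) ⊕ᵛ D ⊙ v
       component : ∀ a b c x y z t → (- a) * x + (- b) * y + (- c) * z + t ≡ 0# → t ≡ a * x + b * y + c * z
       component a b c x y z t e = trans (solve 7 (λ a b c x y z t → t := ((:- a) :* x :+ (:- b) :* y :+ (:- c) :* z :+ t) :+ (a :* x :+ b :* y :+ c :* z)) refl a b c x y z t)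
         (trans (cong (_+ (a * x + b * y + c * z)) e) (subst (λ o → o + (a * x + b * y + c * z) ≡ a * x + b * y + c * z) ⟦⟧-0
           (solve 6 (λ a b c x y z → con 0ℤ :+ (a :* x :+ b :* y :+ c :* z) := a :* x :+ b :* y :+ c :* z) refl a b c x y z)))
       lr : L r
       lr = L-⊕ (L-⊕ (L-⊕ (L-⊙′ (neg↦ a₁) l₁) (L-⊙′ (neg↦ a₂) l₂)) (L-⊙′ (neg↦ a₃) l₃)) (L-⊙′ D↦ lv)
       orth : ∀ {t X Y Z x} → B v₁ t ≡ X → B v₂ t ≡ Y → B v₃ t ≡ Z → B v t ≡ x →
         X * α₁ v + Y * α₂ v + Z * α₃ v ≡ D * x → B r t ≡ 0#
       orth {t} {X} {Y} {Z} {x} refl refl refl refl e = begin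
         B r t                                                              ≡⟨ B-⊕ _ _ t ⟩
         B (comb (- α₁ v) (- α₂ v) (- α₃ v)) t + B (D ⊙ v) t                ≡⟨ cong₂ _+_ (B-sum _ _ _ v₁ v₂ v₃ t) (B-⊙ D v t) ⟩
         (- α₁ v) * X + (- α₂ v) * Y + (- α₃ v) * Z + D * x                 ≡⟨ cong ((- α₁ v) * X + (- α₂ v) * Y + (- α₃ v) * Z +_) (sym e) ⟩
         (- α₁ v) * X + (- α₂ v) * Y + (- α₃ v) * Z + (X * α₁ v + Y * α₂ v + Z * α₃ v)
           ≡⟨ subst (λ o → (- α₁ v) * X + (- α₂ v) * Y + (- α₃ v) * Z + (X * α₁ v + Y * α₂ v + Z * α₃ v) ≡ o) ⟦⟧-0
                (solve 6 (λ a b c x y z → (:- a) :* x :+ (:- b) :* y :+ (:- c) :* z :+ (x :* a :+ y :* b :+ z :* c) := con 0ℤ) refl (α₁ v) (α₂ v) (α₃ v) X Y Z) ⟩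
         0# ∎
         where open ≡-Reasoning
       -- The difference r is orthogonal to the whole triple, so D times 2Q(r) vanishes, and D and 2
       -- cancel.
       Qr≡0 : Q r ≡ 0#
       Qr≡0 = 2-cancel (trans (sym (twice (Q r))) (trans (D-cancel (trans (orthogonal-isotropic v₁ v₂ v₃ r
           (trans (B-sym v₁ r) (orth (B-self v₁) (B-sym v₂ v₁) (B-sym v₃ v₁) refl (gram-adj₁ _ _ _ _ _ _ _ _ _)))
           (trans (B-sym v₂ r) (orth refl (B-self v₂) (B-sym v₃ v₂) refl (gram-adj₂ _ _ _ _ _ _ _ _ _)))
           (trans (B-sym v₃ r) (orth refl refl (B-self v₃) refl (gram-adj₃ _ _ _ _ _ _ _ _ _))))
         (sym (*-zeroʳ D)))) (sym (*-zeroʳ ⟦ ℤ.+ 2 ⟧))))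
       w≡0 : r ≡ 𝟎
       w≡0 = Q-aniso lr Qr≡0

     pairing-value : ∀ {v} t → L v → α₁ v * B t v₁ + α₂ v * B t v₂ + α₃ v * B t v₃ ≡ D * B v t
     pairing-value {v} t lv = begin
       α₁ v * B t v₁ + α₂ v * B t v₂ + α₃ v * B t v₃
         ≡⟨ cong₂ _+_ (cong₂ _+_ (cong (α₁ v *_) (B-sym t v₁)) (cong (α₂ v *_) (B-sym t v₂))) (cong (α₃ v *_) (B-sym t v₃)) ⟩
       α₁ v * B v₁ t + α₂ v * B v₂ t + α₃ v * B v₃ t  ≡⟨ sym (B-sum _ _ _ v₁ v₂ v₃ t) ⟩
       B (comb (α₁ v) (α₂ v) (α₃ v)) t               ≡⟨ cong (λ z → B z t) (sym (expand lv)) ⟩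
       B (D ⊙ v) t                                   ≡⟨ B-⊙ D v t ⟩
       D * B v t ∎
       where open ≡-Reasoning

     pairing : ∀ {v t} β β′ → L v → Dual β v → Dual β′ t → app (adj G) β ⊡ β′ ↦ D * B v t
     pairing {v} {t} β@(tri _ _ _) (tri x y z) lv eβ (ex , ey , ez) with α↦ β eβ
     ... | a₁ , a₂ , a₃ = is (trans (val (a₁ ↦* ex ↦+ a₂ ↦* ey ↦+ a₃ ↦* ez)) (pairing-value t lv))

-- Completeness of the survivor lists.

module SurvivorLists where
 open Certificates
 open QuadraticSpaces
 open TraceOrder
 open QuadraticIntegers
 open Completeness
 open IntegralDivision
 open Lattices
 open import Data.Nat using (zero; suc)
 open import Data.Integer using (ℤ)
 open import Data.Bool using (false; if_then_else_)
 open import Data.Bool.ListAction using (all)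
 open import Data.List using ([]; _∷_; map)
 open import Data.List.Relation.Unary.All using ([]; _∷_)

 ∧-intro : ∀ {a b} → a ≡ true → b ≡ true → a ∧ b ≡ true
 ∧-intro refl refl = refl

 ∈-if : ∀ {A : Set} {b} {x : A} {xs} → b ≡ true → x ∈ xs → x ∈ (if b then xs else [])
 ∈-if refl i = i

 neg³ : O³ → O³
 neg³ (tri x y z) = tri (0O ⊝ x) (0O ⊝ y) (0O ⊝ z)

 isZero-neg : ∀ a → isZero (0ℤ ℤ.- a) ≡ isZero a
 isZero-neg (ℤ.+ zero) = refl
 isZero-neg (ℤ.+ suc n) = refl
 isZero-neg -[1+ n ] = refl

 zeroO-neg : ∀ x → zeroO (0O ⊝ x) ≡ zeroO x
 zeroO-neg (a ∶ b) = cong₂ _∧_ (isZero-neg a) (isZero-neg b)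

 lexNonneg-± : ∀ x → lexNonneg x ≡ true ⊎ lexNonneg (0O ⊝ x) ≡ true
 lexNonneg-± (ℤ.+ zero ∶ ℤ.+ b) = inj₁ refl
 lexNonneg-± (ℤ.+ zero ∶ -[1+ b ]) = inj₂ refl
 lexNonneg-± (ℤ.+ suc a ∶ b) = inj₁ refl
 lexNonneg-± (-[1+ a ] ∶ b) = inj₂ refl

 normalized-± : ∀ β → normalized β ≡ true ⊎ normalized (neg³ β) ≡ true
 normalized-± (tri x y z) rewrite zeroO-neg x | zeroO-neg y with zeroO x | zeroO y
 ... | false | _     = lexNonneg-± x
 ... | true  | false = lexNonneg-± y
 ... | true  | true  = lexNonneg-± z

 zeroO-sound : ∀ x → zeroO x ≡ true → x ≡ 0O
 zeroO-sound (a ∶ b) h with ∧-true h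
 ... | h₁ , h₂ = cong₂ _∶_ (isZero-sound a h₁) (isZero-sound b h₂)

 -- Allows the first coordinate to be filtered by sign before the triples are formed.
 normalized-lex : ∀ x y z → normalized (tri x y z) ≡ true → lexNonneg x ≡ true
 normalized-lex x y z h with zeroO x in e
 ... | false = h
 ... | true rewrite zeroO-sound x e = refl

 module Survivors (A : Ambient) (U : UniversalLattice A) where
   open Ambient A
   open UniversalLattice U
   open Divisibility A
   open Lattice A U
   open ScalarSolver S

   neg-vec : Vec → Vec
   neg-vec u = ι (0O ⊝ (ℤ.+ 1 ∶ ℤ.+ 0)) ⊙ u

   L-neg : ∀ {u} → L u → L (neg-vec u)
   L-neg = L-⊙ (0O ⊝ (ℤ.+ 1 ∶ ℤ.+ 0))

   1↦ : (ℤ.+ 1 ∶ ℤ.+ 0) ↦ 1#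
   1↦ = is (trans (ι-ℤ (ℤ.+ 1)) ⟦⟧-1)

   neg-one : ∀ x → ι (0O ⊝ (ℤ.+ 1 ∶ ℤ.+ 0)) * x ≡ - x
   neg-one x = trans (cong (_* x) (val (neg↦ 1↦))) (subst (λ o → (- o) * x ≡ - x) ⟦⟧-1 (solve 1 (λ x → (:- con (ℤ.+ 1)) :* x := :- x) refl x))

   B-neg : ∀ u v → B (neg-vec u) v ≡ - B u v
   B-neg u v = trans (B-⊙ _ u v) (neg-one (B u v))

   Q-neg : ∀ u → Q (neg-vec u) ≡ Q u
   Q-neg u = trans (Q-⊙ _ u) (trans (solve 2 (λ n q → n :* n :* q := n :* (n :* q)) refl (ι (0O ⊝ (ℤ.+ 1 ∶ ℤ.+ 0))) (Q u))
     (trans (cong (_ *_) (neg-one (Q u))) (trans (neg-one (- Q u)) (solve 1 (λ q → :- (:- q) := q) refl (Q u)))))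

   ↦-unique : ∀ {x y X} → x ↦ X → y ↦ X → x ≡ y
   ↦-unique (is e) (is f) = ι-injective (trans e (sym f))

   zeroO-complete : ∀ {x} → x ↦ 0# → zeroO x ≡ true
   zeroO-complete e rewrite ↦-unique e 0O↦ = refl

   ↦-subst : ∀ {x X Y} → X ≡ Y → x ↦ X → x ↦ Y
   ↦-subst refl e = e

   module WithBase {q₁ q₂ q₃ a b c} (base : Base q₁ q₂ q₃ a b c) where
     open Frame base

     Dual-neg : ∀ β {u} → Dual β u → Dual (neg³ β) (neg-vec u)
     Dual-neg (tri x y z) {u} (ex , ey , ez) =
         ↦-subst (sym (B-neg u v₁)) (neg↦ ex) , ↦-subst (sym (B-neg u v₂)) (neg↦ ey) , ↦-subst (sym (B-neg u v₃)) (neg↦ ez)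

     -- The quotient by the determinant is B(u,v), which is integral on L.
     divides-pairing : ∀ β β′ {u v} → L u → L v → Dual β u → Dual β′ v → divO (2 · δ) (app (adj G) β ⊡ β′) ≡ true
     divides-pairing β β′ lu lv eβ eβ′ with B-integral lu lv
     ... | y , is ey = divO-complete (2 · δ) y (app (adj G) β ⊡ β′) definite
       (trans (cong₂ _*_ (val D↦) ey) (sym (val (pairing β β′ lu eβ eβ′))))

     exts-divide : ∀ bs → All Ext bs → ∀ {v} β → L v → Dual β v → all (λ ax → divO (2 · δ) (ax ⊡ β)) (map (app (adj G)) bs) ≡ true
     exts-divide [] [] β lv eβ = refl
     exts-divide (b ∷ bs) ((u , lu , eb) ∷ es) β lv eβ = ∧-intro (divides-pairing b β lu lv eb eβ) (exts-divide bs es β lv eβ)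

     -- Each filter of `survivors` is a necessary condition: Cauchy-Schwarz with each basis vector,
     -- the binary-ternary Gram inequality, the value equation, and integrality against the extra
     -- vectors.
     normalized-survives : ∀ bs → All Ext bs → ∀ α → tp α ≡ true → tp (minor (adj G)) ≡ true →
       ∀ {v} β → L v → α ↦ Q v → Dual β v → normalized β ≡ true → β ∈ survivors G (adj G) (2 · δ) (map (app (adj G)) bs) α
     normalized-survives bs es α tα tm {v} β@(tri x y z) lv eα eβ@(ex , ey , ez) nβ =
       ∈-concatMap _ (∈-filterᵇ lexNonneg (cands-complete (4 · (q₁ ⊗ α)) x (cauchy-schwarz lv l₁ tα eα e₁ ex)) (normalized-lex x y z nβ))
         (∈-concatMap _ (cands-complete (4 · (q₂ ⊗ α)) y (cauchy-schwarz lv l₂ tα eα e₂ ey))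
           (∈-if (gram-nonneg l₁ l₂ lv e₁ e₂ eα e₁₂ (↦-subst (B-sym v v₁) ex) (↦-subst (B-sym v v₂) ey) tm)
             (∈-map⁺ (tri x y) (∈-filterᵇ _ (cands-complete (4 · (q₃ ⊗ α)) z (cauchy-schwarz lv l₃ tα eα e₃ ez))
               (∧-intro (zeroO-complete equation) (∧-intro (exts-divide bs es β lv eβ) nβ))))))
       where
       -- Pairing `v` with itself gives D times B(v,v), which is twice D times Q(v); the rest
       -- rewrites this as a polynomial in the last coordinate.
       equation : _ ↦ 0#
       equation = ↦-subst
         (trans (rearrange _ _ _ _ _ _ (B v v₁) (B v v₂) (B v v₃) (D * Q v))
           (trans (cong (_- ⟦ ℤ.+ 2 ⟧ * (D * Q v)) (trans (pairing-value v lv) (cong (D *_) (B-self v)))) (vanish D (Q v))))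
         (A₁↦ ↦* (ex ↦* ex) ↦+ A₂↦ ↦* (ey ↦* ey) ↦+ ↦· 2 (A₁₂↦ ↦* (ex ↦* ey)) ↦- ↦· 2 (D↦ ↦* eα)
           ↦+ (↦· 2 (A₁₃↦ ↦* ex ↦+ A₂₃↦ ↦* ey) ↦+ A₃↦ ↦* ez) ↦* ez)
         where
         rearrange : ∀ A₁ A₂ A₃ A₁₂ A₁₃ A₂₃ x y z r →
           A₁ * (x * x) + A₂ * (y * y) + ⟦ ℤ.+ 2 ⟧ * (A₁₂ * (x * y)) - ⟦ ℤ.+ 2 ⟧ * r + (⟦ ℤ.+ 2 ⟧ * (A₁₃ * x + A₂₃ * y) + A₃ * z) * z
           ≡ (A₁ * x + A₁₂ * y + A₁₃ * z) * x + (A₁₂ * x + A₂ * y + A₂₃ * z) * y + (A₁₃ * x + A₂₃ * y + A₃ * z) * z - ⟦ ℤ.+ 2 ⟧ * r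
         rearrange = solve 10 (λ A₁ A₂ A₃ A₁₂ A₁₃ A₂₃ x y z r →
           A₁ :* (x :* x) :+ A₂ :* (y :* y) :+ con (ℤ.+ 2) :* (A₁₂ :* (x :* y)) :- con (ℤ.+ 2) :* r :+ (con (ℤ.+ 2) :* (A₁₃ :* x :+ A₂₃ :* y) :+ A₃ :* z) :* z
           := (A₁ :* x :+ A₁₂ :* y :+ A₁₃ :* z) :* x :+ (A₁₂ :* x :+ A₂ :* y :+ A₂₃ :* z) :* y :+ (A₁₃ :* x :+ A₂₃ :* y :+ A₃ :* z) :* z :- con (ℤ.+ 2) :* r) refl
         vanish : ∀ d q → d * (q + q) - ⟦ ℤ.+ 2 ⟧ * (d * q) ≡ 0#
         vanish d q = subst (λ o → d * (q + q) - ⟦ ℤ.+ 2 ⟧ * (d * q) ≡ o) ⟦⟧-0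
           (solve 2 (λ d q → d :* (q :+ q) :- con (ℤ.+ 2) :* (d :* q) := con 0ℤ) refl d q)

     -- Universality supplies `v`, and one of `v` and its negative has a normalized triple.
     survivors-complete : ∀ bs → All Ext bs → ∀ α → tp α ≡ true → tp (minor (adj G)) ≡ true →
       ∃ λ β → Ext β × β ∈ survivors G (adj G) (2 · δ) (map (app (adj G)) bs) α
     survivors-complete bs es α tα tm with universal α tα
     ... | v , lv , eα with dual-of lv
     ...   | β , eβ with normalized-± β
     ...     | inj₁ nβ = β , (v , lv , eβ) , normalized-survives bs es α tα tm β lv eα eβ nβ
     ...     | inj₂ nβ = neg³ β , (neg-vec v , L-neg lv , Dual-neg β {v} eβ) ,
                 normalized-survives bs es α tα tm (neg³ β) (L-neg lv) (↦-subst (sym (Q-neg v)) eα) (Dual-neg β {v} eβ) nβ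

-- Passing to another triple of vectors.

module Rebasing where
 open Certificates
 open QuadraticSpaces
 open TraceOrder
 open QuadraticIntegers
 open Completeness
 open IntegralDivision
 open Lattices
 open SurvivorLists
 open import Data.Integer using (ℤ)
 open import Data.List using ([]; _∷_)
 open import Data.List.Relation.Unary.All using ([]; _∷_)

 module Rebase (A : Ambient) (U : UniversalLattice A) {q₁ q₂ q₃ a b c}
   (base : Lattice.Base A U q₁ q₂ q₃ a b c) where
   open Ambient A
   open UniversalLattice U
   open Divisibility A
   open Lattice A U
   open Survivors A U
   open WithBase base
   open Frame base
   open ScalarSolver S

   Dual-⊕ : ∀ β β′ {u v} → Dual β u → Dual β′ v → Dual (β ⊕³ β′) (u ⊕ᵛ v)
   Dual-⊕ (tri _ _ _) (tri _ _ _) {u} {v} (x , y , z) (x′ , y′ , z′) =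
     ↦-subst (sym (B-⊕ u v v₁)) (x ↦+ x′) , ↦-subst (sym (B-⊕ u v v₂)) (y ↦+ y′) , ↦-subst (sym (B-⊕ u v v₃)) (z ↦+ z′)

   Dual-⊙ : ∀ t β {u} → Dual β u → Dual (scale³ t β) (ι t ⊙ u)
   Dual-⊙ t (tri _ _ _) {u} (x , y , z) =
     ↦-subst (sym (B-⊙ (ι t) u v₁)) (itself ↦* x) , ↦-subst (sym (B-⊙ (ι t) u v₂)) (itself ↦* y) , ↦-subst (sym (B-⊙ (ι t) u v₃)) (itself ↦* z)

   point : O³ → Vec
   point (tri x y z) = comb (ι x) (ι y) (ι z)

   L-point : ∀ x → L (point x)
   L-point (tri x y z) = L-⊕ (L-⊕ (L-⊙ x l₁) (L-⊙ y l₂)) (L-⊙ z l₃)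

   Dual-point : ∀ x → Dual (app (bil G) x) (point x)
   Dual-point (tri x y z) =
       ↦-subst (trans (order (B v₁ v₁) (B v₂ v₁) (B v₃ v₁) (B-self v₁) (B-sym v₂ v₁) (B-sym v₃ v₁)) (sym (B-sum _ _ _ v₁ v₂ v₃ v₁)))
         (↦· 2 e₁ ↦* itself ↦+ e₁₂ ↦* itself ↦+ e₁₃ ↦* itself)
     , ↦-subst (trans (order₂ (B v₁ v₂) (B v₂ v₂) (B v₃ v₂) refl (B-self v₂) (B-sym v₃ v₂)) (sym (B-sum _ _ _ v₁ v₂ v₃ v₂)))
         (e₁₂ ↦* itself ↦+ ↦· 2 e₂ ↦* itself ↦+ e₂₃ ↦* itself)
     , ↦-subst (trans (order₃ (B v₁ v₃) (B v₂ v₃) (B v₃ v₃) refl refl (B-self v₃)) (sym (B-sum _ _ _ v₁ v₂ v₃ v₃)))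
         (e₁₃ ↦* itself ↦+ e₂₃ ↦* itself ↦+ ↦· 2 e₃ ↦* itself)
     where
     order : ∀ p q r {P Q R} → p ≡ P + P → q ≡ Q → r ≡ R →
       ⟦ ℤ.+ 2 ⟧ * P * ι x + Q * ι y + R * ι z ≡ ι x * p + ι y * q + ι z * r
     order _ _ _ {P} {Q} {R} refl refl refl = solve 6 (λ p q r x y z → con (ℤ.+ 2) :* p :* x :+ q :* y :+ r :* z := x :* (p :+ p) :+ y :* q :+ z :* r) refl P Q R (ι x) (ι y) (ι z)
     order₂ : ∀ p q r {P Q R} → p ≡ P → q ≡ Q + Q → r ≡ R →
       P * ι x + ⟦ ℤ.+ 2 ⟧ * Q * ι y + R * ι z ≡ ι x * p + ι y * q + ι z * r
     order₂ _ _ _ {P} {Q} {R} refl refl refl = solve 6 (λ p q r x y z → p :* x :+ con (ℤ.+ 2) :* q :* y :+ r :* z := x :* p :+ y :* (q :+ q) :+ z :* r) refl P Q R (ι x) (ι y) (ι z)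
     order₃ : ∀ p q r {P Q R} → p ≡ P → q ≡ Q → r ≡ R + R →
       P * ι x + Q * ι y + ⟦ ℤ.+ 2 ⟧ * R * ι z ≡ ι x * p + ι y * q + ι z * r
     order₃ _ _ _ {P} {Q} {R} refl refl refl = solve 6 (λ p q r x y z → p :* x :+ q :* y :+ con (ℤ.+ 2) :* r :* z := x :* p :+ y :* q :+ z :* (r :+ r)) refl P Q R (ι x) (ι y) (ι z)

   -- Surplus coefficients or vectors are ignored, in agreement with `lin`; the zero vector realises
   -- the empty combination.
   Ext-lin : ∀ ys bs → All Ext bs → Ext (lin ys bs)
   Ext-lin [] bs es = zero-ext
     where
     zero-ext : Ext (tri 0O 0O 0O)
     zero-ext = ι 0O ⊙ v₁ , L-⊙ 0O l₁ , zero-B v₁ , zero-B v₂ , zero-B v₃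
       where
       zero-B : ∀ t → 0O ↦ B (ι 0O ⊙ v₁) t
       zero-B t = ↦-subst (sym (trans (B-⊙ (ι 0O) v₁ t) (trans (cong (_* B v₁ t) (val 0O↦)) (trans (solve 2 (λ o x → o :* x := x :* o) refl 0# (B v₁ t)) (*-zeroʳ (B v₁ t)))))) 0O↦
   Ext-lin (y ∷ ys) [] es = Ext-lin [] [] []
   Ext-lin (y ∷ ys) (β ∷ bs) ((u , lu , eu) ∷ es) with Ext-lin ys bs es
   ... | t , lt , et = ι y ⊙ u ⊕ᵛ t , L-⊕ (L-⊙ y lu) lt , Dual-⊕ (scale³ y β) (lin ys bs) {ι y ⊙ u} {t} (Dual-⊙ y β {u} eu) et

   Ext-combo : ∀ bs → All Ext bs → ∀ u → Ext (dual G bs u)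
   Ext-combo bs es (combo x ys) with Ext-lin ys bs es
   ... | t , lt , et = point x ⊕ᵛ t , L-⊕ (L-point x) lt , Dual-⊕ (app (bil G) x) (lin ys bs) {point x} {t} (Dual-point x) et

   disc : O
   disc = 2 · δ

   -- By `pairing`, the tested quantity is D times B(u,v), and D cancels; thus the check determines
   -- the product.
   read-B : ∀ β β′ {u v} x → L u → Dual β u → Dual β′ v → (app (adj G) β ⊡ β′ ==O disc ⊗ x) ≡ true → x ↦ B u v
   read-B β β′ {u} {v} x lu eu ev h = is (D-cancel (sym (trans (sym (val (pairing β β′ lu eu ev)))
     (trans (cong ι (==O-sound (app (adj G) β ⊡ β′) (disc ⊗ x) h)) (val (D↦ ↦* itself {x}))))))

   read-Q : ∀ β {u} x → L u → Dual β u → (app (adj G) β ⊡ β ==O 2 · (disc ⊗ x)) ≡ true → x ↦ Q u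
   read-Q β {u} x lu eu h = is (2-cancel (D-cancel (begin
     D * (⟦ ℤ.+ 2 ⟧ * ι x)     ≡⟨ solve 2 (λ d x → d :* (con (ℤ.+ 2) :* x) := con (ℤ.+ 2) :* (d :* x)) refl D (ι x) ⟩
     ⟦ ℤ.+ 2 ⟧ * (D * ι x)     ≡⟨ sym (val (↦· 2 (D↦ ↦* itself {x}))) ⟩
     ι (2 · (disc ⊗ x))         ≡⟨ cong ι (sym (==O-sound (app (adj G) β ⊡ β) (2 · (disc ⊗ x)) h)) ⟩
     ι (app (adj G) β ⊡ β)     ≡⟨ val (pairing β β lu eu eu) ⟩
     D * B u u                 ≡⟨ cong (D *_) (trans (B-self u) (twice (Q u))) ⟩
     D * (⟦ ℤ.+ 2 ⟧ * Q u)     ∎)))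
     where open ≡-Reasoning

   rebase-base : ∀ {β₁ β₂ β₃} (x₁ : Ext β₁) (x₂ : Ext β₂) (x₃ : Ext β₃) q₁′ q₂′ q₃′ a′ b′ c′ →
     checkGram (adj G) disc β₁ β₂ β₃ (gram q₁′ q₂′ q₃′ a′ b′ c′) ≡ true → tp (2 · δ₃ (gram q₁′ q₂′ q₃′ a′ b′ c′)) ≡ true →
     Base q₁′ q₂′ q₃′ a′ b′ c′
   rebase-base {β₁} {β₂} {β₃} (u₁ , m₁ , d₁) (u₂ , m₂ , d₂) (u₃ , m₃ , d₃) q₁′ q₂′ q₃′ a′ b′ c′ h t
     = record
     { v₁ = u₁ ; v₂ = u₂ ; v₃ = u₃ ; l₁ = m₁ ; l₂ = m₂ ; l₃ = m₃
     ; e₁ = read-Q β₁ q₁′ m₁ d₁ (proj₁ h₁) ; e₂ = read-Q β₂ q₂′ m₂ d₂ (proj₁ h₂) ; e₃ = read-Q β₃ q₃′ m₃ d₃ (proj₁ h₃)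
     ; e₁₂ = read-B β₁ β₂ a′ m₁ d₁ d₂ (proj₁ h₄) ; e₁₃ = read-B β₁ β₃ b′ m₁ d₁ d₃ (proj₁ h₅) ; e₂₃ = read-B β₂ β₃ c′ m₂ d₂ d₃ (proj₂ h₅)
     ; definite = t }
     where
     h₁ = ∧-true {app (adj G) β₁ ⊡ β₁ ==O 2 · (disc ⊗ q₁′)} h
     h₂ = ∧-true {app (adj G) β₂ ⊡ β₂ ==O 2 · (disc ⊗ q₂′)} (proj₂ h₁)
     h₃ = ∧-true {app (adj G) β₃ ⊡ β₃ ==O 2 · (disc ⊗ q₃′)} (proj₂ h₂)
     h₄ = ∧-true {app (adj G) β₁ ⊡ β₂ ==O disc ⊗ a′} (proj₂ h₃)
     h₅ = ∧-true {app (adj G) β₁ ⊡ β₃ ==O disc ⊗ b′} (proj₂ h₄)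

   rebase-exts : ∀ {β₁ β₂ β₃} (x₁ : Ext β₁) (x₂ : Ext β₂) (x₃ : Ext β₃) q₁′ q₂′ q₃′ a′ b′ c′
     (h : checkGram (adj G) disc β₁ β₂ β₃ (gram q₁′ q₂′ q₃′ a′ b′ c′) ≡ true) (t : tp (2 · δ₃ (gram q₁′ q₂′ q₃′ a′ b′ c′)) ≡ true) →
     ∀ ws es → All Ext ws → checkExts (adj G) disc β₁ β₂ β₃ ws es ≡ true → All (Base.Ext (rebase-base x₁ x₂ x₃ q₁′ q₂′ q₃′ a′ b′ c′ h t)) es
   rebase-exts x₁ x₂ x₃ q₁′ q₂′ q₃′ a′ b′ c′ h t [] [] [] k = []
   rebase-exts {β₁} {β₂} {β₃} x₁@(u₁ , m₁ , d₁) x₂@(u₂ , m₂ , d₂) x₃@(u₃ , m₃ , d₃) q₁′ q₂′ q₃′ a′ b′ c′ h t (w ∷ ws) (tri x y z ∷ es) ((v , lv , ev) ∷ vs) k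
     with ∧-true {app (adj G) w ⊡ β₁ ==O disc ⊗ x} k
   ... | k₁ , k with ∧-true {app (adj G) w ⊡ β₂ ==O disc ⊗ y} k
   ... | k₂ , k with ∧-true {app (adj G) w ⊡ β₃ ==O disc ⊗ z} k
   ... | k₃ , k = (v , lv , read-B w β₁ x lv ev d₁ k₁ , read-B w β₂ y lv ev d₂ k₂ , read-B w β₃ z lv ev d₃ k₃) ∷ rebase-exts x₁ x₂ x₃ q₁′ q₂′ q₃′ a′ b′ c′ h t ws es vs k

-- The finitely many classes of L modulo a sublattice.

module FinalStates where
 open Certificates
 open QuadraticSpaces
 open TraceOrder
 open QuadraticIntegers
 open Completeness
 open IntegralDivision
 open Lattices
 open SurvivorLists
 open Rebasing
 open import Data.Nat using (suc)
 open import Data.Integer using (ℤ)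
 open import Data.Bool using (false)
 open import Data.List using ([]; _∷_; map)
 open import Data.List.Membership.Propositional.Properties using (∈-upTo⁺)
 open import Data.List.Relation.Unary.All using ([]; _∷_)

 module Final (A : Ambient) (U : UniversalLattice A) {q₁ q₂ q₃ a b c}
   (base : Lattice.Base A U q₁ q₂ q₃ a b c) where
   open Ambient A
   open UniversalLattice U
   open Divisibility A
   open Lattice A U
   open Survivors A U
   open WithBase base
   open Frame base
   open Rebase A U base
   open ScalarSolver S

   -- One row of the sum of the terms `w τᵀ`, applied to β.
   total : (O³ → O) → List Part → O³ → Carrier
   total pr [] β = 0#
   total pr (part w τ _ ∷ l) β = ι (pr w) * ι (τ ⊡ β) + total pr l β

   0-identity : ∀ x → x ≡ x + 0#
   0-identity x = subst (λ o → x ≡ x + o) ⟦⟧-0 (solve 1 (λ x → x := x :+ con 0ℤ) refl x)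

   -- Subtracting the listed rank-one terms leaves a row divisible by the determinant, so this row
   -- of the adjugate agrees with `total` modulo the determinant.
   divCol-sound : ∀ pr l x y z → divCol disc x y z (column pr l) ≡ true → ∀ β →
     ∃ λ π → ι (tri x y z ⊡ β) ≡ ι disc * ι π + total pr l β
   divCol-sound pr [] x y z h (tri t u v) with ∧-true h
   ... | h₁ , h with ∧-true h
   ... | h₂ , h₃ = quotO disc x ⊗ t ⊕ quotO disc y ⊗ u ⊕ quotO disc z ⊗ v ,
     trans (val (is {x} (sym (quotO-sound disc x definite h₁)) ↦* itself {t} ↦+ is {y} (sym (quotO-sound disc y definite h₂)) ↦* itself {u} ↦+ is {z} (sym (quotO-sound disc z definite h₃)) ↦* itself {v}))
       (trans (solve 7 (λ d x y z t u v → d :* x :* t :+ d :* y :* u :+ d :* z :* v := d :* (x :* t :+ y :* u :+ z :* v)) refl (ι disc) (ι (quotO disc x)) (ι (quotO disc y)) (ι (quotO disc z)) (ι t) (ι u) (ι v))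
       (trans (cong (ι disc *_) (sym (val (itself {quotO disc x} ↦* itself {t} ↦+ itself {quotO disc y} ↦* itself {u} ↦+ itself {quotO disc z} ↦* itself {v})))) (0-identity _)))
   divCol-sound pr (part w τ@(tri τ₁ τ₂ τ₃) _ ∷ l) x y z h β@(tri t u v)
     with divCol-sound pr l (x ⊝ pr w ⊗ τ₁) (y ⊝ pr w ⊗ τ₂) (z ⊝ pr w ⊗ τ₃) h β
   ... | π , e = π , (begin
     ι (tri x y z ⊡ β)
       ≡⟨ val (itself {x} ↦* itself {t} ↦+ itself {y} ↦* itself {u} ↦+ itself {z} ↦* itself {v}) ⟩
     ι x * ι t + ι y * ι u + ι z * ι v
       ≡⟨ solve 10 (λ x y z t u v w p q r → x :* t :+ y :* u :+ z :* v :=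
            ((x :- w :* p) :* t :+ (y :- w :* q) :* u :+ (z :- w :* r) :* v) :+ w :* (p :* t :+ q :* u :+ r :* v))
            refl (ι x) (ι y) (ι z) (ι t) (ι u) (ι v) (ι (pr w)) (ι τ₁) (ι τ₂) (ι τ₃) ⟩
     ((ι x - ι (pr w) * ι τ₁) * ι t + (ι y - ι (pr w) * ι τ₂) * ι u + (ι z - ι (pr w) * ι τ₃) * ι v) + ι (pr w) * (ι τ₁ * ι t + ι τ₂ * ι u + ι τ₃ * ι v)
       ≡⟨ cong₂ _+_ (trans (sym (val ((itself {x} ↦- itself {pr w} ↦* itself {τ₁}) ↦* itself {t} ↦+ (itself {y} ↦- itself {pr w} ↦* itself {τ₂}) ↦* itself {u} ↦+ (itself {z} ↦- itself {pr w} ↦* itself {τ₃}) ↦* itself {v}))) e)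
            (cong (ι (pr w) *_) (sym (val (itself {τ₁} ↦* itself {t} ↦+ itself {τ₂} ↦* itself {u} ↦+ itself {τ₃} ↦* itself {v})))) ⟩
     (ι disc * ι π + total pr l β) + ι (pr w) * ι (τ ⊡ β)
       ≡⟨ solve 3 (λ p q r → (p :+ q) :+ r := p :+ (r :+ q)) refl (ι disc * ι π) (total pr l β) (ι (pr w) * ι (τ ⊡ β)) ⟩
     ι disc * ι π + (ι (pr w) * ι (τ ⊡ β) + total pr l β) ∎)
     where open ≡-Reasoning

   -- Division with remainder in two steps: first the coefficient of ω, which changes the rational
   -- part by a multiple of k, then the rational part.
   residue-split : ∀ m n k t → ∃ λ t₀ → t₀ ∈ residues (residue (suc m) (suc n) k) ×
     (∃ λ g → ∃ λ h → ι t ≡ ι t₀ + ⟦ g ⟧ * ι (ℤ.+ suc m ∶ ℤ.+ 0) + ⟦ h ⟧ * ι (k ∶ ℤ.+ suc n))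
   residue-split m n k (x ∶ y) =
       (ℤ.+ x₀ ∶ ℤ.+ y₀) , ∈-concatMap (λ m → map (λ n → ℤ.+ m ∶ ℤ.+ n) (upTo (suc n))) (∈-upTo⁺ (ℤ.n%ℕd<d x′ (suc m))) (∈-map⁺ (λ n → ℤ.+ x₀ ∶ ℤ.+ n) (∈-upTo⁺ (ℤ.n%ℕd<d y (suc n))))
     , g , h , (begin
       ⟦ x ⟧ + ⟦ y ⟧ * w
         ≡⟨ cong₂ (λ p q → p + q * w)
              (trans (solve 2 (λ a b → a := (a :- b) :+ b) refl ⟦ x ⟧ (⟦ h ⟧ * ⟦ k ⟧)) (cong (_+ ⟦ h ⟧ * ⟦ k ⟧)
                 (trans (cong (⟦ x ⟧ +_) (trans (cong -_ (sym (⟦⟧-* h k))) (sym (⟦⟧-neg (h ℤ.* k))))) (trans (sym (⟦⟧-+ x (ℤ.- (h ℤ.* k))))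
                   (trans (cong ⟦_⟧ (ℤ.a≡a%ℕn+[a/ℕn]*n x′ (suc m))) (trans (⟦⟧-+ (ℤ.+ x₀) (g ℤ.* ℤ.+ suc m)) (cong (⟦ ℤ.+ x₀ ⟧ +_) (⟦⟧-* g (ℤ.+ suc m)))))))))
              (trans (cong ⟦_⟧ (ℤ.a≡a%ℕn+[a/ℕn]*n y (suc n))) (trans (⟦⟧-+ (ℤ.+ y₀) (h ℤ.* ℤ.+ suc n)) (cong (⟦ ℤ.+ y₀ ⟧ +_) (⟦⟧-* h (ℤ.+ suc n))))) ⟩
       ((⟦ ℤ.+ x₀ ⟧ + ⟦ g ⟧ * ⟦ ℤ.+ suc m ⟧) + ⟦ h ⟧ * ⟦ k ⟧) + (⟦ ℤ.+ y₀ ⟧ + ⟦ h ⟧ * ⟦ ℤ.+ suc n ⟧) * w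
         ≡⟨ solve 8 (λ x₀ y₀ g h m n k w → ((x₀ :+ g :* m) :+ h :* k) :+ (y₀ :+ h :* n) :* w
              := (x₀ :+ y₀ :* w) :+ g :* m :+ h :* (k :+ n :* w)) refl ⟦ ℤ.+ x₀ ⟧ ⟦ ℤ.+ y₀ ⟧ ⟦ g ⟧ ⟦ h ⟧ ⟦ ℤ.+ suc m ⟧ ⟦ ℤ.+ suc n ⟧ ⟦ k ⟧ w ⟩
       (⟦ ℤ.+ x₀ ⟧ + ⟦ ℤ.+ y₀ ⟧ * w) + ⟦ g ⟧ * ⟦ ℤ.+ suc m ⟧ + ⟦ h ⟧ * (⟦ k ⟧ + ⟦ ℤ.+ suc n ⟧ * w)
         ≡⟨ cong (λ z → (⟦ ℤ.+ x₀ ⟧ + ⟦ ℤ.+ y₀ ⟧ * w) + ⟦ g ⟧ * z + ⟦ h ⟧ * (⟦ k ⟧ + ⟦ ℤ.+ suc n ⟧ * w)) (sym (ι-ℤ (ℤ.+ suc m))) ⟩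
       (⟦ ℤ.+ x₀ ⟧ + ⟦ ℤ.+ y₀ ⟧ * w) + ⟦ g ⟧ * ι (ℤ.+ suc m ∶ ℤ.+ 0) + ⟦ h ⟧ * (⟦ k ⟧ + ⟦ ℤ.+ suc n ⟧ * w) ∎)
     where
     open ≡-Reasoning
     h = y ℤ./ℕ suc n
     y₀ = y ℤ.%ℕ suc n
     x′ = x ℤ.- h ℤ.* k
     g = x′ ℤ./ℕ suc m
     x₀ = x′ ℤ.%ℕ suc m

   Reduced : (O³ → O) → List Part → O³ → O³ → O³ → Set
   Reduced pr l β x κ = total pr l β ≡ ι (pr x) + ι disc * ι (pr κ)

   -- Changing the pairing with `τ` by the residue module changes its contribution by a multiple of
   -- the determinant, so representatives suffice.
   span-complete : ∀ l → residuesOK disc l ≡ true → ∀ β →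
     ∃ λ x → x ∈ span l × (∃ λ κ → Reduced pr₁ l β x κ × Reduced pr₂ l β x κ × Reduced pr₃ l β x κ)
   span-complete [] h β = tri 0O 0O 0O , here refl , tri 0O 0O 0O , z , z , z
     where
     z : 0# ≡ ι 0O + ι disc * ι 0O
     z = trans (subst (λ o → o ≡ o + ι disc * o) ⟦⟧-0 (solve 1 (λ d → con 0ℤ := con 0ℤ :+ d :* con 0ℤ) refl (ι disc)))
           (cong (λ t → t + ι disc * t) (sym (val 0O↦)))
   span-complete (part w τ (residue (suc m) (suc n) k) ∷ l) h β
     with ∧-true {residueOK disc w (residue (suc m) (suc n) k)} h
   ... | h₁ , h₂ with span-complete l h₂ β | residue-split m n k (τ ⊡ β) | ∧-true {div³ disc (scale³ (ℤ.+ suc m ∶ ℤ.+ 0) w)} h₁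
   span-complete (part (tri w₁ w₂ w₃) τ (residue (suc m) (suc n) k) ∷ l) h β
     | h₁ , h₂ | tri x₁ x₂ x₃ , x∈ , tri κ₁ κ₂ κ₃ , r₁ , r₂ , r₃ | t₀ , t∈ , g , h′ , et | d , d′
     with ∧-true d | ∧-true d′
   ... | d₁ , d | d₁′ , d′ with ∧-true d | ∧-true d′
   ... | d₂ , d₃ | d₂′ , d₃′ =
       scale³ t₀ (tri w₁ w₂ w₃) ⊕³ tri x₁ x₂ x₃ , ∈-concatMap _ x∈ (∈-map⁺ (λ t → scale³ t (tri w₁ w₂ w₃) ⊕³ tri x₁ x₂ x₃) t∈)
     , tri (shift w₁ κ₁) (shift w₂ κ₂) (shift w₃ κ₃)
     , step w₁ x₁ κ₁ (total pr₁ l β) d₁ d₁′ r₁ , step w₂ x₂ κ₂ (total pr₂ l β) d₂ d₂′ r₂ , step w₃ x₃ κ₃ (total pr₃ l β) d₃ d₃′ r₃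
     where
     e₁′ e₂′ : O
     e₁′ = ℤ.+ suc m ∶ ℤ.+ 0
     e₂′ = k ∶ ℤ.+ suc n
     shift : O → O → O
     shift u κ = κ ⊕ scaleℤ g (quotO disc (e₁′ ⊗ u)) ⊕ scaleℤ h′ (quotO disc (e₂′ ⊗ u))
     step : ∀ u x κ s → divO disc (e₁′ ⊗ u) ≡ true → divO disc (e₂′ ⊗ u) ≡ true → s ≡ ι x + ι disc * ι κ →
       ι u * ι (τ ⊡ β) + s ≡ ι (t₀ ⊗ u ⊕ x) + ι disc * ι (shift u κ)
     step u x κ s h₁ h₂ es = begin
       ι u * ι (τ ⊡ β) + s
         ≡⟨ cong₂ (λ p q → ι u * p + q) et es ⟩
       ι u * (ι t₀ + ⟦ g ⟧ * ι e₁′ + ⟦ h′ ⟧ * ι e₂′) + (ι x + ι disc * ι κ)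
         ≡⟨ solve 9 (λ u t g h p q x d κ → u :* (t :+ g :* p :+ h :* q) :+ (x :+ d :* κ) := t :* u :+ x :+ (d :* κ :+ g :* (p :* u) :+ h :* (q :* u)))
              refl (ι u) (ι t₀) ⟦ g ⟧ ⟦ h′ ⟧ (ι e₁′) (ι e₂′) (ι x) (ι disc) (ι κ) ⟩
       ι t₀ * ι u + ι x + (ι disc * ι κ + ⟦ g ⟧ * (ι e₁′ * ι u) + ⟦ h′ ⟧ * (ι e₂′ * ι u))
         ≡⟨ cong₂ (λ p q → ι t₀ * ι u + ι x + (ι disc * ι κ + ⟦ g ⟧ * p + ⟦ h′ ⟧ * q))
              (trans (sym (val (itself {e₁′} ↦* itself {u}))) (sym (quotO-sound disc (e₁′ ⊗ u) definite h₁)))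
              (trans (sym (val (itself {e₂′} ↦* itself {u}))) (sym (quotO-sound disc (e₂′ ⊗ u) definite h₂))) ⟩
       ι t₀ * ι u + ι x + (ι disc * ι κ + ⟦ g ⟧ * (ι disc * P) + ⟦ h′ ⟧ * (ι disc * R))
         ≡⟨ solve 7 (λ d κ g h p q s → s :+ (d :* κ :+ g :* (d :* p) :+ h :* (d :* q)) := s :+ d :* (κ :+ g :* p :+ h :* q))
              refl (ι disc) (ι κ) ⟦ g ⟧ ⟦ h′ ⟧ P R (ι t₀ * ι u + ι x) ⟩
       ι t₀ * ι u + ι x + ι disc * (ι κ + ⟦ g ⟧ * P + ⟦ h′ ⟧ * R)
         ≡⟨ cong₂ (λ p q → p + ι disc * q) (sym (val (itself {t₀} ↦* itself {u} ↦+ itself {x})))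
              (sym (val (itself {κ} ↦+ is (ι-scaleℤ g (quotO disc (e₁′ ⊗ u))) ↦+ is (ι-scaleℤ h′ (quotO disc (e₂′ ⊗ u)))))) ⟩
       ι (t₀ ⊗ u ⊕ x) + ι disc * ι (shift u κ) ∎
       where
       open ≡-Reasoning
       P = ι (quotO disc (e₁′ ⊗ u))
       R = ι (quotO disc (e₂′ ⊗ u))

   -- D times the coordinates of `v` is the adjugate applied to β. Modulo D it is one of the
   -- finitely many vectors in `span l`, and ζ is the integral part of the coordinates.
   reduce : ∀ l → splitOK disc (adj G) l ≡ true → residuesOK disc l ≡ true → ∀ {v} β → Dual β v →
     ∃ λ x → x ∈ span l × (∃ λ ζ → α₁ v ≡ ι (pr₁ x) + D * ι (pr₁ ζ) × α₂ v ≡ ι (pr₂ x) + D * ι (pr₂ ζ) × α₃ v ≡ ι (pr₃ x) + D * ι (pr₃ ζ))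
   reduce l hs hr {v} β@(tri y₁ y₂ y₃) eβ with ∧-true hs | span-complete l hr β | α↦ β eβ
   ... | h₁ , h | x , x∈ , tri κ₁ κ₂ κ₃ , r₁ , r₂ , r₃ | f₁ , f₂ , f₃ with ∧-true h
   ... | h₂ , h₃ with divCol-sound pr₁ l _ _ _ h₁ β | divCol-sound pr₂ l _ _ _ h₂ β | divCol-sound pr₃ l _ _ _ h₃ β
   ... | π₁ , c₁ | π₂ , c₂ | π₃ , c₃ =
     x , x∈ , tri (κ₁ ⊕ π₁) (κ₂ ⊕ π₂) (κ₃ ⊕ π₃) ,
     combine (pr₁ x) π₁ κ₁ c₁ r₁ f₁ , combine (pr₂ x) π₂ κ₂ c₂ r₂ f₂ , combine (pr₃ x) π₃ κ₃ c₃ r₃ f₃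
     where
     combine : ∀ {r s a} X π κ → ι r ≡ ι disc * ι π + s → s ≡ ι X + ι disc * ι κ → r ↦ a → a ≡ ι X + D * ι (κ ⊕ π)
     combine {r} {s} {a} X π κ c e f = begin
       a                                              ≡⟨ trans (sym (val f)) c ⟩
       ι disc * ι π + s                               ≡⟨ cong (ι disc * ι π +_) e ⟩
       ι disc * ι π + (ι X + ι disc * ι κ)            ≡⟨ solve 4 (λ d p x k → d :* p :+ (x :+ d :* k) := x :+ d :* (k :+ p)) refl (ι disc) (ι π) (ι X) (ι κ) ⟩
       ι X + ι disc * (ι κ + ι π)                     ≡⟨ cong₂ (λ d t → ι X + d * t) (val D↦) (sym (val (itself {κ} ↦+ itself {π}))) ⟩
       ι X + D * ι (κ ⊕ π) ∎
       where open ≡-Reasoning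

   D-vec-cancel : ∀ {u v} → D ⊙ u ≡ D ⊙ v → u ≡ v
   D-vec-cancel e = ≡³ (D-cancel (cong proj₁ e)) (D-cancel (cong (λ t → proj₁ (proj₂ t)) e)) (D-cancel (cong (λ t → proj₂ (proj₂ t)) e))

   comb-cong : ∀ {x y z x′ y′ z′} → x ≡ x′ → y ≡ y′ → z ≡ z′ → comb x y z ≡ comb x′ y′ z′
   comb-cong refl refl refl = refl

   ⊙-comb : ∀ d x y z → comb (d * x) (d * y) (d * z) ≡ d ⊙ comb x y z
   ⊙-comb d x y z = ≡³ (lemma d x y z _ _ _) (lemma d x y z _ _ _) (lemma d x y z _ _ _)
     where
     lemma : ∀ d x y z a b c → d * x * a + d * y * b + d * z * c ≡ d * (x * a + y * b + z * c)
     lemma = solve 7 (λ d x y z a b c → d :* x :* a :+ d :* y :* b :+ d :* z :* c := d :* (x :* a :+ y :* b :+ z :* c)) refl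

   coordinates : ∀ {v} x y z → L v → α₁ v ≡ D * x → α₂ v ≡ D * y → α₃ v ≡ D * z → v ≡ comb x y z
   coordinates x y z lv e₁ e₂ e₃ = D-vec-cancel (trans (expand lv) (trans (comb-cong e₁ e₂ e₃) (⊙-comb D x y z)))

   -- Half-integral third coordinates are kept doubled, so that all data stay in the image of `ι`.
   doubled-coordinates : ∀ {v} x y z → L v → α₁ v ≡ D * x → α₂ v ≡ D * y → ⟦ ℤ.+ 2 ⟧ * α₃ v ≡ D * z →
     ⟦ ℤ.+ 2 ⟧ ⊙ v ≡ comb (⟦ ℤ.+ 2 ⟧ * x) (⟦ ℤ.+ 2 ⟧ * y) z
   doubled-coordinates {v} x y z lv e₁ e₂ e₃ = D-vec-cancel (trans (swap v) (trans (cong (⟦ ℤ.+ 2 ⟧ ⊙_) (expand lv))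
     (trans (sym (⊙-comb ⟦ ℤ.+ 2 ⟧ _ _ _)) (trans (comb-cong (trans (cong (⟦ ℤ.+ 2 ⟧ *_) e₁) (swap₁ D x)) (trans (cong (⟦ ℤ.+ 2 ⟧ *_) e₂) (swap₁ D y)) e₃) (⊙-comb D _ _ _)))))
     where
     swap₁ : ∀ d x → ⟦ ℤ.+ 2 ⟧ * (d * x) ≡ d * (⟦ ℤ.+ 2 ⟧ * x)
     swap₁ = solve 2 (λ d x → con (ℤ.+ 2) :* (d :* x) := d :* (con (ℤ.+ 2) :* x)) refl
     swap : ∀ v → D ⊙ (⟦ ℤ.+ 2 ⟧ ⊙ v) ≡ ⟦ ℤ.+ 2 ⟧ ⊙ (D ⊙ v)
     swap _ = ≡³ (sym (swap₁ D _)) (sym (swap₁ D _)) (sym (swap₁ D _))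

   -- If v is not accounted for by the residue x, then v - ζ is a vector of L with coordinates x / D, a genuine enlargement.
   module Enlarge {v} (lv : L v) (x ζ : O³) (a₁ : α₁ v ≡ ι (pr₁ x) + D * ι (pr₁ ζ)) (a₂ : α₂ v ≡ ι (pr₂ x) + D * ι (pr₂ ζ))
     (a₃ : α₃ v ≡ ι (pr₃ x) + D * ι (pr₃ ζ)) where

     v₀ : Vec
     v₀ = v ⊕ᵛ neg-vec (point ζ)

     l₀ : L v₀
     l₀ = L-⊕ lv (L-neg (L-point ζ))

     D⊙v₀ : D ⊙ v₀ ≡ point x
     D⊙v₀ = trans (≡³ (component _ _ _ _ (cong proj₁ ev) _ (cong proj₁ (sym (point-pr ζ))))
                      (component _ _ _ _ (cong (λ t → proj₁ (proj₂ t)) ev) _ (cong (λ t → proj₁ (proj₂ t)) (sym (point-pr ζ))))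
                      (component _ _ _ _ (cong (λ t → proj₂ (proj₂ t)) ev) _ (cong (λ t → proj₂ (proj₂ t)) (sym (point-pr ζ))))) (point-pr x)
       where
       point-pr : ∀ x → comb (ι (pr₁ x)) (ι (pr₂ x)) (ι (pr₃ x)) ≡ point x
       point-pr (tri _ _ _) = refl
       ev : D ⊙ v ≡ comb (ι (pr₁ x) + D * ι (pr₁ ζ)) (ι (pr₂ x) + D * ι (pr₂ ζ)) (ι (pr₃ x) + D * ι (pr₃ ζ))
       ev = trans (expand lv) (comb-cong a₁ a₂ a₃)
       component : ∀ t r₁ r₂ r₃ → D * t ≡ (ι (pr₁ x) + D * ι (pr₁ ζ)) * r₁ + (ι (pr₂ x) + D * ι (pr₂ ζ)) * r₂ + (ι (pr₃ x) + D * ι (pr₃ ζ)) * r₃ →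
         ∀ s → s ≡ ι (pr₁ ζ) * r₁ + ι (pr₂ ζ) * r₂ + ι (pr₃ ζ) * r₃ →
         D * (t + ι (0O ⊝ (ℤ.+ 1 ∶ ℤ.+ 0)) * s) ≡ ι (pr₁ x) * r₁ + ι (pr₂ x) * r₂ + ι (pr₃ x) * r₃
       component t r₁ r₂ r₃ e s es = trans (cong (λ z → D * (t + z)) (trans (neg-one s) (cong -_ es)))
         (trans (solve 8 (λ d t z₁ z₂ z₃ r₁ r₂ r₃ → d :* (t :+ :- (z₁ :* r₁ :+ z₂ :* r₂ :+ z₃ :* r₃)) := d :* t :- d :* (z₁ :* r₁ :+ z₂ :* r₂ :+ z₃ :* r₃)) refl D t (ι (pr₁ ζ)) (ι (pr₂ ζ)) (ι (pr₃ ζ)) r₁ r₂ r₃)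
         (trans (cong (_- D * (ι (pr₁ ζ) * r₁ + ι (pr₂ ζ) * r₂ + ι (pr₃ ζ) * r₃)) e)
         (solve 10 (λ d x₁ x₂ x₃ z₁ z₂ z₃ r₁ r₂ r₃ → (x₁ :+ d :* z₁) :* r₁ :+ (x₂ :+ d :* z₂) :* r₂ :+ (x₃ :+ d :* z₃) :* r₃ :- d :* (z₁ :* r₁ :+ z₂ :* r₂ :+ z₃ :* r₃)
            := x₁ :* r₁ :+ x₂ :* r₂ :+ x₃ :* r₃) refl D (ι (pr₁ x)) (ι (pr₂ x)) (ι (pr₃ x)) (ι (pr₁ ζ)) (ι (pr₂ ζ)) (ι (pr₃ ζ)) r₁ r₂ r₃)))

     β₀ : O³
     β₀ = quot³ disc (app (bil G) x)

     B-point : ∀ t → B (point x) t ≡ D * B v₀ t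
     B-point t = trans (cong (λ z → B z t) (sym D⊙v₀)) (B-⊙ D v₀ t)

     private
       divides : ∀ {r t} → L t → r ↦ B (point x) t → divO disc r ≡ true × quotO disc r ↦ B v₀ t
       divides {r} {t} lt e with B-integral l₀ lt
       ... | y , ey = d , is (cancel disc definite (trans (quotO-sound disc r definite d) (trans (val e) (trans (B-point t) (cong (_* B v₀ t) (sym (val D↦)))))))
         where
         d : divO disc r ≡ true
         d = divO-complete disc y r definite (trans (cong₂ _*_ (val D↦) (val ey)) (trans (sym (B-point t)) (sym (val e))))

     dual-β₀ : div³ disc (app (bil G) x) ≡ true × Dual β₀ v₀
     dual-β₀ = go (app (bil G) x) (Dual-point x)
       where
       go : ∀ r → Dual r (point x) → div³ disc r ≡ true × Dual (quot³ disc r) v₀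
       go (tri r₁ r₂ r₃) (e₁ , e₂ , e₃) =
           ∧-intro (proj₁ f₁) (∧-intro (proj₁ f₂) (proj₁ f₃)) , proj₂ f₁ , proj₂ f₂ , proj₂ f₃
         where
         f₁ = divides {r₁} {v₁} l₁ e₁
         f₂ = divides {r₂} {v₂} l₂ e₂
         f₃ = divides {r₃} {v₃} l₃ e₃

     -- Since D times `v₀` has the integral coordinates x, its value is D² Q(v₀).
     Q-divides : tp (disc ⊗ disc) ≡ true → divO (disc ⊗ disc) (evalG G x) ≡ true
     Q-divides td with Q-integral l₀
     ... | y , ey = divO-complete (disc ⊗ disc) y (evalG G x) td
       (trans (cong₂ _*_ (val (D↦ ↦* D↦)) (val ey)) (trans (sym (Q-⊙ D v₀)) (trans (cong Q D⊙v₀) (Q-point x))))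
       where
       Q-point : ∀ x → Q (point x) ≡ ι (evalG G x)
       Q-point (tri x y z) = trans (Q-3 (ι x) (ι y) (ι z) v₁ v₂ v₃) (trans
         (solve 9 (λ x y z p q r a b c → x :* x :* p :+ y :* y :* q :+ x :* (y :* a) :+ z :* z :* r :+ z :* (x :* b :+ y :* c)
            := p :* (x :* x) :+ q :* (y :* y) :+ r :* (z :* z) :+ a :* (x :* y) :+ b :* (x :* z) :+ c :* (y :* z)) refl (ι x) (ι y) (ι z) (Q v₁) (Q v₂) (Q v₃) (B v₁ v₂) (B v₁ v₃) (B v₂ v₃))
         (sym (val (e₁ ↦* (itself {x} ↦* itself {x}) ↦+ e₂ ↦* (itself {y} ↦* itself {y}) ↦+ e₃ ↦* (itself {z} ↦* itself {z})
           ↦+ e₁₂ ↦* (itself {x} ↦* itself {y}) ↦+ e₁₃ ↦* (itself {x} ↦* itself {z}) ↦+ e₂₃ ↦* (itself {y} ↦* itself {z})))))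

     remains : ∀ k bs l → All Ext bs → tp (disc ⊗ disc) ≡ true → x ∈ span l → inLattice k disc x ≡ false →
       β₀ ∈ remaining G k disc (map (app (adj G)) bs) l × Ext β₀
     remains k bs l es td x∈ ni = ∈-map⁺ (λ x → quot³ disc (app (bil G) x)) (∈-filterᵇ _ x∈
         (∧-intro (cong not ni) (∧-intro (Q-divides td) (∧-intro (proj₁ dual-β₀) (exts-divide bs es β₀ l₀ (proj₂ dual-β₀))))))
       , (v₀ , l₀ , proj₂ dual-β₀)

-- Soundness of the checker.

module CertificateSoundness where
 open Certificates
 open QuadraticSpaces
 open TraceOrder
 open QuadraticIntegers
 open Completeness
 open IntegralDivision
 open Lattices
 open SurvivorLists
 open Rebasing
 open FinalStates
 open import Data.Integer using (ℤ)
 open import Data.Bool using (false)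
 open import Data.Sum using ([_,_]′)
 open import Data.List using ([]; _∷_; map)
 open import Data.List.Relation.Unary.All using ([]; _∷_)
 open import Data.Product using (Σ)

 module Soundness (A : Ambient) (U : UniversalLattice A) (forms : ℕ → Gram × Kind) where
   open Ambient A
   open UniversalLattice U
   open Divisibility A
   open Lattice A U
   open Survivors A U
   open ScalarSolver S
   open Checker s p Δ forms

   IsBasis : ∀ {q₁ q₂ q₃ a b c} → Base q₁ q₂ q₃ a b c → Set
   IsBasis base = ∀ {v} → L v → ∃ λ x → v ≡ Rebase.point A U base x

   -- The first component states that the extra generator g/2 times the third vector lies in L; the
   -- second bounds L from above. Both are phrased after doubling.
   IsHalfBasis : ∀ {q₁ q₂ q₃ a b c} → Base q₁ q₂ q₃ a b c → O → (O → Bool) → Set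
   IsHalfBasis base g mem =
     (∃ λ u → L u × ⟦ ℤ.+ 2 ⟧ ⊙ u ≡ ι g ⊙ Base.v₃ base) ×
     (∀ {v} → L v → ∃ λ x → ∃ λ y → ∃ λ t → mem t ≡ true × ⟦ ℤ.+ 2 ⟧ ⊙ v ≡ Base.comb base (⟦ ℤ.+ 2 ⟧ * ι x) (⟦ ℤ.+ 2 ⟧ * ι y) (ι t))

   Corresponds : Gram × Kind → Set
   Corresponds (gram q₁ q₂ q₃ a b c , free)       = Σ (Base q₁ q₂ q₃ a b c) IsBasis
   Corresponds (gram q₁ q₂ q₃ a b c , half g mem) = Σ (Base q₁ q₂ q₃ a b c) λ base → IsHalfBasis base g mem

   Classified : Set
   Classified = ∃ λ i → Corresponds (forms i)

   ==G-sound : ∀ G φ → (G ==G φ) ≡ true → G ≡ φ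
   ==G-sound (gram a b c d e f) (gram a′ b′ c′ d′ e′ f′) h
     with ∧-true {a ==O a′} h
   ... | h₁ , h with ∧-true {b ==O b′} h
   ... | h₂ , h with ∧-true {c ==O c′} h
   ... | h₃ , h with ∧-true {d ==O d′} h
   ... | h₄ , h with ∧-true {e ==O e′} h
   ... | h₅ , h₆ with ==O-sound a a′ h₁ | ==O-sound b b′ h₂ | ==O-sound c c′ h₃ | ==O-sound d d′ h₄ | ==O-sound e e′ h₅ | ==O-sound f f′ h₆
   ... | refl | refl | refl | refl | refl | refl = refl

   isEmpty-sound : ∀ {β us} → isEmpty us ≡ true → β ∈ us → ⊥
   isEmpty-sound {us = []} _ ()

   module _ {q₁ q₂ q₃ a b c} (base : Base q₁ q₂ q₃ a b c) where
     open WithBase base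
     open Frame base
     open Rebase A U base
     open Final A U base

     -- The extra vector has vanishing first two coordinates and third coordinate g/2, read off from
     -- the adjugate.
     half-vector : ∀ g bs → All Ext bs → kindOK g (adj G) disc bs ≡ true → ∃ λ u → L u × ⟦ ℤ.+ 2 ⟧ ⊙ u ≡ ι g ⊙ v₃
     half-vector g (β ∷ []) ((u , lu , eu) ∷ []) h = u , lu , go (app (adj G) β) (α↦ β eu) h
       where
       go : ∀ r → pr₁ r ↦ α₁ u × pr₂ r ↦ α₂ u × pr₃ r ↦ α₃ u →
         (tri (2 · pr₁ r) (2 · pr₂ r) (2 · pr₃ r) ==³ tri 0O 0O (disc ⊗ g)) ≡ true → ⟦ ℤ.+ 2 ⟧ ⊙ u ≡ ι g ⊙ v₃
       go (tri r₁ r₂ r₃) (f₁ , f₂ , f₃) h with ∧-true {2 · r₁ ==O 0O} h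
       ... | h₁ , h with ∧-true {2 · r₂ ==O 0O} h
       ... | h₂ , h₃ = trans (doubled-coordinates 0# 0# (ι g) lu (vanishes f₁ h₁) (vanishes f₂ h₂) third) (simplify _)
         where
         vanishes : ∀ {r α} → r ↦ α → (2 · r ==O 0O) ≡ true → α ≡ D * 0#
         vanishes {r} {α} f h = trans (2-cancel (trans (sym (val (↦· 2 f))) (trans (cong ι (==O-sound (2 · r) 0O h)) (trans (val 0O↦) (sym (*-zeroʳ ⟦ ℤ.+ 2 ⟧)))))) (sym (*-zeroʳ D))
         third : ⟦ ℤ.+ 2 ⟧ * α₃ u ≡ D * ι g
         third = trans (sym (val (↦· 2 f₃))) (trans (cong ι (==O-sound (2 · r₃) (disc ⊗ g) h₃)) (val (D↦ ↦* itself {g})))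
         simplify : ∀ z → comb (⟦ ℤ.+ 2 ⟧ * 0#) (⟦ ℤ.+ 2 ⟧ * 0#) z ≡ z ⊙ v₃
         simplify z = ≡³ (lemma _ _ _) (lemma _ _ _) (lemma _ _ _)
           where
           lemma : ∀ p q r → (⟦ ℤ.+ 2 ⟧ * 0#) * p + (⟦ ℤ.+ 2 ⟧ * 0#) * q + z * r ≡ z * r
           lemma p q r = subst (λ o → (⟦ ℤ.+ 2 ⟧ * o) * p + (⟦ ℤ.+ 2 ⟧ * o) * q + z * r ≡ z * r) ⟦⟧-0
             (solve 4 (λ p q r z → (con (ℤ.+ 2) :* con 0ℤ) :* p :+ (con (ℤ.+ 2) :* con 0ℤ) :* q :+ z :* r := z :* r) refl p q r z)

     unit-step : ∀ {α} x ζ → α ≡ ι x + D * ι ζ → divO disc x ≡ true → α ≡ D * ι (quotO disc x ⊕ ζ)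
     unit-step {α} x ζ e d = trans e (trans (cong (_+ D * ι ζ) (trans (sym (quotO-sound disc x definite d)) (cong (_* ι (quotO disc x)) (val D↦))))
       (trans (solve 3 (λ d p q → d :* p :+ d :* q := d :* (p :+ q)) refl D (ι (quotO disc x)) (ι ζ)) (cong (D *_) (sym (val (itself {quotO disc x} ↦+ itself {ζ}))))))

     double-step : ∀ {α} x ζ → α ≡ ι x + D * ι ζ → divO disc (2 · x) ≡ true → ⟦ ℤ.+ 2 ⟧ * α ≡ D * ι (quotO disc (2 · x) ⊕ 2 · ζ)
     double-step {α} x ζ e d = trans (cong (⟦ ℤ.+ 2 ⟧ *_) e) (trans
       (solve 3 (λ x d z → con (ℤ.+ 2) :* (x :+ d :* z) := con (ℤ.+ 2) :* x :+ d :* (con (ℤ.+ 2) :* z)) refl (ι x) D (ι ζ))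
       (trans (cong₂ (λ p q → p + D * q) (sym (val (↦· 2 (itself {x})))) (sym (val (↦· 2 (itself {ζ})))))
         (sym (trans (cong (D *_) (val (itself {quotO disc (2 · x)} ↦+ itself {2 · ζ})))
           (trans (solve 3 (λ d p q → d :* (p :+ q) := d :* p :+ d :* q) refl D (ι (quotO disc (2 · x))) (ι (2 · ζ)))
             (cong (_+ D * ι (2 · ζ)) (trans (cong (_* ι (quotO disc (2 · x))) (sym (val D↦))) (quotO-sound disc (2 · x) definite d))))))))

     InBasis : Vec → Set
     InBasis v = ∃ λ x → v ≡ point x

     InBasis-𝟎 : InBasis 𝟎
     InBasis-𝟎 = tri 0O 0O 0O , ≡³ (z _ _ _) (z _ _ _) (z _ _ _)
       where
       z : ∀ p q r → 0# ≡ ι 0O * p + ι 0O * q + ι 0O * r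
       z p q r = trans (subst (λ o → o ≡ o * p + o * q + o * r) ⟦⟧-0 (solve 3 (λ p q r → con 0ℤ := con 0ℤ :* p :+ con 0ℤ :* q :+ con 0ℤ :* r) refl p q r))
         (cong (λ o → o * p + o * q + o * r) (sym (val 0O↦)))

     InBasis-⊕ : ∀ {u v} → InBasis u → InBasis v → InBasis (u ⊕ᵛ v)
     InBasis-⊕ (tri x y z , refl) (tri x′ y′ z′ , refl) = tri (x ⊕ x′) (y ⊕ y′) (z ⊕ z′) ,
       trans (≡³ (lemma _ _ _) (lemma _ _ _) (lemma _ _ _))
         (sym (comb-cong (val (itself {x} ↦+ itself {x′})) (val (itself {y} ↦+ itself {y′})) (val (itself {z} ↦+ itself {z′}))))
       where
       lemma : ∀ p q r → (ι x * p + ι y * q + ι z * r) + (ι x′ * p + ι y′ * q + ι z′ * r) ≡ (ι x + ι x′) * p + (ι y + ι y′) * q + (ι z + ι z′) * r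
       lemma p q r = solve 9 (λ x y z x′ y′ z′ p q r → (x :* p :+ y :* q :+ z :* r) :+ (x′ :* p :+ y′ :* q :+ z′ :* r)
         := (x :+ x′) :* p :+ (y :+ y′) :* q :+ (z :+ z′) :* r) refl (ι x) (ι y) (ι z) (ι x′) (ι y′) (ι z′) p q r

     InBasis-⊙ : ∀ t {u} → InBasis u → InBasis (ι t ⊙ u)
     InBasis-⊙ t (tri x y z , refl) = tri (t ⊗ x) (t ⊗ y) (t ⊗ z) ,
       trans (sym (⊙-comb (ι t) (ι x) (ι y) (ι z))) (sym (comb-cong (val (itself {t} ↦* itself {x})) (val (itself {t} ↦* itself {y})) (val (itself {t} ↦* itself {z}))))

     -- The class of a vector is tested for membership. A class outside the claimed lattice yields a
     -- vector on the list of remaining enlargements.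
     reduced-vector : ∀ k l bs → All Ext bs → tp (disc ⊗ disc) ≡ true → splitOK disc (adj G) l ≡ true → residuesOK disc l ≡ true → ∀ {v} → L v →
       (∃ λ x → ∃ λ ζ → α₁ v ≡ ι (pr₁ x) + D * ι (pr₁ ζ) × α₂ v ≡ ι (pr₂ x) + D * ι (pr₂ ζ) × α₃ v ≡ ι (pr₃ x) + D * ι (pr₃ ζ) × inLattice k disc x ≡ true)
       ⊎ (∃ λ β → β ∈ remaining G k disc (map (app (adj G)) bs) l × Ext β)
     reduced-vector k l bs es td hs hr {v} lv with dual-of lv
     ... | β , eβ with reduce l hs hr {v} β eβ
     ... | x , x∈ , ζ , a₁ , a₂ , a₃ with inLattice k disc x in eq
     ... | true  = inj₁ (x , ζ , a₁ , a₂ , a₃ , eq)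
     ... | false = inj₂ (_ , Enlarge.remains {v} lv x ζ a₁ a₂ a₃ k bs l es td x∈ eq)

     free-vector : ∀ {v} → L v → ∀ x ζ → α₁ v ≡ ι (pr₁ x) + D * ι (pr₁ ζ) → α₂ v ≡ ι (pr₂ x) + D * ι (pr₂ ζ) → α₃ v ≡ ι (pr₃ x) + D * ι (pr₃ ζ) →
       inLattice free disc x ≡ true → InBasis v
     free-vector lv (tri x y z) (tri x′ y′ z′) e₁ e₂ e₃ h with ∧-true {divO disc x} h
     ... | h₁ , h with ∧-true {divO disc y} h
     ... | h₂ , h₃ = tri (quotO disc x ⊕ x′) (quotO disc y ⊕ y′) (quotO disc z ⊕ z′) ,
       coordinates _ _ _ lv (unit-step x x′ e₁ h₁) (unit-step y y′ e₂ h₂) (unit-step z z′ e₃ h₃)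

     -- Adding the integral part ζ moves the doubled third coordinate by an even element, which
     -- explains the closure condition on `mem`.
     half-coordinates : ∀ {v} → L v → ∀ g mem → (∀ t u → mem t ≡ true → mem (t ⊕ 2 · u) ≡ true) → ∀ x ζ →
       α₁ v ≡ ι (pr₁ x) + D * ι (pr₁ ζ) → α₂ v ≡ ι (pr₂ x) + D * ι (pr₂ ζ) → α₃ v ≡ ι (pr₃ x) + D * ι (pr₃ ζ) → inLattice (half g mem) disc x ≡ true →
       ∃ λ x → ∃ λ y → ∃ λ t → mem t ≡ true × ⟦ ℤ.+ 2 ⟧ ⊙ v ≡ comb (⟦ ℤ.+ 2 ⟧ * ι x) (⟦ ℤ.+ 2 ⟧ * ι y) (ι t)
     half-coordinates lv g mem closed (tri x y z) (tri x′ y′ z′) e₁ e₂ e₃ h with ∧-true {divO disc x} h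
     ... | h₁ , h with ∧-true {divO disc y} h
     ... | h₂ , h with ∧-true {divO disc (2 · z)} h
     ... | h₃ , h₄ = quotO disc x ⊕ x′ , quotO disc y ⊕ y′ , quotO disc (2 · z) ⊕ 2 · z′ , closed (quotO disc (2 · z)) z′ h₄ ,
       doubled-coordinates _ _ _ lv (unit-step x x′ e₁ h₁) (unit-step y y′ e₂ h₂) (double-step z z′ e₃ h₃)

   module Run (closed : ∀ i → ∀ {φ g mem} → forms i ≡ (φ , half g mem) → ∀ t u → mem t ≡ true → mem (t ⊕ 2 · u) ≡ true) where

     sound : ∀ {q₁ q₂ q₃ a b c} (base : Base q₁ q₂ q₃ a b c) bs → All (Base.Ext base) bs → ∀ cert →
       let G = gram q₁ q₂ q₃ a b c in check G (adj G) (2 · δ₃ G) bs cert ≡ true → Classified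

     sound-all : ∀ {q₁ q₂ q₃ a b c} (base : Base q₁ q₂ q₃ a b c) bs → All (Base.Ext base) bs → ∀ us certs →
       let G = gram q₁ q₂ q₃ a b c in checkAll G (adj G) (2 · δ₃ G) bs us certs ≡ true → ∀ {β} → β ∈ us → Base.Ext base β → Classified
     sound-all {q₁} {q₂} {q₃} {a} {b} {c} base bs es (u ∷ us) (x ∷ xs) h = λ where
         (here refl) e → sound base (u ∷ bs) (e ∷ es) x (proj₁ h′)
         (there i) e → sound-all base bs es us xs (proj₂ h′) i e
       where
       G = gram q₁ q₂ q₃ a b c
       h′ = ∧-true {check G (adj G) (2 · δ₃ G) (u ∷ bs) x} h

     -- For a free form, a vector outside the sublattice is allowed, provided the continuation of
     -- the certificate classifies L; for a half-integral one the list of such vectors is empty.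
     sound-kind : ∀ {q₁ q₂ q₃ a b c} (base : Base q₁ q₂ q₃ a b c) bs → All (Base.Ext base) bs → ∀ l certs i k →
       let G = gram q₁ q₂ q₃ a b c ; d = 2 · δ₃ G in forms i ≡ (G , k) →
       tp (d ⊗ d) ≡ true → splitOK d (adj G) l ≡ true → residuesOK d l ≡ true →
       checkKind G (adj G) d bs l certs k ≡ true → Classified
     sound-kind {q₁} {q₂} {q₃} {a} {b} {c} base bs es l certs i free eq td hs hr h =
       conclude
         -- Lying in the sublattice is a linear property, so the choice between containment of all
         -- of L and a surviving enlargement can be made on generators.
         (dichotomy (InBasis base) Classified (InBasis-𝟎 base) (InBasis-⊕ base) (InBasis-⊙ base) step)
       where
       G = gram q₁ q₂ q₃ a b c
       conclude : (∀ {v} → L v → InBasis base v) ⊎ Classified → Classified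
       conclude (inj₁ f) = i , subst Corresponds (sym eq) (base , f)
       conclude (inj₂ g) = g
       step : ∀ {v} → L v → InBasis base v ⊎ Classified
       step lv = [ (λ (x , ζ , a₁ , a₂ , a₃ , m) → inj₁ (free-vector base lv x ζ a₁ a₂ a₃ m))
                 , (λ (β , β∈ , e) → inj₂ (sound-all base bs es (remaining G free (2 · δ₃ G) (map (app (adj G)) bs) l) certs h β∈ e)) ]′
                 (reduced-vector base free l bs es td hs hr lv)
     sound-kind {q₁} {q₂} {q₃} {a} {b} {c} base bs es l certs i (half g mem) eq td hs hr h =
       i , subst Corresponds (sym eq) (base , half-vector base g bs es (proj₁ h′) ,
         λ lv → [ (λ (x , ζ , a₁ , a₂ , a₃ , m) → half-coordinates base lv g mem (closed i eq) x ζ a₁ a₂ a₃ m)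
                , (λ (β , β∈ , _) → ⊥-elim (isEmpty-sound (proj₂ h′) β∈)) ]′ (reduced-vector base (half g mem) l bs es td hs hr lv))
       where
       G = gram q₁ q₂ q₃ a b c
       h′ = ∧-true {kindOK g (adj G) (2 · δ₃ G) bs} h

     sound-form : ∀ {q₁ q₂ q₃ a b c} (base : Base q₁ q₂ q₃ a b c) bs → All (Base.Ext base) bs → ∀ l certs i φ k → forms i ≡ (φ , k) →
       let G = gram q₁ q₂ q₃ a b c in checkForm G (adj G) (2 · δ₃ G) bs l certs (φ , k) ≡ true → Classified
     sound-form {q₁} {q₂} {q₃} {a} {b} {c} base bs es l certs i φ k eq h =
       sound-kind base bs es l certs i k (trans eq (cong (_, k) (sym (==G-sound G φ (proj₁ h₁))))) (proj₁ h₂) (proj₁ h₃) (proj₁ h₄) (proj₂ h₄)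
       where
       G = gram q₁ q₂ q₃ a b c
       d = 2 · δ₃ G
       h₁ = ∧-true {G ==G φ} h
       h₂ = ∧-true {tp (d ⊗ d)} (proj₂ h₁)
       h₃ = ∧-true {splitOK d (adj G) l} (proj₂ h₂)
       h₄ = ∧-true {residuesOK d l} (proj₂ h₃)

     sound {q₁} {q₂} {q₃} {a} {b} {c} base bs es (target α cs) h =
       sound-all base bs es _ cs (proj₂ h₂) (proj₂ (proj₂ found)) (proj₁ (proj₂ found))
       where
       h₁ = ∧-true {tp α} h
       h₂ = ∧-true {tp (minor (adj (gram q₁ q₂ q₃ a b c)))} (proj₂ h₁)
       found = WithBase.survivors-complete base bs es α (proj₁ h₁) (proj₁ h₂)
     sound {q₁} {q₂} {q₃} {a} {b} {c} base bs es (rebase u₁ u₂ u₃ us (gram q₁′ q₂′ q₃′ a′ b′ c′) bs′ cert) h =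
       sound (rebase-base (X u₁) (X u₂) (X u₃) q₁′ q₂′ q₃′ a′ b′ c′ (proj₁ h₁) (proj₁ h₃)) bs′
             (rebase-exts (X u₁) (X u₂) (X u₃) q₁′ q₂′ q₃′ a′ b′ c′ (proj₁ h₁) (proj₁ h₃) (map (dual G bs) us) bs′ (exts us) (proj₁ h₂)) cert (proj₂ h₃)
       where
       open Rebase A U base
       G = gram q₁ q₂ q₃ a b c
       G′ = gram q₁′ q₂′ q₃′ a′ b′ c′
       d = 2 · δ₃ G
       X : ∀ u → Base.Ext base (dual G bs u)
       X = Ext-combo bs es
       exts : ∀ us → All (Base.Ext base) (map (dual G bs) us)
       exts [] = []
       exts (u ∷ us) = X u ∷ exts us
       h₁ = ∧-true {checkGram (adj G) d (dual G bs u₁) (dual G bs u₂) (dual G bs u₃) G′} h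
       h₂ = ∧-true {checkExts (adj G) d (dual G bs u₁) (dual G bs u₂) (dual G bs u₃) (map (dual G bs) us) bs′} (proj₂ h₁)
       h₃ = ∧-true {tp (2 · δ₃ G′)} (proj₂ h₂)
     sound base bs es (final i l cs) h = sound-form base bs es l cs i (proj₁ (forms i)) (proj₂ (forms i)) refl h

-- The first two vectors of the search.

module LowRanks where
 open Certificates
 open QuadraticSpaces
 open TraceOrder
 open QuadraticIntegers
 open Completeness
 open IntegralDivision
 open Lattices
 open SurvivorLists
 open CertificateSoundness
 open import Data.Integer using (ℤ)
 open import Data.List using ([]; _∷_)
 open import Data.List.Relation.Unary.All using ([]; _∷_)

 module LowRank (A : Ambient) (U : UniversalLattice A) (forms : ℕ → Gram × Kind)
   (closed : ∀ i → ∀ {φ g mem} → forms i ≡ (φ , half g mem) → ∀ t u → mem t ≡ true → mem (t ⊕ 2 · u) ≡ true) where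
   open Ambient A
   open UniversalLattice U
   open Lattice A U
   open Survivors A U
   open Checker s p Δ forms
   open Soundness A U forms
   open Run closed

   module Rank₁ (u₁ : Vec) (l₁ : L u₁) (e₁ : (ℤ.+ 1 ∶ ℤ.+ 0) ↦ Q u₁) where

     module Rank₂ (u₂ : Vec) (l₂ : L u₂) (q₂ a : O) (e₂ : q₂ ↦ Q u₂) (e₁₂ : a ↦ B u₁ u₂) where

       sound₃ : ∀ β v → L v → β ↦ Q v → ∀ l certs → check₃All q₂ β a l certs ≡ true →
         ∀ {x y} → (x , y) ∈ l → x ↦ B u₁ v → y ↦ B u₂ v → Classified
       sound₃ β v lv e₃ ((x , y) ∷ l) (cert ∷ certs) h (here refl) e₁₃ e₂₃ = sound base [] [] cert (proj₂ h₂)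
         where
         G = gram (ℤ.+ 1 ∶ ℤ.+ 0) q₂ β a x y
         h₁ = ∧-true {check₃ G cert} h
         h₂ = ∧-true {tp (2 · δ₃ G)} (proj₁ h₁)
         base : Base (ℤ.+ 1 ∶ ℤ.+ 0) q₂ β a x y
         base = record { v₁ = u₁ ; v₂ = u₂ ; v₃ = v ; l₁ = l₁ ; l₂ = l₂ ; l₃ = lv ; e₁ = e₁ ; e₂ = e₂ ; e₃ = e₃
                       ; e₁₂ = e₁₂ ; e₁₃ = e₁₃ ; e₂₃ = e₂₃ ; definite = proj₁ h₂ }
       sound₃ β v lv e₃ ((x , y) ∷ l) (cert ∷ certs) h (there i) e₁₃ e₂₃ =
         sound₃ β v lv e₃ l certs (proj₂ (∧-true {check₃ (gram (ℤ.+ 1 ∶ ℤ.+ 0) q₂ β a x y) cert} h)) i e₁₃ e₂₃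

       pairs-complete : ∀ β v → L v → β ↦ Q v → tp β ≡ true → tp (4 · ((ℤ.+ 1 ∶ ℤ.+ 0) ⊗ q₂) ⊝ a ⊗ a) ≡ true →
         ∀ x y → x ↦ B u₁ v → y ↦ B u₂ v → normalized (tri x y 0O) ≡ true →
         (x , y) ∈ pairs q₂ a β (cands (4 · ((ℤ.+ 1 ∶ ℤ.+ 0) ⊗ β))) (cands (4 · (q₂ ⊗ β)))
       pairs-complete β v lv eβ tβ ta x y ex ey nxy =
         ∈-concatMap _ (∈-filterᵇ lexNonneg (cands-complete (4 · ((ℤ.+ 1 ∶ ℤ.+ 0) ⊗ β)) x (cauchy-schwarz lv l₁ tβ eβ e₁ (↦-subst (B-sym u₁ v) ex))) (normalized-lex x y 0O nxy))
           (∈-map⁺ (x ,_) (∈-filterᵇ _ (cands-complete (4 · (q₂ ⊗ β)) y (cauchy-schwarz lv l₂ tβ eβ e₂ (↦-subst (B-sym u₂ v) ey)))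
             (∧-intro (gram-nonneg l₁ l₂ lv e₁ e₂ eβ e₁₂ ex ey ta) nxy)))

       -- The sign of the third vector is free, and it is used to normalize its pair of products
       -- with the first two.
       sound₂ : ∀ cert → check₂ q₂ a cert ≡ true → Classified
       sound₂ (target₂ β certs) h = choose (normalized-± (tri x y 0O))
         where
         h₁ = ∧-true {tp (4 · ((ℤ.+ 1 ∶ ℤ.+ 0) ⊗ q₂) ⊝ a ⊗ a)} h
         h₂ = ∧-true {tp β} (proj₂ h₁)
         l = pairs q₂ a β (cands (4 · ((ℤ.+ 1 ∶ ℤ.+ 0) ⊗ β))) (cands (4 · (q₂ ⊗ β)))
         found = universal β (proj₁ h₂)
         v = proj₁ found
         lv = proj₁ (proj₂ found)
         eβ = proj₂ (proj₂ found)
         xy = B-integral l₁ lv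
         yy = B-integral l₂ lv
         x = proj₁ xy
         y = proj₁ yy
         B-negʳ : ∀ u → - B u v ≡ B u (neg-vec v)
         B-negʳ u = trans (cong -_ (B-sym u v)) (trans (sym (B-neg v u)) (B-sym (neg-vec v) u))
         choose : normalized (tri x y 0O) ≡ true ⊎ normalized (tri (0O ⊝ x) (0O ⊝ y) 0O) ≡ true → Classified
         choose (inj₁ n) = sound₃ β v lv eβ l certs (proj₂ h₂)
           (pairs-complete β v lv eβ (proj₁ h₂) (proj₁ h₁) x y (proj₂ xy) (proj₂ yy) n) (proj₂ xy) (proj₂ yy)
         choose (inj₂ n) = sound₃ β (neg-vec v) (L-neg lv) eβ′ l certs (proj₂ h₂)
           (pairs-complete β (neg-vec v) (L-neg lv) eβ′ (proj₁ h₂) (proj₁ h₁) (0O ⊝ x) (0O ⊝ y) ex′ ey′ n) ex′ ey′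
           where
           eβ′ = ↦-subst (sym (Q-neg v)) eβ
           ex′ = ↦-subst (B-negʳ u₁) (neg↦ (proj₂ xy))
           ey′ = ↦-subst (B-negʳ u₂) (neg↦ (proj₂ yy))

     sound₂-all : ∀ α v → L v → α ↦ Q v → ∀ l certs → check₂All α l certs ≡ true → ∀ {x} → x ∈ l → x ↦ B u₁ v → Classified
     sound₂-all α v lv eα (x ∷ l) (cert ∷ certs) h (here refl) ex =
       Rank₂.sound₂ v lv α x eα ex cert (proj₁ (∧-true {check₂ α x cert} h))
     sound₂-all α v lv eα (x ∷ l) (cert ∷ certs) h (there i) ex =
       sound₂-all α v lv eα l certs (proj₂ (∧-true {check₂ α x cert} h)) i ex

   -- The search starts from a vector of value 1; the sign of the second vector is chosen so that
   -- its product with the first is normalized.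
   sound₁ : ∀ cert → check₁ cert ≡ true → Classified
   sound₁ (target₁ α certs) h = choose (lexNonneg-± x)
     where
     h₁ = ∧-true {tp (ℤ.+ 1 ∶ ℤ.+ 0)} h
     h₂ = ∧-true {tp α} (proj₂ h₁)
     unit = universal (ℤ.+ 1 ∶ ℤ.+ 0) (proj₁ h₁)
     u₁ = proj₁ unit
     lu = proj₁ (proj₂ unit)
     e₁ = proj₂ (proj₂ unit)
     found = universal α (proj₁ h₂)
     v = proj₁ found
     lv = proj₁ (proj₂ found)
     eα = proj₂ (proj₂ found)
     xx = B-integral lu lv
     x = proj₁ xx
     l = filterᵇ lexNonneg (cands (4 · ((ℤ.+ 1 ∶ ℤ.+ 0) ⊗ α)))
     finish : ∀ v → L v → α ↦ Q v → ∀ x → x ↦ B u₁ v → lexNonneg x ≡ true → Classified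
     finish v lv eα x ex n = Rank₁.sound₂-all u₁ lu e₁ α v lv eα l certs (proj₂ h₂)
       (∈-filterᵇ lexNonneg (cands-complete (4 · ((ℤ.+ 1 ∶ ℤ.+ 0) ⊗ α)) x (cauchy-schwarz lv lu (proj₁ h₂) eα e₁ (↦-subst (B-sym u₁ v) ex))) n) ex
     choose : lexNonneg x ≡ true ⊎ lexNonneg (0O ⊝ x) ≡ true → Classified
     choose (inj₁ n) = finish v lv eα x (proj₂ xx) n
     choose (inj₂ n) = finish (neg-vec v) (L-neg lv) (↦-subst (sym (Q-neg v)) eα) (0O ⊝ x)
       (↦-subst (trans (cong -_ (B-sym u₁ v)) (trans (sym (B-neg v u₁)) (B-sym (neg-vec v) u₁))) (neg↦ (proj₂ xx))) n

-- From a frame back to coordinates and ideals.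

module Coordinates where
 open Certificates
 open QuadraticSpaces
 open Vectors
 open BasisChange
 open FinalStates using (module Final)
 open QuadraticIntegers
 open IntegralDivision
 open Lattices
 open SurvivorLists
 open Rebasing
 open import Data.Integer using (ℤ)

 module Output (A : Ambient) (U : UniversalLattice A) {q₁ q₂ q₃ a b c}
   (base : Lattice.Base A U q₁ q₂ q₃ a b c) where
   open Ambient A
   open UniversalLattice U
   open Divisibility A
   open Lattice A U
   open Survivors A U
   open WithBase base
   open Frame base
   open ScalarSolver S

   -- Pairing a relation with the three vectors says that the Gram matrix annihilates its
   -- coefficients; the adjugate turns this into D times each coefficient.
   independent : ∀ x y z → comb x y z ≡ 𝟎 → x ≡ 0# × y ≡ 0# × z ≡ 0#
   independent x y z e =
       vanish (trans (sym (adj-gram₁ _ _ _ _ _ _ x y z)) (zeros adj₁ (λ X Y Z a b c → zero-sum _ _ _)))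
     , vanish (trans (sym (adj-gram₂ _ _ _ _ _ _ x y z)) (zeros adj₂ (λ X Y Z a b c → zero-sum _ _ _)))
     , vanish (trans (sym (adj-gram₃ _ _ _ _ _ _ x y z)) (zeros adj₃ (λ X Y Z a b c → zero-sum _ _ _)))
     where
     vanish : ∀ {x} → D * x ≡ 0# → x ≡ 0#
     vanish e = D-cancel (trans e (sym (*-zeroʳ D)))
     B-zero : ∀ t → B 𝟎 t ≡ 0#
     B-zero t = trans (cong (λ u → B u t) (sym (VectorLaws.0-⊙ S t))) (trans (B-⊙ 0# t t) (VectorLaws.0-left S _))
     flip : ∀ p q r s → x * p + y * q + z * r ≡ s → p * x + q * y + r * z ≡ s
     flip p q r s e = trans (solve 6 (λ x y z p q r → p :* x :+ q :* y :+ r :* z := x :* p :+ y :* q :+ z :* r) refl x y z p q r) e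
     row : ∀ t {p q r} → B v₁ t ≡ p → B v₂ t ≡ q → B v₃ t ≡ r → p * x + q * y + r * z ≡ 0#
     row t refl refl refl = flip _ _ _ _ (trans (sym (B-sum x y z v₁ v₂ v₃ t)) (trans (cong (λ u → B u t) e) (B-zero t)))
     row₁ = row v₁ (B-self v₁) (B-sym v₂ v₁) (B-sym v₃ v₁)
     row₂ = row v₂ refl (B-self v₂) (B-sym v₃ v₂)
     row₃ = row v₃ refl refl (B-self v₃)
     zeros : (f : (X Y Z a b c x y z : Carrier) → Carrier) → (∀ X Y Z a b c → f X Y Z a b c 0# 0# 0# ≡ 0#) →
       f (Q v₁) (Q v₂) (Q v₃) (B v₁ v₂) (B v₁ v₃) (B v₂ v₃)
         ((Q v₁ + Q v₁) * x + B v₁ v₂ * y + B v₁ v₃ * z) (B v₁ v₂ * x + (Q v₂ + Q v₂) * y + B v₂ v₃ * z) (B v₁ v₃ * x + B v₂ v₃ * y + (Q v₃ + Q v₃) * z) ≡ 0#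
     zeros f h rewrite row₁ | row₂ | row₃ = h _ _ _ _ _ _

   Q-comb : ∀ x y z → Q (comb x y z) ≡ ι q₁ * (x * x) + ι q₂ * (y * y) + ι q₃ * (z * z) + ι a * (x * y) + ι b * (x * z) + ι c * (y * z)
   Q-comb x y z rewrite val e₁ | val e₂ | val e₃ | val e₁₂ | val e₁₃ | val e₂₃ = trans (Q-3 x y z v₁ v₂ v₃)
     (solve 9 (λ x y z p q r a b c → x :* x :* p :+ y :* y :* q :+ x :* (y :* a) :+ z :* z :* r :+ z :* (x :* b :+ y :* c)
        := p :* (x :* x) :+ q :* (y :* y) :+ r :* (z :* z) :+ a :* (x :* y) :+ b :* (x :* z) :+ c :* (y :* z)) refl x y z (Q v₁) (Q v₂) (Q v₃) (B v₁ v₂) (B v₁ v₃) (B v₂ v₃))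

   L-comb : ∀ x y z → L (comb (ι x) (ι y) (ι z))
   L-comb x y z = L-⊕ (L-⊕ (L-⊙ x l₁) (L-⊙ y l₂)) (L-⊙ z l₃)

 module HalfOutput (A : Ambient) (U : UniversalLattice A) {q₁ q₂ q₃ a b c} (base : Lattice.Base A U q₁ q₂ q₃ a b c) where
   open Ambient A
   open UniversalLattice U
   open Lattice.Base base
   module WithIdeal
     (h : O) (mem : O → Bool) (γ : Carrier) (2γ : ⟦ ℤ.+ 2 ⟧ * γ ≡ ι h)
     (half-vector : ∃ λ u → L u × ⟦ ℤ.+ 2 ⟧ ⊙ u ≡ ι h ⊙ v₃)
     (half-coordinates : ∀ {v} → L v → ∃ λ x → ∃ λ y → ∃ λ t → mem t ≡ true × ⟦ ℤ.+ 2 ⟧ ⊙ v ≡ comb (⟦ ℤ.+ 2 ⟧ * ι x) (⟦ ℤ.+ 2 ⟧ * ι y) (ι t))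
     where
     open Lattice A U using (2-cancel)
     open Output A U base using (L-comb)
     open ScalarSolver S
     private module W = VectorLaws S

     2-cancel-vec : ∀ {u v} → ⟦ ℤ.+ 2 ⟧ ⊙ u ≡ ⟦ ℤ.+ 2 ⟧ ⊙ v → u ≡ v
     2-cancel-vec e = ≡³ (2-cancel (cong proj₁ e)) (2-cancel (cong (λ t → proj₁ (proj₂ t)) e)) (2-cancel (cong (λ t → proj₂ (proj₂ t)) e))

     γv₃ : L (γ ⊙ v₃)
     γv₃ = let (u , lu , e) = half-vector in subst L (2-cancel-vec (trans e (trans (cong (_⊙ v₃) (sym 2γ)) (W.⊙-* _ γ v₃)))) lu

     coordinates-half : (∀ t → mem t ≡ true → ∃ λ m → ∃ λ n → ι t ≡ ⟦ ℤ.+ 2 ⟧ * (⟦ m ⟧ + ⟦ n ⟧ * γ)) →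
       ∀ {v} → L v → ∃ λ x → ∃ λ y → ∃ λ m → ∃ λ n → v ≡ comb (ι x) (ι y) (⟦ m ⟧ + ⟦ n ⟧ * γ)
     coordinates-half split lv with half-coordinates lv
     ... | x , y , t , mt , e with split t mt
     ... | m , n , et = x , y , m , n ,
       2-cancel-vec (trans e (trans (cong (comb (⟦ ℤ.+ 2 ⟧ * ι x) (⟦ ℤ.+ 2 ⟧ * ι y)) et) (Final.⊙-comb A U base ⟦ ℤ.+ 2 ⟧ (ι x) (ι y) (⟦ m ⟧ + ⟦ n ⟧ * γ))))

     -- The module generated by 1 and γ over the integers is reached by adding integral multiples of
     -- γ times the third vector.
     closed-half : ∀ x y m n → L (comb (ι x) (ι y) (⟦ m ⟧ + ⟦ n ⟧ * γ))
     closed-half x y m n = subst L shuffle (L-⊕ (L-comb x y (m ∶ ℤ.+ 0)) (L-⊙ (n ∶ ℤ.+ 0) γv₃))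
       where
       shuffle : comb (ι x) (ι y) (ι (m ∶ ℤ.+ 0)) ⊕ᵛ ι (n ∶ ℤ.+ 0) ⊙ (γ ⊙ v₃) ≡ comb (ι x) (ι y) (⟦ m ⟧ + ⟦ n ⟧ * γ)
       shuffle = trans (cong₂ (λ p q → comb (ι x) (ι y) p ⊕ᵛ q ⊙ (γ ⊙ v₃)) (ι-ℤ m) (ι-ℤ n))
         (trans (W.⊕-assoc _ _ _) (cong (ι x ⊙ v₁ ⊕ᵛ ι y ⊙ v₂ ⊕ᵛ_)
           (trans (cong (⟦ m ⟧ ⊙ v₃ ⊕ᵛ_) (sym (W.⊙-* ⟦ n ⟧ γ v₃))) (sym (W.⊙-+ ⟦ m ⟧ (⟦ n ⟧ * γ) v₃)))))

     open ChangeOfBasis S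

     ιv : O³ → Vec
     ιv (tri x y z) = ι x , ι y , ι z

     -- A free basis would give elements with `C * T` equal to 2 and with h times `T` divisible by
     -- 2, as in `Compare`. The argument `impossible` states that the arithmetic of the field
     -- excludes this.
     not-spanned : (∀ {y} → volume v₁ v₂ v₃ * y ≡ 0# → y ≡ 0#) →
       (∀ c₁ c₂ c₃ t₁ t₂ t₃ τ τ′ → mem t₁ ≡ true → mem t₂ ≡ true → mem t₃ ≡ true →
           (c₁ ⊗ t₁ ⊕ c₂ ⊗ t₂ ⊕ c₃ ⊗ t₃) ⊗ τ ≡ (ℤ.+ 2 ∶ ℤ.+ 0) → h ⊗ τ ≡ 2 · τ′ → ⊥) →
       ∀ e₁ e₂ e₃ → L e₁ → L e₂ → L e₃ → (∀ {v} → L v → ∃ λ r → v ≡ span³ e₁ e₂ e₃ (ιv r)) → ⊥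
     not-spanned regular impossible e₁ e₂ e₃ m₁ m₂ m₃ spanned =
       go (spanned l₁) (spanned l₂) (spanned l₃) (spanned γv₃) (half-coordinates m₁) (half-coordinates m₂) (half-coordinates m₃)
       where
       cof : O → O → O → O → O
       cof p q r s = p ⊗ s ⊝ q ⊗ r
       c↦ : ∀ p q r s → cof p q r s ↦ cofactor (ι p) (ι q) (ι r) (ι s)
       c↦ p q r s = itself {p} ↦* itself {s} ↦- itself {q} ↦* itself {r}
       detO : O³ → O³ → O³ → O
       detO (tri a b c) (tri d e f) (tri g h i) = a ⊗ (e ⊗ i ⊝ f ⊗ h) ⊝ b ⊗ (d ⊗ i ⊝ f ⊗ g) ⊕ c ⊗ (d ⊗ h ⊝ e ⊗ g)
       d↦ : ∀ r s t → detO r s t ↦ volume (ιv r) (ιv s) (ιv t)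
       d↦ (tri a b c) (tri d e f) (tri g h i) = itself {a} ↦* (itself {e} ↦* itself {i} ↦- itself {f} ↦* itself {h}) ↦- itself {b} ↦* (itself {d} ↦* itself {i} ↦- itself {f} ↦* itself {g})
             ↦+ itself {c} ↦* (itself {d} ↦* itself {h} ↦- itself {e} ↦* itself {g})
       Halved : Vec → Set
       Halved e = ∃ λ x → ∃ λ y → ∃ λ t → mem t ≡ true × ⟦ ℤ.+ 2 ⟧ ⊙ e ≡ comb (⟦ ℤ.+ 2 ⟧ * ι x) (⟦ ℤ.+ 2 ⟧ * ι y) (ι t)
       Spanned : Vec → Set
       Spanned v = ∃ λ r → v ≡ span³ e₁ e₂ e₃ (ιv r)
       go : Spanned v₁ → Spanned v₂ → Spanned v₃ → Spanned (γ ⊙ v₃) → Halved e₁ → Halved e₂ → Halved e₃ → ⊥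
       go (r , er) (s , es) (t , et) (u , eu) (x₁ , y₁ , z₁ , m₁ , f₁) (x₂ , y₂ , z₂ , m₂ , f₂) (x₃ , y₃ , z₃ , m₃ , f₃) =
         impossible (cof x₂ y₂ x₃ y₃) (cof x₃ y₃ x₁ y₁) (cof x₁ y₁ x₂ y₂) z₁ z₂ z₃ (detO r s t) (detO r s u) m₁ m₂ m₃
           (ι-injective (trans (val ((c↦ x₂ y₂ x₃ y₃ ↦* itself {z₁} ↦+ c↦ x₃ y₃ x₁ y₁ ↦* itself {z₂} ↦+ c↦ x₁ y₁ x₂ y₂ ↦* itself {z₃}) ↦* d↦ r s t))
               (trans (sym X.unit-relation) (sym (ι-ℤ (ℤ.+ 2))))))
           (ι-injective (trans (val (itself {h} ↦* d↦ r s t)) (trans X.ideal-relation (sym (val (↦· 2 (d↦ r s u)))))))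
         where
         module X = Compare e₁ e₂ e₃ v₁ v₂ v₃ γ (ι h) 2γ regular (ℤ-regular 3) (ιv r) (ιv s) (ιv t) (ιv u) er es et eu
             (ι x₁) (ι y₁) (ι z₁) (ι x₂) (ι y₂) (ι z₂) (ι x₃) (ι y₃) (ι z₃) f₁ f₂ f₃

-- The field behind an abstraction barrier.

module SealedField where
 open import Defs
 open FieldLaws
 open QuadraticSpaces
 open import Data.Integer using (ℤ; +_)
 open import Algebra.Structures using (IsCommutativeRing)

 -- The operations of F unfold to components by η; sealing them keeps the terms of the abstract theory small.
 opaque
   add : F → F → F
   add = _+F_
   mul : ℕ → F → F → F
   mul = mulF
   neg : F → F
   neg = -F_
   int : ℤ → F
   int = ιℤ

 opaque
   unfolding add mul neg int

   mul≡ : ∀ D x y → mulF D x y ≡ mul D x y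
   mul≡ D x y = refl

   int≡ : ∀ m → ιℤ m ≡ int m
   int≡ m = refl

   sealedRing : ∀ (D : ℕ) → IsCommutativeRing _≡_ add (mul D) neg 0F 1F
   sealedRing D = FieldRing.isCommutativeRing D

   int-+ : ∀ (D : ℕ) m n → int (m ℤ.+ n) ≡ add (int m) (int n)
   int-+ D = FieldRing.ιℤ-+ D
   int-* : ∀ D m n → int (m ℤ.* n) ≡ mul D (int m) (int n)
   int-* D = FieldRing.ιℤ-* D
   int-neg : ∀ (D : ℕ) m → int (ℤ.- m) ≡ neg (int m)
   int-neg D = FieldRing.ιℤ-neg D
   int-0 : int (+ 0) ≡ 0F
   int-0 = refl
   int-1 : int (+ 1) ≡ 1F
   int-1 = refl

 F-scalars : ℕ → Scalars
 F-scalars D = record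
   { Carrier = F ; _+_ = add ; _*_ = mul D ; -_ = neg ; 0# = 0F ; 1# = 1F
   ; isCommutativeRing = sealedRing D ; ⟦_⟧ = int
   ; ⟦⟧-+ = int-+ D ; ⟦⟧-* = int-* D ; ⟦⟧-neg = int-neg D ; ⟦⟧-0 = int-0 ; ⟦⟧-1 = int-1 }

 module Sealed (D : ℕ) where
   open QuadraticSpace (F-scalars D)

   opaque
     unfolding add mul neg int

     +V≡ : ∀ u v → u +V v ≡ u ⊕ v
     +V≡ u v = refl

     scaleV≡ : ∀ x u → scaleV D x u ≡ x ⊙ u
     scaleV≡ x u = refl

     evalForm≡ : ∀ φ x y z → let open Form φ in evalForm D φ x y z ≡ TernaryForm.Q c11 c22 c33 c12 c13 c23 (x , y , z)
     evalForm≡ φ x y z = refl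

     integer≡ : ∀ m n x → ιℤ m +F mulF D (ιℤ n) x ≡ add (int m) (mul D (int n) x)
     integer≡ m n x = refl

-- The quadratic field as an instance of the abstract setting.

module FieldInstance where
 open import Defs
 open FieldLaws
 open SealedField
 open QuadraticSpaces
 open Vectors
 open Certificates
 open IntegralDivision
 open Completeness
 open QuadraticIntegers
 open import Data.Nat using (suc)
 open import Data.Integer using (ℤ; +_)
 open import Data.Rational.Solver using (module +-*-Solver)
 open import Relation.Binary using (tri<; tri≈; tri>)

 neg-neg : ∀ b → ℚ.- (ℚ.- b) ≡ b
 neg-neg = solve 1 (λ b → :- (:- b) := b) refl
   where open +-*-Solver

 4ℚ : ℚ
 4ℚ = + 4 / 1

 -- Positivity of both a + b√D and a - b√D means that a exceeds the absolute value of b√D. The case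
 -- distinction runs over the sign patterns of the two embeddings.
 TotPos⇒ : ∀ D a b → TotPos D (a , b) → 0ℚ ℚ.< a × Dℚ D ℚ.* (b ℚ.* b) ℚ.< a ℚ.* a
 TotPos⇒ D a b (inj₂ (inj₁ (p , _ , q)) , _) = p , q
 TotPos⇒ D a b (inj₂ (inj₂ (p , _)) , inj₁ (q , _)) = ⊥-elim (ℚ.<-irrefl refl (ℚ.<-≤-trans p q))
 TotPos⇒ D a b (inj₂ (inj₂ (p , _)) , inj₂ (inj₁ (q , _))) = ⊥-elim (ℚ.<-irrefl refl (ℚ.<-trans p q))
 TotPos⇒ D a b (inj₂ (inj₂ (_ , p , _)) , inj₂ (inj₂ (_ , q , _))) =
   ⊥-elim (ℚ.<-irrefl refl (ℚ.<-trans p (subst (ℚ._< 0ℚ) (neg-neg b) (ℚ.neg-antimono-< q))))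
 TotPos⇒ D a b (inj₁ (p , _) , inj₂ (inj₂ (q , _))) = ⊥-elim (ℚ.<-irrefl refl (ℚ.<-≤-trans q p))
 TotPos⇒ D a b (inj₁ _ , inj₂ (inj₁ (p , _ , q))) = p , subst (λ t → Dℚ D ℚ.* t ℚ.< a ℚ.* a) (neg-sq b) q
   where
   open +-*-Solver
   neg-sq : ∀ b → (ℚ.- b) ℚ.* (ℚ.- b) ≡ b ℚ.* b
   neg-sq = solve 1 (λ b → (:- b) :* (:- b) := b :* b) refl
 TotPos⇒ D a b (inj₁ (0≤a , 0≤b , ne) , inj₁ (_ , 0≤-b , _)) = 0<a , subst (ℚ._< a ℚ.* a) (sym zero-side) (0<sq a 0<a)
   where
   open +-*-Solver
   b≡0 : b ≡ 0ℚ
   b≡0 = ℚ.≤-antisym (subst (ℚ._≤ 0ℚ) (neg-neg b) (ℚ.neg-antimono-≤ 0≤-b)) 0≤b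
   0<a : 0ℚ ℚ.< a
   0<a = ℚ.≰⇒> λ a≤0 → ne (ℚ.≤-antisym a≤0 0≤a , b≡0)
   0<sq : ∀ a → 0ℚ ℚ.< a → 0ℚ ℚ.< a ℚ.* a
   0<sq a h = subst (ℚ._< a ℚ.* a) (ℚ.*-zeroʳ a) (ℚ.*-monoʳ-<-pos a {{ℚ.positive h}} h)
   zero-side : Dℚ D ℚ.* (b ℚ.* b) ≡ 0ℚ
   zero-side = trans (cong (λ t → Dℚ D ℚ.* (t ℚ.* t)) b≡0) (ℚ.*-zeroʳ (Dℚ D))

 ⇒TotPos : ∀ D a b → 0ℚ ℚ.< a → Dℚ D ℚ.* (b ℚ.* b) ℚ.< a ℚ.* a → TotPos D (a , b)
 ⇒TotPos D a b p q with ℚ.<-cmp b 0ℚ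
 ... | tri< b<0 _ _ = inj₂ (inj₁ (p , b<0 , q)) , inj₁ (ℚ.<⇒≤ p , ℚ.<⇒≤ (ℚ.neg-antimono-< b<0) , λ (e , _) → ℚ.<-irrefl (sym e) p)
 ... | tri≈ _ refl _ = inj₁ (ℚ.<⇒≤ p , ℚ.≤-refl , λ (e , _) → ℚ.<-irrefl (sym e) p) , inj₁ (ℚ.<⇒≤ p , ℚ.≤-refl , λ (e , _) → ℚ.<-irrefl (sym e) p)
 ... | tri> _ _ 0<b = inj₁ (ℚ.<⇒≤ p , ℚ.<⇒≤ 0<b , λ (e , _) → ℚ.<-irrefl (sym e) p)
     , inj₂ (inj₁ (p , ℚ.neg-antimono-< 0<b , subst (λ t → Dℚ D ℚ.* t ℚ.< a ℚ.* a) (sym (neg-sq b)) q))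
   where
   open +-*-Solver
   neg-sq : ∀ b → (ℚ.- b) ℚ.* (ℚ.- b) ≡ b ℚ.* b
   neg-sq = solve 1 (λ b → (:- b) :* (:- b) := b :* b) refl

 -- `κ` inverts the coefficient of √D in ω, so it rescales that coordinate of a + bω to the integer
 -- b; the last field compares √D with √Δ accordingly.
 record Discriminant (D : ℕ) : Set where
   field
     s p : ℤ
     Δ : ℕ
     Δ≡ : + Δ ≡ s ℤ.* s ℤ.+ + 4 ℤ.* p
     s≤1 : ∣ s ∣ ℕ.≤ 1
     1≤Δ : 1 ℕ.≤ Δ
     ω² : mulF D (ω D) (ω D) ≡ ιℤ p +F mulF D (ιℤ s) (ω D)
     2re-ω : re (ω D) ℚ.+ re (ω D) ≡ s / 1
     κ : ℚ
     κ-im : κ ℚ.* im (ω D) ≡ 1ℚ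
     Δκ² : + Δ / 1 ℚ.* (κ ℚ.* κ) ≡ 4ℚ ℚ.* Dℚ D

 module Instance {D : ℕ} (disc : Discriminant D) where
   open Discriminant disc
   open FieldRing D
   open Arithmetic s p Δ

   ιO : O → F
   ιO (a ∶ b) = ιℤ a +F mulF D (ιℤ b) (ω D)

   private
     r i : ℚ
     r = re (ω D)
     i = im (ω D)

   2re : ∀ a b → re (ιO (a ∶ b)) ℚ.+ re (ιO (a ∶ b)) ≡ trace (a ∶ b) / 1
   2re a b = trans (solve 5 (λ a b d r i → (a :+ (b :* r :+ d :* (con 0ℚ :* i))) :+ (a :+ (b :* r :+ d :* (con 0ℚ :* i)))
       := con (+ 2 / 1) :* a :+ (r :+ r) :* b) refl (a / 1) (b / 1) (Dℚ D) r i)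
     (trans (cong₂ ℚ._+_ (sym (/1-* (+ 2) a)) (trans (cong (ℚ._* (b / 1)) 2re-ω) (sym (/1-* s b)))) (sym (/1-+ (+ 2 ℤ.* a) (s ℤ.* b))))
     where open +-*-Solver

   κim : ∀ a b → κ ℚ.* im (ιO (a ∶ b)) ≡ b / 1
   κim a b = trans (solve 4 (λ k b r i → k :* (con 0ℚ :+ (b :* i :+ con 0ℚ :* r)) := (k :* i) :* b) refl κ (b / 1) r i)
     (trans (cong (ℚ._* (b / 1)) κ-im) (ℚ.*-identityˡ (b / 1)))
     where open +-*-Solver

   ιO-injective : ∀ {x y} → ιO x ≡ ιO y → x ≡ y
   ιO-injective {a ∶ b} {c ∶ d} e = same b≡d
     where
     open +-*-Solver
     b≡d : b ≡ d
     b≡d = /1-injective b d (trans (sym (κim a b)) (trans (cong (λ z → κ ℚ.* im z) e) (κim c d)))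
     same : b ≡ d → (a ∶ b) ≡ (c ∶ d)
     same refl = cong (_∶ b) (/1-injective a c (ℚ-cancel (a / 1) (c / 1) _ (cong re e)))
       where
       ℚ-cancel : ∀ x y z → x ℚ.+ z ≡ y ℚ.+ z → x ≡ y
       ℚ-cancel x y z e = trans (solve 2 (λ x z → x := x :+ z :- z) refl x z) (trans (cong (ℚ._- z) e) (solve 2 (λ y z → y :+ z :- z := y) refl y z))

   private
     4re² : ∀ a b → 4ℚ ℚ.* (re (ιO (a ∶ b)) ℚ.* re (ιO (a ∶ b))) ≡ (trace (a ∶ b) ℤ.* trace (a ∶ b)) / 1
     4re² a b = trans (lemma (re (ιO (a ∶ b)))) (trans (cong₂ ℚ._*_ (2re a b) (2re a b)) (sym (/1-* (trace (a ∶ b)) (trace (a ∶ b)))))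
       where
       open +-*-Solver
       lemma : ∀ x → 4ℚ ℚ.* (x ℚ.* x) ≡ (x ℚ.+ x) ℚ.* (x ℚ.+ x)
       lemma = solve 1 (λ x → con 4ℚ :* (x :* x) := (x :+ x) :* (x :+ x)) refl

     4Dim² : ∀ a b → 4ℚ ℚ.* (Dℚ D ℚ.* (im (ιO (a ∶ b)) ℚ.* im (ιO (a ∶ b)))) ≡ (+ Δ ℤ.* (b ℤ.* b)) / 1
     4Dim² a b = trans (lemma 4ℚ (Dℚ D) (im (ιO (a ∶ b)))) (trans (cong (ℚ._* (y ℚ.* y)) (sym Δκ²))
       (trans (lemma₂ (+ Δ / 1) κ y) (trans (cong (λ t → + Δ / 1 ℚ.* (t ℚ.* t)) (κim a b))
         (sym (trans (/1-* (+ Δ) (b ℤ.* b)) (cong (+ Δ / 1 ℚ.*_) (/1-* b b)))))))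
       where
       open +-*-Solver
       y = im (ιO (a ∶ b))
       lemma : ∀ f d y → f ℚ.* (d ℚ.* (y ℚ.* y)) ≡ (f ℚ.* d) ℚ.* (y ℚ.* y)
       lemma = solve 3 (λ f d y → f :* (d :* (y :* y)) := (f :* d) :* (y :* y)) refl
       lemma₂ : ∀ δ k y → (δ ℚ.* (k ℚ.* k)) ℚ.* (y ℚ.* y) ≡ δ ℚ.* ((k ℚ.* y) ℚ.* (k ℚ.* y))
       lemma₂ = solve 3 (λ δ k y → (δ :* (k :* k)) :* (y :* y) := δ :* ((k :* y) :* (k :* y))) refl

   open Enumeration s p Δ Δ≡ s≤1 1≤Δ using (Pos)

   -- After multiplication by four, the squares of the rational coordinates become t² and Δb², and
   -- the inequalities are those of integers.
   Pos⇒TotPos : ∀ x → Pos x → TotPos D (ιO x)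
   Pos⇒TotPos x@(a ∶ b) (h , k) = ⇒TotPos D _ _
     (ℚ.≰⇒> λ le → ℚ.<-irrefl refl (ℚ.<-≤-trans (subst (0ℚ ℚ.<_) (sym (2re a b)) (/1-mono-< {0ℤ} {trace x} h)) (ℚ.+-mono-≤ {re (ιO x)} {0ℚ} {re (ιO x)} {0ℚ} le le)))
     (ℚ.*-cancelˡ-<-nonNeg 4ℚ (subst₂ ℚ._<_ (sym (4Dim² a b)) (sym (4re² a b)) (/1-mono-< k)))

   TotPos⇒Pos : ∀ x → TotPos D (ιO x) → Pos x
   TotPos⇒Pos x@(a ∶ b) t with TotPos⇒ D _ _ t
   ... | h , k = /1-cancel-< (subst (0ℚ ℚ.<_) (2re a b) (ℚ.+-mono-< h h))
     , /1-cancel-< (subst₂ ℚ._<_ (4Dim² a b) (4re² a b) (ℚ.*-monoʳ-<-pos 4ℚ k))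

   ℤ-regularF : ∀ N {y} → mulF D (ιℤ (+ suc N)) y ≡ 0F → y ≡ 0F
   ℤ-regularF N {a , b} e = cong₂ _,_ (cancel a (trans (lemma₁ (+ suc N / 1) a b (Dℚ D)) (cong re e)))
                                    (cancel b (trans (lemma₂ (+ suc N / 1) a b) (cong im e)))
     where
     open +-*-Solver
     M = + suc N / 1
     lemma₁ : ∀ m a b d → m ℚ.* a ≡ m ℚ.* a ℚ.+ d ℚ.* (0ℚ ℚ.* b)
     lemma₁ = solve 4 (λ m a b d → m :* a := m :* a :+ d :* (con 0ℚ :* b)) refl
     lemma₂ : ∀ m a b → m ℚ.* b ≡ m ℚ.* b ℚ.+ 0ℚ ℚ.* a
     lemma₂ = solve 3 (λ m a b → m :* b := m :* b :+ con 0ℚ :* a) refl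
     0<M : 0ℚ ℚ.< M
     0<M = /1-mono-< {0ℤ} {+ suc N} (ℤ.+<+ (s≤s z≤n))
     cancel : ∀ x → M ℚ.* x ≡ 0ℚ → x ≡ 0ℚ
     cancel x e with ℚ.<-cmp x 0ℚ
     ... | tri≈ _ x≡0 _ = x≡0
     ... | tri< x<0 _ _ = ⊥-elim (ℚ.<-irrefl (trans e (sym (ℚ.*-zeroʳ M))) (ℚ.*-monoʳ-<-pos M {{ℚ.positive 0<M}} x<0))
     ... | tri> _ _ 0<x = ⊥-elim (ℚ.<-irrefl (trans (ℚ.*-zeroʳ M) (sym e)) (ℚ.*-monoʳ-<-pos M {{ℚ.positive 0<M}} 0<x))

   open Scalars (F-scalars D) using () renaming (_+_ to _⊹_; _*_ to _⋆_)
   open Sealed D using (integer≡)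

   sealed-ω² : ω D ⋆ ω D ≡ int p ⊹ int s ⋆ ω D
   sealed-ω² = trans (sym (mul≡ D (ω D) (ω D))) (trans ω² (integer≡ p s (ω D)))

   sealed-ι : ∀ x → QuadInt.ι (F-scalars D) s p Δ (ω D) sealed-ω² x ≡ ιO x
   sealed-ι (a ∶ b) = sym (integer≡ a b (ω D))

   ambient : Ambient
   ambient = record
     { S = F-scalars D ; s = s ; p = p ; Δ = Δ ; Δ≡ = Δ≡ ; s≤1 = s≤1 ; 1≤Δ = 1≤Δ ; w = ω D ; w² = sealed-ω²
     ; ι-injective = λ {x} {y} e → ιO-injective {x} {y} (trans (sym (sealed-ι x)) (trans e (sealed-ι y)))
     ; ℤ-regular = λ N {y} e → ℤ-regularF N (trans (mul≡ D (ιℤ (+ suc N)) y) (trans (cong (λ t → t ⋆ y) (int≡ (+ suc N))) e)) }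

-- Finitely generated modules.

module GeneratedModules where
 open QuadraticSpaces
 open Vectors
 open Certificates
 open IntegralDivision
 open Completeness
 open QuadraticIntegers
 open Lattices
 open import Data.Nat using (zero; suc)
 open import Data.Integer using (ℤ)
 open import Data.Fin using (zero; suc)

 module Generated (A : Ambient) where
   open Ambient A
   private module W = VectorLaws S

   Integral : Carrier → Set
   Integral x = ∃ λ o → x ≡ ι o

   combination : (k : ℕ) → (Fin k → Carrier) → (Fin k → Vec) → Vec
   combination zero c g = 𝟎
   combination (suc k) c g = c zero ⊙ g zero ⊕ᵛ combination k (λ i → c (suc i)) (λ i → g (suc i))

   In : (k : ℕ) → (Fin k → Vec) → Vec → Set
   In k g v = ∃ λ c → (∀ i → Integral (c i)) × combination k c g ≡ v

   Integral-+ : ∀ {x y} → Integral x → Integral y → Integral (x + y)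
   Integral-+ (o , refl) (o′ , refl) = o ⊕ o′ , sym (val (itself {o} ↦+ itself {o′}))

   Integral-* : ∀ o {x} → Integral x → Integral (ι o * x)
   Integral-* o (o′ , refl) = o ⊗ o′ , sym (val (itself {o} ↦* itself {o′}))

   Integral-0 : Integral 0#
   Integral-0 = 0O , sym (trans (ι-ℤ 0ℤ) ⟦⟧-0)

   Integral-1 : Integral 1#
   Integral-1 = (ℤ.+ 1 ∶ ℤ.+ 0) , sym (trans (ι-ℤ (ℤ.+ 1)) ⟦⟧-1)

   combination-+ : ∀ k (c c′ : Fin k → Carrier) g → combination k (λ i → c i + c′ i) g ≡ combination k c g ⊕ᵛ combination k c′ g
   combination-+ zero c c′ g = sym (W.𝟎-⊕ 𝟎)
   combination-+ (suc k) c c′ g = trans (cong₂ _⊕ᵛ_ (W.⊙-+ (c zero) (c′ zero) (g zero)) (combination-+ k _ _ _)) (W.⊕-swap _ _ _ _)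

   combination-* : ∀ k x (c : Fin k → Carrier) g → combination k (λ i → x * c i) g ≡ x ⊙ combination k c g
   combination-* zero x c g = sym (W.⊙-𝟎 x)
   combination-* (suc k) x c g = trans (cong₂ _⊕ᵛ_ (W.⊙-* x (c zero) (g zero)) (combination-* k x _ _)) (sym (W.⊙-⊕ x _ _))

   combination-0 : ∀ k g → combination k (λ _ → 0#) g ≡ 𝟎
   combination-0 zero g = refl
   combination-0 (suc k) g = trans (cong₂ _⊕ᵛ_ (W.0-⊙ (g zero)) (combination-0 k _)) (W.𝟎-⊕ 𝟎)

   In-⊕ : ∀ k g {u v} → In k g u → In k g v → In k g (u ⊕ᵛ v)
   In-⊕ k g (c , ic , refl) (c′ , ic′ , refl) = (λ i → c i + c′ i) , (λ i → Integral-+ (ic i) (ic′ i)) , combination-+ k c c′ g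

   In-⊙ : ∀ k g o {u} → In k g u → In k g (ι o ⊙ u)
   In-⊙ k g o (c , ic , refl) = (λ i → ι o * c i) , (λ i → Integral-* o (ic i)) , combination-* k (ι o) c g

   -- The step is applied to the generators only. If each of them satisfies P, linearity gives P on
   -- all combinations; otherwise one of them has already produced G.
   dichotomy : ∀ k g (P : Vec → Set) (G : Set) → P 𝟎 → (∀ {u v} → P u → P v → P (u ⊕ᵛ v)) → (∀ x {u} → P u → P (ι x ⊙ u)) →
     (∀ {v} → In k g v → P v ⊎ G) → (∀ {v} → In k g v → P v) ⊎ G
   dichotomy k g P G P0 P+ P* = λ step → go k g step
     where
     conclude : ∀ k g → (∀ i → P (g i)) → ∀ c → (∀ i → Integral (c i)) → P (combination k c g)
     conclude zero g h c ic = P0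
     conclude (suc k) g h c ic with ic zero
     ... | o , e = P+ (subst (λ x → P (x ⊙ g zero)) (sym e) (P* o (h zero))) (conclude k _ (λ i → h (suc i)) _ (λ i → ic (suc i)))
     gens : ∀ k g → (∀ {v} → In k g v → P v ⊎ G) → (∀ i → P (g i)) ⊎ G
     gens zero g step = inj₁ λ ()
     gens (suc k) g step = both (step first) (gens k (λ i → g (suc i)) (λ (c , ic , e) → step (shift c , shiftI c ic , trans (cong₂ _⊕ᵛ_ (W.0-⊙ (g zero)) e) (W.𝟎-⊕ _))))
       where
       delta : Fin (suc k) → Carrier
       delta zero = 1#
       delta (suc _) = 0#
       deltaI : ∀ i → Integral (delta i)
       deltaI zero = Integral-1
       deltaI (suc _) = Integral-0
       first : In (suc k) g (g zero)
       first = delta , deltaI , trans (cong₂ _⊕ᵛ_ (W.1-⊙ (g zero)) (combination-0 k _)) (W.⊕-𝟎 (g zero))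
       shift : (Fin k → Carrier) → Fin (suc k) → Carrier
       shift c zero = 0#
       shift c (suc i) = c i
       shiftI : ∀ c → (∀ i → Integral (c i)) → ∀ i → Integral (shift c i)
       shiftI c ic zero = Integral-0
       shiftI c ic (suc i) = ic i
       both : P (g zero) ⊎ G → (∀ i → P (g (suc i))) ⊎ G → (∀ i → P (g i)) ⊎ G
       both (inj₂ x) _ = inj₂ x
       both (inj₁ _) (inj₂ x) = inj₂ x
       both (inj₁ x) (inj₁ xs) = inj₁ λ { zero → x ; (suc i) → xs i }
     go : ∀ k g → (∀ {v} → In k g v → P v ⊎ G) → (∀ {v} → In k g v → P v) ⊎ G
     go k g step with gens k g step
     ... | inj₂ x = inj₂ x
     ... | inj₁ h = inj₁ λ { (c , ic , refl) → conclude k g h c ic }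

-- The given lattice as a universal lattice.

module LatticeInstances where
 open import Defs
 open FieldLaws
 open SealedField
 open QuadraticSpaces
 open Vectors
 open Certificates using (O; _∶_; 0O; tri; O³; Gram; gram)
 open IntegralDivision
 open Completeness
 open QuadraticIntegers
 open Lattices
 open GeneratedModules
 open FieldInstance
 open import Data.Nat using (zero; suc)
 open import Data.Fin using (zero; suc)
 open import Data.Product.Properties using (≡-dec)
 open import Relation.Binary using (DecidableEquality)

 _≟F_ : DecidableEquality F
 _≟F_ = ≡-dec ℚ._≟_ ℚ._≟_

 _≟V_ : DecidableEquality V
 _≟V_ = ≡-dec _≟F_ (≡-dec _≟F_ _≟F_)

 zero-not-positive : ∀ {D} → TotPos D 0F → ⊥
 zero-not-positive {D} t = ℚ.<-irrefl refl (proj₁ (TotPos⇒ D 0ℚ 0ℚ t))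

 module LatticeInstance {D : ℕ} (disc : Discriminant D) (Qf : Form) (k : ℕ) (g : Fin k → V)
   (integral : IntegralLat D Qf k g) (univ : Universal D Qf k g) where
   open Discriminant disc using (s; p; Δ)
   open Instance disc
   open Ambient ambient hiding (s; p; Δ)
   module W = VectorLaws S
   open Sealed D
   open Generated ambient public
   open Form Qf

   quadraticForm : QuadraticForm
   quadraticForm = ternaryForm c11 c22 c33 c12 c13 c23

   open QuadraticForm quadraticForm

   Member : V → Set
   Member = In k g

   InO⇒ : ∀ {x} → InO D x → Integral x
   InO⇒ (m , n , e) = (m ∶ n) , trans e (sym (sealed-ι (m ∶ n)))

   ⇒InO : ∀ o → InO D (ι o)
   ⇒InO (m ∶ n) = m , n , sealed-ι (m ∶ n)

   linComb≡ : ∀ k c g → linComb D k c g ≡ combination k c g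
   linComb≡ zero c g = refl
   linComb≡ (suc k) c g = trans (+V≡ _ _) (cong₂ _⊕ᵛ_ (scaleV≡ (c zero) (g zero)) (linComb≡ k _ _))

   InLat⇒ : ∀ {v} → InLat D k g v → Member v
   InLat⇒ (c , ic , e) = c , (λ i → InO⇒ (ic i)) , trans (sym (linComb≡ k c g)) e

   ⇒InLat : ∀ {v} → Member v → InLat D k g v
   ⇒InLat (c , ic , e) = c , (λ i → subst (InO D) (sym (proj₂ (ic i))) (⇒InO (proj₁ (ic i)))) , trans (linComb≡ k c g) e

   Qv≡ : ∀ v → Qv D Qf v ≡ Q v
   Qv≡ (x , y , z) = evalForm≡ Qf x y z

   Q-zero : Q 𝟎 ≡ 0#
   Q-zero = trans (cong Q (sym (W.⊙-𝟎 0#))) (trans (Q-⊙ 0# 𝟎) (trans (cong (_* Q 𝟎) (W.0-left 0#)) (W.0-left (Q 𝟎))))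

   positive : ∀ {u} → Member u → u ≢ 0V → TotPos D (Q u)
   positive {u} iu ne = subst (TotPos D) (Qv≡ u) (proj₁ univ u (⇒InLat iu) ne)

   -- Equality of vectors over F is decidable, and a non-zero vector of value zero would make zero
   -- totally positive.
   aniso : ∀ {u} → Member u → Q u ≡ 0# → u ≡ 𝟎
   aniso {u} iu e = decide (u ≟V 0V)
     where
     decide : Dec (u ≡ 0V) → u ≡ 0V
     decide (yes h) = h
     decide (no h) = ⊥-elim (zero-not-positive {D} (subst (TotPos D) e (positive iu h)))


   Q-nonneg′ : ∀ x {u} → Member u → x ↦ Q u → Nonneg x
   Q-nonneg′ x {u} iu e = decide (u ≟V 0V)
     where
     open TraceOrder.Positivity Δ
     decide : Dec (u ≡ 0V) → Nonneg x
     decide (no h) = TotPositive⇒TotNonneg {trace x} {imO x} (TotPos⇒Pos x (subst (TotPos D) (trans (sym (val e)) (sealed-ι x)) (positive iu h)))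
     decide (yes h) = subst Nonneg (sym (ι-injective {x} {0O} (trans (val e) (trans (cong Q h) (trans Q-zero (sym (trans (ι-ℤ 0ℤ) ⟦⟧-0))))))) 0-nonneg

   universal′ : ∀ x → tp x ≡ true → ∃ λ u → Member u × x ↦ Q u
   universal′ x t = proj₁ found , InLat⇒ (proj₁ (proj₂ found)) , is (trans (sym (proj₂ (proj₂ found))) (Qv≡ (proj₁ found)))
     where found = proj₂ univ (ι x) (⇒InO x) (subst (TotPos D) (sym (sealed-ι x)) (Pos⇒TotPos x (tp-sound x t)))

   lattice : UniversalLattice ambient
   lattice = record
     { quadraticForm = quadraticForm ; L = Member ; L-⊕ = In-⊕ k g ; L-⊙ = In-⊙ k g
     ; Q-integral = λ {u} iu → let (o , e) = InO⇒ (integral u (⇒InLat iu)) in o , is (trans (sym e) (Qv≡ u))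
     ; Q-nonneg = Q-nonneg′ ; Q-aniso = aniso ; universal = universal′ ; dichotomy = dichotomy k g }

-- Correspondence with a form in the sense of the statement.

module Correspondences where
 open import Defs
 open FieldLaws
 open SealedField
 open QuadraticSpaces
 open Vectors
 open BasisChange
 open Certificates using (O; _∶_; 0O; tri; O³; Gram; gram; Kind; free; half; _·_)
 open IntegralDivision
 open Completeness
 open QuadraticIntegers
 open Lattices
 open Rebasing
 open GeneratedModules
 open CertificateSoundness
 open Coordinates
 open FieldInstance
 open LatticeInstances
 open import Data.Integer using (+_)
 open import Relation.Nullary using (¬_)

 module Correspondence {D : ℕ} (disc : Discriminant D) (Qf : Form) (k : ℕ) (g : Fin k → V)
   (integral : IntegralLat D Qf k g) (univ : Universal D Qf k g) where
   open Discriminant disc using (s; p; Δ)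
   open Instance disc
   open LatticeInstance disc Qf k g integral univ
   open Ambient ambient hiding (s; p; Δ; disc₂; disc₃)
   open Sealed D
   open Lattice ambient lattice using (Base)
   open Soundness ambient lattice (λ _ → gram 0O 0O 0O 0O 0O 0O , free) using (IsBasis; IsHalfBasis)
   private module X = VectorLaws S

   formOf : Gram → Form
   formOf (gram q₁ q₂ q₃ a b c) = form (ιO q₁) (ιO q₂) (ιO q₃) (ιO a) (ιO b) (ιO c)

   combination≡ : ∀ x y z u v t → scaleV D x u +V scaleV D y v +V scaleV D z t ≡ x ⊙ u ⊕ᵛ y ⊙ v ⊕ᵛ z ⊙ t
   combination≡ x y z u v t = trans (+V≡ _ _) (cong₂ _⊕ᵛ_ (trans (+V≡ _ _) (cong₂ _⊕ᵛ_ (scaleV≡ x u) (scaleV≡ y v))) (scaleV≡ z t))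

   module _ {q₁ q₂ q₃ a b c} (base : Base q₁ q₂ q₃ a b c) where
     open Base base
     open Output ambient lattice base

     value : ∀ x y z → Qv D Qf (scaleV D x v₁ +V scaleV D y v₂ +V scaleV D z v₃) ≡ evalForm D (formOf (gram q₁ q₂ q₃ a b c)) x y z
     value x y z = begin
       Qv D Qf (scaleV D x v₁ +V scaleV D y v₂ +V scaleV D z v₃)  ≡⟨ cong (Qv D Qf) (combination≡ x y z v₁ v₂ v₃) ⟩
       Qv D Qf (comb x y z)                                      ≡⟨ Qv≡ (comb x y z) ⟩
       Q (comb x y z)                                            ≡⟨ Q-comb x y z ⟩
       TernaryForm.Q (ι q₁) (ι q₂) (ι q₃) (ι a) (ι b) (ι c) (x , y , z)
         ≡⟨ congruence (sealed-ι q₁) (sealed-ι q₂) (sealed-ι q₃) (sealed-ι a) (sealed-ι b) (sealed-ι c) ⟩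
       TernaryForm.Q (ιO q₁) (ιO q₂) (ιO q₃) (ιO a) (ιO b) (ιO c) (x , y , z)
         ≡⟨ sym (evalForm≡ (formOf (gram q₁ q₂ q₃ a b c)) x y z) ⟩
       evalForm D (formOf (gram q₁ q₂ q₃ a b c)) x y z ∎
       where
       open ≡-Reasoning
       open QuadraticForm (UniversalLattice.quadraticForm lattice) using (Q)
       congruence : ∀ {q₁ q₂ q₃ a b c q₁′ q₂′ q₃′ a′ b′ c′} → q₁ ≡ q₁′ → q₂ ≡ q₂′ → q₃ ≡ q₃′ → a ≡ a′ → b ≡ b′ → c ≡ c′ →
         TernaryForm.Q q₁ q₂ q₃ a b c (x , y , z) ≡ TernaryForm.Q q₁′ q₂′ q₃′ a′ b′ c′ (x , y , z)
       congruence refl refl refl refl refl refl = refl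

     independentV : LinIndep D v₁ v₂ v₃
     independentV x y z e = independent x y z (trans (sym (combination≡ x y z v₁ v₂ v₃)) e)

     corresponds-free : IsBasis base → Corr D Qf k g (formOf (gram q₁ q₂ q₃ a b c))
     corresponds-free coords = v₁ , v₂ , v₃ , (independentV , coordinates , closed) , λ x y z _ _ _ → value x y z
       where
       coordinates : ∀ v → InLat D k g v → ∃ λ x → ∃ λ y → ∃ λ z → InO D x × InO D y × InO D z × v ≡ scaleV D x v₁ +V scaleV D y v₂ +V scaleV D z v₃
       coordinates v iv = go (coords {v} (InLat⇒ iv))
         where
         go : (∃ λ x → v ≡ Rebase.point ambient lattice base x) → _
         go (tri x y z , e) = ι x , ι y , ι z , ⇒InO x , ⇒InO y , ⇒InO z , trans e (sym (combination≡ (ι x) (ι y) (ι z) v₁ v₂ v₃))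
       closed : ∀ x y z → InO D x → InO D y → InO D z → InLat D k g (scaleV D x v₁ +V scaleV D y v₂ +V scaleV D z v₃)
       closed x y z ix iy iz = go x y z (InO⇒ ix) (InO⇒ iy) (InO⇒ iz)
         where
         go : ∀ x y z → Integral x → Integral y → Integral z → InLat D k g (scaleV D x v₁ +V scaleV D y v₂ +V scaleV D z v₃)
         go _ _ _ (x , refl) (y , refl) (z , refl) = ⇒InLat (subst Member (sym (combination≡ (ι x) (ι y) (ι z) v₁ v₂ v₃)) (L-comb x y z))

   module HalfIdeal (γ : F) (h : O) (mem : O → Bool) (2γ : int (+ 2) * γ ≡ ι h)
     {q₁ q₂ q₃ a b c} (base : Base q₁ q₂ q₃ a b c) (basis : IsHalfBasis base h mem) where
     open Base base
     open HalfOutput.WithIdeal ambient lattice base h mem γ 2γ (proj₁ basis) (proj₂ basis)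

     corresponds-half : (∀ t → mem t ≡ true → ∃ λ m → ∃ λ n → ι t ≡ int (+ 2) * (int m + int n * γ)) →
       CorrWith D (InZSpan D γ) Qf k g (formOf (gram q₁ q₂ q₃ a b c))
     corresponds-half split = v₁ , v₂ , v₃ , (independentV base , coordinates , closed) , λ x y z _ _ _ → value base x y z
       where
       coordinates : ∀ v → InLat D k g v → ∃ λ x → ∃ λ y → ∃ λ z → InO D x × InO D y × InZSpan D γ z × v ≡ scaleV D x v₁ +V scaleV D y v₂ +V scaleV D z v₃
       coordinates v iv = go (coordinates-half split {v} (InLat⇒ iv))
         where
         go : (∃ λ x → ∃ λ y → ∃ λ m → ∃ λ n → v ≡ comb (ι x) (ι y) (int m + int n * γ)) → _
         go (x , y , m , n , e) = ι x , ι y , int m + int n * γ , ⇒InO x , ⇒InO y , (m , n , sym (integer≡ m n γ))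
           , trans e (sym (combination≡ (ι x) (ι y) (int m + int n * γ) v₁ v₂ v₃))
       closed : ∀ x y z → InO D x → InO D y → InZSpan D γ z → InLat D k g (scaleV D x v₁ +V scaleV D y v₂ +V scaleV D z v₃)
       closed x y z ix iy (m , n , e) = go x y z (InO⇒ ix) (InO⇒ iy) (trans e (integer≡ m n γ))
         where
         go : ∀ x y z → Integral x → Integral y → z ≡ int m + int n * γ → InLat D k g (scaleV D x v₁ +V scaleV D y v₂ +V scaleV D z v₃)
         go _ _ _ (x , refl) (y , refl) refl = ⇒InLat (subst Member (sym (combination≡ (ι x) (ι y) (int m + int n * γ) v₁ v₂ v₃)) (closed-half x y m n))

     open ChangeOfBasis S

     -- The discriminant of the frame is the square of its volume times that of the form, so
     -- anything annihilated by the volume is annihilated by D.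
     volume-regular : ∀ {y} → volume v₁ v₂ v₃ * y ≡ 0# → y ≡ 0#
     volume-regular {y} e = Lattice.Frame.D-cancel ambient lattice base (trans (cong (_* y)
         (TernaryForm.volume-discriminant c11 c22 c33 c12 c13 c23 v₁ v₂ v₃))
       (trans (X.rearrange (volume v₁ v₂ v₃) (TernaryForm.discr c11 c22 c33 c12 c13 c23) y)
         (trans (cong (volume v₁ v₂ v₃ * TernaryForm.discr c11 c22 c33 c12 c13 c23 *_) e) (trans (X.0-right _) (sym (X.0-right _))))))
       where open Form Qf

     -- The members of a free basis lie in L, as the combinations with coefficients 1, 0, 0 and
     -- their permutations; then `not-spanned` applies.
     not-free : (∀ c₁ c₂ c₃ t₁ t₂ t₃ τ τ′ → mem t₁ ≡ true → mem t₂ ≡ true → mem t₃ ≡ true →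
         (c₁ ⊗ t₁ Certificates.⊕ c₂ ⊗ t₂ Certificates.⊕ c₃ ⊗ t₃) ⊗ τ ≡ (+ 2 ∶ + 0) → h ⊗ τ ≡ 2 · τ′ → ⊥) → ¬ Free D k g
     not-free impossible (e₁ , e₂ , e₃ , (_ , coords , closed)) =
       not-spanned volume-regular impossible e₁ e₂ e₃
         (member 1# 0# 0# Integral-1 Integral-0 Integral-0 (X.first e₁ e₂ e₃)) (member 0# 1# 0# Integral-0 Integral-1 Integral-0 (X.second e₁ e₂ e₃))
         (member 0# 0# 1# Integral-0 Integral-0 Integral-1 (X.third e₁ e₂ e₃))
         (λ {v} iv → spanned v (coords v (⇒InLat iv)))
       where
       InO′ : ∀ {x} → Integral x → InO D x
       InO′ (o , e) = subst (InO D) (sym e) (⇒InO o)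
       member : ∀ x y z → Integral x → Integral y → Integral z → ∀ {e} → x ⊙ e₁ ⊕ᵛ y ⊙ e₂ ⊕ᵛ z ⊙ e₃ ≡ e → Member e
       member x y z ix iy iz eq = subst Member (trans (combination≡ x y z e₁ e₂ e₃) eq) (InLat⇒ (closed x y z (InO′ ix) (InO′ iy) (InO′ iz)))
       spanned : ∀ v → (∃ λ x → ∃ λ y → ∃ λ z → InO D x × InO D y × InO D z × v ≡ scaleV D x e₁ +V scaleV D y e₂ +V scaleV D z e₃) →
         ∃ λ r → v ≡ span³ e₁ e₂ e₃ (ιv r)
       spanned v (x , y , z , ix , iy , iz , e) = go x y z (InO⇒ ix) (InO⇒ iy) (InO⇒ iz) (trans e (combination≡ x y z e₁ e₂ e₃))
         where
         go : ∀ x y z → Integral x → Integral y → Integral z → v ≡ x ⊙ e₁ ⊕ᵛ y ⊙ e₂ ⊕ᵛ z ⊙ e₃ → ∃ λ r → v ≡ span³ e₁ e₂ e₃ (ιv r)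
         go _ _ _ (x , refl) (y , refl) (z , refl) e = tri x y z , e

-- Elements of small slope.

module LinearGrowth where
 open Certificates
 open QuadraticSpaces
 open TraceOrder
 open QuadraticIntegers
 open Completeness
 open IntegralDivision
 open Lattices
 open SurvivorLists
 open import Data.Nat using (zero; suc)
 open import Data.Integer using (ℤ; +_)

 module SmallSlope (S : Scalars) where
   open Scalars S
   open ScalarSolver S
   private
     c : ℤ → Carrier
     c = ⟦_⟧

   -- From E - W ≥ 0 it follows that (A - fn)² ≤ 4k: the trace A stays close to fn.
   lower : ∀ A n f k → (c (+ 2) * (k * (f + c (+ 2))) + - (A * A + f * f * (n * n))) + - (c (+ 2) * (f * (k + - (A * n)))) + (A + - (f * n)) * (A + - (f * n)) ≡ c (+ 4) * k
   lower = solve 4 (λ A n f k → (con (+ 2) :* (k :* (f :+ con (+ 2))) :- (A :* A :+ f :* f :* (n :* n))) :- con (+ 2) :* (f :* (k :- A :* n)) :+ (A :- f :* n) :* (A :- f :* n)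
     := con (+ 4) :* k) refl

   -- From E + W ≥ 0 it follows that 4f(An - k) ≤ 4k, which is impossible for An > k once f exceeds
   -- k.
   upper : ∀ A n f k → (c (+ 2) * (k * (f + c (+ 2))) + - (A * A + f * f * (n * n))) + c (+ 2) * (f * (k + - (A * n))) + (A + - (f * n)) * (A + - (f * n)) + c (+ 4) * (f * (A * n + - k)) ≡ c (+ 4) * k
   upper = solve 4 (λ A n f k → (con (+ 2) :* (k :* (f :+ con (+ 2))) :- (A :* A :+ f :* f :* (n :* n))) :+ con (+ 2) :* (f :* (k :- A :* n)) :+ (A :- f :* n) :* (A :- f :* n) :+ con (+ 4) :* (f :* (A :* n :- k))
     := con (+ 4) :* k) refl

   -- If A is close to fn, then An is close to fn², at least 30n², against An ≤ k ≤ 20. Completing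
   -- the square with weight 8 makes this quantitative: every summand on the left is non-negative,
   -- hence 416n² ≤ 400.
   middle : ∀ A n f k → (c (+ 4) * k + - ((A + - (f * n)) * (A + - (f * n)))) + c (+ 16) * (k + - (A * n)) + ((A + - (f * n)) + c (+ 8) * n) * ((A + - (f * n)) + c (+ 8) * n)
     + (c (+ 16) * ((f + - c (+ 30)) * (n * n)) + c (+ 20) * (c (+ 20) + - k)) + c (+ 416) * (n * n) ≡ c (+ 400)
   middle = solve 4 (λ A n f k → (con (+ 4) :* k :- (A :- f :* n) :* (A :- f :* n)) :+ con (+ 16) :* (k :- A :* n) :+ ((A :- f :* n) :+ con (+ 8) :* n) :* ((A :- f :* n) :+ con (+ 8) :* n)
     :+ (con (+ 16) :* ((f :- con (+ 30)) :* (n :* n)) :+ con (+ 20) :* (con (+ 20) :- k)) :+ con (+ 416) :* (n :* n) := con (+ 400)) refl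

 private module ℤ-slope = SmallSlope ℤ-scalars

 0≤-summand : ∀ x y z → 0ℤ ℤ.≤ x → x ℤ.+ y ≡ z → y ℤ.≤ z
 0≤-summand x y z 0≤x e = subst₂ ℤ._≤_ (ℤ.+-identityˡ y) e (ℤ.+-monoˡ-≤ y 0≤x)

 private
   infixl 6 _⊹_
   _⊹_ : ∀ {x y} → 0ℤ ℤ.≤ x → 0ℤ ℤ.≤ y → 0ℤ ℤ.≤ x ℤ.+ y
   _⊹_ {x} {y} p q = ℤ.+-mono-≤ {0ℤ} {x} {0ℤ} {y} p q

 square-small : ∀ n → + 416 ℤ.* (n ℤ.* n) ℤ.≤ + 400 → n ≡ 0ℤ
 square-small (+ zero) _ = refl
 square-small (+ suc n) h = ⊥-elim (ℤ.<⇒≱ (ℤ.+<+ (ℕ.m≤m+n 401 15)) (ℤ.≤-trans (ℤ.*-monoˡ-≤-nonNeg (+ 416) {+ 1} {+ suc n ℤ.* + suc n} (ℤ.+≤+ (s≤s z≤n))) h))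
 square-small -[1+ n ] h = ⊥-elim (ℤ.<⇒≱ (ℤ.+<+ (ℕ.m≤m+n 401 15)) (ℤ.≤-trans (ℤ.*-monoˡ-≤-nonNeg (+ 416) {+ 1} { -[1+ n ] ℤ.* -[1+ n ]} (ℤ.+≤+ (s≤s z≤n))) h))

 -- With slope f ≈ √Δ, the two conditions say that 2k(f+2) ≥ A² + f²n² ± 2f(k - An).
 slope-zero : ∀ A n f k → + 30 ℤ.≤ f → 0ℤ ℤ.≤ k → k ℤ.≤ + 20 →
   let E = + 2 ℤ.* (k ℤ.* (f ℤ.+ + 2)) ℤ.- (A ℤ.* A ℤ.+ f ℤ.* f ℤ.* (n ℤ.* n)) ; W = + 2 ℤ.* (f ℤ.* (k ℤ.- A ℤ.* n)) in
   0ℤ ℤ.≤ E ℤ.- W → 0ℤ ℤ.≤ E ℤ.+ W → n ≡ 0ℤ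
 slope-zero A n f k 30≤f 0≤k k≤20 h₁ h₂ with A ℤ.* n ℤ.≤? k
 ... | yes An≤k = square-small n (0≤-summand _ (+ 416 ℤ.* (n ℤ.* n)) (+ 400)
       (_⊹_ {x₁ ℤ.+ x₂ ℤ.+ x₃} {x₄ ℤ.+ x₅} (_⊹_ {x₁ ℤ.+ x₂} {x₃} (_⊹_ {x₁} {x₂} (ℤ.i≤j⇒0≤j-i {δ²} {+ 4 ℤ.* k} (0≤-summand _ δ² (+ 4 ℤ.* k) h₁ (ℤ-slope.lower A n f k)))
                     (0≤-* {+ 16} {k ℤ.- A ℤ.* n} (ℤ.+≤+ z≤n) (ℤ.i≤j⇒0≤j-i An≤k)))
              (0≤-sq (A ℤ.- f ℤ.* n ℤ.+ + 8 ℤ.* n)))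
         (_⊹_ {x₄} {x₅} (0≤-* {+ 16} {(f ℤ.- + 30) ℤ.* (n ℤ.* n)} (ℤ.+≤+ z≤n) (0≤-* {f ℤ.- + 30} {n ℤ.* n} (ℤ.i≤j⇒0≤j-i 30≤f) (0≤-sq n)))
              (0≤-* {+ 20} {+ 20 ℤ.- k} (ℤ.+≤+ z≤n) (ℤ.i≤j⇒0≤j-i k≤20))))
       (ℤ-slope.middle A n f k))
   where
   δ² = (A ℤ.- f ℤ.* n) ℤ.* (A ℤ.- f ℤ.* n)
   x₁ = + 4 ℤ.* k ℤ.- δ²
   x₂ = + 16 ℤ.* (k ℤ.- A ℤ.* n)
   x₃ = (A ℤ.- f ℤ.* n ℤ.+ + 8 ℤ.* n) ℤ.* (A ℤ.- f ℤ.* n ℤ.+ + 8 ℤ.* n)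
   x₄ = + 16 ℤ.* ((f ℤ.- + 30) ℤ.* (n ℤ.* n))
   x₅ = + 20 ℤ.* (+ 20 ℤ.- k)
 -- Here An - k is at least 1, so f ≤ k ≤ 20, contrary to f ≥ 30.
 ... | no An≰k = ⊥-elim (ℤ.<⇒≱ (ℤ.+<+ (ℕ.m≤m+n 21 9)) (ℤ.≤-trans 30≤f (ℤ.≤-trans f≤k k≤20)))
   where
   y = A ℤ.* n ℤ.- k
   1≤y : + 1 ℤ.≤ y
   1≤y = ℤ.i<j⇒suc[i]≤j (subst (ℤ._< y) (ℤ.+-inverseʳ k) (ℤ.+-monoˡ-< (ℤ.- k) (ℤ.≰⇒> An≰k)))
   0≤f : 0ℤ ℤ.≤ f
   0≤f = ℤ.≤-trans (ℤ.+≤+ z≤n) 30≤f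
   4fy≤4k : + 4 ℤ.* (f ℤ.* y) ℤ.≤ + 4 ℤ.* k
   4fy≤4k = 0≤-summand _ (+ 4 ℤ.* (f ℤ.* y)) (+ 4 ℤ.* k)
     (_⊹_ {+ 2 ℤ.* (k ℤ.* (f ℤ.+ + 2)) ℤ.- (A ℤ.* A ℤ.+ f ℤ.* f ℤ.* (n ℤ.* n)) ℤ.+ + 2 ℤ.* (f ℤ.* (k ℤ.- A ℤ.* n))} {(A ℤ.- f ℤ.* n) ℤ.* (A ℤ.- f ℤ.* n)} h₂ (0≤-sq (A ℤ.- f ℤ.* n))) (ℤ-slope.upper A n f k)
   f≤k : f ℤ.≤ k
   f≤k = ℤ.≤-trans (subst (ℤ._≤ f ℤ.* y) (ℤ.*-identityʳ f) (ℤ.*-monoˡ-≤-nonNeg f {{ℤ.nonNegative 0≤f}} 1≤y)) (ℤ.*-cancelˡ-≤-pos (f ℤ.* y) k (+ 4) 4fy≤4k)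

-- No universal ternary lattice for large discriminant.

module LargeDiscriminants where
 open Certificates
 open QuadraticSpaces
 open TraceOrder
 open QuadraticIntegers
 open Completeness
 open IntegralDivision
 open Lattices
 open SurvivorLists
 open LinearGrowth
 open import Data.Nat using (zero; suc)
 open import Data.Integer using (ℤ; +_)
 open import Data.Bool using (false)
 open import Data.Bool.ListAction using (all)
 open import Data.List using (_∷_)

 all-sound : ∀ {A : Set} (f : A → Bool) xs → all f xs ≡ true → ∀ {x} → x ∈ xs → f x ≡ true
 all-sound f (x ∷ xs) h (here refl) = proj₁ (∧-true h)
 all-sound f (x ∷ xs) h (there i) = all-sound f xs (proj₂ (∧-true {f x} h)) i

 -- The least positive integer not represented by x² + mxy + 2y² over the integers: 5 for m = 0, and
 -- 3 for m equal to ±1 or ±2.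
 third : ℤ → ℕ
 third (+ zero) = 5
 third _ = 3

 -- half the Gram determinant of the forms 1, 2, third m with inner products m, x, y
 halfDet : ℤ → ℤ → ℤ → ℤ
 halfDet m x y = + 8 ℤ.* + third m ℤ.+ m ℤ.* (x ℤ.* y) ℤ.- y ℤ.* y ℤ.- + 2 ℤ.* (x ℤ.* x) ℤ.- + third m ℤ.* (m ℤ.* m)

 -- A finite evaluation over the ranges allowed by Cauchy-Schwarz. Together with non-negativity of
 -- the Gram determinant it shows that the three vectors are independent.
 halfDet-nonzero : ∀ {m x y} → m ∈ ints 2 → x ∈ ints 4 → y ∈ ints 6 → isZero (halfDet m x y) ≡ false
 halfDet-nonzero {m} {x} {y} mi xi yi = not-true (all-sound (cell m x) (ints 6) (all-sound (row m) (ints 4) (all-sound plane (ints 2) refl mi) xi) yi)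
   where
   cell : ℤ → ℤ → ℤ → Bool
   cell m x y = not (isZero (halfDet m x y))
   row : ℤ → ℤ → Bool
   row m x = all (cell m x) (ints 6)
   plane : ℤ → Bool
   plane m = all (row m) (ints 4)
   not-true : ∀ {b} → not b ≡ true → b ≡ false
   not-true {false} _ = refl

 square-bound : ∀ k m c → m ℤ.* m ℤ.≤ + c → c ℕ.< suc k ℕ.* suc k → ∣ m ∣ ℕ.≤ k
 square-bound k m c h lt with ∣ m ∣ ℕ.≤? k
 ... | yes le = le
 ... | no nle = ⊥-elim (ℕ.<-irrefl refl (ℕ.<-≤-trans lt (ℕ.≤-trans (ℕ.*-mono-≤ (ℕ.≰⇒> nle) (ℕ.≰⇒> nle)) (ℤ.drop‿+≤+ (subst (ℤ._≤ + c) (abs m) h)))))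
   where
   abs : ∀ m → m ℤ.* m ≡ + (∣ m ∣ ℕ.* ∣ m ∣)
   abs (+ n) = sym (ℤ.pos-* n n)
   abs -[1+ n ] = refl

 module SlopeIdentities (S : Scalars) where
   open Scalars S
   open ScalarSolver S

   im-slope : ∀ q x m n s → ⟦ + 4 ⟧ * (q * ⟦ + 1 ⟧ + ⟦ + 0 ⟧ * x + s * (⟦ + 0 ⟧ * ⟦ + 1 ⟧)) + - (m * n + n * m + s * (n * n)) ≡ ⟦ + 4 ⟧ * q + - ((⟦ + 2 ⟧ * m + s * n) * n)
   im-slope = solve 5 (λ q x m n s → con (+ 4) :* (q :* con (+ 1) :+ con (+ 0) :* x :+ s :* (con (+ 0) :* con (+ 1))) :- (m :* n :+ n :* m :+ s :* (n :* n))
     := con (+ 4) :* q :- (con (+ 2) :* m :+ s :* n) :* n) refl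

   trace-slope : ∀ q x s p → ⟦ + 2 ⟧ * (⟦ + 2 ⟧ * (⟦ + 4 ⟧ * (q * x + p * (⟦ + 0 ⟧ * ⟦ + 1 ⟧))) + s * (⟦ + 4 ⟧ * (q * ⟦ + 1 ⟧ + ⟦ + 0 ⟧ * x + s * (⟦ + 0 ⟧ * ⟦ + 1 ⟧)))) ≡ ⟦ + 2 ⟧ * (⟦ + 4 ⟧ * q * (⟦ + 2 ⟧ * x + s * ⟦ + 1 ⟧))
   trace-slope = solve 4 (λ q x s p → con (+ 2) :* (con (+ 2) :* (con (+ 4) :* (q :* x :+ p :* (con (+ 0) :* con (+ 1)))) :+ s :* (con (+ 4) :* (q :* con (+ 1) :+ con (+ 0) :* x :+ s :* (con (+ 0) :* con (+ 1)))))
     := con (+ 2) :* (con (+ 4) :* q :* (con (+ 2) :* x :+ s :* con (+ 1)))) refl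

   subtract : ∀ a b c → a + b ≡ c → a ≡ c + - b
   subtract a b _ refl = solve 2 (λ a b → a := a :+ b :- b) refl a b

   square-product : ∀ f w → (f * w) * (f * w) ≡ (f * f) * (w * w)
   square-product = solve 2 (λ f w → (f :* w) :* (f :* w) := (f :* f) :* (w :* w)) refl

   half-det : ∀ t m x y → ⟦ + 4 ⟧ * (⟦ + 1 ⟧ * (⟦ + 2 ⟧ * t)) + m * (x * y) + - (⟦ + 1 ⟧ * (y * y)) + - (⟦ + 2 ⟧ * (x * x)) + - (t * (m * m))
     ≡ ⟦ + 8 ⟧ * t + m * (x * y) + - (y * y) + - (⟦ + 2 ⟧ * (x * x)) + - (t * (m * m))
   half-det = solve 4 (λ t m x y → con (+ 4) :* (con (+ 1) :* (con (+ 2) :* t)) :+ m :* (x :* y) :- con (+ 1) :* (y :* y) :- con (+ 2) :* (x :* x) :- t :* (m :* m)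
     := con (+ 8) :* t :+ m :* (x :* y) :- y :* y :- con (+ 2) :* (x :* x) :- t :* (m :* m)) refl

 private module ℤ-id = SlopeIdentities ℤ-scalars

 module Large (A : Ambient) (U : UniversalLattice A) where
   open Ambient A renaming (_+_ to _⊹_)
   open UniversalLattice U
   open Lattice A U
   open Survivors A U

   infix 4 _isℤ_
   _isℤ_ : O → ℤ → Set
   x isℤ m = x ≡ (m ∶ 0ℤ)

   isℤ-↦ : ∀ {x m} → x ↦ ⟦ m ⟧ → x isℤ m
   isℤ-↦ {x} {m} e = ↦-unique e (is (ι-ℤ m))

   ↦-isℤ : ∀ m → (m ∶ 0ℤ) ↦ ⟦ m ⟧
   ↦-isℤ m = is (ι-ℤ m)

   _ℤ+_ : ∀ {x y m n} → x isℤ m → y isℤ n → x ⊕ y isℤ m ℤ.+ n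
   _ℤ+_ {m = m} {n} refl refl = isℤ-↦ (↦-subst (sym (⟦⟧-+ m n)) (↦-isℤ m ↦+ ↦-isℤ n))

   _ℤ-_ : ∀ {x y m n} → x isℤ m → y isℤ n → x ⊝ y isℤ m ℤ.- n
   _ℤ-_ {m = m} {n} refl refl = isℤ-↦ (↦-subst (sym (trans (⟦⟧-+ m (ℤ.- n)) (cong (⟦ m ⟧ ⊹_) (⟦⟧-neg n)))) (↦-isℤ m ↦- ↦-isℤ n))

   _ℤ*_ : ∀ {x y m n} → x isℤ m → y isℤ n → x ⊗ y isℤ m ℤ.* n
   _ℤ*_ {m = m} {n} refl refl = isℤ-↦ (↦-subst (sym (⟦⟧-* m n)) (↦-isℤ m ↦* ↦-isℤ n))

   ℤ· : ∀ k {x m} → x isℤ m → k · x isℤ + k ℤ.* m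
   ℤ· k {m = m} refl = isℤ-↦ (↦-subst (sym (⟦⟧-* (+ k) m)) (↦· k (↦-isℤ m)))

   infixl 6 _ℤ+_ _ℤ-_
   infixl 7 _ℤ*_

   trace-ℤ : ∀ m → trace (m ∶ 0ℤ) ≡ + 2 ℤ.* m
   trace-ℤ m = trans (cong (λ z → + 2 ℤ.* m ℤ.+ z) (ℤ.*-zeroʳ s)) (ℤ.+-identityʳ _)

   IsInteger : O → Set
   IsInteger x = ∃ λ m → x isℤ m

   -- For Δ > 4c, the square of an irrational integer is not dominated by c.
   bounded-rational : ∀ c x → 4 ℕ.* c ℕ.< Δ → psd ((+ c ∶ 0ℤ) ⊝ x ⊗ x) ≡ true → ∃ λ m → x isℤ m × m ℤ.* m ℤ.≤ + c
   bounded-rational c x@(m ∶ n) lt h = m , cong (m ∶_) n≡0 , ℤ.*-cancelˡ-≤-pos (m ℤ.* m) (+ c) (+ 4) (ℤ.≤-trans (4m² n≡0) (subst (λ z → t ℤ.* t ℤ.≤ z) bound-value t²≤))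
     where
     t = trace x
     bound : t ℤ.* t ℤ.+ + Δ ℤ.* (n ℤ.* n) ℤ.≤ + 2 ℤ.* trace (+ c ∶ 0ℤ)
     bound = square-trace (+ c ∶ 0ℤ) x (psd-sound ((+ c ∶ 0ℤ) ⊝ x ⊗ x) h)
     bound-value : + 2 ℤ.* trace (+ c ∶ 0ℤ) ≡ + 4 ℤ.* + c
     bound-value = trans (cong (+ 2 ℤ.*_) (trace-ℤ (+ c))) (sym (ℤ.*-assoc (+ 2) (+ 2) (+ c)))
     Δn²≤ : + Δ ℤ.* (n ℤ.* n) ℤ.≤ + 4 ℤ.* + c
     Δn²≤ = subst (λ z → + Δ ℤ.* (n ℤ.* n) ℤ.≤ z) bound-value (ℤ.≤-trans (0≤-summand (t ℤ.* t) _ _ (0≤-sq t) refl) bound)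
     t²≤ : t ℤ.* t ℤ.≤ + 2 ℤ.* trace (+ c ∶ 0ℤ)
     t²≤ = ℤ.≤-trans (0≤-summand (+ Δ ℤ.* (n ℤ.* n)) _ _ (0≤-* {+ Δ} {n ℤ.* n} (ℤ.+≤+ z≤n) (0≤-sq n)) (ℤ.+-comm (+ Δ ℤ.* (n ℤ.* n)) (t ℤ.* t))) bound
     n≡0 : n ≡ 0ℤ
     n≡0 = small n (subst₂ ℤ._≤_ refl (sym (ℤ.pos-* 4 c)) Δn²≤)
       where
       small : ∀ n → + Δ ℤ.* (n ℤ.* n) ℤ.≤ + (4 ℕ.* c) → n ≡ 0ℤ
       small (+ zero) _ = refl
       small (+ suc k) h = ⊥-elim (too-big (k ℕ.+ k ℕ.* suc k) h)
         where
         too-big : ∀ j → + Δ ℤ.* + suc j ℤ.≤ + (4 ℕ.* c) → ⊥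
         too-big j h = ℕ.<-irrefl refl (ℕ.<-≤-trans lt (ℕ.≤-trans (ℕ.m≤m*n Δ (suc j)) (ℤ.drop‿+≤+ (subst (ℤ._≤ + (4 ℕ.* c)) (sym (ℤ.pos-* Δ (suc j))) h))))
       small -[1+ k ] h = ⊥-elim (too-big (k ℕ.+ k ℕ.* suc k) h)
         where
         too-big : ∀ j → + Δ ℤ.* + suc j ℤ.≤ + (4 ℕ.* c) → ⊥
         too-big j h = ℕ.<-irrefl refl (ℕ.<-≤-trans lt (ℕ.≤-trans (ℕ.m≤m*n Δ (suc j)) (ℤ.drop‿+≤+ (subst (ℤ._≤ + (4 ℕ.* c)) (sym (ℤ.pos-* Δ (suc j))) h))))
     4m² : n ≡ 0ℤ → + 4 ℤ.* (m ℤ.* m) ℤ.≤ t ℤ.* t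
     4m² e = ℤ.≤-reflexive (sym (trans (cong (λ z → z ℤ.* z) (trans (cong (λ n → trace (m ∶ n)) e) (trace-ℤ m))) (square-double m)))
       where open TraceIdentities ℤ-scalars

   -- The target (a + √Δ)/2 with a = f + 2, where f² ≤ Δ < a².
   slope-rational : ∀ f x q b → + 30 ℤ.≤ f → f ℤ.* f ℤ.≤ + Δ → trace (x ∶ + 1) ≡ f ℤ.+ + 2 → q ℕ.≤ 5 →
     psd (4 · ((+ q ∶ 0ℤ) ⊗ (x ∶ + 1)) ⊝ b ⊗ b) ≡ true → IsInteger b
   slope-rational f x q b@(m ∶ n) 30≤f f²≤Δ tα q≤5 h = m , cong (m ∶_)
       (slope-zero t n f k 30≤f (ℤ.+≤+ z≤n) (ℤ.+≤+ (ℕ.*-monoʳ-≤ 4 q≤5)) (ℤ.≤-trans (sq-step (ℤ.- (f ℤ.* W)) neg-square-le) (enlarge (ℤ.- (f ℤ.* W)) (ℤ.- (+ 2 ℤ.* (f ℤ.* W))) double-neg))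
         (ℤ.≤-trans (sq-step (f ℤ.* W) square-le) (enlarge (f ℤ.* W) (+ 2 ℤ.* (f ℤ.* W)) refl)))
     where
     open TraceIdentities ℤ-scalars
     t = trace b
     k = + (4 ℕ.* q)
     W = k ℤ.- t ℤ.* n
     c = 4 · ((+ q ∶ 0ℤ) ⊗ (x ∶ + 1)) ⊝ b ⊗ b
     E = + 2 ℤ.* (k ℤ.* (f ℤ.+ + 2)) ℤ.- (t ℤ.* t ℤ.+ f ℤ.* f ℤ.* (n ℤ.* n))
     nonneg = psd-sound c h
     im-c : imO c ≡ W
     im-c = trans (ℤ-id.im-slope (+ q) x m n s) (cong (λ z → z ℤ.- t ℤ.* n) (sym (ℤ.pos-* 4 q)))
     trace-c : + 2 ℤ.* trace c ≡ + 2 ℤ.* (k ℤ.* (f ℤ.+ + 2)) ℤ.- (t ℤ.* t ℤ.+ + Δ ℤ.* (n ℤ.* n))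
     trace-c = trans (ℤ-id.subtract (+ 2 ℤ.* trace c) (+ 2 ℤ.* trace (b ⊗ b)) _
         (trace-⊝ (+ 4 ℤ.* (+ q ℤ.* x ℤ.+ p ℤ.* (+ 0 ℤ.* + 1))) (+ 4 ℤ.* (+ q ℤ.* + 1 ℤ.+ + 0 ℤ.* x ℤ.+ s ℤ.* (+ 0 ℤ.* + 1)))
           (m ℤ.* m ℤ.+ p ℤ.* (n ℤ.* n)) (m ℤ.* n ℤ.+ n ℤ.* m ℤ.+ s ℤ.* (n ℤ.* n)) s))
       (cong₂ ℤ._-_ (trans (ℤ-id.trace-slope (+ q) x s p) (cong₂ (λ u v → + 2 ℤ.* (u ℤ.* v)) (sym (ℤ.pos-* 4 q)) tα))
         (sym (trace-⊗ m n m n s p (+ Δ) Δ≡)))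
     ff≤ : ∀ y → (f ℤ.* f) ℤ.* (y ℤ.* y) ℤ.≤ + Δ ℤ.* (y ℤ.* y)
     ff≤ y = ℤ.*-monoʳ-≤-nonNeg (y ℤ.* y) {{ℤ.nonNegative (0≤-sq y)}} f²≤Δ
     square-le : (f ℤ.* W) ℤ.* (f ℤ.* W) ℤ.≤ trace c ℤ.* trace c
     square-le = subst (ℤ._≤ trace c ℤ.* trace c) (sym (ℤ-id.square-product f W)) (ℤ.≤-trans (ff≤ W)
       (subst (λ z → + Δ ℤ.* (z ℤ.* z) ℤ.≤ trace c ℤ.* trace c) im-c (proj₂ nonneg)))
     neg-square-le : (ℤ.- (f ℤ.* W)) ℤ.* (ℤ.- (f ℤ.* W)) ℤ.≤ trace c ℤ.* trace c
     neg-square-le = subst (ℤ._≤ trace c ℤ.* trace c) (TraceNorm.neg-square ℤ-scalars (f ℤ.* W)) square-le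
     double-neg : + 2 ℤ.* (ℤ.- (f ℤ.* W)) ≡ ℤ.- (+ 2 ℤ.* (f ℤ.* W))
     double-neg = sym (ℤ.neg-distribʳ-* (+ 2) (f ℤ.* W))
     sq-step : ∀ y → y ℤ.* y ℤ.≤ trace c ℤ.* trace c → 0ℤ ℤ.≤ + 2 ℤ.* (trace c ℤ.+ y)
     sq-step y h = 0≤-* {+ 2} {trace c ℤ.+ y} (ℤ.+≤+ z≤n) (sq-≤⇒0≤+ {y} {trace c} h (proj₁ nonneg))
     -- Replacing Δ by the smaller f² only enlarges the bound.
     trace-le : + 2 ℤ.* trace c ℤ.≤ E
     trace-le = subst (ℤ._≤ E) (sym trace-c) (ℤ.+-monoʳ-≤ (+ 2 ℤ.* (k ℤ.* (f ℤ.+ + 2))) (ℤ.neg-mono-≤ (ℤ.+-monoʳ-≤ (t ℤ.* t) (ff≤ n))))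
     enlarge : ∀ y z → + 2 ℤ.* y ≡ z → + 2 ℤ.* (trace c ℤ.+ y) ℤ.≤ E ℤ.+ z
     enlarge y z e = subst₂ ℤ._≤_ (sym (ℤ.*-distribˡ-+ (+ 2) (trace c) y)) (cong (λ z → E ℤ.+ z) e) (ℤ.+-monoˡ-≤ (+ 2 ℤ.* y) trace-le)

   -- The largest Cauchy-Schwarz bound among vectors of values 1, 2 and at most 5 is 4 times 10, and
   -- such products are rational once Δ exceeds four times the bound; this is the origin of 160.
   module Contradiction (160<Δ : 160 ℕ.< Δ) (f x : ℤ) (30≤f : + 30 ℤ.≤ f) (f²≤Δ : f ℤ.* f ℤ.≤ + Δ) (tα : trace (x ∶ + 1) ≡ f ℤ.+ + 2)
     (tpα : tp (x ∶ + 1) ≡ true) (tpℤ : ∀ m → tp (+ suc m ∶ 0ℤ) ≡ true) where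

     cs-rational : ∀ {u v} k q a → 4 ℕ.* (4 ℕ.* (k ℕ.* suc q)) ℕ.< Δ → L u → L v → (+ suc q ∶ 0ℤ) ↦ Q u → (+ k ∶ 0ℤ) ↦ Q v → a ↦ B u v →
       ∃ λ m → a isℤ m × m ℤ.* m ℤ.≤ + (4 ℕ.* (k ℕ.* suc q))
     cs-rational {u} {v} k q a lt lu lv eu ev ea = bounded-rational (4 ℕ.* (k ℕ.* suc q)) a lt
       (subst (λ z → psd (z ⊝ a ⊗ a) ≡ true) c≡ (cauchy-schwarz lu lv (tpℤ q) eu ev ea))
       where
       c≡ : 4 · ((+ k ∶ 0ℤ) ⊗ (+ suc q ∶ 0ℤ)) ≡ (+ (4 ℕ.* (k ℕ.* suc q)) ∶ 0ℤ)
       c≡ = trans (ℤ· 4 (_ℤ*_ {m = + k} {+ suc q} refl refl)) (cong (_∶ 0ℤ) (trans (cong (+ 4 ℤ.*_) (sym (ℤ.pos-* k (suc q)))) (sym (ℤ.pos-* 4 (k ℕ.* suc q)))))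

     unit = universal (+ 1 ∶ 0ℤ) (tpℤ 0)
     u₁ = proj₁ unit
     l₁ = proj₁ (proj₂ unit)
     e₁ = proj₂ (proj₂ unit)
     two = universal (+ 2 ∶ 0ℤ) (tpℤ 1)
     u₂ = proj₁ two
     l₂ = proj₁ (proj₂ two)
     e₂ = proj₂ (proj₂ two)
     alpha = universal (x ∶ + 1) tpα
     v = proj₁ alpha
     lv = proj₁ (proj₂ alpha)
     eα = proj₂ (proj₂ alpha)

     lt : ∀ c → c ℕ.≤ 160 → c ℕ.< Δ
     lt c le = ℕ.≤-<-trans le 160<Δ

     module Ternary (t : ℕ) (t≤4 : t ℕ.≤ 4) (m : ℤ) (t≡ : third m ≡ suc t) (m∈ : m ∈ ints 2) (a : O) (a≡ : a isℤ m) (ea : a ↦ B u₁ u₂) where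

       found = universal (+ suc t ∶ 0ℤ) (tpℤ t)
       u₃ = proj₁ found
       l₃ = proj₁ (proj₂ found)
       e₃ = proj₂ (proj₂ found)
       b13 = B-integral l₁ l₃
       b23 = B-integral l₂ l₃
       b = proj₁ b13
       c = proj₁ b23
       st≤5 : suc t ℕ.≤ 5
       st≤5 = s≤s t≤4
       r13 = cs-rational (suc t) 0 b (lt _ (ℕ.*-monoʳ-≤ 4 (ℕ.*-monoʳ-≤ 4 (ℕ.≤-trans (ℕ.*-monoˡ-≤ 1 st≤5) (ℕ.m≤m+n 5 5))))) l₁ l₃ e₁ e₃ (proj₂ b13)
       r23 = cs-rational (suc t) 1 c (lt _ (ℕ.*-monoʳ-≤ 4 (ℕ.*-monoʳ-≤ 4 (ℕ.*-monoˡ-≤ 2 st≤5)))) l₂ l₃ e₂ e₃ (proj₂ b23)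
       y z : ℤ
       y = proj₁ r13
       z = proj₁ r23
       y∈ : y ∈ ints 4
       y∈ = ∈-ints (square-bound 4 y (4 ℕ.* (suc t ℕ.* 1)) (proj₂ (proj₂ r13)) (s≤s (ℕ.≤-trans (ℕ.*-monoʳ-≤ 4 (ℕ.*-monoˡ-≤ 1 st≤5)) (ℕ.m≤m+n 20 4))))
       z∈ : z ∈ ints 6
       z∈ = ∈-ints (square-bound 6 z (4 ℕ.* (suc t ℕ.* 2)) (proj₂ (proj₂ r23)) (s≤s (ℕ.≤-trans (ℕ.*-monoʳ-≤ 4 (ℕ.*-monoˡ-≤ 2 st≤5)) (ℕ.m≤m+n 40 8))))

       G = gram (+ 1 ∶ 0ℤ) (+ 2 ∶ 0ℤ) (+ suc t ∶ 0ℤ) a b c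
       d : ℤ
       d = halfDet m y z
       δ≡ : δ₃ G isℤ d
       δ≡ = trans (ℤ· 4 (_ℤ*_ {m = + 1} {+ 2 ℤ.* + suc t} refl (_ℤ*_ {m = + 2} {+ suc t} refl refl)) ℤ+ a≡ ℤ* (proj₁ (proj₂ r13) ℤ* proj₁ (proj₂ r23))
           ℤ- _ℤ*_ {m = + 1} {z ℤ.* z} refl (proj₁ (proj₂ r23) ℤ* proj₁ (proj₂ r23)) ℤ- _ℤ*_ {m = + 2} {y ℤ.* y} refl (proj₁ (proj₂ r13) ℤ* proj₁ (proj₂ r13)) ℤ- _ℤ*_ {m = + suc t} {m ℤ.* m} refl (a≡ ℤ* a≡))
         (cong (_∶ 0ℤ) (trans (ℤ-id.half-det (+ suc t) m y z)
           (cong (λ t → + 8 ℤ.* + t ℤ.+ m ℤ.* (y ℤ.* z) ℤ.- z ℤ.* z ℤ.- + 2 ℤ.* (y ℤ.* y) ℤ.- + t ℤ.* (m ℤ.* m)) (sym t≡))))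
       minor≡ : tp (4 · ((+ 1 ∶ 0ℤ) ⊗ (+ 2 ∶ 0ℤ)) ⊝ a ⊗ a) ≡ true
       minor≡ = trans (cong tp (ℤ· 4 (_ℤ*_ {m = + 1} {+ 2} refl refl) ℤ- a≡ ℤ* a≡)) (positive m∈)
         where
         -- Along the list 2, -2, 1, -1, 0 the values of 8 - m² are 4, 4, 7, 7, 8, and `tpℤ` is
         -- indexed by the predecessor.
         positive : ∀ {m} → m ∈ ints 2 → tp (+ 8 ℤ.- m ℤ.* m ∶ 0ℤ) ≡ true
         positive (here refl) = tpℤ 3
         positive (there (here refl)) = tpℤ 3
         positive (there (there (here refl))) = tpℤ 6
         positive (there (there (there (here refl)))) = tpℤ 6
         positive (there (there (there (there (here refl))))) = tpℤ 7
       d-positive : ∃ λ j → d ≡ + suc j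
       d-positive = go d (halfDet-nonzero m∈ y∈ z∈)
         (subst (λ g → psd g ≡ true) δ≡ (gram-nonneg l₁ l₂ l₃ e₁ e₂ e₃ ea (proj₂ b13) (proj₂ b23) minor≡))
         where
         go : ∀ d → isZero d ≡ false → psd (d ∶ 0ℤ) ≡ true → ∃ λ j → d ≡ + suc j
         go (+ suc j) _ _ = j , refl
         go -[1+ j ] _ h = ⊥-elim (ℤ.<⇒≱ (ℤ.-<+ {j} {0}) (ℤ.*-cancelˡ-≤-pos 0ℤ -[1+ j ] (+ 2) (subst (0ℤ ℤ.≤_) (trace-ℤ -[1+ j ]) (proj₁ (psd-sound (-[1+ j ] ∶ 0ℤ) h)))))
       2δ≡ : 2 · δ₃ G isℤ + 2 ℤ.* d
       2δ≡ = ℤ· 2 δ≡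
       base : Base (+ 1 ∶ 0ℤ) (+ 2 ∶ 0ℤ) (+ suc t ∶ 0ℤ) a b c
       base = record { v₁ = u₁ ; v₂ = u₂ ; v₃ = u₃ ; l₁ = l₁ ; l₂ = l₂ ; l₃ = l₃ ; e₁ = e₁ ; e₂ = e₂ ; e₃ = e₃
                     ; e₁₂ = ea ; e₁₃ = proj₂ b13 ; e₂₃ = proj₂ b23
                     ; definite = trans (cong tp 2δ≡) (trans (cong (λ d → tp (+ 2 ℤ.* d ∶ 0ℤ)) (proj₂ d-positive)) (tpℤ (proj₁ d-positive ℕ.+ suc (proj₁ d-positive ℕ.+ 0)))) }
       open Frame base using (pairing; D; D↦)

       rational : ∀ {u} q → q ℕ.≤ 5 → L u → (+ q ∶ 0ℤ) ↦ Q u → ∃ λ o → o ↦ B v u × IsInteger o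
       rational q q≤5 lu eu with B-integral lv lu
       ... | o , eo = o , eo , slope-rational f x q o 30≤f f²≤Δ tα q≤5 (cauchy-schwarz lv lu tpα eα eu eo)

       w₁ = rational 1 (ℕ.m≤m+n 1 4) l₁ e₁
       w₂ = rational 2 (ℕ.m≤m+n 2 3) l₂ e₂
       w₃ = rational (suc t) st≤5 l₃ e₃
       β : O³
       β = tri (proj₁ w₁) (proj₁ w₂) (proj₁ w₃)

       app-ℤ : ∀ {q₁ q₂ q₃ a b c x y z} → IsInteger q₁ → IsInteger q₂ → IsInteger q₃ → IsInteger a → IsInteger b → IsInteger c → IsInteger x → IsInteger y → IsInteger z →
         IsInteger (app (gram q₁ q₂ q₃ a b c) (tri x y z) ⊡ tri x y z)
       app-ℤ (_ , q₁) (_ , q₂) (_ , q₃) (_ , a) (_ , b) (_ , c) (_ , x) (_ , y) (_ , z) = _ ,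
         (q₁ ℤ* x ℤ+ a ℤ* y ℤ+ b ℤ* z) ℤ* x ℤ+ (a ℤ* x ℤ+ q₂ ℤ* y ℤ+ c ℤ* z) ℤ* y ℤ+ (b ℤ* x ℤ+ c ℤ* y ℤ+ q₃ ℤ* z) ℤ* z
       adj-ℤ : ∀ {q₁ q₂ q₃ a b c x y z} → IsInteger q₁ → IsInteger q₂ → IsInteger q₃ → IsInteger a → IsInteger b → IsInteger c → IsInteger x → IsInteger y → IsInteger z →
         IsInteger (app (adj (gram q₁ q₂ q₃ a b c)) (tri x y z) ⊡ tri x y z)
       adj-ℤ (_ , q₁) (_ , q₂) (_ , q₃) (_ , a) (_ , b) (_ , c) = app-ℤ
         (_ , ℤ· 4 (q₂ ℤ* q₃) ℤ- c ℤ* c) (_ , ℤ· 4 (q₁ ℤ* q₃) ℤ- b ℤ* b) (_ , ℤ· 4 (q₁ ℤ* q₂) ℤ- a ℤ* a)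
         (_ , b ℤ* c ℤ- ℤ· 2 (q₃ ℤ* a)) (_ , a ℤ* c ℤ- ℤ· 2 (q₂ ℤ* b)) (_ , a ℤ* b ℤ- ℤ· 2 (q₁ ℤ* c))

       integer-pairing : IsInteger (app (adj G) β ⊡ β)
       integer-pairing = adj-ℤ (_ , refl) (_ , refl) (_ , refl) (_ , a≡) (_ , proj₁ (proj₂ r13)) (_ , proj₁ (proj₂ r23))
         (proj₂ (proj₂ w₁)) (proj₂ (proj₂ w₂)) (proj₂ (proj₂ w₃))

       -- the left side is a rational integer, the right side an irrational multiple of α
       impossible : ⊥
       impossible = conclude (trans (sym (proj₂ integer-pairing)) paired)
         where
         paired : app (adj G) β ⊡ β ≡ (+ 2 ℤ.* d ∶ 0ℤ) ⊗ ((x ∶ + 1) ⊕ (x ∶ + 1))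
         paired = trans (↦-unique (pairing β β lv (proj₁ (proj₂ w₁) , proj₁ (proj₂ w₂) , proj₁ (proj₂ w₃)) (proj₁ (proj₂ w₁) , proj₁ (proj₂ w₂) , proj₁ (proj₂ w₃)))
             (↦-subst (cong (D *_) (sym (B-self v))) (D↦ ↦* (eα ↦+ eα)))) (cong (_⊗ ((x ∶ + 1) ⊕ (x ∶ + 1))) 2δ≡)
         im-part : imO ((+ 2 ℤ.* d ∶ 0ℤ) ⊗ ((x ∶ + 1) ⊕ (x ∶ + 1))) ≡ + 2 ℤ.* d ℤ.* + 2
         im-part = trans (cong (λ z → + 2 ℤ.* d ℤ.* + 2 ℤ.+ z ℤ.+ s ℤ.* (0ℤ ℤ.* + 2)) (ℤ.*-zeroˡ (x ℤ.+ x)))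
           (trans (cong₂ ℤ._+_ (ℤ.+-identityʳ (+ 2 ℤ.* d ℤ.* + 2)) (ℤ.*-zeroʳ s)) (ℤ.+-identityʳ _))
         conclude : ∀ {N} → (N ∶ 0ℤ) ≡ (+ 2 ℤ.* d ∶ 0ℤ) ⊗ ((x ∶ + 1) ⊕ (x ∶ + 1)) → ⊥
         conclude e = absurd (proj₁ d-positive) (subst (λ d → 0ℤ ≡ + 2 ℤ.* d ℤ.* + 2) (proj₂ d-positive) (trans (cong imO e) im-part))
           where
           absurd : ∀ j → 0ℤ ≡ + 2 ℤ.* + suc j ℤ.* + 2 → ⊥
           absurd j ()

     contradiction : ⊥
     contradiction = go m m≤8 (proj₁ (proj₂ rational)) m∈
       where
       b12 = B-integral l₁ l₂
       a = proj₁ b12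
       rational = cs-rational 2 0 a (lt 32 (ℕ.m≤m+n 32 128)) l₁ l₂ e₁ e₂ (proj₂ b12)
       m = proj₁ rational
       m≤8 = proj₂ (proj₂ rational)
       m∈ : m ∈ ints 2
       m∈ = ∈-ints (square-bound 2 m 8 m≤8 (ℕ.m≤m+n 9 0))
       go : ∀ m → m ℤ.* m ℤ.≤ + 8 → a isℤ m → m ∈ ints 2 → ⊥
       -- The first argument is the predecessor of `third m`: 4 for the orthogonal case and 2
       -- otherwise.
       go (+ zero) _ a≡ m∈ = Ternary.impossible 4 (ℕ.m≤m+n 4 0) (+ 0) refl m∈ a a≡ (proj₂ b12)
       go (+ suc k) _ a≡ m∈ = Ternary.impossible 2 (ℕ.m≤m+n 2 2) (+ suc k) refl m∈ a a≡ (proj₂ b12)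
       go -[1+ k ] _ a≡ m∈ = Ternary.impossible 2 (ℕ.m≤m+n 2 2) -[1+ k ] refl m∈ a a≡ (proj₂ b12)

-- The primes above 2 for √10 and √65.

module Parity where
 open Certificates
 open QuadraticSpaces
 open TraceOrder
 open Completeness using (∧-true)
 open IntegralDivision using (divℤ-sound)
 open import Data.Nat using (suc)
 open import Data.Integer using (ℤ; +_)

 -- The squares modulo 5 are 0, 1 and 4, so -2 and -3 are not squares.
 square-mod5 : ∀ a b c → a ℕ.* a ℕ.+ c ≡ b ℕ.* 5 → c ℕ.% 5 ≡ 2 ⊎ c ℕ.% 5 ≡ 3 → ⊥
 square-mod5 a b c e = cases (a ℕ.% 5) (c ℕ.% 5) (ℕ.m%n<n a 5) sum
   where
   sum : ((a ℕ.% 5) ℕ.* (a ℕ.% 5) ℕ.+ (c ℕ.% 5)) ℕ.% 5 ≡ 0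
   sum = trans (trans (sym (trans (ℕ.%-distribˡ-+ (a ℕ.* a) c 5) (trans (cong (λ z → (z ℕ.+ c ℕ.% 5) ℕ.% 5) (ℕ.%-distribˡ-* a a 5))
       (trans (cong (λ z → (((a ℕ.% 5) ℕ.* (a ℕ.% 5)) ℕ.% 5 ℕ.+ z) ℕ.% 5) (sym (ℕ.m%n%n≡m%n c 5))) (sym (ℕ.%-distribˡ-+ ((a ℕ.% 5) ℕ.* (a ℕ.% 5)) (c ℕ.% 5) 5)))))) (cong (ℕ._% 5) e)) (ℕ.m*n%n≡0 b 5)
   cases : ∀ r q → r ℕ.< 5 → (r ℕ.* r ℕ.+ q) ℕ.% 5 ≡ 0 → q ≡ 2 ⊎ q ≡ 3 → ⊥
   cases 0 _ _ () (inj₁ refl)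
   cases 1 _ _ () (inj₁ refl)
   cases 2 _ _ () (inj₁ refl)
   cases 3 _ _ () (inj₁ refl)
   cases 4 _ _ () (inj₁ refl)
   cases 0 _ _ () (inj₂ refl)
   cases 1 _ _ () (inj₂ refl)
   cases 2 _ _ () (inj₂ refl)
   cases 3 _ _ () (inj₂ refl)
   cases 4 _ _ () (inj₂ refl)
   cases (suc (suc (suc (suc (suc _))))) _ (s≤s (s≤s (s≤s (s≤s (s≤s ()))))) _ _

 ∣∣-square : ∀ u → + (∣ u ∣ ℕ.* ∣ u ∣) ≡ u ℤ.* u
 ∣∣-square (+ n) = ℤ.pos-* n n
 ∣∣-square -[1+ n ] = refl

 square≢ : ∀ u b c → c ≡ 2 ⊎ c ≡ 3 → u ℤ.* u ℤ.+ + c ≡ b ℤ.* + 5 → ⊥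
 square≢ u (+ b) c h e = square-mod5 (∣ u ∣) b c (ℤ.+-injective (trans (ℤ.pos-+ (∣ u ∣ ℕ.* ∣ u ∣) c)
   (trans (cong (ℤ._+ + c) (∣∣-square u)) (trans e (sym (ℤ.pos-* b 5)))))) (small h)
   where
   small : c ≡ 2 ⊎ c ≡ 3 → c ℕ.% 5 ≡ 2 ⊎ c ℕ.% 5 ≡ 3
   small (inj₁ refl) = inj₁ refl
   small (inj₂ refl) = inj₂ refl
 square≢ u -[1+ b ] c h e = ⊥-elim (negative (trans (ℤ.pos-+ (∣ u ∣ ℕ.* ∣ u ∣) c) (trans (cong (ℤ._+ + c) (∣∣-square u)) e)))
   where
   negative : ∀ {m} → + m ≡ -[1+ b ] ℤ.* + 5 → ⊥
   negative ()

 unit-product : ∀ x y → x ℤ.* y ≡ + 1 → x ≡ + 1 ⊎ x ≡ -[1+ 0 ]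
 unit-product x y e = cases x (ℕ.m*n≡1⇒m≡1 (∣ x ∣) (∣ y ∣) (trans (sym (ℤ.abs-* x y)) (cong ∣_∣ e)))
   where
   cases : ∀ x → ∣ x ∣ ≡ 1 → x ≡ + 1 ⊎ x ≡ -[1+ 0 ]
   cases (+ _) refl = inj₁ refl
   cases -[1+ _ ] refl = inj₂ refl

 module NormIdentities (S : Scalars) where
   open Scalars S
   open ScalarSolver S

   norm-⊗ : ∀ a b c d s p → let X = a * c + p * (b * d) ; Y = a * d + b * c + s * (b * d) in
     (a * a + s * (a * b) + - (p * (b * b))) * (c * c + s * (c * d) + - (p * (d * d))) ≡ X * X + s * (X * Y) + - (p * (Y * Y))
   norm-⊗ = solve 6 (λ a b c d s p → let X = a :* c :+ p :* (b :* d) ; Y = a :* d :+ b :* c :+ s :* (b :* d) in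
     (a :* a :+ s :* (a :* b) :- p :* (b :* b)) :* (c :* c :+ s :* (c :* d) :- p :* (d :* d)) := X :* X :+ s :* (X :* Y) :- p :* (Y :* Y)) refl

   half-norm₁₀ : ∀ u v → (⟦ + 2 ⟧ * u) * (⟦ + 2 ⟧ * u) + ⟦ + 0 ⟧ * ((⟦ + 2 ⟧ * u) * v) + - (⟦ + 10 ⟧ * (v * v)) ≡ ⟦ + 2 ⟧ * (⟦ + 2 ⟧ * (u * u) + - (⟦ + 5 ⟧ * (v * v)))
   half-norm₁₀ = solve 2 (λ u v → (con (+ 2) :* u) :* (con (+ 2) :* u) :+ con (+ 0) :* ((con (+ 2) :* u) :* v) :- con (+ 10) :* (v :* v) := con (+ 2) :* (con (+ 2) :* (u :* u) :- con (+ 5) :* (v :* v))) refl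

   half-norm₆₅ : ∀ u v → (⟦ + 2 ⟧ * u) * (⟦ + 2 ⟧ * u) + ⟦ + 1 ⟧ * ((⟦ + 2 ⟧ * u) * v) + - (⟦ + 16 ⟧ * (v * v)) ≡ ⟦ + 2 ⟧ * (⟦ + 2 ⟧ * (u * u) + u * v + - (⟦ + 8 ⟧ * (v * v)))
   half-norm₆₅ = solve 2 (λ u v → (con (+ 2) :* u) :* (con (+ 2) :* u) :+ con (+ 1) :* ((con (+ 2) :* u) :* v) :- con (+ 16) :* (v :* v) := con (+ 2) :* (con (+ 2) :* (u :* u) :+ u :* v :- con (+ 8) :* (v :* v))) refl

   half-norm₆₅′ : ∀ k l → (⟦ + 2 ⟧ * k + l) * (⟦ + 2 ⟧ * k + l) + ⟦ + 1 ⟧ * ((⟦ + 2 ⟧ * k + l) * l) + - (⟦ + 16 ⟧ * (l * l)) ≡ ⟦ + 2 ⟧ * (⟦ + 2 ⟧ * (k * k) + ⟦ + 3 ⟧ * (k * l) + - (⟦ + 7 ⟧ * (l * l)))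
   half-norm₆₅′ = solve 2 (λ k l → (con (+ 2) :* k :+ l) :* (con (+ 2) :* k :+ l) :+ con (+ 1) :* ((con (+ 2) :* k :+ l) :* l) :- con (+ 16) :* (l :* l) := con (+ 2) :* (con (+ 2) :* (k :* k) :+ con (+ 3) :* (k :* l) :- con (+ 7) :* (l :* l))) refl

   quarter : ∀ x y → (⟦ + 2 ⟧ * x) * (⟦ + 2 ⟧ * y) ≡ ⟦ + 4 ⟧ * (x * y)
   quarter = solve 2 (λ x y → (con (+ 2) :* x) :* (con (+ 2) :* y) := con (+ 4) :* (x :* y)) refl

   -- Multiplying 2u² - 5v² = r by 3, the inverse of 2 modulo 5, gives u² congruent to 3r.
   square₁₀ : ∀ u v c r b → ⟦ + 2 ⟧ * (u * u) + - (⟦ + 5 ⟧ * (v * v)) ≡ r → ⟦ c ⟧ ≡ b * ⟦ + 5 ⟧ + - (⟦ + 3 ⟧ * r) →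
     u * u + ⟦ c ⟧ ≡ (⟦ + 3 ⟧ * (v * v) + - (u * u) + b) * ⟦ + 5 ⟧
   square₁₀ u v c _ b refl e = trans (cong (λ z → u * u + z) e) (solve 3 (λ u v b → u :* u :+ (b :* con (+ 5) :- con (+ 3) :* (con (+ 2) :* (u :* u) :- con (+ 5) :* (v :* v)))
     := (con (+ 3) :* (v :* v) :- u :* u :+ b) :* con (+ 5)) refl u v b)

   -- Completing the square: 8(2u² + uv - 8v²) = (4u + v)² - 65v².
   square₆₅ : ∀ u v c r b → ⟦ + 2 ⟧ * (u * u) + u * v + - (⟦ + 8 ⟧ * (v * v)) ≡ r → ⟦ c ⟧ ≡ b * ⟦ + 5 ⟧ + - (⟦ + 8 ⟧ * r) →
     (⟦ + 4 ⟧ * u + v) * (⟦ + 4 ⟧ * u + v) + ⟦ c ⟧ ≡ (⟦ + 13 ⟧ * (v * v) + b) * ⟦ + 5 ⟧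
   square₆₅ u v c _ b refl e = trans (cong (λ z → (⟦ + 4 ⟧ * u + v) * (⟦ + 4 ⟧ * u + v) + z) e) (solve 3 (λ u v b → (con (+ 4) :* u :+ v) :* (con (+ 4) :* u :+ v) :+ (b :* con (+ 5) :- con (+ 8) :* (con (+ 2) :* (u :* u) :+ u :* v :- con (+ 8) :* (v :* v)))
     := (con (+ 13) :* (v :* v) :+ b) :* con (+ 5)) refl u v b)

   even₁₀ : ∀ x y k l → x * (⟦ + 2 ⟧ * k) + ⟦ + 10 ⟧ * (y * l) ≡ ⟦ + 2 ⟧ * (x * k + ⟦ + 5 ⟧ * (y * l))
   even₁₀ = solve 4 (λ x y k l → x :* (con (+ 2) :* k) :+ con (+ 10) :* (y :* l) := con (+ 2) :* (x :* k :+ con (+ 5) :* (y :* l))) refl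

   even₆₅ : ∀ x y k l → x * (⟦ + 2 ⟧ * k + l) + ⟦ + 16 ⟧ * (y * l) ≡ ⟦ + 2 ⟧ * (x * k + - (y * k) + ⟦ + 7 ⟧ * (y * l)) + (x * l + y * (⟦ + 2 ⟧ * k + l) + ⟦ + 1 ⟧ * (y * l))
   even₆₅ = solve 4 (λ x y k l → x :* (con (+ 2) :* k :+ l) :+ con (+ 16) :* (y :* l) := con (+ 2) :* (x :* k :- y :* k :+ con (+ 7) :* (y :* l)) :+ (x :* l :+ y :* (con (+ 2) :* k :+ l) :+ con (+ 1) :* (y :* l))) refl

   add-even : ∀ k l m n → (⟦ + 2 ⟧ * k + l) + (⟦ + 2 ⟧ * m + n) ≡ ⟦ + 2 ⟧ * (k + m) + (l + n)
   add-even = solve 4 (λ k l m n → (con (+ 2) :* k :+ l) :+ (con (+ 2) :* m :+ n) := con (+ 2) :* (k :+ m) :+ (l :+ n)) refl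

   add-even₀ : ∀ k m → ⟦ + 2 ⟧ * k + ⟦ + 2 ⟧ * m ≡ ⟦ + 2 ⟧ * (k + m)
   add-even₀ = solve 2 (λ k m → con (+ 2) :* k :+ con (+ 2) :* m := con (+ 2) :* (k :+ m)) refl

   solve-even : ∀ a b c → ⟦ + 1 ⟧ * a + ⟦ + 16 ⟧ * (⟦ + 1 ⟧ * b) ≡ ⟦ + 2 ⟧ * c → a ≡ ⟦ + 2 ⟧ * (c + - (⟦ + 8 ⟧ * b))
   solve-even a b c e = trans (solve 2 (λ a b → a := (con (+ 1) :* a :+ con (+ 16) :* (con (+ 1) :* b)) :- con (+ 16) :* b) refl a b)
     (trans (cong (λ z → z + - (⟦ + 16 ⟧ * b)) e) (solve 2 (λ c b → con (+ 2) :* c :- con (+ 16) :* b := con (+ 2) :* (c :- con (+ 8) :* b)) refl c b))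

   solve-even₁₀ : ∀ a b c → ⟦ + 0 ⟧ * b + ⟦ + 1 ⟧ * a + ⟦ + 0 ⟧ * (⟦ + 1 ⟧ * b) ≡ ⟦ + 2 ⟧ * c → a ≡ ⟦ + 2 ⟧ * c
   solve-even₁₀ a b c e = trans (solve 2 (λ a b → a := con (+ 0) :* b :+ con (+ 1) :* a :+ con (+ 0) :* (con (+ 1) :* b)) refl a b) e

   difference : ∀ a b c → ⟦ + 2 ⟧ * c ≡ a + - b → a ≡ ⟦ + 2 ⟧ * c + b
   difference a b c e = trans (solve 2 (λ a b → a := a :- b :+ b) refl a b) (cong (_+ b) (sym e))

 private module I = NormIdentities ℤ-scalars

 -- Membership in twice the fractional ideal of the third coordinate: (2, √10) in the first case and
 -- (2, 1 + ω) in the second.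
 mem₁₀ mem₆₅ : O → Bool
 mem₁₀ (a ∶ b) = divℤ 2 a
 mem₆₅ (a ∶ b) = divℤ 2 (a ℤ.- b)

 module Sqrt10 where
   open Arithmetic (+ 0) (+ 10) 40 public

   Even : O → Set
   Even t = ∃ λ k → ∃ λ l → t ≡ (+ 2 ℤ.* k ∶ l)

   mem-sound : ∀ t → mem₁₀ t ≡ true → Even t
   mem-sound (a ∶ b) h = quotℤ 2 a , b , cong (_∶ b) (sym (divℤ-sound 2 a (s≤s z≤n) h))

   Even-⊗ : ∀ c t → Even t → Even (c ⊗ t)
   Even-⊗ (x ∶ y) _ (k , l , refl) =
     x ℤ.* k ℤ.+ + 5 ℤ.* (y ℤ.* l) , x ℤ.* l ℤ.+ y ℤ.* (+ 2 ℤ.* k) ℤ.+ + 0 ℤ.* (y ℤ.* l) , cong (_∶ (x ℤ.* l ℤ.+ y ℤ.* (+ 2 ℤ.* k) ℤ.+ + 0 ℤ.* (y ℤ.* l))) (I.even₁₀ x y k l)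

   Even-⊕ : ∀ t u → Even t → Even u → Even (t ⊕ u)
   Even-⊕ _ _ (k , l , refl) (m , n , refl) = k ℤ.+ m , l ℤ.+ n , cong (_∶ (l ℤ.+ n)) (I.add-even₀ k m)

   -- The combination σ of the tᵢ lies in an ideal of even norms, and divisibility of √10 τ by 2
   -- makes the norm of τ even. As στ = 2 has norm 4, the norm of τ is ±2. Then 2u² - 5v² = ±1,
   -- which fails modulo 5.
   impossible : ∀ c₁ c₂ c₃ t₁ t₂ t₃ τ τ′ → mem₁₀ t₁ ≡ true → mem₁₀ t₂ ≡ true → mem₁₀ t₃ ≡ true →
     (c₁ ⊗ t₁ ⊕ c₂ ⊗ t₂ ⊕ c₃ ⊗ t₃) ⊗ τ ≡ (+ 2 ∶ + 0) → (+ 0 ∶ + 1) ⊗ τ ≡ 2 · τ′ → ⊥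
   impossible c₁ c₂ c₃ t₁ t₂ t₃ (a ∶ b) (a′ ∶ b′) m₁ m₂ m₃ e e′ =
     go _ (Even-⊕ (c₁ ⊗ t₁ ⊕ c₂ ⊗ t₂) (c₃ ⊗ t₃) (Even-⊕ (c₁ ⊗ t₁) (c₂ ⊗ t₂) (Even-⊗ c₁ t₁ (mem-sound t₁ m₁)) (Even-⊗ c₂ t₂ (mem-sound t₂ m₂))) (Even-⊗ c₃ t₃ (mem-sound t₃ m₃))) a
       (I.solve-even₁₀ a b b′ (cong im₂ e′)) e
     where
     im₂ : O → ℤ
     im₂ (_ ∶ y) = y
     H : ℤ → ℤ → ℤ
     H u v = + 2 ℤ.* (u ℤ.* u) ℤ.- + 5 ℤ.* (v ℤ.* v)
     go : ∀ σ → Even σ → ∀ a → a ≡ + 2 ℤ.* b′ → σ ⊗ (a ∶ b) ≡ (+ 2 ∶ + 0) → ⊥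
     go _ (k , l , refl) _ refl e = finish (unit-product (H b′ b) (H k l) (trans (ℤ.*-comm (H b′ b) (H k l))
       (ℤ.*-cancelˡ-≡ (+ 4) (H k l ℤ.* H b′ b) (+ 1) (trans (sym (I.quarter (H k l) (H b′ b))) (trans (sym (cong₂ ℤ._*_ (I.half-norm₁₀ k l) (I.half-norm₁₀ b′ b)))
         (trans (I.norm-⊗ (+ 2 ℤ.* k) l (+ 2 ℤ.* b′) b (+ 0) (+ 10)) (cong normO e)))))))
       where
       finish : H b′ b ≡ + 1 ⊎ H b′ b ≡ -[1+ 0 ] → ⊥
       finish (inj₁ h) = square≢ b′ (+ 3 ℤ.* (b ℤ.* b) ℤ.- b′ ℤ.* b′ ℤ.+ + 1) 2 (inj₁ refl) (I.square₁₀ b′ b (+ 2) (+ 1) (+ 1) h refl)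
       finish (inj₂ h) = square≢ b′ (+ 3 ℤ.* (b ℤ.* b) ℤ.- b′ ℤ.* b′ ℤ.+ + 0) 3 (inj₂ refl) (I.square₁₀ b′ b (+ 3) -[1+ 0 ] (+ 0) h refl)

 module Sqrt65 where
   open Arithmetic (+ 1) (+ 16) 65 public

   Even : O → Set
   Even t = ∃ λ k → ∃ λ l → t ≡ (+ 2 ℤ.* k ℤ.+ l ∶ l)

   mem-sound : ∀ t → mem₆₅ t ≡ true → Even t
   mem-sound (a ∶ b) h = quotℤ 2 (a ℤ.- b) , b , cong (_∶ b) (I.difference a b _ (divℤ-sound 2 (a ℤ.- b) (s≤s z≤n) h))

   Even-⊗ : ∀ c t → Even t → Even (c ⊗ t)
   Even-⊗ (x ∶ y) _ (k , l , refl) =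
     x ℤ.* k ℤ.- y ℤ.* k ℤ.+ + 7 ℤ.* (y ℤ.* l) , x ℤ.* l ℤ.+ y ℤ.* (+ 2 ℤ.* k ℤ.+ l) ℤ.+ + 1 ℤ.* (y ℤ.* l) , cong (_∶ (x ℤ.* l ℤ.+ y ℤ.* (+ 2 ℤ.* k ℤ.+ l) ℤ.+ + 1 ℤ.* (y ℤ.* l))) (I.even₆₅ x y k l)

   Even-⊕ : ∀ t u → Even t → Even u → Even (t ⊕ u)
   Even-⊕ _ _ (k , l , refl) (m , n , refl) = k ℤ.+ m , l ℤ.+ n , cong (_∶ (l ℤ.+ n)) (I.add-even k l m n)

   -- Here (1 + ω)τ divisible by 2 makes the rational coordinate of τ even, so τ has even norm and
   -- so does σ. Again the norm of τ would be ±2, now excluded by the completed square modulo 5.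
   impossible : ∀ c₁ c₂ c₃ t₁ t₂ t₃ τ τ′ → mem₆₅ t₁ ≡ true → mem₆₅ t₂ ≡ true → mem₆₅ t₃ ≡ true →
     (c₁ ⊗ t₁ ⊕ c₂ ⊗ t₂ ⊕ c₃ ⊗ t₃) ⊗ τ ≡ (+ 2 ∶ + 0) → (+ 1 ∶ + 1) ⊗ τ ≡ 2 · τ′ → ⊥
   impossible c₁ c₂ c₃ t₁ t₂ t₃ (a ∶ b) (a′ ∶ b′) m₁ m₂ m₃ e e′ =
     go _ (Even-⊕ (c₁ ⊗ t₁ ⊕ c₂ ⊗ t₂) (c₃ ⊗ t₃) (Even-⊕ (c₁ ⊗ t₁) (c₂ ⊗ t₂) (Even-⊗ c₁ t₁ (mem-sound t₁ m₁)) (Even-⊗ c₂ t₂ (mem-sound t₂ m₂))) (Even-⊗ c₃ t₃ (mem-sound t₃ m₃))) a (a′ ℤ.- + 8 ℤ.* b)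
       (I.solve-even a b a′ (cong re₂ e′)) e
     where
     re₂ : O → ℤ
     re₂ (x ∶ _) = x
     H K : ℤ → ℤ → ℤ
     H u v = + 2 ℤ.* (u ℤ.* u) ℤ.+ u ℤ.* v ℤ.- + 8 ℤ.* (v ℤ.* v)
     K k l = + 2 ℤ.* (k ℤ.* k) ℤ.+ + 3 ℤ.* (k ℤ.* l) ℤ.- + 7 ℤ.* (l ℤ.* l)
     go : ∀ σ → Even σ → ∀ a u → a ≡ + 2 ℤ.* u → σ ⊗ (a ∶ b) ≡ (+ 2 ∶ + 0) → ⊥
     go _ (k , l , refl) _ u refl e = finish (unit-product (H u b) (K k l) (trans (ℤ.*-comm (H u b) (K k l))
       (ℤ.*-cancelˡ-≡ (+ 4) (K k l ℤ.* H u b) (+ 1) (trans (sym (I.quarter (K k l) (H u b))) (trans (sym (cong₂ ℤ._*_ (I.half-norm₆₅′ k l) (I.half-norm₆₅ u b)))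
         (trans (I.norm-⊗ (+ 2 ℤ.* k ℤ.+ l) l (+ 2 ℤ.* u) b (+ 1) (+ 16)) (cong normO e)))))))
       where
       finish : H u b ≡ + 1 ⊎ H u b ≡ -[1+ 0 ] → ⊥
       finish (inj₁ h) = square≢ (+ 4 ℤ.* u ℤ.+ b) (+ 13 ℤ.* (b ℤ.* b) ℤ.+ + 2) 2 (inj₁ refl) (I.square₆₅ u b (+ 2) (+ 1) (+ 2) h refl)
       finish (inj₂ h) = square≢ (+ 4 ℤ.* u ℤ.+ b) (+ 13 ℤ.* (b ℤ.* b) ℤ.+ -[1+ 0 ]) 3 (inj₂ refl) (I.square₆₅ u b (+ 3) -[1+ 0 ] -[1+ 0 ] h refl)

-- The two kinds of discriminants and the bound on them.

module Discriminants where
 open import Defs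
 open FieldLaws
 open QuadraticSpaces using (module ScalarSolver)
 open Certificates
 open IntegralDivision
 open Completeness
 open FieldInstance
 open Lattices
 open LargeDiscriminants
 open import Data.Nat using (zero; suc)
 open import Data.Integer using (ℤ; +_)
 open import Data.Rational using (½)
 open import Data.Rational.Solver using (module +-*-Solver)

 ω-half : ∀ D → D ℕ.% 4 ≡ 1 → ω D ≡ (½ , ½)
 ω-half D e with D ℕ.% 4 ℕ.≟ 1
 ... | yes _ = refl
 ... | no ne = ⊥-elim (ne e)

 ω-root : ∀ D → D ℕ.% 4 ≢ 1 → ω D ≡ √D
 ω-root D ne with D ℕ.% 4 ℕ.≟ 1
 ... | yes e = ⊥-elim (ne e)
 ... | no _ = refl

 discriminant₁ : ∀ D → D ℕ.% 4 ≡ 1 → Discriminant D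
 discriminant₁ D e = record
   { s = + 1 ; p = + (D ℕ./ 4) ; Δ = D
   ; Δ≡ = trans (cong +_ D≡) (trans (ℤ.pos-+ 1 (4 ℕ.* (D ℕ./ 4))) (cong (ℤ._+_ (+ 1)) (ℤ.pos-* 4 (D ℕ./ 4))))
   ; s≤1 = s≤s z≤n ; 1≤Δ = subst (1 ℕ.≤_) (sym D≡) (s≤s z≤n)
   ; ω² = subst (λ w → mulF D w w ≡ ιℤ (+ (D ℕ./ 4)) +F mulF D (ιℤ (+ 1)) w) (sym (ω-half D e))
       (cong₂ _,_ (trans (cong (λ d → ½ ℚ.* ½ ℚ.+ d ℚ.* (½ ℚ.* ½)) Dℚ≡) (re-id (+ (D ℕ./ 4) / 1) (Dℚ D))) refl)
   ; 2re-ω = cong (λ w → re w ℚ.+ re w) (ω-half D e)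
   ; κ = + 2 / 1 ; κ-im = cong (λ w → + 2 / 1 ℚ.* im w) (ω-half D e)
   ; Δκ² = ℚ.*-comm (+ D / 1) 4ℚ }
   where
   open +-*-Solver
   D≡ : D ≡ 1 ℕ.+ 4 ℕ.* (D ℕ./ 4)
   D≡ = trans (ℕ.m≡m%n+[m/n]*n D 4) (cong₂ ℕ._+_ e (ℕ.*-comm (D ℕ./ 4) 4))
   Dℚ≡ : Dℚ D ≡ 1ℚ ℚ.+ 4ℚ ℚ.* (+ (D ℕ./ 4) / 1)
   Dℚ≡ = trans (cong (λ d → + d / 1) D≡) (trans (cong (_/ 1) (ℤ.pos-+ 1 (4 ℕ.* (D ℕ./ 4)))) (trans (/1-+ (+ 1) (+ (4 ℕ.* (D ℕ./ 4))))
     (cong (1ℚ ℚ.+_) (trans (cong (_/ 1) (ℤ.pos-* 4 (D ℕ./ 4))) (/1-* (+ 4) (+ (D ℕ./ 4)))))))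
   re-id : ∀ q d → ½ ℚ.* ½ ℚ.+ (1ℚ ℚ.+ 4ℚ ℚ.* q) ℚ.* (½ ℚ.* ½) ≡ q ℚ.+ (1ℚ ℚ.* ½ ℚ.+ d ℚ.* (0ℚ ℚ.* ½))
   re-id = solve 2 (λ q d → con ½ :* con ½ :+ (con 1ℚ :+ con 4ℚ :* q) :* (con ½ :* con ½) := q :+ (con 1ℚ :* con ½ :+ d :* (con 0ℚ :* con ½))) refl

 discriminant₀ : ∀ D → 1 ℕ.≤ D → D ℕ.% 4 ≢ 1 → Discriminant D
 discriminant₀ D 1≤D ne = record
   { s = + 0 ; p = + D ; Δ = 4 ℕ.* D
   ; Δ≡ = trans (ℤ.pos-* 4 D) (sym (ℤ.+-identityˡ (+ 4 ℤ.* + D)))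
   ; s≤1 = z≤n ; 1≤Δ = ℕ.≤-trans 1≤D (ℕ.m≤n*m D 4)
   ; ω² = subst (λ w → mulF D w w ≡ ιℤ (+ D) +F mulF D (ιℤ (+ 0)) w) (sym (ω-root D ne)) (cong₂ _,_ (re-id (Dℚ D)) refl)
   ; 2re-ω = cong (λ w → re w ℚ.+ re w) (ω-root D ne)
   ; κ = 1ℚ ; κ-im = cong (λ w → 1ℚ ℚ.* im w) (ω-root D ne)
   ; Δκ² = trans (ℚ.*-identityʳ (+ (4 ℕ.* D) / 1)) (trans (cong (_/ 1) (ℤ.pos-* 4 D)) (/1-* (+ 4) (+ D))) }
   where
   open +-*-Solver
   re-id : ∀ d → 0ℚ ℚ.* 0ℚ ℚ.+ d ℚ.* (1ℚ ℚ.* 1ℚ) ≡ d ℚ.+ (0ℚ ℚ.* 0ℚ ℚ.+ d ℚ.* (0ℚ ℚ.* 1ℚ))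
   re-id = solve 1 (λ d → con 0ℚ :* con 0ℚ :+ d :* (con 1ℚ :* con 1ℚ) := d :+ (con 0ℚ :* con 0ℚ :+ d :* (con 0ℚ :* con 1ℚ))) refl

 -- A discrete intermediate value argument, used with squares to place √Δ between two integers of
 -- the same parity.
 bracket : ∀ (F : ℕ → ℕ) Δ fuel y → F y ℕ.≤ Δ → Δ ℕ.< F (fuel ℕ.+ y) → ∃ λ z → y ℕ.≤ z × F z ℕ.≤ Δ × Δ ℕ.< F (suc z)
 bracket F Δ zero y h k = ⊥-elim (ℕ.<-irrefl refl (ℕ.<-≤-trans k h))
 bracket F Δ (suc fuel) y h k with F (suc y) ℕ.≤? Δ
 ... | no n = y , ℕ.≤-refl , h , ℕ.≰⇒> n
 ... | yes le with bracket F Δ fuel (suc y) le (subst (λ z → Δ ℕ.< F z) (sym (ℕ.+-suc fuel y)) k)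
 ...   | z , y≤z , r = z , ℕ.≤-trans (ℕ.n≤1+n y) y≤z , r

 module LargeDiscriminant {D : ℕ} (disc : Discriminant D) (U : UniversalLattice (Instance.ambient disc)) where
   open Discriminant disc
   open Instance disc
   open Ambient ambient hiding (s; p; Δ)
   open TraceOrder.Positivity Δ

   tp-complete : ∀ t b → TotPositive t b → tpAux t b ≡ true
   tp-complete (+ t) b (_ , h) = <⇒<ᵇ (ℤ.drop‿+<+ (subst₂ ℤ._<_ (sym (sq-abs b)) (sym (ℤ.pos-* t t)) h))
     where
     <⇒<ᵇ : ∀ {m n} → m ℕ.< n → (m ℕ.<ᵇ n) ≡ true
     <⇒<ᵇ h = Function.Bundles.Equivalence.to Data.Bool.Properties.T-≡ (ℕ.<⇒<ᵇ h)
   tp-complete -[1+ t ] b (() , _)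

   tp-integer : ∀ m → tp (+ suc m ∶ 0ℤ) ≡ true
   tp-integer m = subst (λ t → tpAux t 0ℤ ≡ true) (sym (trans (cong (ℤ._+_ (+ 2 ℤ.* + suc m)) (ℤ.*-zeroʳ s)) (ℤ.+-identityʳ (+ 2 ℤ.* + suc m))))
     (subst (λ z → (z ℕ.<ᵇ (suc m ℕ.+ (suc m ℕ.+ 0)) ℕ.* (suc m ℕ.+ (suc m ℕ.+ 0))) ≡ true) (sym (ℕ.*-zeroʳ Δ)) refl)

   -- s is 0 or 1 and Δ ≡ s mod 2; the bracketing interval consists of consecutive numbers of that parity
   absurd : ∀ σ → s ≡ + σ → 961 ℕ.≤ Δ → (∀ y → 15 ℕ.≤ y → (σ ℕ.+ 2 ℕ.* y) ℕ.* (σ ℕ.+ 2 ℕ.* y) ℕ.≤ Δ →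
       Δ ℕ.< (σ ℕ.+ 2 ℕ.* suc y) ℕ.* (σ ℕ.+ 2 ℕ.* suc y) → ⊥) → σ ℕ.≤ 1 → ⊥
   absurd σ s≡ 961≤Δ k σ≤1 =
     let (y , 15≤y , lo , hi) = bracket (λ y → (σ ℕ.+ 2 ℕ.* y) ℕ.* (σ ℕ.+ 2 ℕ.* y)) Δ Δ 15 (ℕ.≤-trans (start σ σ≤1) 961≤Δ) (square-above Δ (σ ℕ.+ 2 ℕ.* (Δ ℕ.+ 15)) (above Δ)) in k y 15≤y lo hi
     where
     start : ∀ σ → σ ℕ.≤ 1 → (σ ℕ.+ 30) ℕ.* (σ ℕ.+ 30) ℕ.≤ 961
     start 0 _ = ℕ.m≤m+n 900 61
     start 1 _ = ℕ.≤-refl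
     start (suc (suc _)) (s≤s ())
     square-above : ∀ x G → x ℕ.< G → x ℕ.< G ℕ.* G
     square-above x (suc G) h = ℕ.<-≤-trans h (ℕ.m≤m*n (suc G) (suc G))
     above : ∀ x → x ℕ.< σ ℕ.+ 2 ℕ.* (x ℕ.+ 15)
     above x = ℕ.<-≤-trans {x} {x ℕ.+ 15} (ℕ.m<m+n x (s≤s z≤n)) (ℕ.≤-trans (ℕ.m≤m+n (x ℕ.+ 15) (x ℕ.+ 15 ℕ.+ 0)) (ℕ.m≤n+m (2 ℕ.* (x ℕ.+ 15)) σ))

   -- For both parities (σ + 30)² is at most 961 = 31², so the bracketing can start at f = σ + 30.
   large : ∀ σ → s ≡ + σ → σ ℕ.≤ 1 → 961 ℕ.≤ Δ → ⊥
   large σ s≡ σ≤1 961≤Δ = absurd σ s≡ 961≤Δ step σ≤1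
     where
     step : ∀ y → 15 ℕ.≤ y → (σ ℕ.+ 2 ℕ.* y) ℕ.* (σ ℕ.+ 2 ℕ.* y) ℕ.≤ Δ → Δ ℕ.< (σ ℕ.+ 2 ℕ.* suc y) ℕ.* (σ ℕ.+ 2 ℕ.* suc y) → ⊥
     -- The element (y + 1) + ω has trace f + 2, the next integer of the same parity after f. It is
     -- totally positive because √Δ is smaller than f + 2.
     step y 15≤y lo hi = Large.Contradiction.contradiction ambient U (ℕ.≤-trans (ℕ.m≤m+n 161 800) 961≤Δ) (+ f) (+ suc y)
       (ℤ.+≤+ (ℕ.≤-trans (ℕ.*-monoʳ-≤ 2 15≤y) (ℕ.m≤n+m (2 ℕ.* y) σ)))
       (subst (ℤ._≤ + Δ) (ℤ.pos-* f f) (ℤ.+≤+ lo)) trace≡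
       (subst (λ t → tpAux t (+ 1) ≡ true) (sym trace≡) (tp-complete (+ f ℤ.+ + 2) (+ 1)
         (ℤ.+<+ (ℕ.≤-trans (s≤s z≤n) (ℕ.m≤n+m 2 f)) , subst₂ ℤ._<_ (sym (ℤ.*-identityʳ (+ Δ))) (ℤ.pos-* (f ℕ.+ 2) (f ℕ.+ 2)) (ℤ.+<+ (subst (λ z → Δ ℕ.< z ℕ.* z) next hi)))))
       tp-integer
       where
       f = σ ℕ.+ 2 ℕ.* y
       next : σ ℕ.+ 2 ℕ.* suc y ≡ f ℕ.+ 2
       next = trans (cong (σ ℕ.+_) (trans (ℕ.*-suc 2 y) (ℕ.+-comm 2 (2 ℕ.* y)))) (sym (ℕ.+-assoc σ (2 ℕ.* y) 2))
       trace≡ : + 2 ℤ.* + suc y ℤ.+ s ℤ.* + 1 ≡ + f ℤ.+ + 2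
       trace≡ = trans (cong₂ ℤ._+_ (sym (ℤ.pos-* 2 (suc y))) (trans (ℤ.*-identityʳ s) s≡))
         (trans (ℤ.+-comm (+ (2 ℕ.* suc y)) (+ σ)) (trans (sym (ℤ.pos-+ σ (2 ℕ.* suc y))) (trans (cong +_ next) (ℤ.pos-+ f 2))))

-- From accepted certificates to forms or to a contradiction.

module Refutation where
 open import Defs
 open QuadraticSpaces
 open Certificates
 open IntegralDivision
 open Lattices
 open CertificateSoundness
 open LowRanks
 open FieldInstance
 open LatticeInstances
 open Correspondences
 open Discriminants
 open import Data.Nat using (zero; suc; _≤_)
 open import Data.Integer using (+_)
 open import Data.Bool using (false)
 open import Data.List using ([]; _∷_; map)

 -- membership in this ideal always fails, so no lattice corresponds to it
 noForm : Gram × Kind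
 noForm = gram 0O 0O 0O 0O 0O 0O , half 0O (λ _ → false)

 -- An index beyond the list gives `noForm`, so a wrong index in a certificate cannot produce a
 -- false classification.
 select : List Gram → ℕ → Gram × Kind
 select []      _       = noForm
 select (G ∷ _) zero    = G , free
 select (_ ∷ l) (suc i) = select l i

 Closed : (ℕ → Gram × Kind) → Set
 Closed forms = ∀ i → ∀ {φ g mem} → forms i ≡ (φ , half g mem) → ∀ t u → mem t ≡ true → mem (t ⊕ 2 · u) ≡ true

 select-closed : ∀ l → Closed (select l)
 select-closed []      i       refl t u ()
 select-closed (_ ∷ _) zero    ()
 select-closed (_ ∷ l) (suc i) e = select-closed l i e

 -- Nested like the disjunctions of the statement, with no trailing empty case, so the result has
 -- literally the required type.
 Choice : (Form → Set) → List Form → Set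
 Choice C []           = ⊥
 Choice C (φ ∷ [])     = C φ
 Choice C (φ ∷ ψ ∷ l)  = C φ ⊎ Choice C (ψ ∷ l)

 module Classify {D : ℕ} (disc : Discriminant D) (forms : ℕ → Gram × Kind) (closed : Closed forms) (cert : Cert₁)
   (ok : Checker.check₁ (Discriminant.s disc) (Discriminant.p disc) (Discriminant.Δ disc) forms cert ≡ true)
   (Q : Form) (k : ℕ) (g : Fin k → V) (integral : IntegralLat D Q k g) (univ : Universal D Q k g) where
   open Instance disc using (ambient)
   open LatticeInstance disc Q k g integral univ using (lattice)
   open Correspondence disc Q k g integral univ public
   open Lattice ambient lattice public using (module Base)
   open Soundness ambient lattice forms public using (Corresponds; Classified)

   classified : Classified
   classified = LowRank.sound₁ ambient lattice forms closed cert ok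

   noForm-absurd : Corresponds noForm → ⊥
   noForm-absurd (base , _ , coords) = go (coords (Base.l₁ base))
     where
     go : ∀ {A B C : Set} {P : A → B → C → Set} → (∃ λ x → ∃ λ y → ∃ λ t → false ≡ true × P x y t) → ⊥
     go (_ , _ , _ , () , _)

   choice : ∀ l i → Corresponds (select l i) → Choice (Corr D Q k g) (map formOf l)
   choice []                                _       c = noForm-absurd c
   choice (gram _ _ _ _ _ _ ∷ [])     zero    (base , basis) = corresponds-free base basis
   choice (_ ∷ [])                          (suc i) c = ⊥-elim (noForm-absurd c)
   choice (gram _ _ _ _ _ _ ∷ _ ∷ _)  zero    (base , basis) = inj₁ (corresponds-free base basis)
   choice (_ ∷ G ∷ l)                       (suc i) c = inj₂ (choice (G ∷ l) i c)

 module FreeForms {D : ℕ} (disc : Discriminant D) (grams : List Gram) (cert : Cert₁)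
   (ok : Checker.check₁ (Discriminant.s disc) (Discriminant.p disc) (Discriminant.Δ disc) (select grams) cert ≡ true)
   (Q : Form) (k : ℕ) (g : Fin k → V) (integral : IntegralLat D Q k g) (univ : Universal D Q k g) where
   open Classify disc (select grams) (select-closed grams) cert ok Q k g integral univ

   chosen : Choice (Corr D Q k g) (map formOf grams)
   chosen = choice grams (proj₁ classified) (proj₂ classified)

 -- Taking the decision as an argument lets the same case split drive both the evaluation and the
 -- proof.
 checkBy : ∀ D → Dec (D ℕ.% 4 ≡ 1) → Cert₁ → Bool
 checkBy D (yes _) = Checker.check₁ (+ 1) (+ (D ℕ./ 4)) D (select [])
 checkBy D (no _)  = Checker.check₁ (+ 0) (+ D) (4 ℕ.* D) (select [])

 module Excluded (D : ℕ) (1≤D : 1 ≤ D) (Q : Form) (k : ℕ) (g : Fin k → V) (integral : IntegralLat D Q k g) (univ : Universal D Q k g) where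

   -- With an empty list of forms the conclusion of a certificate is the empty disjunction.
   refuted : ∀ cert → checkBy D (D ℕ.% 4 ℕ.≟ 1) cert ≡ true → ⊥
   refuted cert = go (D ℕ.% 4 ℕ.≟ 1)
     where
     go : ∀ d → checkBy D d cert ≡ true → ⊥
     go (yes e) ok = FreeForms.chosen (discriminant₁ D e) [] cert ok Q k g integral univ
     go (no ne) ok = FreeForms.chosen (discriminant₀ D 1≤D ne) [] cert ok Q k g integral univ

   -- The discriminant is 4D, and 4 times 241 is 964, just past 961.
   large₀ : D ℕ.% 4 ≢ 1 → 241 ≤ D → ⊥
   large₀ ne 241≤D = LargeDiscriminant.large disc (LatticeInstance.lattice disc Q k g integral univ) 0 refl z≤n
     (ℕ.≤-trans (ℕ.m≤m+n 961 3) (ℕ.*-monoʳ-≤ 4 241≤D))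
     where disc = discriminant₀ D 1≤D ne

   large : 961 ≤ D → ⊥
   large 961≤D = go (D ℕ.% 4 ℕ.≟ 1)
     where
     go : Dec (D ℕ.% 4 ≡ 1) → ⊥
     go (yes e) = LargeDiscriminant.large disc (LatticeInstance.lattice disc Q k g integral univ) 1 refl (s≤s z≤n) 961≤D
       where disc = discriminant₁ D e
     go (no ne) = large₀ ne (ℕ.≤-trans (ℕ.m≤m+n 241 720) 961≤D)

-- The certificates.

module CertificateData where
 open Certificates
 open import Data.Integer using (ℤ; +_)
 open import Data.List using ([]; _∷_; map; replicate)

 infix 9 _&_ _&-_ _-&_ _-&-_
 _&_ _&-_ _-&_ _-&-_ : ℕ → ℕ → O
 a & b = + a ∶ + b
 a &- b = + a ∶ ℤ.- + b
 a -& b = (ℤ.- + a) ∶ + b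
 a -&- b = (ℤ.- + a) ∶ ℤ.- + b

 1O -1O : O
 1O = 1 & 0
 -1O = 1 -& 0

 at : O → O → O → Combo
 at x y z = combo (tri x y z) []

 -- The fourth coefficient belongs to the vector found last, which heads the list of extra vectors.
 at⁺ : O → O → O → O → Combo
 at⁺ x y z t = combo (tri x y z) (t ∷ [])

 e₁ e₂ e₃ -e₃ : Combo
 e₁ = at 1O 0O 0O
 e₂ = at 0O 1O 0O
 e₃ = at 0O 0O 1O
 -e₃ = at 0O 0O -1O

 -- A target whose survivor list is empty: an element that the current state cannot represent.
 leaf : O → Cert
 leaf α = target α []

 leaves : List O → List Cert
 leaves = map leaf

 integers : List ℕ → List Cert
 integers = map (λ k → leaf (k & 0))

 -- first target 2, second target a - ω, third targets rational integers
 uniform : ℕ → List ℕ → List ℕ → List ℕ → Cert₁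
 uniform a l₂ l₁ l₀ = target₁ (2 & 0) (map (λ l → target₂ (a &- 1) (integers l)) (l₂ ∷ l₁ ∷ l₀ ∷ []))

 table0 : List (ℕ × Cert₁)
 table0 =
   (11 , target₁ (2 & 0) (target₂ (5 &- 1) (leaves (17 &- 5 ∷ 17 &- 5 ∷ 3 & 0 ∷ 17 &- 5 ∷ 17 &- 5 ∷ 3 & 0 ∷ 3 & 0 ∷ 3 & 0 ∷ 17 &- 5 ∷ 17 &- 5 ∷ 17 &- 5 ∷ 5 & 1 ∷ 17 &- 5 ∷ 17 &- 5 ∷ 3 & 0 ∷ 17 &- 5 ∷ 3 & 0 ∷ 17 &- 5 ∷ 3 & 0 ∷ 3 & 0 ∷ 17 &- 5 ∷ 3 & 0 ∷ 3 & 0 ∷ 3 & 0 ∷ 5 & 1 ∷ 3 & 0 ∷ 5 & 1 ∷ [])) ∷ target₂ (4 &- 1) (leaves (5 &- 1 ∷ 4 & 1 ∷ 5 &- 1 ∷ 4 & 1 ∷ 3 & 0 ∷ 3 & 0 ∷ 3 & 0 ∷ 3 & 0 ∷ 4 & 1 ∷ 3 & 0 ∷ 3 & 0 ∷ 3 & 0 ∷ 3 & 0 ∷ [])) ∷ target₂ (4 &- 1) (leaf (17 &- 5) ∷ leaf (17 &- 5) ∷ leaf (5 &- 1) ∷ leaf (5 &- 1) ∷ leaf (4 & 1) ∷ leaf (17 &- 5) ∷ leaf (5 &- 1) ∷ leaf (4 & 1) ∷ leaf (17 &- 5) ∷ leaf (4 & 1) ∷ leaf (4 & 1) ∷ leaf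 (5 &- 1) ∷ leaf (5 & 0) ∷ target (10 &- 3) (leaf (17 &- 5) ∷ leaf (17 &- 5) ∷ []) ∷ leaf (4 & 1) ∷ target (10 &- 3) (leaf (17 &- 5) ∷ leaf (17 &- 5) ∷ []) ∷ leaf (5 & 0) ∷ leaf (4 & 1) ∷ leaf (5 & 0) ∷ []) ∷ [])) ∷
   (14 , target₁ (4 &- 1) (target₂ (5 & 0) (leaf (21 &- 5) ∷ leaf (21 &- 5) ∷ leaf (21 &- 5) ∷ leaf (21 &- 5) ∷ leaf (21 &- 5) ∷ leaf (16 &- 3) ∷ leaf (16 &- 3) ∷ target (14 &- 3) (leaf (21 &- 5) ∷ leaf (21 &- 5) ∷ leaf (21 &- 5) ∷ leaf (21 &- 5) ∷ []) ∷ leaf (14 &- 3) ∷ leaf (14 &- 3) ∷ leaf (14 &- 3) ∷ leaf (7 &- 1) ∷ []) ∷ target₂ (4 & 1) (leaf (5 & 0) ∷ leaf (2 & 0) ∷ target (15 &- 4) (leaf (21 &- 5) ∷ []) ∷ target (15 &- 4) (leaf (21 &- 5) ∷ leaf (21 &- 5) ∷ []) ∷ []) ∷ [])) ∷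
   (15 , target₁ (2 & 0) (target₂ (4 &- 1) (target (3 & 0) (leaf (7 &- 1) ∷ leaf (7 &- 1) ∷ leaf (7 &- 1) ∷ leaf (7 &- 1) ∷ []) ∷ []) ∷ target₂ (4 &- 1) (leaves (7 &- 1 ∷ 3 & 0 ∷ [])) ∷ target₂ (4 &- 1) (leaves (12 &- 3 ∷ 5 & 0 ∷ 12 &- 3 ∷ 5 & 0 ∷ [])) ∷ [])) ∷
   (19 , target₁ (5 &- 1) (target₂ (9 & 2) (integers (5 ∷ 5 ∷ 2 ∷ 2 ∷ 2 ∷ 2 ∷ [])) ∷ target₂ (9 &- 2) (integers (3 ∷ 5 ∷ 5 ∷ 3 ∷ 2 ∷ 2 ∷ 2 ∷ 2 ∷ 2 ∷ [])) ∷ [])) ∷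
   (22 , target₁ (5 &- 1) (target₂ (6 & 1) (leaf (2 & 0) ∷ leaf (6 &- 1) ∷ leaf (2 & 0) ∷ target (197 &- 42) (leaf (17 &- 3) ∷ []) ∷ leaf (2 & 0) ∷ target (197 &- 42) (leaf (17 &- 3) ∷ []) ∷ leaf (2 & 0) ∷ leaf (2 & 0) ∷ leaf (6 &- 1) ∷ []) ∷ target₂ (5 & 1) (leaf (2 & 0) ∷ leaf (2 & 0) ∷ leaf (6 & 1) ∷ leaf (2 & 0) ∷ target (197 &- 42) (leaf (17 &- 3) ∷ []) ∷ leaf (17 &- 3) ∷ leaf (2 & 0) ∷ []) ∷ [])) ∷
   []

 table1 : List (ℕ × Cert₁)
 table1 =
   (23 , target₁ (5 &- 1) (target₂ (5 & 1) (leaves (24 &- 5 ∷ 2 & 0 ∷ 2 & 0 ∷ [])) ∷ [])) ∷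
   (26 , target₁ (2 & 0) (target₂ (6 &- 1) (integers (replicate 5 3)) ∷ target₂ (6 &- 1) (leaves (10 &- 1 ∷ 10 &- 1 ∷ 3 & 0 ∷ 3 & 0 ∷ 3 & 0 ∷ 3 & 0 ∷ 3 & 0 ∷ 3 & 0 ∷ 3 & 0 ∷ 3 & 0 ∷ [])) ∷ target₂ (6 &- 1) (leaves (7 &- 1 ∷ 6 & 1 ∷ 7 &- 1 ∷ 6 & 1 ∷ 7 &- 1 ∷ 7 &- 1 ∷ 10 &- 1 ∷ 10 &- 1 ∷ 5 & 0 ∷ 8 &- 1 ∷ 6 & 1 ∷ 5 & 0 ∷ 5 & 0 ∷ 5 & 0 ∷ [])) ∷ [])) ∷
   (29 , target₁ (2 & 0) (target₂ (4 &- 1) (leaves (3 & 1 ∷ 3 & 1 ∷ 3 & 1 ∷ 3 & 1 ∷ 3 & 1 ∷ 3 & 0 ∷ 3 & 0 ∷ 3 & 0 ∷ 3 & 1 ∷ 3 & 0 ∷ 3 & 1 ∷ [])) ∷ target₂ (4 &- 1) (leaves (6 & 0 ∷ 3 & 1 ∷ 3 & 1 ∷ 3 & 1 ∷ 6 & 0 ∷ 3 & 1 ∷ 3 & 1 ∷ 3 & 1 ∷ 3 & 0 ∷ 3 & 1 ∷ 3 & 1 ∷ 3 & 0 ∷ 3 & 0 ∷ 3 & 0 ∷ 3 & 0 ∷ 3 & 0 ∷ 3 & 0 ∷ 3 & 1 ∷ 3 & 0 ∷ 3 & 0 ∷ 3 & 0 ∷ 3 & 0 ∷ 3 & 0 ∷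 [])) ∷ target₂ (4 &- 1) (leaves (3 & 1 ∷ 3 & 1 ∷ 3 & 1 ∷ 3 & 1 ∷ 3 & 1 ∷ 3 & 1 ∷ 3 & 1 ∷ 3 & 1 ∷ 3 & 1 ∷ 5 &- 1 ∷ 5 &- 1 ∷ 3 & 1 ∷ 3 & 1 ∷ 3 & 1 ∷ 3 & 1 ∷ 3 & 1 ∷ 3 & 1 ∷ 3 & 1 ∷ 3 & 1 ∷ 3 & 1 ∷ 4 & 1 ∷ [])) ∷ [])) ∷
   (30 , target₁ (6 &- 1) (target₂ (11 &- 2) (leaves (2 & 0 ∷ 7 &- 1 ∷ [])) ∷ target₂ (11 &- 2) (leaves (17 &- 3 ∷ 2 & 0 ∷ [])) ∷ [])) ∷
   (31 , target₁ (2 & 0) (target₂ (6 &- 1) (integers (replicate 3 3)) ∷ target₂ (6 &- 1) (integers (replicate 4 3)) ∷ target₂ (6 &- 1) (leaves (5 & 0 ∷ 5 & 0 ∷ 5 & 0 ∷ 14 &- 1 ∷ 14 &- 1 ∷ 5 & 0 ∷ [])) ∷ [])) ∷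
   (34 , target₁ (6 &- 1) (target₂ (6 & 1) (integers (replicate 3 2)) ∷ [])) ∷
   (35 , target₁ (2 & 0) (target₂ (6 &- 1) (leaves (9 &- 1 ∷ [])) ∷ target₂ (6 &- 1) (integers (3 ∷ [])) ∷ target₂ (6 &- 1) (leaves (18 &- 3 ∷ [])) ∷ [])) ∷
   (37 , target₁ (4 &- 1) (target₂ (3 & 1) (integers (replicate 7 2)) ∷ target₂ (3 & 1) (integers (2 ∷ 2 ∷ 2 ∷ 2 ∷ 2 ∷ 2 ∷ 2 ∷ 2 ∷ 3 ∷ [])) ∷ [])) ∷
   (38 , target₁ (2 & 0) (target₂ (7 &- 1) (leaf (3 & 0) ∷ target (37 &- 6) (leaf (44 &- 7) ∷ []) ∷ leaf (3 & 0) ∷ target (37 &- 6) (leaf (44 &- 7) ∷ []) ∷ leaf (3 & 0) ∷ []) ∷ target₂ (7 &- 1) (integers (replicate 7 3)) ∷ target₂ (8 &- 1) (target (37 &- 6) (leaf (44 &- 7) ∷ []) ∷ target (37 &- 6) (leaf (44 &- 7) ∷ []) ∷ leaf (5 & 0) ∷ leaf (5 & 0) ∷ leaf (5 & 0) ∷ leaf (5 & 0) ∷ leaf (8 & 1) ∷ target (37 &- 6) (leaf (44 &- 7) ∷ []) ∷ leaf (5 & 0) ∷ target (37 &- 6) (leaf (44 &- 7) ∷ []) ∷ leaf (5 & 0) ∷ leaf (5 & 0) ∷ leaf (5 & 0) ∷ leaf (5 & 0) ∷ leaf (5 & 0) ∷ leaf (5 & 0) ∷ leaf (5 & 0) ∷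 leaf (5 & 0) ∷ leaf (7 &- 1) ∷ leaf (5 & 0) ∷ leaf (5 & 0) ∷ leaf (5 & 0) ∷ leaf (5 & 0) ∷ leaf (8 & 1) ∷ []) ∷ [])) ∷
   []

 table2 : List (ℕ × Cert₁)
 table2 =
   (39 , target₁ (2 & 0) (target₂ (7 &- 1) (integers (replicate 5 3)) ∷ target₂ (7 &- 1) (integers (replicate 7 3)) ∷ target₂ (7 &- 1) (leaves (8 &- 1 ∷ 8 &- 1 ∷ 5 & 0 ∷ 5 & 0 ∷ 5 & 0 ∷ 25 &- 4 ∷ 5 & 0 ∷ 25 &- 4 ∷ 5 & 0 ∷ [])) ∷ [])) ∷
   (42 , target₁ (7 &- 1) (target₂ (13 &- 2) (integers (replicate 2 2)) ∷ target₂ (13 &- 2) (integers (2 ∷ 3 ∷ [])) ∷ [])) ∷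
   (43 , uniform 7 (replicate 3 3) (replicate 4 3) (replicate 5 5)) ∷
   (46 , target₁ (7 &- 1) (target₂ (7 & 1) (leaf (2 & 0) ∷ target (2 & 0) (leaf (41 &- 6) ∷ []) ∷ leaf (2 & 0) ∷ leaf (2 & 0) ∷ []) ∷ [])) ∷
   (47 , target₁ (7 &- 1) (target₂ (7 & 1) (integers (2 ∷ 2 ∷ 3 ∷ [])) ∷ [])) ∷
   (51 , target₁ (2 & 0) (target₂ (8 &- 1) (integers (replicate 5 3)) ∷ target₂ (8 &- 1) (integers (replicate 7 3)) ∷ target₂ (8 &- 1) (leaves (9 &- 1 ∷ 9 &- 1 ∷ 5 & 0 ∷ 5 & 0 ∷ 5 & 0 ∷ 5 & 0 ∷ 5 & 0 ∷ 5 & 0 ∷ [])) ∷ [])) ∷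
   (53 , target₁ (2 & 0) (target₂ (5 &- 1) (integers (replicate 5 3)) ∷ target₂ (5 &- 1) (leaves (4 & 1 ∷ 3 & 0 ∷ 4 & 1 ∷ 3 & 0 ∷ 3 & 0 ∷ 3 & 0 ∷ 3 & 0 ∷ 3 & 0 ∷ 6 & 0 ∷ 3 & 0 ∷ 3 & 0 ∷ 3 & 0 ∷ 3 & 0 ∷ 3 & 0 ∷ [])) ∷ target₂ (5 &- 1) (leaves (4 & 1 ∷ 4 & 1 ∷ 6 &- 1 ∷ 4 & 1 ∷ 4 & 1 ∷ 6 &- 1 ∷ 4 & 1 ∷ 4 & 1 ∷ 4 & 1 ∷ 4 & 1 ∷ 4 & 1 ∷ 4 & 1 ∷ 4 & 1 ∷ 4 & 1 ∷ 5 & 1 ∷ 4 & 1 ∷ 4 & 1 ∷ [])) ∷ [])) ∷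
   (55 , target₁ (2 & 0) (target₂ (8 &- 1) (leaves (3 & 0 ∷ 13 &- 1 ∷ 3 & 0 ∷ 13 &- 1 ∷ 11 &- 1 ∷ [])) ∷ target₂ (8 &- 1) (integers (replicate 7 3)) ∷ target₂ (8 &- 1) (leaves (5 & 0 ∷ 5 & 0 ∷ 9 &- 1 ∷ 5 & 0 ∷ 5 & 0 ∷ 5 & 0 ∷ [])) ∷ [])) ∷
   (57 , target₁ (2 & 0) (target₂ (5 &- 1) (integers (replicate 5 3)) ∷ target₂ (5 &- 1) (leaves (4 & 1 ∷ 171 &- 40 ∷ 4 & 1 ∷ 171 &- 40 ∷ 3 & 0 ∷ 3 & 0 ∷ 3 & 0 ∷ 3 & 0 ∷ 6 & 0 ∷ 3 & 0 ∷ 3 & 0 ∷ 3 & 0 ∷ 3 & 0 ∷ [])) ∷ target₂ (5 &- 1) (leaves (4 & 1 ∷ 5 & 0 ∷ 4 & 1 ∷ 5 & 0 ∷ 4 & 1 ∷ 4 & 1 ∷ 4 & 1 ∷ 4 & 1 ∷ 4 & 1 ∷ 4 & 1 ∷ 4 & 1 ∷ 4 & 1 ∷ 5 & 0 ∷ [])) ∷ [])) ∷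
   []

 table3 : List (ℕ × Cert₁)
 table3 =
   (58 , target₁ (2 & 0) (target₂ (8 &- 1) (integers (replicate 3 3)) ∷ target₂ (8 &- 1) (integers (replicate 4 3)) ∷ target₂ (8 &- 1) (leaves (12 &- 1 ∷ 12 &- 1 ∷ 5 & 0 ∷ 5 & 0 ∷ 5 & 0 ∷ [])) ∷ [])) ∷
   (59 , uniform 8 (replicate 3 3) (replicate 4 3) (replicate 3 5)) ∷
   (61 , target₁ (9 &- 2) (target₂ (7 & 2) (leaves (172 &- 39 ∷ 172 &- 39 ∷ 2 & 0 ∷ 2 & 0 ∷ [])) ∷ target₂ (7 & 2) (integers (2 ∷ 2 ∷ 2 ∷ 2 ∷ 3 ∷ 2 ∷ 2 ∷ [])) ∷ [])) ∷
   (62 , target₁ (2 & 0) (target₂ (8 &- 1) (integers (3 ∷ [])) ∷ target₂ (8 &- 1) (integers (3 ∷ [])) ∷ target₂ (8 &- 1) (leaves (63 &- 8 ∷ 5 & 0 ∷ [])) ∷ [])) ∷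
   (66 , target₁ (2 & 0) (target₂ (9 &- 1) (leaves (10 &- 1 ∷ 14 &- 1 ∷ 10 &- 1 ∷ 14 &- 1 ∷ 3 & 0 ∷ [])) ∷ target₂ (9 &- 1) (integers (replicate 7 3)) ∷ target₂ (9 &- 1) (leaf (5 & 0) ∷ leaf (5 & 0) ∷ leaf (5 & 0) ∷ leaf (5 & 0) ∷ leaf (10 &- 1) ∷ target (49 &- 6) (target (11 &- 1) (leaf (41 &- 5) ∷ leaf (41 &- 5) ∷ []) ∷ []) ∷ leaf (5 & 0) ∷ leaf (5 & 0) ∷ []) ∷ [])) ∷
   (67 , uniform 9 (replicate 5 3) (replicate 7 3) (replicate 8 5)) ∷
   (69 , target₁ (5 &- 1) (target₂ (2 & 0) (leaves (3 & 0 ∷ 3 & 0 ∷ 3 & 0 ∷ 4 & 1 ∷ 4 & 1 ∷ [])) ∷ target₂ (4 & 1) (leaves (2 & 0 ∷ 2 & 0 ∷ 2 & 0 ∷ 14 &- 3 ∷ 6 & 0 ∷ 2 & 0 ∷ 14 &- 3 ∷ [])) ∷ [])) ∷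
   (70 , target₁ (2 & 0) (target₂ (9 &- 1) (integers (replicate 5 3)) ∷ target₂ (9 &- 1) (integers (replicate 7 3)) ∷ target₂ (9 &- 1) (leaves (5 & 0 ∷ 5 & 0 ∷ 5 & 0 ∷ 11 &- 1 ∷ 5 & 0 ∷ 5 & 0 ∷ [])) ∷ [])) ∷
   (71 , uniform 9 (replicate 5 3) (replicate 7 3) (replicate 6 5)) ∷
   (73 , target₁ (5 &- 1) (target₂ (4 & 1) (integers (6 ∷ 2 ∷ 2 ∷ [])) ∷ [])) ∷
   (74 , target₁ (2 & 0) (target₂ (9 &- 1) (integers (replicate 3 3)) ∷ target₂ (9 &- 1) (integers (replicate 4 3)) ∷ target₂ (9 &- 1) (leaves (13 &- 1 ∷ 13 &- 1 ∷ 5 & 0 ∷ 5 & 0 ∷ 5 & 0 ∷ [])) ∷ [])) ∷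
   (78 , target₁ (9 &- 1) (target₂ (9 & 1) (leaves (2 & 0 ∷ 53 &- 6 ∷ 2 & 0 ∷ 2 & 0 ∷ [])) ∷ [])) ∷
   (79 , uniform 9 (3 ∷ []) (3 ∷ []) (5 ∷ [])) ∷
   (82 , uniform 10 (replicate 5 3) (replicate 7 3) (replicate 8 5)) ∷
   (83 , uniform 10 (replicate 5 3) (replicate 7 3) (replicate 8 5)) ∷
   (85 , target₁ (2 & 0) (target₂ (6 &- 1) (integers (replicate 5 3)) ∷ target₂ (6 &- 1) (leaf (3 & 0) ∷ leaf (3 & 0) ∷ leaf (3 & 0) ∷ leaf (3 & 0) ∷ leaf (3 & 0) ∷ leaf (3 & 0) ∷ target (21 &- 4) (leaf (47 &- 9) ∷ []) ∷ leaf (10 & 0) ∷ leaf (3 & 0) ∷ leaf (3 & 0) ∷ leaf (3 & 0) ∷ []) ∷ target₂ (6 &- 1) (leaves (5 & 0 ∷ 5 & 1 ∷ 5 & 0 ∷ 5 & 1 ∷ 5 & 0 ∷ 5 & 0 ∷ 5 & 0 ∷ 5 & 0 ∷ 5 & 0 ∷ 5 & 1 ∷ 8 &- 1 ∷ 5 & 0 ∷ 5 & 0 ∷ 10 & 0 ∷ [])) ∷ [])) ∷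
   (86 , uniform 10 (replicate 5 3) (replicate 7 3) (replicate 6 5)) ∷
   (87 , target₁ (2 & 0) (target₂ (10 &- 1) (integers (replicate 5 3)) ∷ target₂ (10 &- 1) (integers (replicate 7 3)) ∷ target₂ (10 &- 1) (leaves (14 &- 1 ∷ 14 &- 1 ∷ 5 & 0 ∷ 5 & 0 ∷ 5 & 0 ∷ 5 & 0 ∷ [])) ∷ [])) ∷
   (89 , target₁ (2 & 0) (target₂ (6 &- 1) (integers (replicate 5 3)) ∷ target₂ (6 &- 1) (integers (replicate 11 3)) ∷ target₂ (6 &- 1) (leaves (5 & 0 ∷ 5 & 0 ∷ 5 & 0 ∷ 5 & 0 ∷ 5 & 0 ∷ 5 & 0 ∷ 5 & 0 ∷ 7 & 0 ∷ 5 & 1 ∷ 5 & 0 ∷ 7 & 0 ∷ 5 & 0 ∷ [])) ∷ [])) ∷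
   (91 , uniform 10 (replicate 3 3) (replicate 4 3) (5 ∷ 5 ∷ 5 ∷ 5 ∷ 10 ∷ [])) ∷
   (93 , target₁ (6 &- 1) (target₂ (9 & 2) (integers (replicate 8 2)) ∷ target₂ (9 & 2) (leaves (2 & 0 ∷ 2 & 0 ∷ 2 & 0 ∷ 2 & 0 ∷ 2 & 0 ∷ 16 &- 3 ∷ 2 & 0 ∷ 2 & 0 ∷ 2 & 0 ∷ 16 &- 3 ∷ [])) ∷ [])) ∷
   (94 , target₁ (2 & 0) (target₂ (10 &- 1) (integers (replicate 3 3)) ∷ target₂ (10 &- 1) (integers (replicate 4 3)) ∷ target₂ (10 &- 1) (leaf (5 & 0) ∷ target (10 & 1) (leaf (49 &- 5) ∷ []) ∷ leaf (5 & 0) ∷ []) ∷ [])) ∷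
   (95 , uniform 10 (replicate 3 3) (replicate 2 3) (10 ∷ 5 ∷ 5 ∷ [])) ∷
   (97 , target₁ (11 &- 2) (target₂ (9 & 2) (integers (replicate 4 2)) ∷ [])) ∷
   (101 , target₁ (2 & 0) (target₂ (6 &- 1) (integers (replicate 3 3)) ∷ target₂ (6 &- 1) (integers (replicate 5 3)) ∷ target₂ (6 &- 1) (leaves (5 & 0 ∷ 5 & 0 ∷ 5 & 0 ∷ 5 & 1 ∷ 5 & 0 ∷ 5 & 0 ∷ [])) ∷ [])) ∷
   (102 , target₁ (2 & 0) (target₂ (11 &- 1) (integers (replicate 5 3)) ∷ target₂ (11 &- 1) (integers (replicate 7 3)) ∷ target₂ (11 &- 1) (leaves (12 &- 1 ∷ 12 &- 1 ∷ 5 & 0 ∷ 5 & 0 ∷ 5 & 0 ∷ 5 & 0 ∷ 5 & 0 ∷ 5 & 0 ∷ [])) ∷ [])) ∷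
   (103 , uniform 11 (replicate 5 3) (replicate 7 3) (replicate 8 5)) ∷
   (105 , target₁ (6 &- 1) (target₂ (2 & 0) (leaves (3 & 0 ∷ 3 & 0 ∷ 3 & 0 ∷ 10 &- 1 ∷ 5 & 0 ∷ [])) ∷ target₂ (3 & 0) (leaf (2 & 0) ∷ leaf (2 & 0) ∷ leaf (2 & 0) ∷ target (45 &- 8) (leaf (23 &- 4) ∷ []) ∷ target (45 &- 8) (leaf (23 &- 4) ∷ []) ∷ target (17 &- 3) (leaf (23 &- 4) ∷ []) ∷ target (17 &- 3) (leaf (23 &- 4) ∷ []) ∷ leaf (5 & 0) ∷ leaf (2 & 0) ∷ leaf (2 & 0) ∷ leaf (17 &- 2) ∷ leaf (2 & 0) ∷ leaf (2 & 0) ∷ leaf (17 &- 2) ∷ leaf (2 & 0) ∷ leaf (2 & 0) ∷ leaf (2 & 0) ∷ leaf (2 & 0) ∷ leaf (2 & 0) ∷ leaf (2 & 0) ∷ target (2 & 0) (leaf (23 &- 4) ∷ leaf (23 &- 4) ∷ []) ∷ leaf (2 & 0) ∷ leaf (2 & 0) ∷ leaf (2 & 0) ∷ leaf (45 &- 8) ∷ []) ∷ [])) ∷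
   (106 , target₁ (2 & 0) (target₂ (11 &- 1) (integers (replicate 5 3)) ∷ target₂ (11 &- 1) (integers (replicate 7 3)) ∷ target₂ (11 &- 1) (leaves (15 &- 1 ∷ 15 &- 1 ∷ 5 & 0 ∷ 5 & 0 ∷ 5 & 0 ∷ 5 & 0 ∷ [])) ∷ [])) ∷
   (107 , uniform 11 (replicate 5 3) (replicate 7 3) (replicate 6 5)) ∷
   (109 , uniform 6 (replicate 3 3) (replicate 2 3) (replicate 3 5)) ∷
   (110 , target₁ (2 & 0) (target₂ (11 &- 1) (integers (replicate 5 3)) ∷ target₂ (11 &- 1) (integers (replicate 4 3)) ∷ target₂ (11 &- 1) (leaves (5 & 0 ∷ 5 & 0 ∷ 5 & 0 ∷ 13 &- 1 ∷ 21 &- 2 ∷ 5 & 0 ∷ [])) ∷ [])) ∷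
   (111 , target₁ (2 & 0) (target₂ (11 &- 1) (integers (replicate 3 3)) ∷ target₂ (11 &- 1) (integers (replicate 4 3)) ∷ target₂ (11 &- 1) (leaves (15 &- 1 ∷ 15 &- 1 ∷ 5 & 0 ∷ 5 & 0 ∷ 5 & 0 ∷ [])) ∷ [])) ∷
   (113 , target₁ (6 &- 1) (target₂ (5 & 1) (integers (replicate 3 2)) ∷ [])) ∷
   (114 , target₁ (2 & 0) (target₂ (11 &- 1) (integers (replicate 3 3)) ∷ target₂ (11 &- 1) (integers (replicate 4 3)) ∷ target₂ (11 &- 1) (leaves (12 &- 1 ∷ 5 & 0 ∷ 5 & 0 ∷ [])) ∷ [])) ∷
   (115 , target₁ (2 & 0) (target₂ (11 &- 1) (integers (replicate 3 3)) ∷ target₂ (11 &- 1) (integers (replicate 2 3)) ∷ target₂ (11 &- 1) (leaves (12 &- 1 ∷ 5 & 0 ∷ 5 & 0 ∷ [])) ∷ [])) ∷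
   (118 , uniform 11 (3 ∷ []) (3 ∷ []) (replicate 2 5)) ∷
   (119 , uniform 11 (3 ∷ []) (3 ∷ []) (5 ∷ [])) ∷
   (122 , target₁ (2 & 0) (target₂ (12 &- 1) (integers (replicate 5 3)) ∷ target₂ (12 &- 1) (integers (replicate 7 3)) ∷ target₂ (12 &- 1) (leaves (5 & 0 ∷ 5 & 0 ∷ 16 &- 1 ∷ 16 &- 1 ∷ 5 & 0 ∷ 5 & 0 ∷ 5 & 0 ∷ 5 & 0 ∷ [])) ∷ [])) ∷
   (123 , uniform 12 (replicate 5 3) (replicate 7 3) (replicate 8 5)) ∷
   (127 , uniform 12 (replicate 5 3) (replicate 7 3) (replicate 6 5)) ∷
   (129 , target₁ (2 & 0) (target₂ (7 &- 1) (integers (replicate 5 3)) ∷ target₂ (7 &- 1) (integers (replicate 8 3)) ∷ target₂ (7 &- 1) (leaves (5 & 0 ∷ 5 & 0 ∷ 5 & 0 ∷ 5 & 0 ∷ 5 & 0 ∷ 6 & 1 ∷ 5 & 0 ∷ 5 & 0 ∷ 5 & 0 ∷ [])) ∷ [])) ∷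
   (130 , uniform 12 (replicate 5 3) (replicate 7 3) (5 ∷ 5 ∷ 5 ∷ 10 ∷ 5 ∷ 5 ∷ [])) ∷
   (131 , uniform 12 (replicate 5 3) (replicate 4 3) (replicate 6 5)) ∷
   (133 , target₁ (2 & 0) (target₂ (13 &- 2) (leaves (10 &- 1 ∷ 10 &- 1 ∷ 3 & 0 ∷ [])) ∷ target₂ (3 & 0) (leaves (6 & 0 ∷ 5 & 0 ∷ 5 & 0 ∷ 6 & 0 ∷ 5 & 0 ∷ 7 &- 1 ∷ 7 &- 1 ∷ 5 & 0 ∷ 20 &- 2 ∷ 7 &- 1 ∷ 7 &- 1 ∷ 10 &- 1 ∷ 7 &- 1 ∷ 10 &- 1 ∷ 7 &- 1 ∷ 7 &- 1 ∷ 7 &- 1 ∷ 7 &- 1 ∷ 7 &- 1 ∷ 5 & 0 ∷ 6 & 0 ∷ 7 &- 1 ∷ 5 & 0 ∷ 6 & 0 ∷ [])) ∷ target₂ (7 &- 1) (leaves (5 & 0 ∷ 5 & 0 ∷ 5 & 0 ∷ 10 &- 1 ∷ 5 & 0 ∷ 5 & 0 ∷ 20 &- 2 ∷ [])) ∷ [])) ∷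
   []

 table4 : List (ℕ × Cert₁)
 table4 =
   (134 , uniform 12 (replicate 3 3) (replicate 4 3) (replicate 5 5)) ∷
   (137 , target₁ (7 &- 1) (target₂ (11 & 2) (integers (replicate 6 2)) ∷ target₂ (11 & 2) (integers (replicate 7 2)) ∷ [])) ∷
   (138 , uniform 12 (replicate 3 3) (replicate 2 3) (replicate 3 5)) ∷
   (139 , uniform 12 (3 ∷ []) (replicate 2 3) (replicate 2 5)) ∷
   (141 , target₁ (13 &- 2) (target₂ (11 & 2) (integers (5 ∷ 2 ∷ 2 ∷ 5 ∷ [])) ∷ [])) ∷
   (142 , uniform 12 (3 ∷ []) (3 ∷ []) (5 ∷ [])) ∷
   (143 , uniform 12 (3 ∷ []) (3 ∷ []) (5 ∷ [])) ∷
   (145 , target₁ (2 & 0) (target₂ (7 &- 1) (integers (replicate 3 3)) ∷ target₂ (7 &- 1) (integers (replicate 4 3)) ∷ target₂ (7 &- 1) (leaves (11 &- 1 ∷ 11 &- 1 ∷ 5 & 0 ∷ 5 & 0 ∷ 5 & 0 ∷ [])) ∷ [])) ∷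
   (146 , uniform 13 (replicate 5 3) (replicate 7 3) (replicate 8 5)) ∷
   (149 , uniform 7 (replicate 3 3) (replicate 4 3) (replicate 5 5)) ∷
   (151 , uniform 13 (replicate 5 3) (replicate 7 3) (replicate 6 5)) ∷
   (154 , uniform 13 (replicate 5 3) (replicate 7 3) (replicate 6 5)) ∷
   (155 , target₁ (2 & 0) (target₂ (13 &- 1) (integers (replicate 5 3)) ∷ target₂ (13 &- 1) (integers (replicate 4 3)) ∷ target₂ (13 &- 1) (leaves (5 & 0 ∷ 5 & 0 ∷ 14 &- 1 ∷ 5 & 0 ∷ 5 & 0 ∷ 5 & 0 ∷ [])) ∷ [])) ∷
   (157 , target₁ (7 &- 1) (target₂ (6 & 1) (integers (replicate 4 2)) ∷ [])) ∷
   (158 , uniform 13 (replicate 3 3) (replicate 4 3) (replicate 5 5)) ∷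
   (159 , uniform 13 (replicate 3 3) (replicate 4 3) (replicate 5 5)) ∷
   (161 , target₁ (7 &- 1) (target₂ (6 & 1) (leaf (2 & 0) ∷ target (2 & 0) (leaf (35 &- 5) ∷ []) ∷ leaf (2 & 0) ∷ []) ∷ [])) ∷
   (163 , uniform 13 (3 ∷ []) (replicate 2 3) (replicate 2 5)) ∷
   (165 , target₁ (2 & 0) (target₂ (7 &- 1) (leaves (10 &- 1 ∷ [])) ∷ target₂ (7 &- 1) (integers (3 ∷ [])) ∷ target₂ (7 &- 1) (leaves (12 &- 1 ∷ [])) ∷ [])) ∷
   (166 , uniform 13 (3 ∷ []) (3 ∷ []) (5 ∷ [])) ∷
   (167 , uniform 13 (3 ∷ []) (3 ∷ []) (5 ∷ [])) ∷
   (170 , uniform 14 (replicate 5 3) (replicate 7 3) (5 ∷ 5 ∷ 5 ∷ 5 ∷ 5 ∷ 15 ∷ 5 ∷ 5 ∷ [])) ∷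
   (173 , uniform 8 (replicate 5 3) (replicate 7 3) (replicate 8 5)) ∷
   (174 , uniform 14 (replicate 5 3) (replicate 7 3) (replicate 8 5)) ∷
   (177 , uniform 8 (replicate 5 3) (replicate 7 3) (replicate 8 5)) ∷
   (178 , uniform 14 (replicate 5 3) (replicate 7 3) (replicate 6 5)) ∷
   (179 , uniform 14 (replicate 5 3) (replicate 7 3) (replicate 6 5)) ∷
   (181 , uniform 8 (replicate 5 3) (replicate 7 3) (replicate 8 5)) ∷
   (182 , uniform 14 (replicate 5 3) (replicate 4 3) (replicate 6 5)) ∷
   (183 , uniform 14 (replicate 3 3) (replicate 4 3) (replicate 5 5)) ∷
   (185 , target₁ (2 & 0) (target₂ (8 &- 1) (integers (replicate 5 3)) ∷ target₂ (8 &- 1) (integers (replicate 7 3)) ∷ target₂ (8 &- 1) (leaves (12 &- 1 ∷ 12 &- 1 ∷ 5 & 0 ∷ 5 & 0 ∷ 5 & 0 ∷ 5 & 0 ∷ [])) ∷ [])) ∷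
   (186 , uniform 14 (replicate 3 3) (replicate 4 3) (replicate 3 5)) ∷
   (187 , uniform 14 (replicate 3 3) (replicate 4 3) (replicate 3 5)) ∷
   (190 , uniform 14 (3 ∷ []) (replicate 2 3) (replicate 2 5)) ∷
   (191 , uniform 14 (3 ∷ []) (replicate 2 3) (replicate 2 5)) ∷
   (193 , uniform 8 (replicate 5 3) (replicate 4 3) (replicate 6 5)) ∷
   (194 , uniform 14 (3 ∷ []) (3 ∷ []) (5 ∷ [])) ∷
   (195 , uniform 14 (3 ∷ []) (3 ∷ []) (5 ∷ [])) ∷
   (197 , uniform 8 (replicate 3 3) (replicate 4 3) (replicate 5 5)) ∷
   (199 , uniform 15 (replicate 5 3) (replicate 7 3) (replicate 8 5)) ∷
   (201 , uniform 8 (replicate 3 3) (replicate 4 3) (replicate 5 5)) ∷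
   (202 , uniform 15 (replicate 5 3) (replicate 7 3) (replicate 8 5)) ∷
   (203 , uniform 15 (replicate 5 3) (replicate 7 3) (replicate 8 5)) ∷
   (205 , uniform 8 (replicate 3 3) (replicate 4 3) (replicate 3 5)) ∷
   (206 , uniform 15 (replicate 5 3) (replicate 7 3) (replicate 6 5)) ∷
   []

 table5 : List (ℕ × Cert₁)
 table5 =
   (209 , target₁ (2 & 0) (target₂ (8 &- 1) (leaves (3 & 0 ∷ 3 & 0 ∷ 11 &- 1 ∷ [])) ∷ target₂ (8 &- 1) (integers (replicate 2 3)) ∷ target₂ (8 &- 1) (integers (5 ∷ 5 ∷ 10 ∷ [])) ∷ [])) ∷
   (210 , uniform 15 (replicate 5 3) (replicate 4 3) (replicate 6 5)) ∷
   (211 , uniform 15 (replicate 3 3) (replicate 4 3) (replicate 5 5)) ∷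
   (213 , target₁ (8 &- 1) (target₂ (7 & 1) (integers (replicate 4 2)) ∷ [])) ∷
   (214 , uniform 15 (replicate 3 3) (replicate 4 3) (replicate 3 5)) ∷
   (215 , uniform 15 (replicate 3 3) (replicate 4 3) (replicate 3 5)) ∷
   (217 , target₁ (2 & 0) (target₂ (8 &- 1) (integers (3 ∷ [])) ∷ target₂ (8 &- 1) (integers (3 ∷ [])) ∷ target₂ (8 &- 1) (leaves (16 &- 1 ∷ 5 & 0 ∷ [])) ∷ [])) ∷
   (218 , uniform 15 (3 ∷ []) (replicate 2 3) (replicate 2 5)) ∷
   (219 , uniform 15 (3 ∷ []) (replicate 2 3) (replicate 2 5)) ∷
   (221 , target₁ (2 & 0) (target₂ (8 &- 1) (integers (3 ∷ [])) ∷ target₂ (8 &- 1) (integers (3 ∷ [])) ∷ target₂ (8 &- 1) (leaves (13 &- 1 ∷ [])) ∷ [])) ∷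
   (222 , uniform 15 (3 ∷ []) (3 ∷ []) (5 ∷ [])) ∷
   (223 , uniform 15 (3 ∷ []) (3 ∷ []) (5 ∷ [])) ∷
   (226 , uniform 16 (replicate 5 3) (replicate 7 3) (replicate 8 5)) ∷
   (227 , uniform 16 (replicate 5 3) (replicate 7 3) (replicate 8 5)) ∷
   (229 , uniform 9 (replicate 5 3) (replicate 7 3) (replicate 8 5)) ∷
   (230 , uniform 16 (replicate 5 3) (replicate 7 3) (replicate 8 5)) ∷
   (231 , uniform 16 (replicate 5 3) (replicate 7 3) (replicate 8 5)) ∷
   (233 , uniform 9 (replicate 5 3) (replicate 7 3) (replicate 8 5)) ∷
   (235 , uniform 16 (replicate 5 3) (replicate 7 3) (replicate 6 5)) ∷
   (237 , uniform 9 (replicate 5 3) (replicate 7 3) (replicate 8 5)) ∷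
   (238 , uniform 16 (replicate 5 3) (replicate 7 3) (replicate 6 5)) ∷
   (239 , uniform 16 (replicate 5 3) (replicate 4 3) (replicate 6 5)) ∷
   (241 , uniform 9 (replicate 5 3) (replicate 7 3) (replicate 6 5)) ∷
   (249 , uniform 9 (replicate 5 3) (replicate 7 3) (replicate 6 5)) ∷
   (253 , target₁ (2 & 0) (target₂ (9 &- 1) (leaves (3 & 0 ∷ 3 & 0 ∷ 3 & 0 ∷ 3 & 0 ∷ 12 &- 1 ∷ [])) ∷ target₂ (9 &- 1) (integers (replicate 4 3)) ∷ target₂ (9 &- 1) (leaf (5 & 0) ∷ leaf (5 & 0) ∷ leaf (5 & 0) ∷ leaf (5 & 0) ∷ target (8 & 1) (leaf (43 &- 5) ∷ []) ∷ leaf (14 &- 1) ∷ []) ∷ [])) ∷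
   (257 , uniform 9 (replicate 3 3) (replicate 4 3) (replicate 5 5)) ∷
   (265 , uniform 9 (replicate 3 3) (replicate 4 3) (replicate 3 5)) ∷
   (269 , uniform 9 (replicate 3 3) (replicate 4 3) (replicate 3 5)) ∷
   (273 , target₁ (2 & 0) (target₂ (9 &- 1) (integers (3 ∷ [])) ∷ target₂ (9 &- 1) (integers (replicate 2 3)) ∷ target₂ (9 &- 1) (target (8 & 1) (leaf (53 &- 6) ∷ []) ∷ leaf (5 & 0) ∷ []) ∷ [])) ∷
   (277 , target₁ (9 &- 1) (target₂ (8 & 1) (integers (replicate 4 2)) ∷ [])) ∷
   (281 , uniform 9 (3 ∷ []) (3 ∷ []) (5 ∷ [])) ∷
   (285 , target₁ (2 & 0) (target₂ (9 &- 1) (integers (3 ∷ [])) ∷ target₂ (9 &- 1) (integers (3 ∷ [])) ∷ target₂ (9 &- 1) (leaves (14 &- 1 ∷ [])) ∷ [])) ∷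
   (293 , uniform 10 (replicate 5 3) (replicate 7 3) (replicate 8 5)) ∷
   (301 , uniform 10 (replicate 5 3) (replicate 7 3) (replicate 8 5)) ∷
   (305 , uniform 10 (replicate 5 3) (replicate 7 3) (replicate 8 5)) ∷
   (309 , uniform 10 (replicate 5 3) (replicate 7 3) (replicate 6 5)) ∷
   (313 , uniform 10 (replicate 5 3) (replicate 7 3) (replicate 6 5)) ∷
   (317 , uniform 10 (replicate 5 3) (replicate 7 3) (replicate 6 5)) ∷
   (321 , uniform 10 (replicate 5 3) (replicate 4 3) (replicate 6 5)) ∷
   (329 , target₁ (2 & 0) (target₂ (10 &- 1) (integers (replicate 3 3)) ∷ target₂ (10 &- 1) (integers (replicate 4 3)) ∷ target₂ (10 &- 1) (leaf (5 & 0) ∷ leaf (5 & 0) ∷ leaf (5 & 0) ∷ target (9 & 1) (leaf (39 &- 4) ∷ []) ∷ leaf (5 & 0) ∷ []) ∷ [])) ∷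
   (337 , uniform 10 (replicate 3 3) (replicate 4 3) (replicate 3 5)) ∷
   (341 , target₁ (2 & 0) (target₂ (10 &- 1) (integers (replicate 3 3)) ∷ target₂ (10 &- 1) (integers (replicate 2 3)) ∷ target₂ (10 &- 1) (leaf (5 & 0) ∷ target (9 & 1) (leaf (49 &- 5) ∷ []) ∷ leaf (5 & 0) ∷ []) ∷ [])) ∷
   (345 , uniform 10 (3 ∷ []) (replicate 2 3) (replicate 2 5)) ∷
   (349 , target₁ (10 &- 1) (target₂ (9 & 1) (integers (replicate 4 2)) ∷ [])) ∷
   (353 , uniform 10 (3 ∷ []) (3 ∷ []) (5 ∷ [])) ∷
   []

 table6 : List (ℕ × Cert₁)
 table6 =
   (357 , uniform 10 (3 ∷ []) (3 ∷ []) (13 ∷ [])) ∷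
   (365 , uniform 11 (replicate 5 3) (replicate 7 3) (replicate 8 5)) ∷
   (373 , uniform 11 (replicate 5 3) (replicate 7 3) (replicate 8 5)) ∷
   (377 , target₁ (2 & 0) (target₂ (11 &- 1) (integers (replicate 5 3)) ∷ target₂ (11 &- 1) (integers (replicate 7 3)) ∷ target₂ (11 &- 1) (leaves (5 & 0 ∷ 5 & 0 ∷ 15 &- 1 ∷ 15 &- 1 ∷ 5 & 0 ∷ 5 & 0 ∷ 5 & 0 ∷ 5 & 0 ∷ [])) ∷ [])) ∷
   (381 , uniform 11 (replicate 5 3) (replicate 7 3) (replicate 6 5)) ∷
   (385 , target₁ (2 & 0) (target₂ (11 &- 1) (integers (replicate 5 3)) ∷ target₂ (11 &- 1) (integers (replicate 7 3)) ∷ target₂ (11 &- 1) (leaves (5 & 0 ∷ 5 & 0 ∷ 5 & 0 ∷ 5 & 0 ∷ 19 &- 1 ∷ 5 & 0 ∷ [])) ∷ [])) ∷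
   (389 , uniform 11 (replicate 5 3) (replicate 7 3) (replicate 6 5)) ∷
   (393 , uniform 11 (replicate 5 3) (replicate 7 3) (replicate 6 5)) ∷
   (397 , uniform 11 (replicate 5 3) (replicate 4 3) (replicate 6 5)) ∷
   (401 , uniform 11 (replicate 3 3) (replicate 4 3) (replicate 5 5)) ∷
   (409 , uniform 11 (replicate 3 3) (replicate 4 3) (replicate 5 5)) ∷
   (413 , uniform 11 (replicate 3 3) (replicate 4 3) (replicate 3 5)) ∷
   (417 , uniform 11 (replicate 3 3) (replicate 4 3) (replicate 3 5)) ∷
   (421 , uniform 11 (3 ∷ []) (replicate 2 3) (replicate 2 5)) ∷
   (429 , target₁ (11 &- 1) (target₂ (10 & 1) (integers (2 ∷ 2 ∷ 13 ∷ 3 ∷ [])) ∷ [])) ∷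
   (433 , uniform 11 (3 ∷ []) (3 ∷ []) (5 ∷ [])) ∷
   (437 , target₁ (2 & 0) (target₂ (11 &- 1) (integers (3 ∷ [])) ∷ target₂ (11 &- 1) (integers (3 ∷ [])) ∷ target₂ (11 &- 1) (leaves (16 &- 1 ∷ [])) ∷ [])) ∷
   (445 , uniform 12 (replicate 5 3) (replicate 7 3) (replicate 8 5)) ∷
   (449 , uniform 12 (replicate 5 3) (replicate 7 3) (replicate 8 5)) ∷
   (453 , uniform 12 (replicate 5 3) (replicate 7 3) (replicate 8 5)) ∷
   (457 , uniform 12 (replicate 5 3) (replicate 7 3) (replicate 8 5)) ∷
   (461 , uniform 12 (replicate 5 3) (replicate 7 3) (replicate 8 5)) ∷
   (465 , target₁ (2 & 0) (target₂ (12 &- 1) (integers (replicate 5 3)) ∷ target₂ (12 &- 1) (integers (replicate 7 3)) ∷ target₂ (12 &- 1) (leaves (5 & 0 ∷ 5 & 0 ∷ 5 & 0 ∷ 5 & 0 ∷ 23 &- 2 ∷ 5 & 0 ∷ [])) ∷ [])) ∷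
   (469 , uniform 12 (replicate 5 3) (replicate 7 3) (replicate 6 5)) ∷
   (473 , uniform 12 (replicate 5 3) (replicate 7 3) (replicate 6 5)) ∷
   (481 , target₁ (2 & 0) (target₂ (12 &- 1) (integers (replicate 5 3)) ∷ target₂ (12 &- 1) (integers (replicate 4 3)) ∷ target₂ (12 &- 1) (leaves (16 &- 1 ∷ 16 &- 1 ∷ 5 & 0 ∷ 5 & 0 ∷ 5 & 0 ∷ 5 & 0 ∷ [])) ∷ [])) ∷
   (485 , uniform 12 (replicate 3 3) (replicate 4 3) (replicate 5 5)) ∷
   (489 , uniform 12 (replicate 3 3) (replicate 4 3) (replicate 5 5)) ∷
   (493 , uniform 12 (replicate 3 3) (replicate 4 3) (5 ∷ 5 ∷ 5 ∷ 5 ∷ 13 ∷ [])) ∷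
   (497 , uniform 12 (replicate 3 3) (replicate 4 3) (replicate 3 5)) ∷
   (501 , uniform 12 (replicate 3 3) (replicate 4 3) (replicate 3 5)) ∷
   (505 , uniform 12 (replicate 3 3) (replicate 2 3) (replicate 3 5)) ∷
   (509 , uniform 12 (3 ∷ []) (replicate 2 3) (replicate 2 5)) ∷
   (517 , uniform 12 (3 ∷ []) (3 ∷ []) (replicate 2 5)) ∷
   (521 , uniform 12 (3 ∷ []) (3 ∷ []) (5 ∷ [])) ∷
   (533 , uniform 13 (replicate 5 3) (replicate 7 3) (replicate 8 5)) ∷
   (537 , uniform 13 (replicate 5 3) (replicate 7 3) (replicate 8 5)) ∷
   (541 , uniform 13 (replicate 5 3) (replicate 7 3) (replicate 8 5)) ∷
   (545 , uniform 13 (replicate 5 3) (replicate 7 3) (replicate 8 5)) ∷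
   (553 , uniform 13 (replicate 5 3) (replicate 7 3) (replicate 6 5)) ∷
   (557 , uniform 13 (replicate 5 3) (replicate 7 3) (replicate 6 5)) ∷
   (561 , uniform 13 (replicate 5 3) (replicate 7 3) (5 ∷ 5 ∷ 5 ∷ 5 ∷ 5 ∷ 10 ∷ [])) ∷
   (565 , uniform 13 (replicate 5 3) (replicate 7 3) (replicate 6 5)) ∷
   (569 , uniform 13 (replicate 5 3) (replicate 7 3) (replicate 6 5)) ∷
   (573 , uniform 13 (replicate 5 3) (replicate 4 3) (replicate 6 5)) ∷
   []

 table7 : List (ℕ × Cert₁)
 table7 =
   (577 , uniform 13 (replicate 3 3) (replicate 4 3) (replicate 5 5)) ∷
   (581 , uniform 13 (replicate 3 3) (replicate 4 3) (replicate 5 5)) ∷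
   (589 , target₁ (2 & 0) (target₂ (13 &- 1) (integers (replicate 3 3)) ∷ target₂ (13 &- 1) (integers (replicate 4 3)) ∷ target₂ (13 &- 1) (leaves (5 & 0 ∷ 5 & 0 ∷ 18 &- 1 ∷ [])) ∷ [])) ∷
   (593 , uniform 13 (replicate 3 3) (replicate 4 3) (replicate 3 5)) ∷
   (597 , uniform 13 (replicate 3 3) (replicate 2 3) (replicate 3 5)) ∷
   (601 , uniform 13 (3 ∷ []) (replicate 2 3) (replicate 2 5)) ∷
   (609 , uniform 13 (3 ∷ []) (replicate 2 3) (replicate 2 5)) ∷
   (613 , uniform 13 (3 ∷ []) (3 ∷ []) (5 ∷ [])) ∷
   (617 , uniform 13 (3 ∷ []) (3 ∷ []) (5 ∷ [])) ∷
   (629 , target₁ (2 & 0) (target₂ (14 &- 1) (integers (replicate 5 3)) ∷ target₂ (14 &- 1) (integers (replicate 7 3)) ∷ target₂ (14 &- 1) (leaves (5 & 0 ∷ 5 & 0 ∷ 18 &- 1 ∷ 18 &- 1 ∷ 5 & 0 ∷ 5 & 0 ∷ 5 & 0 ∷ 13 & 0 ∷ [])) ∷ [])) ∷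
   (633 , uniform 14 (replicate 5 3) (replicate 7 3) (replicate 8 5)) ∷
   (641 , uniform 14 (replicate 5 3) (replicate 7 3) (replicate 8 5)) ∷
   (645 , uniform 14 (replicate 5 3) (replicate 7 3) (replicate 8 5)) ∷
   (649 , uniform 14 (replicate 5 3) (replicate 7 3) (replicate 8 5)) ∷
   (653 , uniform 14 (replicate 5 3) (replicate 7 3) (replicate 6 5)) ∷
   (661 , uniform 14 (replicate 5 3) (replicate 7 3) (replicate 6 5)) ∷
   (665 , uniform 14 (replicate 5 3) (replicate 7 3) (5 ∷ 5 ∷ 5 ∷ 5 ∷ 5 ∷ 10 ∷ [])) ∷
   (669 , uniform 14 (replicate 5 3) (replicate 4 3) (replicate 6 5)) ∷
   (673 , uniform 14 (replicate 5 3) (replicate 4 3) (replicate 6 5)) ∷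
   (677 , uniform 14 (replicate 3 3) (replicate 4 3) (replicate 5 5)) ∷
   (681 , uniform 14 (replicate 3 3) (replicate 4 3) (replicate 5 5)) ∷
   (685 , uniform 14 (replicate 3 3) (replicate 4 3) (replicate 5 5)) ∷
   (689 , uniform 14 (replicate 3 3) (replicate 4 3) (replicate 5 5)) ∷
   (697 , uniform 14 (replicate 3 3) (replicate 4 3) (replicate 3 5)) ∷
   (701 , uniform 14 (replicate 3 3) (replicate 2 3) (replicate 3 5)) ∷
   (705 , uniform 14 (3 ∷ []) (replicate 2 3) (replicate 2 5)) ∷
   (709 , uniform 14 (3 ∷ []) (replicate 2 3) (replicate 2 5)) ∷
   (713 , uniform 14 (3 ∷ []) (replicate 2 3) (replicate 2 5)) ∷
   (717 , uniform 14 (3 ∷ []) (3 ∷ []) (5 ∷ [])) ∷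
   (721 , uniform 14 (3 ∷ []) (3 ∷ []) (5 ∷ [])) ∷
   (733 , uniform 15 (replicate 5 3) (replicate 7 3) (replicate 8 5)) ∷
   (737 , uniform 15 (replicate 5 3) (replicate 7 3) (replicate 8 5)) ∷
   (741 , target₁ (2 & 0) (target₂ (15 &- 1) (integers (replicate 5 3)) ∷ target₂ (15 &- 1) (integers (replicate 7 3)) ∷ target₂ (15 &- 1) (leaves (5 & 0 ∷ 5 & 0 ∷ 5 & 0 ∷ 5 & 0 ∷ 5 & 0 ∷ 5 & 0 ∷ 13 & 0 ∷ 20 &- 1 ∷ [])) ∷ [])) ∷
   (745 , uniform 15 (replicate 5 3) (replicate 7 3) (replicate 8 5)) ∷
   (749 , uniform 15 (replicate 5 3) (replicate 7 3) (replicate 8 5)) ∷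
   (753 , uniform 15 (replicate 5 3) (replicate 7 3) (replicate 8 5)) ∷
   (757 , uniform 15 (replicate 5 3) (replicate 7 3) (replicate 6 5)) ∷
   (761 , uniform 15 (replicate 5 3) (replicate 7 3) (replicate 6 5)) ∷
   (769 , uniform 15 (replicate 5 3) (replicate 7 3) (replicate 6 5)) ∷
   (773 , uniform 15 (replicate 5 3) (replicate 7 3) (replicate 6 5)) ∷
   (777 , uniform 15 (replicate 5 3) (replicate 4 3) (replicate 6 5)) ∷
   (781 , uniform 15 (replicate 5 3) (replicate 4 3) (replicate 6 5)) ∷
   (785 , uniform 15 (replicate 3 3) (replicate 4 3) (replicate 5 5)) ∷
   (789 , uniform 15 (replicate 3 3) (replicate 4 3) (replicate 5 5)) ∷
   (793 , uniform 15 (replicate 3 3) (replicate 4 3) (replicate 5 5)) ∷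
   []

 table8 : List (ℕ × Cert₁)
 table8 =
   (797 , uniform 15 (replicate 3 3) (replicate 4 3) (replicate 5 5)) ∷
   (805 , uniform 15 (replicate 3 3) (replicate 4 3) (replicate 3 5)) ∷
   (809 , uniform 15 (replicate 3 3) (replicate 2 3) (replicate 3 5)) ∷
   (813 , uniform 15 (3 ∷ []) (replicate 2 3) (replicate 2 5)) ∷
   (817 , uniform 15 (3 ∷ []) (replicate 2 3) (replicate 2 5)) ∷
   (821 , uniform 15 (3 ∷ []) (replicate 2 3) (replicate 2 5)) ∷
   (829 , uniform 15 (3 ∷ []) (3 ∷ []) (5 ∷ [])) ∷
   (849 , uniform 16 (replicate 5 3) (replicate 7 3) (replicate 8 5)) ∷
   (853 , uniform 16 (replicate 5 3) (replicate 7 3) (replicate 8 5)) ∷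
   (857 , uniform 16 (replicate 5 3) (replicate 7 3) (replicate 8 5)) ∷
   (861 , uniform 16 (replicate 5 3) (replicate 7 3) (replicate 8 5)) ∷
   (865 , uniform 16 (replicate 5 3) (replicate 7 3) (replicate 8 5)) ∷
   (869 , uniform 16 (replicate 5 3) (replicate 7 3) (replicate 8 5)) ∷
   (877 , uniform 16 (replicate 5 3) (replicate 7 3) (replicate 6 5)) ∷
   (881 , uniform 16 (replicate 5 3) (replicate 7 3) (replicate 6 5)) ∷
   (885 , uniform 16 (replicate 5 3) (replicate 7 3) (replicate 6 5)) ∷
   (889 , uniform 16 (replicate 5 3) (replicate 7 3) (replicate 6 5)) ∷
   (893 , uniform 16 (replicate 5 3) (replicate 4 3) (replicate 6 5)) ∷
   (897 , uniform 16 (replicate 5 3) (replicate 4 3) (replicate 6 5)) ∷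
   (901 , uniform 16 (replicate 3 3) (replicate 4 3) (replicate 5 5)) ∷
   (905 , uniform 16 (replicate 3 3) (replicate 4 3) (replicate 5 5)) ∷
   (913 , uniform 16 (replicate 3 3) (replicate 4 3) (replicate 5 5)) ∷
   (917 , uniform 16 (replicate 3 3) (replicate 4 3) (replicate 3 5)) ∷
   (921 , uniform 16 (replicate 3 3) (replicate 4 3) (replicate 3 5)) ∷
   (929 , uniform 16 (replicate 3 3) (replicate 2 3) (replicate 3 5)) ∷
   (933 , uniform 16 (3 ∷ []) (replicate 2 3) (replicate 2 5)) ∷
   (937 , uniform 16 (3 ∷ []) (replicate 2 3) (replicate 2 5)) ∷
   (941 , uniform 16 (3 ∷ []) (replicate 2 3) (replicate 2 5)) ∷
   (949 , uniform 16 (3 ∷ []) (3 ∷ []) (5 ∷ [])) ∷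
   (953 , uniform 16 (3 ∷ []) (3 ∷ []) (5 ∷ [])) ∷
   (957 , uniform 16 (3 ∷ []) (3 ∷ []) (5 ∷ [])) ∷
   []

 g6-0 : Gram
 g6-0 = gram 1O 1O (2 & 0) 0O 1O (0 & 1)

 -- This is ε₆ times `g6-0`: scaling by a totally positive unit permutes the totally positive
 -- integers and preserves universality.
 g6-1 : Gram
 g6-1 = gram (5 & 2) (5 & 2) (10 & 4) 0O (5 & 2) (12 & 5)

 g6-2 : Gram
 g6-2 = gram 1O (3 & 0) (3 & 1) 1O (2 & 1) 0O

 g6-3 : Gram
 g6-3 = gram (5 & 2) (15 & 6) (27 & 11) (5 & 2) (22 & 9) 0O

 -- Modulo the determinant, here 2ε₆³, the adjugate has rank one, and a single part with
 -- representatives modulo 2 describes all classes.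
 f6-1 : Cert
 f6-1 = final 1 (part (tri (0 & 1) 1O 0O) (tri (0 & 1) 1O 0O) (residue 2 2 (+ 0)) ∷ []) ([])

 into6-1 : Combo → Combo → Combo → Cert
 into6-1 u v w = rebase u v w [] g6-1 [] f6-1

 f6-2 : Cert
 f6-2 = final 2 (part (tri 0O (2 & 1) (5 & 0)) (tri 0O (4 & 1) 1O) (residue 6 2 (+ 0)) ∷ []) ([])

 into6-2 : Combo → Combo → Combo → Cert
 into6-2 u v w = rebase u v w [] g6-2 [] f6-2

 f6-3 : Cert
 f6-3 = final 3 (part (tri 0O (2 & 1) (5 & 0)) (tri 0O (4 & 1) 1O) (residue 6 2 (+ 0)) ∷ []) ([])

 into6-3 : Combo → Combo → Combo → Cert
 into6-3 u v w = rebase u v w [] g6-3 [] f6-3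

 f6-0 : Cert
 f6-0 = final 0 (part (tri (0 & 1) 1O 0O) (tri (0 & 1) 1O 0O) (residue 2 2 (+ 0)) ∷ []) ([])

 into6-0 : Combo → Combo → Combo → Cert
 into6-0 u v w = rebase u v w [] g6-0 [] f6-0

 c6 : Cert₁
 c6 = target₁ (3 & 1) (target₂ (4 &- 1) (into6-1 (at (5 -&- 2) 0O (5 & 2)) (at (5 -&- 2) (2 & 1) 0O) (at (12 -&- 5) (3 & 1) (5 & 2)) ∷ target (8 &- 3) (into6-1 (at⁺ (3 & 1) (2 -& 0) (2 -& 0) 1O) (at (5 -&- 2) (2 & 1) 0O) (at⁺ (4 -&- 2) (1 & 1) (2 -& 0) 1O) ∷ into6-1 (at⁺ (1 -& 3) (0 &- 1) (0 &- 1) 1O) (at (5 -&- 2) (2 & 1) 0O) (at⁺ (8 -& 0) (3 & 0) (0 &- 1) 1O) ∷ into6-1 (at⁺ (6 & 1) (3 -& 0) (3 -& 0) 1O) (at (5 -&- 2) (2 & 1) 0O) (at⁺ (1 -&- 2) (0 & 1) (3 -& 0) 1O) ∷ into6-1 (at⁺ (2 -& 3) (1 &- 1) (1 &- 1) 1O) (at (5 -&- 2) (2 & 1) 0O) (at⁺ (9 -& 0) (4 & 0) (1 &- 1) 1O) ∷ []) ∷ target (8 &- 3) (into6-1 (at⁺ 1O 0O (1 -& 1) (2 & 0)) (at (5 -&- 2) (2 & 1) 0O) (at⁺ (6 -&- 3) (3 & 1) (1 -& 1) (2 & 0)) ∷ into6-1 (at⁺ (3 -& 2) 0O (2 & 0)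 1O) (at (5 -&- 2) (2 & 1) 0O) (at⁺ (10 -&- 1) (3 & 1) (2 & 0) 1O) ∷ into6-1 (at⁺ (3 & 0) 0O (0 & 1) 1O) (at (5 -&- 2) (2 & 1) 0O) (at⁺ (4 -&- 3) (3 & 1) (0 & 1) 1O) ∷ into6-1 (at⁺ (7 -& 4) 0O (3 &- 1) (2 & 0)) (at (5 -&- 2) (2 & 1) 0O) (at⁺ (14 -& 1) (3 & 1) (3 &- 1) (2 & 0)) ∷ []) ∷ target (8 &- 3) (into6-1 (at⁺ (1 -&- 1) (2 & 0) (2 -& 0) 1O) (at (5 -&- 2) (2 & 1) 0O) (at⁺ (8 -&- 4) (5 & 1) (2 -& 0) 1O) ∷ into6-1 (at⁺ (7 -& 1) (0 & 1) (0 &- 1) 1O) (at (5 -&- 2) (2 & 1) 0O) (at⁺ (14 -&- 2) (3 & 2) (0 &- 1) 1O) ∷ into6-1 (at⁺ (0 &- 2) (3 & 0) (3 -& 0) 1O) (at (5 -&- 2) (2 & 1) 0O) (at⁺ (7 -&- 5) (6 & 1) (3 -& 0) 1O) ∷ into6-1 (at⁺ (6 -& 2) (1 -& 1) (1 &- 1) 1O) (at (5 -&- 2) (2 & 1) 0O) (at⁺ (13 -&- 1) (2 & 2) (1 &- 1) 1O) ∷ []) ∷ into6-2 e₁ (at (5 & 1) (1 -&- 1) -1O) e₂ ∷ leaf (8 &- 3) ∷ leaf (8 &- 3) ∷ into6-2 e₁ (at (2 & 0) -1O -1O) e₂ ∷ into6-1 (at (7 & 3) (5 -&- 2) (5 &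 2)) (at (5 -&- 2) (2 & 1) 0O) (at 0O (2 -&- 1) (5 & 2)) ∷ target (4 & 1) (into6-3 (at (5 -&- 2) (2 & 1) 0O) (at⁺ (3 & 1) 1O (2 -&- 1) 1O) (at (12 -&- 5) (5 & 2) 0O) ∷ into6-3 (at (5 -&- 2) (2 & 1) 0O) (at⁺ 1O 1O 0O 1O) (at (12 -&- 5) (5 & 2) 0O) ∷ into6-3 (at (5 -&- 2) (2 & 1) 0O) (at⁺ 0O (1 & 1) (2 -&- 1) 1O) (at (12 -&- 5) (5 & 2) 0O) ∷ into6-3 (at (5 -&- 2) (2 & 1) 0O) (at⁺ (2 -&- 1) (1 & 1) 0O 1O) (at (12 -&- 5) (5 & 2) 0O) ∷ []) ∷ into6-1 (at (15 -&- 6) (5 & 2) (5 & 2)) (at (5 -&- 2) (2 & 1) 0O) (at (22 -&- 9) (8 & 3) (5 & 2)) ∷ leaf (4 & 1) ∷ leaf (8 &- 3) ∷ leaf (4 & 1) ∷ leaf (8 &- 3) ∷ leaf (4 & 1) ∷ leaf (4 & 1) ∷ into6-0 (at (3 -&- 1) (0 & 1) 1O) e₁ (at (2 -& 0) (1 -& 1) 1O) ∷ target (4 & 1) (into6-0 (at⁺ (7 & 3) (4 -&- 1) -1O (0 & 1)) e₁ (at⁺ (8 & 4) (5 -&- 1) -1O (0 & 1)) ∷ into6-0 (at⁺ (43 & 19) (28 -&- 5) (5 & 1) (0 & 4)) e₁ (at⁺ (44 & 20) (29 -&- 5) (5 & 1) (0 & 4)) ∷ into6-0 (at⁺ (11 -&-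 5) (8 & 1) (7 -&- 4) (0 & 3)) e₁ (at⁺ (10 -&- 4) (7 & 1) (7 -&- 4) (0 & 3)) ∷ into6-0 (at⁺ (19 & 7) (4 -&- 5) (5 & 3) (0 & 2)) e₁ (at⁺ (20 & 8) (5 -&- 5) (5 & 3) (0 & 2)) ∷ []) ∷ leaf (4 & 1) ∷ []) ∷ target₂ (4 &- 1) (leaves (8 &- 3 ∷ 8 &- 3 ∷ 8 &- 3 ∷ 8 &- 3 ∷ 4 & 1 ∷ 4 & 1 ∷ 8 &- 3 ∷ 4 & 1 ∷ 8 &- 3 ∷ 4 & 1 ∷ [])) ∷ target₂ (4 &- 1) (into6-0 (at (3 -&- 1) 0O (2 & 1)) (at 1O (2 -& 1) -1O) (at -1O (3 &- 1) 1O) ∷ into6-0 (at (3 & 1) 0O (2 -&- 1)) (at (1 &- 1) (2 -& 1) 1O) (at (1 -& 1) (3 &- 1) -1O) ∷ target (5 &- 2) (into6-0 (at⁺ 0O 0O -1O 1O) (at⁺ 0O (2 -& 1) 0O 1O) (at⁺ (3 &- 1) (3 &- 1) (3 -& 1) (2 & 0)) ∷ into6-0 (at⁺ (7 -& 3) 0O (2 &- 1) (2 & 0)) (at⁺ (7 -& 3) (2 -& 1) (3 &- 1) (2 & 0)) (at⁺ (2 -& 1) (3 &- 1) 0O 1O) ∷ []) ∷ leaf (8 &- 3) ∷ leaf (2 & 0) ∷ leaf (8 &- 3) ∷ leaf (2 & 0) ∷ target (5 &- 2) (into6-0 (at⁺ (2 -& 1) 0O 1O 1O) (at⁺ 0O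 (2 -& 1) 0O 1O) (at⁺ (9 -& 4) (3 &- 1) (3 &- 1) (2 & 0)) ∷ into6-0 (at⁺ (3 &- 1) 0O (2 -& 1) (2 & 0)) (at⁺ (5 &- 2) (2 -& 1) (3 -& 1) (2 & 0)) (at⁺ (2 -& 1) (3 &- 1) 0O 1O) ∷ []) ∷ leaf (2 & 0) ∷ leaf (8 &- 3) ∷ leaf (2 & 0) ∷ leaf (2 & 0) ∷ leaf (2 & 0) ∷ leaf (2 & 0) ∷ leaf (2 & 0) ∷ leaf (8 &- 3) ∷ into6-3 (at (1 & 1) (2 & 0) (2 -&- 1)) (at (4 & 2) 1O (2 -&- 1)) (at (3 & 1) (2 & 1) (5 -&- 2)) ∷ into6-3 (at (3 -&- 1) (2 & 0) (2 & 1)) (at 0O 1O (2 & 1)) (at (7 -&- 3) (2 & 1) (5 & 2)) ∷ leaf (2 & 0) ∷ leaf (2 & 0) ∷ leaf (4 & 1) ∷ leaf (2 & 0) ∷ leaf (2 & 0) ∷ leaf (2 & 0) ∷ leaf (4 & 1) ∷ leaf (2 & 0) ∷ leaf (2 & 0) ∷ leaf (4 & 1) ∷ leaf (2 & 0) ∷ leaf (8 &- 3) ∷ leaf (2 & 0) ∷ leaf (8 &- 3) ∷ leaf (2 & 0) ∷ leaf (2 & 0) ∷ leaf (2 & 0) ∷ leaf (2 & 0) ∷ leaf (2 & 0) ∷ leaf (2 & 0) ∷ leaf (2 & 0) ∷ leaf (2 & 0) ∷ leaf (2 & 0) ∷ leaf (4 & 1) ∷ []) ∷ target₂ (5 &-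 2) (leaf (4 &- 1) ∷ into6-1 (at 0O 0O (5 -&- 2)) (at (5 -&- 2) (2 & 1) (22 -&- 9)) (at (5 -&- 2) (3 & 1) (27 -&- 11)) ∷ into6-1 (at (2 & 1) 0O (5 & 2)) (at (5 & 2) (2 & 1) (22 & 9)) (at (7 & 3) (3 & 1) (27 & 11)) ∷ leaf (3 &- 1) ∷ target (8 &- 3) (into6-1 (at⁺ (1 -& 1) (6 -& 2) (0 &- 1) 1O) (at 0O 0O (5 -&- 2)) (at⁺ (1 -& 1) (5 -& 2) (5 -&- 3) 1O) ∷ into6-1 (at⁺ (1 -& 1) (4 &- 2) (2 -& 0) 1O) (at 0O 0O (5 -&- 2)) (at⁺ (1 -& 1) (5 &- 2) (7 -&- 2) 1O) ∷ into6-1 (at⁺ (0 & 1) (6 &- 3) (3 -& 0) 1O) (at 0O 0O (5 -&- 2)) (at⁺ (0 & 1) (7 &- 3) (8 -&- 2) 1O) ∷ into6-1 (at⁺ (0 & 1) (8 -& 3) (1 &- 1) 1O) (at 0O 0O (5 -&- 2)) (at⁺ (0 & 1) (7 -& 3) (4 -&- 3) 1O) ∷ []) ∷ leaf (8 &- 3) ∷ leaf (8 &- 3) ∷ target (4 &- 1) (into6-2 e₁ (at⁺ (3 & 0) -1O (7 & 3) (1 & 1)) (at⁺ (4 & 0) (3 -& 1) (2 & 1) (0 & 1)) ∷ into6-2 e₁ (at⁺ (3 & 0) -1O (2 -&- 1) (1 & 1)) (at⁺ (4 & 0) (3 -& 1) (4 -&- 2) (0 & 1)) ∷ into6-2 e₁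 (at⁺ (3 & 0) (3 &- 1) (7 & 3) (1 & 1)) (at⁺ (4 & 0) (3 &- 1) (2 & 1) (0 & 1)) ∷ into6-2 e₁ (at⁺ (3 & 0) (3 &- 1) (2 -&- 1) (1 & 1)) (at⁺ (4 & 0) (3 &- 1) (4 -&- 2) (0 & 1)) ∷ []) ∷ []) ∷ [])

 grams6 : List Gram
 grams6 = g6-0 ∷ g6-1 ∷ g6-2 ∷ g6-3 ∷ []

 g7-0 : Gram
 g7-0 = gram 1O 1O (2 & 0) 0O 0O (0 & 1)

 g7-1 : Gram
 g7-1 = gram (8 & 3) (8 & 3) (16 & 6) 0O 0O (21 & 8)

 f7-0 : Cert
 f7-0 = final 0 (part (tri 1O 0O 0O) (tri 1O 0O 0O) (residue 2 2 (+ 0)) ∷ []) ([])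

 into7-0 : Combo → Combo → Combo → Cert
 into7-0 u v w = rebase u v w [] g7-0 [] f7-0

 f7-1 : Cert
 f7-1 = final 1 (part (tri 1O 0O 0O) (tri 1O 0O 0O) (residue 2 2 (+ 0)) ∷ []) ([])

 into7-1 : Combo → Combo → Combo → Cert
 into7-1 u v w = rebase u v w [] g7-1 [] f7-1

 c7 : Cert₁
 c7 = target₁ (3 &- 1) (target₂ (3 & 0) (into7-0 (at -1O 1O 1O) (at (2 -& 1) (2 & 0) 0O) (at (4 &- 1) (0 & 1) 0O) ∷ into7-0 (at (1 &- 1) -1O 1O) (at (2 -& 1) (2 & 0) 0O) (at (4 &- 1) (0 & 1) 0O) ∷ into7-0 (at (1 &- 1) (2 -& 0) 1O) (at (2 -& 1) (2 & 0) 0O) (at (4 &- 1) (0 & 1) 0O) ∷ target (9 &- 3) (into7-1 (at⁺ (2 &- 3) 0O (2 -& 2) (0 & 1)) (at 1O (3 -&- 1) 0O) (at -1O (5 -&- 2) 0O) ∷ into7-1 (at⁺ (5 -& 0) 0O (5 &- 1) (0 & 1)) (at 1O (3 -&- 1) 0O) (at -1O (5 -&- 2) 0O) ∷ into7-1 (at⁺ (5 -& 0) (0 &- 2) (2 -& 2) (0 & 1)) (at 1O (3 -&- 1) 0O) (at -1O (5 -&- 2) 0O) ∷ into7-1 (at⁺ (12 -& 3) (0 &- 2) (5 &- 1) (0 & 1)) (at 1O (3 -&- 1) 0O) (at -1O (5 -&- 2) 0O) ∷ []) ∷ into7-0 (at (3 -& 1) (2 & 0) 1O) (at (2 -& 1)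 (2 & 0) 0O) (at (4 &- 1) (0 & 1) 0O) ∷ into7-0 (at (3 &- 1) (0 & 1) 1O) (at (2 -& 1) (2 & 0) 0O) (at (4 &- 1) (0 & 1) 0O) ∷ into7-0 (at (4 -& 1) (0 &- 1) 1O) (at (2 -& 1) (2 & 0) 0O) (at (4 &- 1) (0 & 1) 0O) ∷ target (9 &- 3) (into7-1 (at⁺ (18 -& 5) (4 &- 4) (2 -& 2) (0 & 1)) (at 1O (3 -&- 1) 0O) (at -1O (5 -&- 2) 0O) ∷ into7-1 (at⁺ (17 &- 8) (10 -& 2) (5 &- 1) (0 & 1)) (at 1O (3 -&- 1) 0O) (at -1O (5 -&- 2) 0O) ∷ into7-1 (at⁺ (25 -& 8) (4 &- 6) (2 -& 2) (0 & 1)) (at 1O (3 -&- 1) 0O) (at -1O (5 -&- 2) 0O) ∷ into7-1 (at⁺ (10 &- 5) (10 -& 0) (5 &- 1) (0 & 1)) (at 1O (3 -&- 1) 0O) (at -1O (5 -&- 2) 0O) ∷ []) ∷ leaf (6 & 0) ∷ []) ∷ target₂ (3 & 0) (leaf (2 & 0) ∷ target (8 &- 3) (into7-0 (at⁺ (5 &- 3) (4 &- 1) 1O (0 & 2)) (at⁺ (3 &- 1) (1 &- 1) 0O (0 & 1)) (at⁺ (4 &- 1) (0 &- 1) 0O (0 & 1)) ∷ into7-0 (at⁺ (5 &- 2) (3 -& 0) 1O (0 & 1)) (at⁺ (10 &- 3) (6 -& 0) 0O (0 & 2)) (at⁺ (11 &- 3) (7 -& 0) 0O (0 & 2)) ∷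 []) ∷ leaf (2 & 0) ∷ target (8 &- 3) (into7-0 (at⁺ (2 &- 2) (3 & 0) 1O (0 & 1)) (at⁺ (3 &- 1) (1 &- 1) 0O (0 & 1)) (at⁺ (4 &- 1) (0 &- 1) 0O (0 & 1)) ∷ into7-0 (at⁺ (9 &- 4) (4 -& 1) 1O (0 & 2)) (at⁺ (10 &- 3) (6 -& 0) 0O (0 & 2)) (at⁺ (11 &- 3) (7 -& 0) 0O (0 & 2)) ∷ []) ∷ leaf (2 & 0) ∷ leaf (2 & 0) ∷ leaf (3 & 1) ∷ target (8 &- 3) (into7-0 (at⁺ (2 &- 1) (1 &- 1) 1O (0 & 1)) (at⁺ (3 &- 1) (1 &- 1) 0O (0 & 1)) (at⁺ (4 &- 1) (0 &- 1) 0O (0 & 1)) ∷ into7-0 (at⁺ (9 &- 3) (6 -& 0) 1O (0 & 2)) (at⁺ (10 &- 3) (6 -& 0) 0O (0 & 2)) (at⁺ (11 &- 3) (7 -& 0) 0O (0 & 2)) ∷ []) ∷ leaf (3 & 1) ∷ target (8 &- 3) (into7-0 (at⁺ (3 &- 3) (6 & 0) 1O (0 & 2)) (at⁺ (3 &- 1) (1 &- 1) 0O (0 & 1)) (at⁺ (4 &- 1) (0 &- 1) 0O (0 & 1)) ∷ into7-0 (at⁺ (3 &- 2) (1 -& 1) 1O (0 & 1)) (at⁺ (10 &- 3) (6 -& 0) 0O (0 & 2)) (at⁺ (11 &- 3) (7 -& 0) 0O (0 & 2)) ∷ []) ∷ target (4 &- 1) (target (9 &- 3) (into7-1 (combo (tri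 (2 &- 3) 0O (2 -& 2)) (0 & 1 ∷ 0 & 0 ∷ [])) (combo (tri (13 & 2) (9 -&- 5) 0O) (0 & 0 ∷ 0 & 2 ∷ [])) (at (5 & 2) (8 -&- 3) 0O) ∷ into7-1 (combo (tri (5 -& 0) 0O (5 &- 1)) (0 & 1 ∷ 0 & 0 ∷ [])) (combo (tri (13 & 2) (9 -&- 5) 0O) (0 & 0 ∷ 0 & 2 ∷ [])) (at (5 & 2) (8 -&- 3) 0O) ∷ into7-1 (combo (tri (9 &- 2) (0 &- 2) (2 -& 2)) (0 & 1 ∷ 0 & 2 ∷ [])) (combo (tri (13 & 2) (9 -&- 5) 0O) (0 & 0 ∷ 0 & 2 ∷ [])) (at (5 & 2) (8 -&- 3) 0O) ∷ into7-1 (combo (tri (2 & 1) (0 &- 2) (5 &- 1)) (0 & 1 ∷ 0 & 2 ∷ [])) (combo (tri (13 & 2) (9 -&- 5) 0O) (0 & 0 ∷ 0 & 2 ∷ [])) (at (5 & 2) (8 -&- 3) 0O) ∷ []) ∷ target (9 &- 3) (into7-1 (combo (tri (2 &- 3) 0O (2 -& 2)) (0 & 1 ∷ 0 & 0 ∷ [])) (combo (tri (6 & 0) (2 -& 0) 0O) (0 & 0 ∷ 0 & 1 ∷ [])) (at (5 & 2) (8 -&- 3) 0O) ∷ into7-1 (combo (tri (5 -& 0) 0O (5 &- 1)) (0 & 1 ∷ 0 & 0 ∷ [])) (combo (tri (6 & 0) (2 -& 0) 0O) (0 & 0 ∷ 0 & 1 ∷ [])) (at (5 & 2) (8 -&-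 3) 0O) ∷ into7-1 (combo (tri (2 &- 4) (7 & 3) (2 -& 2)) (0 & 1 ∷ 0 & 1 ∷ [])) (combo (tri (6 & 0) (2 -& 0) 0O) (0 & 0 ∷ 0 & 1 ∷ [])) (at (5 & 2) (8 -&- 3) 0O) ∷ into7-1 (combo (tri (5 -&- 1) (7 & 3) (5 &- 1)) (0 & 1 ∷ 0 & 1 ∷ [])) (combo (tri (6 & 0) (2 -& 0) 0O) (0 & 0 ∷ 0 & 1 ∷ [])) (at (5 & 2) (8 -&- 3) 0O) ∷ []) ∷ target (3 & 1) (into7-1 (combo (tri (5 -& 0) 0O (5 & 0)) (0 & 0 ∷ 0 & 1 ∷ [])) (combo (tri -1O (9 -&- 3) 0O) (0 & 2 ∷ 0 & 0 ∷ [])) (at (5 & 2) (8 -&- 3) 0O) ∷ into7-1 (combo (tri (5 -& 0) 0O (5 & 0)) (0 & 0 ∷ 0 & 1 ∷ [])) (combo (tri -1O (2 -&- 1) 0O) (0 & 1 ∷ 0 & 0 ∷ [])) (at (5 & 2) (8 -&- 3) 0O) ∷ into7-1 (combo (tri (5 -& 0) 0O (5 & 0)) (0 & 0 ∷ 0 & 1 ∷ [])) (combo (tri (13 & 4) (23 -&- 9) 0O) (0 & 2 ∷ 0 & 0 ∷ [])) (at (5 & 2) (8 -&- 3) 0O) ∷ into7-1 (combo (tri (5 -& 0) 0O (5 & 0)) (0 & 0 ∷ 0 & 1 ∷ [])) (combo (tri (1 -&- 1) (5 & 2) 0O) (0 & 1 ∷ 0 & 0 ∷ [])) (at (5 & 2)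 (8 -&- 3) 0O) ∷ []) ∷ []) ∷ target (8 &- 3) (into7-0 (at⁺ (3 &- 3) (7 & 0) 1O (0 & 2)) (at⁺ (3 &- 1) (1 &- 1) 0O (0 & 1)) (at⁺ (4 &- 1) (0 &- 1) 0O (0 & 1)) ∷ into7-0 (at⁺ (3 &- 2) (0 & 1) 1O (0 & 1)) (at⁺ (10 &- 3) (6 -& 0) 0O (0 & 2)) (at⁺ (11 &- 3) (7 -& 0) 0O (0 & 2)) ∷ []) ∷ leaf (2 & 0) ∷ target (8 &- 3) (into7-0 (at⁺ (3 &- 1) (0 &- 1) 1O (0 & 1)) (at⁺ (3 &- 1) (1 &- 1) 0O (0 & 1)) (at⁺ (4 &- 1) (0 &- 1) 0O (0 & 1)) ∷ into7-0 (at⁺ (10 &- 3) (7 -& 0) 1O (0 & 2)) (at⁺ (10 &- 3) (6 -& 0) 0O (0 & 2)) (at⁺ (11 &- 3) (7 -& 0) 0O (0 & 2)) ∷ []) ∷ leaf (2 & 0) ∷ leaf (2 & 0) ∷ leaf (2 & 0) ∷ leaf (2 & 0) ∷ target (8 &- 3) (target (9 &- 3) (into7-1 (combo (tri (1 -&- 3) (9 & 1) (2 -& 2)) (0 & 1 ∷ 0 & 1 ∷ [])) (combo (tri (6 & 0) (2 -&- 2) 0O) (0 & 0 ∷ 0 & 1 ∷ [])) (at (5 & 2) (8 -&- 3) 0O) ∷ into7-1 (combo (tri (1 -&- 2) (2 & 2) (5 &- 1)) (0 & 1 ∷ 0 & 0 ∷ [])) (combo (tri (6 & 0) (2 -&-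 2) 0O) (0 & 0 ∷ 0 & 1 ∷ [])) (at (5 & 2) (8 -&- 3) 0O) ∷ into7-1 (combo (tri (1 -&- 4) (16 & 2) (2 -& 2)) (0 & 1 ∷ 0 & 2 ∷ [])) (combo (tri (6 & 0) (2 -&- 2) 0O) (0 & 0 ∷ 0 & 1 ∷ [])) (at (5 & 2) (8 -&- 3) 0O) ∷ into7-1 (combo (tri (1 -&- 3) (9 & 3) (5 &- 1)) (0 & 1 ∷ 0 & 1 ∷ [])) (combo (tri (6 & 0) (2 -&- 2) 0O) (0 & 0 ∷ 0 & 1 ∷ [])) (at (5 & 2) (8 -&- 3) 0O) ∷ []) ∷ target (9 &- 3) (into7-1 (combo (tri (6 &- 5) (2 & 2) (2 -& 2)) (0 & 1 ∷ 0 & 2 ∷ [])) (combo (tri (13 &- 2) (9 -&- 1) 0O) (0 & 0 ∷ 0 & 2 ∷ [])) (at (5 & 2) (8 -&- 3) 0O) ∷ into7-1 (combo (tri (1 -&- 2) (2 & 2) (5 &- 1)) (0 & 1 ∷ 0 & 0 ∷ [])) (combo (tri (13 &- 2) (9 -&- 1) 0O) (0 & 0 ∷ 0 & 2 ∷ [])) (at (5 & 2) (8 -&- 3) 0O) ∷ into7-1 (combo (tri (1 -&- 3) (9 & 3) (2 -& 2)) (0 & 1 ∷ 0 & 1 ∷ [])) (combo (tri (13 &- 2) (9 -&- 1) 0O) (0 & 0 ∷ 0 & 2 ∷ [])) (at (5 & 2) (8 -&- 3) 0O) ∷ into7-1 (combo (tri (6 &- 5) (2 & 4) (5 &- 1))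 (0 & 1 ∷ 0 & 2 ∷ [])) (combo (tri (13 &- 2) (9 -&- 1) 0O) (0 & 0 ∷ 0 & 2 ∷ [])) (at (5 & 2) (8 -&- 3) 0O) ∷ []) ∷ into7-1 (at⁺ (1 -&- 1) (2 & 2) (5 &- 1) (0 & 1)) (at⁺ (6 & 1) (9 -&- 1) (7 &- 3) (0 & 2)) (at (5 & 2) (8 -&- 3) 0O) ∷ []) ∷ leaf (2 & 0) ∷ leaf (6 & 0) ∷ []) ∷ target₂ (8 &- 3) (leaf (3 & 0) ∷ target (3 & 1) (into7-0 e₁ (at⁺ 0O (5 -&- 2) (3 -&- 1) (0 & 1)) (at 0O -1O (3 & 1)) ∷ into7-0 e₁ (at⁺ 0O (5 -&- 2) (11 & 4) (0 & 1)) (at 0O -1O (3 & 1)) ∷ into7-0 e₁ (at⁺ 0O (5 -&- 3) (17 -&- 6) (0 & 2)) (at 0O -1O (3 & 1)) ∷ into7-0 e₁ (at⁺ 0O (5 -&- 3) (25 & 10) (0 & 2)) (at 0O -1O (3 & 1)) ∷ []) ∷ into7-0 e₁ (at 0O (3 & 1) (8 & 3)) (at 0O (5 & 2) (13 & 5)) ∷ leaf (3 & 1) ∷ []) ∷ [])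

 grams7 : List Gram
 grams7 = g7-0 ∷ g7-1 ∷ []

 g10-0 : Gram
 g10-0 = gram 1O (4 & 1) (4 & 0) 0O (2 & 0) (6 & 1)

 -- The determinant is 4 and the adjugate modulo 4 needs three parts; their representative counts
 -- multiply to 16, the norm of 4.
 f10-0 : Cert
 f10-0 = final 0 (part (tri (2 & 0) (0 & 2) 0O) (tri 1O 0O 0O) (residue 2 2 (+ 0)) ∷ part (tri (0 & 2) 0O (0 & 2)) (tri 0O 1O 0O) (residue 2 1 (+ 0)) ∷ part (tri 0O (0 & 2) 0O) (tri 0O 0O 1O) (residue 2 1 (+ 0)) ∷ []) ([])

 -- Each `rebase` carries one extra vector, √10/2 times the third basis vector. Its products with
 -- the basis are √10, 5 + 3√10 and 4√10.
 c10 : Cert₁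
 c10 = target₁ (4 &- 1) (target₂ (5 &- 1) (target (11 &- 3) (rebase (at 0O -1O 1O) (at (2 & 0) -1O 0O) (at 1O (2 -& 0) 1O) ((at⁺ (3 & 0) (1 &- 1) (2 -& 1) 1O) ∷ []) g10-0 ((tri (0 & 1) (5 & 3) (0 & 4)) ∷ []) f10-0 ∷ rebase (at 0O -1O 1O) (at (2 & 0) -1O 0O) (at 1O (2 -& 0) 1O) ((at⁺ (3 & 0) (3 -& 0) (2 & 0) 1O) ∷ []) g10-0 ((tri (0 & 1) (5 & 3) (0 & 4)) ∷ []) f10-0 ∷ rebase (at 0O -1O 1O) (at (2 & 0) -1O 0O) (at 1O (2 -& 0) 1O) ((at⁺ (4 -& 2) (3 &- 2) (2 -& 1) 1O) ∷ []) g10-0 ((tri (0 & 1) (5 & 3) (0 & 4)) ∷ []) f10-0 ∷ rebase (at 0O -1O 1O) (at (2 & 0) -1O 0O) (at 1O (2 -& 0) 1O) ((at⁺ (4 -& 2) (1 -&- 1) (2 & 0) 1O) ∷ []) g10-0 ((tri (0 & 1) (5 & 3) (0 & 4)) ∷ []) f10-0 ∷ []) ∷ leaf (6 &- 1) ∷ target (11 &- 3) (rebase (at (2 -& 1) 1O 1O) (at (2 & 0) -1O 0O) (at (1 -& 1) 0O 1O) ((at⁺ (17 &- 4) (3 -& 1) (2 -& 1) 1O) ∷ []) g10-0 ((tri (0 & 1) (5 & 3) (0 & 4)) ∷ []) f10-0 ∷ rebase (at (2 -& 1) 1O 1O) (at (2 & 0) -1O 0O) (at (1 -& 1) 0O 1O)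 ((at⁺ (1 -& 2) 1O (2 & 0) 1O) ∷ []) g10-0 ((tri (0 & 1) (5 & 3) (0 & 4)) ∷ []) f10-0 ∷ rebase (at (2 -& 1) 1O 1O) (at (2 & 0) -1O 0O) (at (1 -& 1) 0O 1O) ((at⁺ (10 &- 2) -1O (2 -& 1) 1O) ∷ []) g10-0 ((tri (0 & 1) (5 & 3) (0 & 4)) ∷ []) f10-0 ∷ rebase (at (2 -& 1) 1O 1O) (at (2 & 0) -1O 0O) (at (1 -& 1) 0O 1O) ((at⁺ (8 -& 4) (3 &- 1) (2 & 0) 1O) ∷ []) g10-0 ((tri (0 & 1) (5 & 3) (0 & 4)) ∷ []) f10-0 ∷ []) ∷ leaf (10 &- 3) ∷ leaf (10 &- 3) ∷ leaf (7 &- 1) ∷ leaf (5 & 1) ∷ leaf (7 &- 1) ∷ leaf (9 &- 1) ∷ leaf (5 & 1) ∷ target (6 &- 1) (rebase (at⁺ (13 -& 2) (5 -&- 4) (4 -&- 2) (0 & 1)) (at (2 & 0) -1O 0O) (at⁺ (12 -& 2) (6 -&- 4) (4 -&- 2) (0 & 1)) ((at⁺ (15 -& 3) (5 -&- 5) (5 -&- 2) (0 & 1)) ∷ []) g10-0 ((tri (0 & 1) (5 & 3) (0 & 4)) ∷ []) f10-0 ∷ rebase (at⁺ (33 -& 11) (25 &- 1) (6 & 3) (0 & 2)) (at (2 & 0) -1O 0O) (at⁺ (32 -& 11) (24 &- 1) (6 & 3) (0 & 2)) ((at⁺ (35 -& 12) (25 &- 2) (5 & 3) (0 & 2)) ∷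 []) g10-0 ((tri (0 & 1) (5 & 3) (0 & 4)) ∷ []) f10-0 ∷ rebase (at⁺ (27 &- 7) (5 & 7) (6 & 3) (0 & 2)) (at (2 & 0) -1O 0O) (at⁺ (28 &- 7) (4 & 7) (6 & 3) (0 & 2)) ((at⁺ (25 &- 6) (5 & 6) (5 & 3) (0 & 2)) ∷ []) g10-0 ((tri (0 & 1) (5 & 3) (0 & 4)) ∷ []) f10-0 ∷ rebase (at⁺ (17 &- 7) (15 -& 0) (4 -&- 2) (0 & 1)) (at (2 & 0) -1O 0O) (at⁺ (18 &- 7) (16 -& 0) (4 -&- 2) (0 & 1)) ((at⁺ (15 &- 6) (15 -&- 1) (5 -&- 2) (0 & 1)) ∷ []) g10-0 ((tri (0 & 1) (5 & 3) (0 & 4)) ∷ []) f10-0 ∷ []) ∷ target (6 &- 1) (rebase (at⁺ (33 -& 2) (5 -&- 7) (6 & 3) (0 & 2)) (at (2 & 0) -1O 0O) (at⁺ (32 -& 2) (6 -&- 7) (6 & 3) (0 & 2)) ((at⁺ (30 -& 2) (5 -&- 7) (5 & 3) (0 & 2)) ∷ []) g10-0 ((tri (0 & 1) (5 & 3) (0 & 4)) ∷ []) f10-0 ∷ rebase (at⁺ (13 -& 8) (15 & 0) (4 -&- 2) (0 & 1)) (at (2 & 0) -1O 0O) (at⁺ (12 -& 8) (14 & 0) (4 -&- 2) (0 & 1)) ((at⁺ (10 -& 8) (15 & 0) (5 -&- 2) (0 & 1)) ∷ []) g10-0 ((tri (0 & 1) (5 & 3) (0 & 4)) ∷ []) f10-0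 ∷ rebase (at⁺ (17 &- 1) (5 & 4) (4 -&- 2) (0 & 1)) (at (2 & 0) -1O 0O) (at⁺ (18 &- 1) (4 & 4) (4 -&- 2) (0 & 1)) ((at⁺ (20 &- 1) (5 & 4) (5 -&- 2) (0 & 1)) ∷ []) g10-0 ((tri (0 & 1) (5 & 3) (0 & 4)) ∷ []) f10-0 ∷ rebase (at⁺ (27 &- 16) (25 -& 1) (6 & 3) (0 & 2)) (at (2 & 0) -1O 0O) (at⁺ (28 &- 16) (26 -& 1) (6 & 3) (0 & 2)) ((at⁺ (30 &- 16) (25 -& 1) (5 & 3) (0 & 2)) ∷ []) g10-0 ((tri (0 & 1) (5 & 3) (0 & 4)) ∷ []) f10-0 ∷ []) ∷ leaf (9 &- 1) ∷ leaf (5 & 1) ∷ leaf (5 & 1) ∷ leaf (5 & 1) ∷ []) ∷ target₂ (2 & 0) (leaves (5 &- 1 ∷ 5 &- 1 ∷ 5 &- 1 ∷ 3 & 0 ∷ 5 &- 1 ∷ 10 &- 3 ∷ 4 & 1 ∷ 10 &- 3 ∷ 10 &- 3 ∷ 4 & 1 ∷ 10 &- 3 ∷ 3 & 0 ∷ 3 & 0 ∷ 3 & 0 ∷ 3 & 0 ∷ 10 &- 3 ∷ 5 &- 1 ∷ 5 &- 1 ∷ 5 &- 1 ∷ 10 &- 3 ∷ 4 & 1 ∷ 4 & 1 ∷ [])) ∷ target₂ (2 & 0) (target (11 &- 3) (rebase e₁ (at (0 &- 1) -1O (0 & 1)) (at (2 &- 1) -1O (1 -& 1)) ((at⁺ (10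 -& 2) (1 &- 1) (8 &- 1) 1O) ∷ []) g10-0 ((tri (0 & 1) (5 & 3) (0 & 4)) ∷ []) f10-0 ∷ rebase e₁ (at (0 &- 1) -1O (0 & 1)) (at (2 &- 1) -1O (1 -& 1)) ((at⁺ (4 -& 1) -1O (2 & 0) 1O) ∷ []) g10-0 ((tri (0 & 1) (5 & 3) (0 & 4)) ∷ []) f10-0 ∷ rebase e₁ (at (0 &- 1) -1O (0 & 1)) (at (2 &- 1) -1O (1 -& 1)) ((at⁺ (3 -& 0) -1O (1 & 1) 1O) ∷ []) g10-0 ((tri (0 & 1) (5 & 3) (0 & 4)) ∷ []) f10-0 ∷ rebase e₁ (at (0 &- 1) -1O (0 & 1)) (at (2 &- 1) -1O (1 -& 1)) ((at⁺ (11 -& 3) (1 &- 1) (9 &- 2) 1O) ∷ []) g10-0 ((tri (0 & 1) (5 & 3) (0 & 4)) ∷ []) f10-0 ∷ []) ∷ target (11 &- 3) (rebase e₁ (at (0 & 1) -1O (0 &- 1)) (at (0 & 1) -1O (1 &- 1)) ((at⁺ (6 & 0) (1 &- 1) (8 -& 1) 1O) ∷ []) g10-0 ((tri (0 & 1) (5 & 3) (0 & 4)) ∷ []) f10-0 ∷ rebase e₁ (at (0 & 1) -1O (0 &- 1)) (at (0 & 1) -1O (1 &- 1)) ((at⁺ (0 & 1) -1O (2 -& 0) 1O) ∷ []) g10-0 ((tri (0 & 1) (5 & 3) (0 & 4)) ∷ []) f10-0 ∷ rebase e₁ (at (0 & 1) -1O (0 &- 1)) (at (0 & 1) -1O (1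 &- 1)) ((at⁺ (1 -& 2) -1O (1 -&- 1) 1O) ∷ []) g10-0 ((tri (0 & 1) (5 & 3) (0 & 4)) ∷ []) f10-0 ∷ rebase e₁ (at (0 & 1) -1O (0 &- 1)) (at (0 & 1) -1O (1 &- 1)) ((at⁺ (7 &- 1) (1 &- 1) (9 -& 2) 1O) ∷ []) g10-0 ((tri (0 & 1) (5 & 3) (0 & 4)) ∷ []) f10-0 ∷ []) ∷ leaf (3 & 0) ∷ leaf (3 & 0) ∷ leaf (3 & 0) ∷ leaf (4 & 1) ∷ leaf (3 & 0) ∷ leaf (3 & 0) ∷ leaf (4 & 1) ∷ leaf (3 & 0) ∷ leaf (3 & 0) ∷ leaf (3 & 0) ∷ leaf (3 & 0) ∷ leaf (3 & 0) ∷ leaf (3 & 0) ∷ leaf (3 & 0) ∷ leaf (6 &- 1) ∷ leaf (4 & 1) ∷ leaf (4 & 1) ∷ leaf (6 &- 1) ∷ target (11 &- 3) (rebase e₁ (at⁺ (20 &- 8) (9 & 6) (15 -&- 1) (0 & 4)) (at⁺ (26 &- 10) (10 & 7) (18 -&- 1) (0 & 5)) ((at⁺ (2 -& 1) (3 & 1) (1 -&- 1) 1O) ∷ []) g10-0 ((tri (0 & 1) (5 & 3) (0 & 4)) ∷ []) f10-0 ∷ rebase e₁ (at⁺ (10 &- 4) (1 -&- 2) (5 & 0) (0 & 2)) (at⁺ (6 &- 2) (0 &- 1) (2 & 0) (0 & 1)) ((at⁺ (8 &- 3) (3 -&- 2) (6 & 0) (1 & 2)) ∷ []) g10-0 ((tri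 (0 & 1) (5 & 3) (0 & 4)) ∷ []) f10-0 ∷ rebase e₁ (at⁺ (20 &- 8) (9 & 6) (5 &- 5) (0 & 4)) (at⁺ (26 &- 10) (10 & 7) (7 &- 6) (0 & 5)) ((at⁺ (13 &- 5) (8 & 5) (3 &- 4) (1 & 3)) ∷ []) g10-0 ((tri (0 & 1) (5 & 3) (0 & 4)) ∷ []) f10-0 ∷ rebase e₁ (at⁺ (10 &- 4) (1 -&- 2) (5 -& 2) (0 & 2)) (at⁺ (6 &- 2) (0 &- 1) (3 -& 1) (0 & 1)) ((at⁺ (23 &- 9) (8 -&- 6) (8 -& 5) (1 & 5)) ∷ []) g10-0 ((tri (0 & 1) (5 & 3) (0 & 4)) ∷ []) f10-0 ∷ []) ∷ leaf (4 & 1) ∷ leaf (5 & 1) ∷ []) ∷ [])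

 g13-0 : Gram
 g13-0 = gram 1O 1O (2 & 0) 0O (0 & 1) (1 &- 1)

 g13-1 : Gram
 g13-1 = gram 1O 1O (2 & 0) 1O 0O (0 & 1)

 -- The conjugate of `g13-1`, since ω goes to 1 - ω. Conjugation preserves universality, whence the
 -- conjugate pairs in the list.
 g13-2 : Gram
 g13-2 = gram 1O 1O (2 & 0) 1O 0O (1 &- 1)

 g13-3 : Gram
 g13-3 = gram 1O (2 & 0) (3 & 1) (0 & 1) (2 & 0) 0O

 g13-4 : Gram
 g13-4 = gram 1O (2 & 0) (4 &- 1) (1 &- 1) (2 & 0) 0O

 g13-5 : Gram
 g13-5 = gram 1O 1O (2 & 1) 0O 0O (0 & 1)

 g13-6 : Gram
 g13-6 = gram 1O (2 & 0) (2 & 1) 0O (0 & 1) (0 & 1)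

 g13-7 : Gram
 g13-7 = gram 1O (2 & 0) (3 &- 1) 0O (1 &- 1) (1 &- 1)

 f13-0 : Cert
 f13-0 = final 0 (part (tri 1O (1 & 1) 0O) (tri (0 & 1) 1O 0O) (residue 2 2 (+ 0)) ∷ []) ([])

 into13-0 : Combo → Combo → Combo → Cert
 into13-0 u v w = rebase u v w [] g13-0 [] f13-0

 f13-1 : Cert
 f13-1 = final 1 (part (tri (2 & 1) (2 & 0) (3 & 0)) (tri (4 & 1) (4 & 0) (3 & 0)) (residue 6 2 (+ 0)) ∷ []) ([])

 into13-1 : Combo → Combo → Combo → Cert
 into13-1 u v w = rebase u v w [] g13-1 [] f13-1

 -- Half the determinant has norm 9, while that of `g13-0` is 1. The lattice is not maximal: two
 -- enlargements survive, and each of them leads to `g13-0`.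
 f13-7 : Cert
 f13-7 = final 7 (part (tri (10 & 1) (2 & 1) (10 & 0)) (tri (11 & 0) 1O (8 & 0)) (residue 18 2 (+ 6)) ∷ []) (into13-0 (at⁺ (28 -&- 20) (9 -&- 7) (22 -&- 16) 1O) e₁ (at⁺ (55 -&- 41) (19 -&- 14) (45 -&- 32) (2 & 0)) ∷ into13-0 (at⁺ (113 -&- 82) (38 -&- 29) (92 -&- 66) (2 & 0)) e₁ (at⁺ (55 -&- 41) (19 -&- 14) (45 -&- 32) 1O) ∷ [])

 into13-7 : Combo → Combo → Combo → Cert
 into13-7 u v w = rebase u v w [] g13-7 [] f13-7

 f13-3 : Cert
 f13-3 = final 3 (part (tri (26 & 0) (26 & 0) (13 & 1)) (tri (18 & 0) (18 & 0) 1O) (residue 34 2 (+ 8)) ∷ []) ([])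

 into13-3 : Combo → Combo → Combo → Cert
 into13-3 u v w = rebase u v w [] g13-3 [] f13-3

 f13-6 : Cert
 f13-6 = final 6 (part (tri (3 & 1) (13 & 1) (10 & 0)) (tri (11 & 0) 1O (8 & 0)) (residue 18 2 (+ 10)) ∷ []) (into13-0 (at⁺ (9 &- 5) (59 &- 28) (52 &- 24) (0 & 1)) (at⁺ (15 &- 8) (116 &- 55) (98 &- 46) (0 & 2)) (at⁺ (14 &- 8) (115 &- 55) (97 &- 45) (0 & 2)) ∷ into13-0 (at⁺ (33 &- 18) (233 &- 111) (202 &- 94) (0 & 2)) (at⁺ (15 &- 8) (116 &- 55) (98 &- 46) (0 & 1)) (at⁺ (14 &- 8) (115 &- 55) (97 &- 45) (0 & 1)) ∷ [])

 into13-6 : Combo → Combo → Combo → Cert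
 into13-6 u v w = rebase u v w [] g13-6 [] f13-6

 f13-2 : Cert
 f13-2 = final 2 (part (tri (1 & 1) (2 & 0) (3 & 0)) (tri (3 & 1) (4 & 0) (3 & 0)) (residue 6 2 (+ 4)) ∷ []) ([])

 into13-2 : Combo → Combo → Combo → Cert
 into13-2 u v w = rebase u v w [] g13-2 [] f13-2

 f13-5 : Cert
 f13-5 = final 5 (part (tri (19 & 1) (12 & 0) (4 & 0)) (tri (13 & 0) (16 & 0) (14 & 0)) (residue 26 2 (+ 12)) ∷ []) ([])

 into13-5 : Combo → Combo → Combo → Cert
 into13-5 u v w = rebase u v w [] g13-5 [] f13-5

 f13-4 : Cert
 f13-4 = final 4 (part (tri (26 & 0) (26 & 0) (4 & 1)) (tri (18 & 0) (18 & 0) 1O) (residue 34 2 (+ 24)) ∷ []) ([])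

 into13-4 : Combo → Combo → Combo → Cert
 into13-4 u v w = rebase u v w [] g13-4 [] f13-4

 c13 : Cert₁
 c13 = target₁ (3 &- 1) (target₂ (2 & 1) (into13-0 (at (2 -& 0) (0 &- 1) 1O) (at (0 &- 1) -1O (1 -& 1)) (at (2 &- 1) (2 -& 0) (2 -& 1)) ∷ into13-0 (at (1 -& 1) (0 &- 1) -1O) (at (2 & 0) -1O (1 &- 1)) (at (3 &- 1) (2 -& 0) (2 &- 1)) ∷ leaf (8 &- 3) ∷ leaf (8 &- 3) ∷ target (16 &- 6) (into13-0 (at⁺ 1O (0 &- 2) (2 -& 0) (0 & 1)) (at⁺ (1 -& 1) -1O (1 &- 1) 1O) (at⁺ 1O (2 -&- 2) (0 &- 1) (1 & 1)) ∷ into13-0 (at⁺ (1 & 1) 1O (1 -&- 1) (1 & 1)) (at⁺ (3 & 0) (2 & 0) (2 &- 2) (0 & 1)) (at⁺ (1 -& 1) -1O -1O 1O) ∷ into13-0 (at⁺ (2 -&- 2) (1 -&- 1) (0 & 1) (1 & 1)) (at⁺ (3 &- 3) -1O (1 -& 1) (0 & 1)) (at⁺ (4 -& 1) (0 &- 1) (3 &- 1) 1O) ∷ into13-0 (at⁺ (4 &- 3) (0 & 1) 1O (0 & 1)) (at⁺ (5 -& 2) (2 & 0) 0O 1O) (at⁺ (0 &- 2) (1 & 1) (2 & 0) (1 & 1)) ∷ into13-0 (at⁺ (2 -& 2) (3 &- 1) (2 -& 1) (0 & 1)) (at⁺ (2 & 0) (1 -& 1) (2 &- 1) 1O) (at⁺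 (1 & 1) 1O 1O (1 & 1)) ∷ into13-0 (at⁺ (0 & 1) (0 &- 1) 1O (1 & 1)) (at⁺ (0 & 1) (2 &- 1) (5 &- 2) (0 & 1)) (at⁺ 1O (2 -& 0) (2 -& 1) 1O) ∷ into13-0 (at⁺ (7 &- 1) (3 -& 0) (1 &- 1) (0 & 1)) (at⁺ (4 -& 3) (2 &- 1) -1O 1O) (at⁺ (4 & 1) (2 -&- 1) (1 &- 1) (1 & 1)) ∷ into13-0 (at⁺ (3 & 2) 0O (2 -& 0) (1 & 1)) (at⁺ (6 & 0) (1 -& 1) (4 -& 1) (0 & 1)) (at⁺ (2 -& 2) (1 &- 1) (4 &- 2) 1O) ∷ into13-0 (at⁺ (4 &- 1) (2 -& 1) -1O 1O) (at⁺ (0 & 2) (3 & 1) (0 &- 1) (1 & 1)) (at⁺ (4 -& 3) (4 &- 1) (1 &- 1) (0 & 1)) ∷ into13-0 (at⁺ (3 &- 1) (3 -& 0) (3 -& 1) 1O) (at⁺ (1 -& 1) (1 -&- 2) (1 &- 1) (1 & 1)) (at⁺ (4 -& 2) (1 &- 3) (4 &- 2) (0 & 1)) ∷ into13-0 (at⁺ (1 &- 1) -1O (3 &- 1) 1O) (at⁺ (3 -&- 1) 1O (1 & 1) (1 & 1)) (at⁺ (4 -& 0) (1 &- 1) (2 -& 2) (0 & 1)) ∷ into13-0 (at⁺ (0 & 1) (0 &- 1) (3 &- 2) 1O) (at⁺ (2 & 2) (1 -&- 1) (2 -&- 1) (1 & 1)) (at⁺ (2 & 1) (2 -&- 1) (5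 -& 1) (0 & 1)) ∷ []) ∷ target (16 &- 6) (into13-0 (at⁺ (1 -&- 2) (0 &- 2) (2 & 0) (0 & 1)) (at⁺ (3 -& 0) -1O (1 -& 1) 1O) (at⁺ (2 -&- 2) (2 -&- 2) (0 & 1) (1 & 1)) ∷ into13-0 (at⁺ (3 -&- 2) 1O (1 & 1) (1 & 1)) (at⁺ (1 -&- 2) (2 & 0) (2 -& 2) (0 & 1)) (at⁺ (2 -& 0) -1O 1O 1O) ∷ into13-0 (at⁺ 1O (1 -&- 1) (0 &- 1) (1 & 1)) (at⁺ (5 &- 2) -1O (1 &- 1) (0 & 1)) (at⁺ (4 -& 2) (0 &- 1) (3 -& 1) 1O) ∷ into13-0 (at⁺ (5 &- 2) (0 & 1) -1O (0 & 1)) (at⁺ (5 -& 2) (2 & 0) 0O 1O) (at⁺ (2 & 0) (1 & 1) (2 -& 0) (1 & 1)) ∷ into13-0 (at⁺ (1 -& 2) (3 &- 1) (2 &- 1) (0 & 1)) (at⁺ 1O (1 -& 1) (2 -& 1) 1O) (at⁺ (2 & 2) 1O -1O (1 & 1)) ∷ into13-0 (at⁺ (1 & 2) (0 &- 1) -1O (1 & 1)) (at⁺ (1 -& 2) (2 &- 1) (5 -& 2) (0 & 1)) (at⁺ (2 & 0) (2 -& 0) (2 &- 1) 1O) ∷ into13-0 (at⁺ (5 &- 2) (3 -& 0) (1 -& 1) (0 & 1)) (at⁺ (5 -& 2) (2 &- 1) 1O 1O) (at⁺ (2 & 0) (2 -&- 1) (1 -& 1) (1 & 1)) ∷ into13-0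 (at⁺ 1O 0O (2 & 0) (1 & 1)) (at⁺ (5 &- 2) (1 -& 1) (4 &- 1) (0 & 1)) (at⁺ (4 -& 2) (1 &- 1) (4 -& 2) 1O) ∷ into13-0 (at⁺ (3 &- 2) (2 -& 1) 1O 1O) (at⁺ (3 -& 0) (3 & 1) (0 & 1) (1 & 1)) (at⁺ (6 -& 2) (4 &- 1) (1 -& 1) (0 & 1)) ∷ into13-0 (at⁺ (3 &- 2) (3 -& 0) (3 &- 1) 1O) (at⁺ (3 -& 0) (1 -&- 2) (1 -& 1) (1 & 1)) (at⁺ (6 -& 2) (1 &- 3) (4 -& 2) (0 & 1)) ∷ into13-0 (at⁺ 1O -1O (3 -& 1) 1O) (at⁺ (1 & 2) 1O (1 -&- 1) (1 & 1)) (at⁺ (0 & 2) (1 &- 1) (2 &- 2) (0 & 1)) ∷ into13-0 (at⁺ (3 -& 0) (0 &- 1) (3 -& 2) 1O) (at⁺ (3 -&- 2) (1 -&- 1) (2 & 1) (1 & 1)) (at⁺ (0 &- 2) (2 -&- 1) (5 &- 1) (0 & 1)) ∷ []) ∷ into13-1 (at 0O -1O (2 -& 1)) e₁ (at (1 -& 1) 1O 0O) ∷ into13-7 e₁ (at (1 -& 1) 1O -1O) (at -1O 0O (2 -& 1)) ∷ into13-0 (at (1 -& 1) 1O -1O) (at (2 & 0) (1 & 1) (1 &- 1)) (at (3 &- 1) -1O (2 &- 1)) ∷ into13-0 (at -1O 1O 1O) (at -1O (1 & 1) (1 -& 1)) (at 0O -1O (2 -& 1)) ∷ into13-7 e₁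 (at -1O 1O 1O) (at (2 &- 1) 0O (2 &- 1)) ∷ into13-1 (at (3 &- 1) -1O (2 &- 1)) e₁ (at (1 -& 1) 1O 0O) ∷ into13-0 (at 0O -1O (2 &- 1)) (at (2 -& 1) (3 &- 1) (5 -& 2)) (at (2 -& 1) (3 &- 2) (7 -& 3)) ∷ leaf (3 & 0) ∷ into13-0 (at 0O (1 -&- 1) -1O) (at (2 -& 1) (0 &- 1) (1 &- 1)) (at (2 -& 1) (0 &- 1) (2 &- 1)) ∷ into13-3 e₁ (at (1 -& 1) 1O 0O) (at 1O (1 -&- 1) -1O) ∷ into13-0 (at -1O (1 -&- 1) 1O) (at -1O (0 &- 1) (1 -& 1)) (at 0O (0 &- 1) (2 -& 1)) ∷ into13-3 e₁ (at (1 -& 1) 1O 0O) (at 0O (1 -&- 1) 1O) ∷ leaf (3 & 0) ∷ into13-0 (at (2 &- 1) -1O (2 -& 1)) (at (7 -& 3) (3 &- 1) (5 &- 2)) (at (9 -& 4) (3 &- 2) (7 &- 3)) ∷ into13-1 (at 0O (1 -&- 1) 1O) e₁ (at (1 -& 1) 1O 0O) ∷ into13-3 e₁ (at (1 -& 1) 1O 0O) (at 1O 0O -1O) ∷ into13-1 (at (2 -& 1) (1 &- 1) (2 -& 1)) e₁ (at (1 -& 1) 1O 0O) ∷ leaf (8 &- 3) ∷ leaf (3 & 0) ∷ []) ∷ target₂ (2 & 0) (into13-1 (at 0O 1O 1O) e₁ (at (0 & 1) 0O -1O) ∷ into13-0 (at (2 & 2) (2 & 1) (1 -&- 1)) e₁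 (at (3 & 1) (1 & 1) (1 -&- 1)) ∷ into13-1 (at (0 & 1) 1O -1O) e₁ e₃ ∷ into13-0 (at -1O (2 & 1) (1 & 1)) e₁ (at (0 &- 1) (1 & 1) (1 & 1)) ∷ into13-7 e₁ (at -1O (1 -&- 1) -1O) e₂ ∷ into13-7 e₁ (at (1 -&- 1) (1 -&- 1) 1O) e₂ ∷ into13-0 (at 0O 1O -1O) e₁ (at (1 &- 1) 0O -1O) ∷ into13-6 e₁ (at 0O 1O -1O) (at (1 & 1) (1 & 1) 0O) ∷ into13-2 (at (0 &- 1) (1 -&- 1) -1O) e₁ e₃ ∷ into13-2 (at -1O (1 -&- 1) 1O) e₁ (at (1 &- 1) 0O -1O) ∷ into13-6 e₁ (at (1 -& 1) 1O 1O) (at (1 & 1) (1 & 1) 0O) ∷ into13-0 (at (1 -& 1) 1O 1O) e₁ e₃ ∷ into13-0 (at -1O 0O 1O) e₁ (at (0 &- 1) -1O 1O) ∷ into13-0 (at (3 -&- 2) (2 -&- 2) (1 & 1)) e₁ (at (2 -&- 3) (3 -&- 2) (1 & 1)) ∷ into13-5 (at -1O 0O 1O) e₁ (at -1O (1 -&- 1) 0O) ∷ into13-0 (at -1O (2 -&- 2) (1 -&- 1)) e₁ (at (0 &- 1) (3 -&- 2) (1 -&- 1)) ∷ into13-0 (at 1O 0O -1O) e₁ (at (2 &- 1) -1O -1O) ∷ into13-0 (at -1O (0 &- 1) -1O) e₁ (at (0 &- 1) (1 -&- 1) -1O) ∷ into13-0 (at (2 -& 0) (0 &- 1) 1O) e₁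 (at (1 -&- 1) (1 -&- 1) 1O) ∷ into13-0 (at (2 & 2) (3 & 2) (1 -&- 1)) e₁ (at (3 & 1) (2 & 2) (1 -&- 1)) ∷ leaf (5 &- 1) ∷ leaf (4 & 1) ∷ into13-0 (at (1 & 1) (3 & 2) (1 & 1)) e₁ (at (2 & 0) (2 & 2) (1 & 1)) ∷ leaf (5 &- 1) ∷ leaf (4 & 1) ∷ into13-6 e₁ e₃ (at (1 & 1) (1 & 1) 0O) ∷ target (6 &- 2) (into13-2 (at⁺ (1 -& 1) 0O 0O 1O) e₁ (at⁺ (3 -& 2) 1O (1 -& 1) (2 & 0)) ∷ into13-2 (at⁺ (3 -& 1) (2 -&- 1) (1 &- 1) (2 & 0)) e₁ (at⁺ (2 -& 0) (1 -&- 1) 0O 1O) ∷ into13-2 (at⁺ (1 &- 1) -1O (2 &- 1) 1O) e₁ (at⁺ (1 &- 2) -1O (3 &- 1) (2 & 0)) ∷ into13-2 (at⁺ (1 -&- 1) (0 &- 1) (3 -& 1) (2 & 0)) e₁ (at⁺ (1 -&- 1) (0 &- 1) (2 -& 1) 1O) ∷ into13-2 (at⁺ (2 -& 0) (1 -&- 1) -1O 1O) e₁ (at⁺ (5 -& 0) (1 -&- 2) (3 -& 1) (2 & 0)) ∷ into13-2 (at⁺ (1 -& 1) (0 & 1) (3 &- 1) (2 & 0)) e₁ (at⁺ -1O 0O 1O 1O) ∷ []) ∷ into13-7 e₁ e₃ e₂ ∷ target (4 & 2) (into13-1 (at⁺ (3 -&- 1) 1O -1O (0 & 1)) e₁ (at⁺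 (6 -&- 1) (3 & 1) (2 -&- 1) (0 & 2)) ∷ into13-1 (at⁺ (6 -&- 4) (2 -&- 1) (2 & 1) (0 & 2)) e₁ (at⁺ (3 -&- 1) 0O 1O (0 & 1)) ∷ into13-1 (at⁺ (6 -&- 4) (2 -&- 3) (2 & 3) (0 & 2)) e₁ (at⁺ (3 -&- 1) (0 &- 1) (1 & 1) (0 & 1)) ∷ into13-1 (at⁺ (0 &- 1) (1 & 1) (1 -&- 1) (0 & 1)) e₁ (at⁺ (0 &- 1) (3 & 3) (2 -&- 3) (0 & 2)) ∷ into13-1 (at⁺ (0 &- 1) (2 -&- 2) (2 & 2) (0 & 1)) e₁ (at⁺ (0 &- 1) (3 -&- 3) (4 & 3) (0 & 2)) ∷ into13-1 (at⁺ (6 & 2) (4 & 3) (4 -&- 3) (0 & 2)) e₁ (at⁺ (3 & 2) (3 & 2) (2 -&- 2) (0 & 1)) ∷ []) ∷ leaf (6 &- 2) ∷ []) ∷ target₂ (2 & 1) (into13-0 (at 0O -1O (2 -& 1)) e₁ (at 1O (0 &- 1) (2 &- 1)) ∷ into13-0 (at 0O (1 -&- 1) 1O) e₁ (at 1O 0O -1O) ∷ into13-4 e₁ (at 1O 0O -1O) (at 1O 1O (2 &- 1)) ∷ leaf (3 & 0) ∷ into13-0 (at 1O -1O (2 &- 1)) e₁ (at 0O (0 &- 1) (2 -& 1)) ∷ into13-4 e₁ (at (0 &- 1) 0O 1O) (at 0O 1O (2 -& 1)) ∷ leaf (3 & 0) ∷ into13-0 (at (1 & 1) (1 -&- 1)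 -1O) e₁ (at (0 &- 1) 0O 1O) ∷ into13-1 (at 1O (1 -&- 1) 1O) e₁ (at 1O (1 & 1) (1 &- 1)) ∷ into13-7 e₁ (at (1 &- 1) 1O (3 &- 1)) (at (2 &- 1) 0O (2 &- 1)) ∷ target (6 &- 2) (into13-0 (at⁺ (1 &- 1) 1O -1O (0 & 1)) e₁ (at⁺ (3 &- 2) 1O (1 &- 1) (0 & 1)) ∷ into13-0 (at⁺ (1 &- 1) (2 -&- 1) (1 -& 1) (0 & 1)) e₁ (at⁺ (3 &- 2) (2 -&- 1) 1O (0 & 1)) ∷ into13-0 (at⁺ 0O (1 -&- 1) -1O (1 & 1)) e₁ (at⁺ (2 &- 1) (1 -&- 1) (1 &- 1) (1 & 1)) ∷ into13-0 (at⁺ (2 -&- 1) 0O (1 -& 1) (1 & 1)) e₁ (at⁺ (0 &- 2) 0O 1O (1 & 1)) ∷ into13-0 (at⁺ (2 -& 1) 1O (4 -& 2) (0 & 1)) e₁ (at⁺ 0O 1O (2 -& 1) (0 & 1)) ∷ into13-0 (at⁺ (4 & 0) (2 -&- 1) (2 &- 1) (0 & 1)) e₁ (at⁺ (6 &- 1) (2 -&- 1) (4 &- 2) (0 & 1)) ∷ into13-0 (at⁺ 1O 0O (2 &- 1) 1O) e₁ (at⁺ (3 &- 1) 0O (4 &- 2) 1O) ∷ into13-0 (at⁺ (3 -& 2) (1 -&- 1) (4 -& 2) 1O) e₁ (at⁺ (1 -& 1) (1 -&- 1) (2 -& 1) 1O) ∷ into13-0 (at⁺ -1O (1 & 1) (2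 -& 0) (1 & 1)) e₁ (at⁺ (1 &- 1) (1 & 1) (0 &- 1) (1 & 1)) ∷ into13-0 (at⁺ -1O (2 -&- 2) (0 & 1) (1 & 1)) e₁ (at⁺ (1 &- 1) (2 -&- 2) (2 & 0) (1 & 1)) ∷ into13-0 (at⁺ 1O (0 &- 1) (2 &- 1) 1O) e₁ (at⁺ (3 &- 1) (0 &- 1) (4 &- 2) 1O) ∷ into13-0 (at⁺ (3 -& 1) -1O (4 -& 2) 1O) e₁ (at⁺ -1O -1O (2 -& 1) 1O) ∷ []) ∷ into13-7 e₁ (at (2 -& 1) 1O (3 -& 1)) (at -1O 0O (2 -& 1)) ∷ into13-1 (at (1 & 1) (1 -&- 1) -1O) e₁ (at (2 -& 0) (1 & 1) (1 -& 1)) ∷ target (6 &- 2) (into13-0 (at⁺ (1 &- 2) 1O 1O (0 & 1)) e₁ (at⁺ (0 &- 2) 1O (1 -& 1) (0 & 1)) ∷ into13-0 (at⁺ (4 &- 1) (2 -&- 1) (1 &- 1) (0 & 1)) e₁ (at⁺ (3 &- 1) (2 -&- 1) -1O (0 & 1)) ∷ into13-0 (at⁺ (0 &- 1) (1 -&- 1) 1O (1 & 1)) e₁ (at⁺ (1 -&- 1) (1 -&- 1) (1 -& 1) (1 & 1)) ∷ into13-0 (at⁺ (1 &- 1) 0O (1 &- 1) (1 & 1)) e₁ (at⁺ (0 &- 1) 0O -1O (1 & 1)) ∷ into13-0 (at⁺ (4 &- 1) 1O (4 &- 2) (0 & 1)) e₁ (at⁺ (3 &- 1) 1O (2 &- 1)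 (0 & 1)) ∷ into13-0 (at⁺ (1 & 1) (2 -&- 1) (2 -& 1) (0 & 1)) e₁ (at⁺ (0 & 1) (2 -&- 1) (4 -& 2) (0 & 1)) ∷ into13-0 (at⁺ (2 -& 1) 0O (2 -& 1) 1O) e₁ (at⁺ (3 -& 1) 0O (4 -& 2) 1O) ∷ into13-0 (at⁺ (3 & 0) (1 -&- 1) (4 &- 2) 1O) e₁ (at⁺ (2 & 0) (1 -&- 1) (2 &- 1) 1O) ∷ into13-0 (at⁺ (1 -&- 2) (1 & 1) (2 & 0) (1 & 1)) e₁ (at⁺ (2 -&- 2) (1 & 1) (0 & 1) (1 & 1)) ∷ into13-0 (at⁺ (2 & 1) (2 -&- 2) (0 &- 1) (1 & 1)) e₁ (at⁺ (1 & 1) (2 -&- 2) (2 -& 0) (1 & 1)) ∷ into13-0 (at⁺ (2 -& 1) (0 &- 1) (2 -& 1) 1O) e₁ (at⁺ (3 -& 1) (0 &- 1) (4 -& 2) 1O) ∷ into13-0 (at⁺ (3 &- 1) -1O (4 &- 2) 1O) e₁ (at⁺ (2 &- 1) -1O (2 &- 1) 1O) ∷ []) ∷ target (6 &- 2) (into13-0 (at⁺ (1 &- 1) (0 &- 1) 1O (0 & 1)) e₁ (at⁺ (3 &- 2) (1 -&- 1) (1 -& 1) (0 & 1)) ∷ into13-0 (at⁺ (1 &- 1) 0O (1 &- 1) (0 & 1)) e₁ (at⁺ (3 &- 2) -1O -1O (0 & 1)) ∷ into13-0 (at⁺ 0O (2 -&- 2) 1O (1 & 1)) e₁ (at⁺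 (2 &- 1) (3 -&- 2) (1 -& 1) (1 & 1)) ∷ into13-0 (at⁺ (2 -&- 1) (2 & 1) (1 &- 1) (1 & 1)) e₁ (at⁺ (0 &- 2) (1 & 1) -1O (1 & 1)) ∷ into13-0 (at⁺ (2 -& 1) (3 & 0) (4 &- 2) (0 & 1)) e₁ (at⁺ 0O (2 & 0) (2 &- 1) (0 & 1)) ∷ into13-0 (at⁺ (4 & 0) (3 -&- 1) (2 -& 1) (0 & 1)) e₁ (at⁺ (6 &- 1) (4 -&- 1) (4 -& 2) (0 & 1)) ∷ into13-0 (at⁺ 1O -1O (2 -& 1) 1O) e₁ (at⁺ (3 &- 1) (2 -& 0) (4 -& 2) 1O) ∷ into13-0 (at⁺ (3 -& 2) (1 &- 1) (4 &- 2) 1O) e₁ (at⁺ (1 -& 1) (0 &- 1) (2 &- 1) 1O) ∷ into13-0 (at⁺ -1O (1 -&- 1) (2 & 0) (1 & 1)) e₁ (at⁺ (1 &- 1) (2 -&- 1) (0 & 1) (1 & 1)) ∷ into13-0 (at⁺ -1O 1O (0 &- 1) (1 & 1)) e₁ (at⁺ (1 &- 1) 0O (2 -& 0) (1 & 1)) ∷ into13-0 (at⁺ 1O (1 -&- 1) (2 -& 1) 1O) e₁ (at⁺ (3 &- 1) (2 -&- 1) (4 -& 2) 1O) ∷ into13-0 (at⁺ (3 -& 1) 1O (4 &- 2) 1O) e₁ (at⁺ -1O 0O (2 &- 1) 1O) ∷ []) ∷ target (6 &- 2) (into13-0 (at⁺ (2 &- 1) (0 &- 1) -1O (0 & 1))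 e₁ (at⁺ (2 &- 1) (1 -&- 1) (1 &- 1) (0 & 1)) ∷ into13-0 (at⁺ (2 &- 2) 0O (1 -& 1) (0 & 1)) e₁ (at⁺ (2 &- 2) -1O 1O (0 & 1)) ∷ into13-0 (at⁺ 1O (2 -&- 2) -1O (1 & 1)) e₁ (at⁺ 1O (3 -&- 2) (1 &- 1) (1 & 1)) ∷ into13-0 (at⁺ (1 -&- 2) (2 & 1) (1 -& 1) (1 & 1)) e₁ (at⁺ (1 -&- 2) (1 & 1) 1O (1 & 1)) ∷ into13-0 (at⁺ (2 &- 1) (3 & 0) (4 -& 2) (0 & 1)) e₁ (at⁺ (2 &- 1) (2 & 0) (2 -& 1) (0 & 1)) ∷ into13-0 (at⁺ (2 & 1) (3 -&- 1) (2 &- 1) (0 & 1)) e₁ (at⁺ (2 & 1) (4 -&- 1) (4 &- 2) (0 & 1)) ∷ into13-0 (at⁺ (1 -& 1) -1O (2 &- 1) 1O) e₁ (at⁺ (1 -& 1) (2 -& 0) (4 &- 2) 1O) ∷ into13-0 (at⁺ 1O (1 &- 1) (4 -& 2) 1O) e₁ (at⁺ 1O (0 &- 1) (2 -& 1) 1O) ∷ into13-0 (at⁺ 1O (1 -&- 1) (2 -& 0) (1 & 1)) e₁ (at⁺ 1O (2 -&- 1) (0 &- 1) (1 & 1)) ∷ into13-0 (at⁺ (1 -&- 1) 1O (0 & 1) (1 & 1)) e₁ (at⁺ (1 -&- 1) 0O (2 & 0) (1 & 1)) ∷ into13-0 (at⁺ (1 -& 1) (1 -&- 1) (2 &- 1)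 1O) e₁ (at⁺ (1 -& 1) (2 -&- 1) (4 &- 2) 1O) ∷ into13-0 (at⁺ (1 &- 1) 1O (4 -& 2) 1O) e₁ (at⁺ (1 &- 1) 0O (2 -& 1) 1O) ∷ []) ∷ into13-0 (at 1O (0 &- 1) (2 -& 1)) e₁ (at 0O -1O (2 &- 1)) ∷ leaf (2 & 0) ∷ into13-0 (at (1 -& 1) (0 &- 1) (2 &- 1)) e₁ (at (2 &- 1) -1O (2 -& 1)) ∷ leaf (2 & 0) ∷ leaf (2 & 0) ∷ leaf (2 & 0) ∷ leaf (3 & 0) ∷ into13-1 (at 1O -1O (2 &- 1)) e₁ (at 1O (2 -& 1) (5 &- 2)) ∷ leaf (2 & 0) ∷ target (2 & 0) (into13-1 (at⁺ 1O (1 -&- 1) 1O 1O) e₁ (at⁺ 0O 0O 0O 1O) ∷ into13-1 (at⁺ (0 &- 1) 1O (3 -& 1) (2 & 0)) e₁ (at⁺ (1 -&- 1) (2 & 1) (4 -& 1) (2 & 0)) ∷ into13-1 (at⁺ (2 & 1) (3 -&- 2) (1 -& 1) (2 & 0)) e₁ (at⁺ (1 & 1) (2 -&- 1) (2 -& 1) (2 & 0)) ∷ []) ∷ leaf (2 & 0) ∷ leaf (2 & 0) ∷ []) ∷ target₂ (2 & 1) (into13-2 (at 0O -1O (2 -& 1)) e₁ (at (0 &- 1) 0O 1O) ∷ into13-4 e₁ (at 1O 0O -1O) (at 1O -1O 0O) ∷ into13-2 (at 1O -1O (2 &- 1)) e₁ (at 1O 0O -1O) ∷ into13-4 e₁ (at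 (0 &- 1) 0O 1O) (at 1O -1O 0O) ∷ into13-2 (at (1 -&- 1) (1 -&- 1) (0 & 1)) e₁ (at (0 &- 1) 0O 1O) ∷ into13-2 (at (1 -&- 1) (1 & 1) (0 & 1)) e₁ (at (0 &- 1) 0O 1O) ∷ leaf (8 &- 3) ∷ leaf (8 &- 3) ∷ leaf (3 & 0) ∷ leaf (2 & 0) ∷ leaf (2 & 0) ∷ into13-2 (at (2 &- 1) -1O (3 &- 1)) e₁ (at -1O 1O (2 -& 1)) ∷ into13-2 (at (2 &- 1) 1O (3 &- 1)) e₁ (at -1O -1O (2 -& 1)) ∷ target (2 & 0) (into13-2 (at⁺ (2 &- 1) (2 -&- 1) (1 & 1) (0 & 2)) e₁ (at⁺ (2 &- 1) -1O 1O (0 & 1)) ∷ into13-2 (at⁺ (2 & 1) 1O (2 -& 0) (0 & 1)) e₁ (at⁺ (5 & 1) (2 & 1) (2 -&- 1) (0 & 2)) ∷ into13-2 (at⁺ (4 -& 1) (2 -&- 3) (5 -& 3) (0 & 2)) e₁ (at⁺ -1O (1 -&- 1) (2 -& 1) (0 & 1)) ∷ []) ∷ target (2 & 0) (into13-2 (at⁺ (5 & 1) (2 -&- 1) (1 -&- 1) (0 & 2)) e₁ (at⁺ (2 & 0) -1O -1O (0 & 1)) ∷ into13-2 (at⁺ (2 &- 1) 1O (2 & 0) (0 & 1)) e₁ (at⁺ (2 &- 2) (2 & 1) (2 & 1) (0 & 2)) ∷ into13-2 (at⁺ (5 &- 1) (2 -&- 3) (5 &- 3) (0 & 2)) e₁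 (at⁺ (2 &- 1) (1 -&- 1) (2 &- 1) (0 & 1)) ∷ []) ∷ leaf (2 & 0) ∷ into13-2 (at 0O (1 -&- 1) 1O) e₁ (at (0 &- 1) (3 -&- 2) (1 & 1)) ∷ leaf (3 & 0) ∷ leaf (2 & 0) ∷ leaf (3 & 0) ∷ into13-2 (at 1O (1 -&- 1) -1O) e₁ (at 1O (3 -&- 2) (1 -&- 1)) ∷ leaf (2 & 0) ∷ target (2 & 0) (into13-2 (at⁺ (2 & 0) (1 -&- 1) 0O (0 & 1)) e₁ (at⁺ (3 &- 1) (0 &- 1) (2 -& 1) (0 & 1)) ∷ into13-2 (at⁺ (2 & 1) (2 & 3) (3 &- 2) (0 & 2)) e₁ (at⁺ (3 & 0) (3 & 3) (1 &- 1) (0 & 2)) ∷ into13-2 (at⁺ (1 -& 1) -1O (3 &- 2) (0 & 1)) e₁ (at⁺ 0O 0O (1 &- 1) (0 & 1)) ∷ []) ∷ target (2 & 0) (into13-2 (at⁺ (2 & 1) (2 -&- 3) (3 &- 2) (0 & 2)) e₁ (at⁺ (3 & 0) (3 -&- 3) (1 &- 1) (0 & 2)) ∷ into13-2 (at⁺ (2 & 0) (1 & 1) 0O (0 & 1)) e₁ (at⁺ (3 &- 1) (0 & 1) (2 -& 1) (0 & 1)) ∷ into13-2 (at⁺ (2 &- 1) (2 -&- 1) (3 -& 2) (0 & 2)) e₁ (at⁺ (3 &- 2) (3 -&- 1) (5 -& 3) (0 & 2)) ∷ []) ∷ leaf (2 & 0) ∷ leaf (2 & 0) ∷ leaf (2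 & 0) ∷ into13-5 e₁ (at 0O (1 -&- 1) 1O) (at 0O (3 -&- 2) (1 & 1)) ∷ leaf (2 & 0) ∷ into13-5 e₁ (at 0O -1O (2 &- 1)) -e₃ ∷ leaf (2 & 0) ∷ leaf (5 &- 1) ∷ leaf (8 &- 3) ∷ leaf (2 & 0) ∷ target (5 &- 1) (leaf (2 & 0) ∷ leaf (2 & 0) ∷ leaf (2 & 0) ∷ leaf (2 & 0) ∷ []) ∷ []) ∷ [])

 grams13 : List Gram
 grams13 = g13-0 ∷ g13-1 ∷ g13-2 ∷ g13-3 ∷ g13-4 ∷ g13-5 ∷ g13-6 ∷ g13-7 ∷ []

 g17-0 : Gram
 g17-0 = gram 1O 1O (2 & 0) 0O 1O (0 & 1)

 g17-1 : Gram
 g17-1 = gram 1O 1O (2 & 0) 0O 1O (1 &- 1)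

 g17-2 : Gram
 g17-2 = gram 1O (2 & 0) (2 & 0) (0 & 1) (1 &- 1) -1O

 g17-3 : Gram
 g17-3 = gram 1O (4 & 0) (6 & 0) 0O (1 &- 1) (1 &- 4)

 g17-4 : Gram
 g17-4 = gram 1O (4 & 0) (6 & 0) 0O (0 & 1) (3 -& 4)

 g17-5 : Gram
 g17-5 = gram 1O 1O (2 & 0) 0O 0O (0 & 1)

 g17-6 : Gram
 g17-6 = gram 1O 1O (2 & 0) 0O 0O (1 &- 1)

 g17-7 : Gram
 g17-7 = gram 1O (2 & 1) (6 & 2) (1 & 1) (3 & 0) 0O

 g17-8 : Gram
 g17-8 = gram 1O (3 &- 1) (8 &- 2) (2 &- 1) (3 & 0) 0O

 g17-9 : Gram
 g17-9 = gram 1O (2 & 1) (3 & 0) 0O (0 & 1) (2 & 0)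

 g17-10 : Gram
 g17-10 = gram 1O (3 &- 1) (3 & 0) 0O (1 &- 1) (2 & 0)

 f17-2 : Cert
 f17-2 = final 2 (part (tri 1O (1 & 1) (0 & 1)) (tri 1O (1 & 1) (0 & 1)) (residue 2 2 (+ 0)) ∷ []) ([])

 into17-2 : Combo → Combo → Combo → Cert
 into17-2 u v w = rebase u v w [] g17-2 [] f17-2

 -- Another lattice that is not maximal: half its determinant has norm 4, and both surviving
 -- enlargements lead to `g17-2`, where it is 1.
 f17-9 : Cert
 f17-9 = final 9 (part (tri (4 & 0) 0O 0O) (tri 1O 0O 0O) (residue 2 1 (+ 0)) ∷ part (tri 0O (0 & 1) (4 & 0)) (tri 0O 1O 0O) (residue 2 2 (+ 0)) ∷ part (tri 0O (4 & 0) 0O) (tri 0O 0O 1O) (residue 2 1 (+ 0)) ∷ []) (into17-2 (at⁺ (7 -& 3) (2 &- 1) (2 &- 1) 1O) (at⁺ (5 -& 2) (6 -& 2) (5 &- 2) 1O) (at (2 -& 0) (5 &- 2) (2 -& 1)) ∷ into17-2 (at⁺ (5 -& 2) (11 -& 4) (5 &- 2) 1O) (at⁺ (7 -& 3) (6 -& 2) (2 &- 1) 1O) (at (2 &- 1) (5 -& 2) (2 &- 1)) ∷ [])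

 into17-9 : Combo → Combo → Combo → Cert
 into17-9 u v w = rebase u v w [] g17-9 [] f17-9

 f17-1 : Cert
 f17-1 = final 1 (part (tri (1 & 1) (3 & 0) (2 & 0)) (tri (3 & 1) 1O (2 & 0)) (residue 4 2 (+ 0)) ∷ []) ([])

 into17-1 : Combo → Combo → Combo → Cert
 into17-1 u v w = rebase u v w [] g17-1 [] f17-1

 -- The one surviving enlargement leads to `g17-1`, the conjugate of the lattice reached in the same
 -- way from `g17-6`.
 f17-5 : Cert
 f17-5 = final 5 (part (tri (12 & 1) 0O 0O) (tri 1O 0O 0O) (residue 2 2 (+ 0)) ∷ part (tri 0O (8 & 0) (8 & 0)) (tri 0O 1O 0O) (residue 2 1 (+ 0)) ∷ part (tri 0O (8 & 0) (4 & 0)) (tri 0O 0O 1O) (residue 4 1 (+ 0)) ∷ []) (into17-1 e₂ e₁ (at⁺ (6 -&- 5) 0O (2 -&- 1) 1O) ∷ [])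

 into17-5 : Combo → Combo → Combo → Cert
 into17-5 u v w = rebase u v w [] g17-5 [] f17-5

 f17-8 : Cert
 f17-8 = final 8 (part (tri (4 & 0) (7 & 0) (2 & 1)) (tri (4 & 0) 1O (4 & 1)) (residue 8 2 (+ 6)) ∷ []) (into17-2 (at⁺ (38 -&- 25) (69 -&- 45) (47 -&- 30) (0 & 1)) (at (2 & 2) (2 & 1) (1 -&- 1)) (at -1O 1O 0O) ∷ [])

 into17-8 : Combo → Combo → Combo → Cert
 into17-8 u v w = rebase u v w [] g17-8 [] f17-8

 f17-0 : Cert
 f17-0 = final 0 (part (tri (0 & 1) (3 & 0) (2 & 0)) (tri (2 & 1) 1O (2 & 0)) (residue 4 2 (+ 2)) ∷ []) ([])

 into17-0 : Combo → Combo → Combo → Cert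
 into17-0 u v w = rebase u v w [] g17-0 [] f17-0

 f17-4 : Cert
 f17-4 = final 4 (part (tri (9 & 0) (16 & 1) (14 & 0)) (tri 1O (12 & 1) (16 & 0)) (residue 26 2 (+ 10)) ∷ []) ([])

 into17-4 : Combo → Combo → Combo → Cert
 into17-4 u v w = rebase u v w [] g17-4 [] f17-4

 f17-7 : Cert
 f17-7 = final 7 (part (tri (4 & 0) (7 & 0) (3 & 1)) (tri (4 & 0) 1O (5 & 1)) (residue 8 2 (+ 0)) ∷ []) (into17-2 (at⁺ (28 -& 11) (47 -& 18) (8 -& 3) 1O) (at (4 &- 2) (3 &- 1) (2 -& 1)) (at⁺ (29 -& 10) (46 -& 18) (8 -& 3) 1O) ∷ [])

 into17-7 : Combo → Combo → Combo → Cert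
 into17-7 u v w = rebase u v w [] g17-7 [] f17-7

 f17-10 : Cert
 f17-10 = final 10 (part (tri (4 & 0) 0O 0O) (tri 1O 0O 0O) (residue 2 1 (+ 1)) ∷ part (tri 0O (7 & 1) (4 & 0)) (tri 0O 1O 0O) (residue 2 2 (+ 0)) ∷ part (tri 0O (4 & 0) 0O) (tri 0O 0O 1O) (residue 2 1 (+ 1)) ∷ []) (into17-2 (at⁺ (9 -&- 6) (64 -&- 41) (25 -&- 16) (0 & 1)) (at⁺ (9 -&- 6) (65 -&- 41) (25 -&- 16) (0 & 1)) (at⁺ (11 -&- 7) (61 -&- 39) (26 -&- 17) (0 & 1)) ∷ into17-2 (at⁺ (10 -&- 7) (70 -&- 45) (27 -&- 17) (0 & 1)) (at⁺ (10 -&- 7) (71 -&- 45) (27 -&- 17) (0 & 1)) (at⁺ (9 -&- 7) (73 -&- 47) (26 -&- 16) (0 & 1)) ∷ [])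

 into17-10 : Combo → Combo → Combo → Cert
 into17-10 u v w = rebase u v w [] g17-10 [] f17-10

 f17-6 : Cert
 f17-6 = final 6 (part (tri (3 & 1) 0O 0O) (tri 1O 0O 0O) (residue 2 2 (+ 0)) ∷ part (tri 0O (8 & 0) (8 & 0)) (tri 0O 1O 0O) (residue 2 1 (+ 1)) ∷ part (tri 0O (8 & 0) (4 & 0)) (tri 0O 0O 1O) (residue 4 1 (+ 3)) ∷ []) (into17-0 e₂ e₁ (at⁺ (2 -& 0) (4 &- 2) (1 &- 1) (0 & 1)) ∷ [])

 into17-6 : Combo → Combo → Combo → Cert
 into17-6 u v w = rebase u v w [] g17-6 [] f17-6

 f17-3 : Cert
 f17-3 = final 3 (part (tri (9 & 0) (5 & 1) (14 & 0)) (tri 1O (1 & 1) (16 & 0)) (residue 26 2 (+ 14)) ∷ []) ([])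

 into17-3 : Combo → Combo → Combo → Cert
 into17-3 u v w = rebase u v w [] g17-3 [] f17-3

 c17 : Cert₁
 c17 = target₁ (2 & 0) (target₂ (3 & 0) (into17-9 e₁ (at (2 & 1) (3 -&- 2) (2 & 1)) (at (2 & 1) (1 -&- 1) 1O) ∷ leaf (6 & 3) ∷ into17-5 (at (0 &- 1) 1O 1O) e₁ e₂ ∷ into17-5 (at 0O -1O 1O) e₁ e₂ ∷ leaf (6 & 3) ∷ into17-9 e₁ (at (6 -&- 4) (3 & 2) (2 & 1)) e₃ ∷ into17-2 (at (2 & 1) (0 &- 1) 1O) (at (3 & 1) (3 -& 0) (1 -& 1)) (at (0 &- 1) 1O 0O) ∷ into17-2 (at (3 & 0) (0 &- 1) -1O) (at (2 -& 2) (3 -& 0) (1 &- 1)) (at (0 &- 1) 1O 0O) ∷ target (9 &- 3) (into17-8 e₁ (at (1 &- 1) 1O 0O) (at⁺ (3 & 0) (1 -& 1) 1O (0 & 1)) ∷ into17-8 e₁ (at (1 &- 1) 1O 0O) (at⁺ (7 &- 2) (1 -& 1) (3 -& 1) (0 & 1)) ∷ into17-8 e₁ (at (1 &- 1) 1O 0O) (at⁺ -1O (1 -& 1) (1 &- 1) (0 & 1)) ∷ into17-8 e₁ (at (1 &- 1) 1O 0O) (at⁺ (3 &- 3) (1 -& 3) (3 -& 2) (0 & 1)) ∷ into17-8 e₁ (at (1 &- 1) 1O 0O) (at⁺ (3 & 1) (1 -&- 1) (1 &- 1) (0 & 1)) ∷ into17-8 e₁ (at (1 &- 1) 1O 0O)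 (at⁺ (7 &- 2) (1 -& 1) (3 -& 2) (0 & 1)) ∷ into17-2 (at⁺ (0 & 1) (2 -& 1) 1O (0 & 1)) (at 1O -1O -1O) (at (0 &- 1) 1O 0O) ∷ into17-2 (at⁺ (16 &- 2) (6 &- 5) (3 -&- 1) (0 & 3)) (at 1O -1O -1O) (at (0 &- 1) 1O 0O) ∷ into17-2 (at⁺ (8 -& 1) (6 & 1) (9 &- 4) (0 & 3)) (at 1O -1O -1O) (at (0 &- 1) 1O 0O) ∷ into17-2 (at⁺ (8 & 0) (2 -&- 1) (3 -& 1) (0 & 1)) (at 1O -1O -1O) (at (0 &- 1) 1O 0O) ∷ into17-8 e₁ (at (1 &- 1) 1O 0O) (at⁺ (5 -&- 1) (1 -& 3) 1O (0 & 1)) ∷ into17-8 e₁ (at (1 &- 1) 1O 0O) (at⁺ (7 &- 1) (1 -&- 1) (3 -& 1) (0 & 1)) ∷ []) ∷ leaf (6 &- 1) ∷ target (9 &- 3) (into17-8 e₁ (at (1 &- 1) 1O 0O) (at⁺ (4 &- 1) (1 -& 1) -1O (0 & 1)) ∷ into17-8 e₁ (at (1 &- 1) 1O 0O) (at⁺ (0 & 1) (1 -& 1) (3 &- 1) (0 & 1)) ∷ into17-8 e₁ (at (1 &- 1) 1O 0O) (at⁺ (8 -& 0) (1 -& 3) (3 &- 2) (0 & 1)) ∷ into17-8 e₁ (at (1 &- 1) 1O 0O) (at⁺ (4 &- 1) (1 -& 1) (1 -& 1) (0 & 1)) ∷ into17-8 e₁ (at (1 &- 1) 1O 0O) (at⁺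 (4 -& 1) (1 -& 1) (3 &- 2) (0 & 1)) ∷ into17-8 e₁ (at (1 &- 1) 1O 0O) (at⁺ (8 & 0) (1 -&- 1) (1 -& 1) (0 & 1)) ∷ into17-2 (at⁺ 1O (2 -& 1) -1O (0 & 1)) (at (0 & 1) -1O 1O) (at (0 &- 1) 1O 0O) ∷ into17-2 (at⁺ (17 & 1) (6 &- 5) (3 & 1) (0 & 3)) (at (0 & 1) -1O 1O) (at (0 &- 1) 1O 0O) ∷ into17-2 (at⁺ (17 &- 8) (6 & 1) (9 -& 4) (0 & 3)) (at (0 & 1) -1O 1O) (at (0 &- 1) 1O 0O) ∷ into17-2 (at⁺ (1 & 3) (2 -&- 1) (3 &- 1) (0 & 1)) (at (0 & 1) -1O 1O) (at (0 &- 1) 1O 0O) ∷ into17-8 e₁ (at (1 &- 1) 1O 0O) (at⁺ (4 -&- 2) (1 -& 3) -1O (0 & 1)) ∷ into17-8 e₁ (at (1 &- 1) 1O 0O) (at⁺ (0 & 2) (1 -&- 1) (3 &- 1) (0 & 1)) ∷ []) ∷ into17-2 (at (2 & 0) 0O -1O) (at (1 -& 1) 1O (1 &- 1)) (at (0 &- 1) 1O 0O) ∷ into17-2 (at -1O 0O 1O) (at (2 &- 2) 1O (1 -& 1)) (at (0 &- 1) 1O 0O) ∷ into17-0 (at (1 -&- 1) (1 & 1) -1O) e₁ e₂ ∷ leaf (6 & 3) ∷ leaf (6 & 3) ∷ target (6 & 3) (into17-0 (at⁺ (1 -&- 1) 0O 0O 1O) e₁ e₂ ∷ into17-0 (at⁺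 (1 -&- 1) 0O 0O 1O) e₁ e₂ ∷ into17-0 (at⁺ (6 -&- 4) (3 & 1) (1 &- 1) (3 & 0)) e₁ e₂ ∷ into17-0 (at⁺ (4 -&- 6) (3 & 1) (1 -& 1) (3 & 0)) e₁ e₂ ∷ into17-0 (at⁺ (2 & 1) (1 -&- 1) -1O 1O) e₁ e₂ ∷ into17-0 (at⁺ (0 & 1) (1 -&- 1) 1O 1O) e₁ e₂ ∷ into17-0 (at⁺ (9 -&- 4) (6 & 4) (2 -&- 1) (3 & 0)) e₁ e₂ ∷ into17-0 (at⁺ (13 -&- 6) (6 & 4) (2 & 1) (3 & 0)) e₁ e₂ ∷ []) ∷ into17-0 (at (3 -&- 1) (1 & 1) 1O) e₁ e₂ ∷ into17-2 (at (0 &- 1) (2 & 0) 1O) (at (3 -&- 1) (1 -& 2) (1 -& 1)) (at (0 &- 1) 1O 0O) ∷ leaf (6 &- 1) ∷ leaf (5 & 2) ∷ leaf (6 &- 1) ∷ into17-2 (at (1 &- 1) (2 & 0) -1O) (at (4 -& 0) (1 -& 2) (1 &- 1)) (at (0 &- 1) 1O 0O) ∷ leaf (6 &- 1) ∷ leaf (5 & 2) ∷ leaf (6 &- 1) ∷ target (5 & 0) (into17-2 (at⁺ (0 & 1) 0O 0O 1O) (at⁺ (2 & 1) (0 & 1) 1O (1 & 1)) (at (0 &- 1) 1O 0O) ∷ into17-2 (at⁺ (0 & 1) 0O 0O 1O) (at⁺ (4 & 1) 1O -1O (1 & 1)) (at (0 &- 1) 1O 0O) ∷ into17-2 (at⁺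 (2 & 1) (1 &- 1) -1O 1O) (at⁺ (4 & 3) (3 -& 0) (0 &- 1) (1 & 1)) (at (0 &- 1) 1O 0O) ∷ into17-2 (at⁺ (0 & 1) 0O 1O 1O) (at⁺ (4 & 1) 1O (0 & 1) (1 & 1)) (at (0 &- 1) 1O 0O) ∷ into17-8 e₁ (at (1 &- 1) 1O 0O) (at⁺ 1O -1O 0O 1O) ∷ into17-8 e₁ (at (1 &- 1) 1O 0O) (at⁺ 1O -1O 0O 1O) ∷ into17-8 e₁ (at (1 &- 1) 1O 0O) (at⁺ (1 &- 1) 1O -1O 1O) ∷ into17-8 e₁ (at (1 &- 1) 1O 0O) (at⁺ (1 -&- 1) (0 & 1) 1O 1O) ∷ into17-8 e₁ (at (1 &- 1) 1O 0O) (at⁺ (1 &- 1) 1O (2 -& 1) 1O) ∷ into17-8 e₁ (at (1 &- 1) 1O 0O) (at⁺ (3 -& 1) (5 -& 2) (2 &- 1) 1O) ∷ into17-8 e₁ (at (1 &- 1) 1O 0O) (at⁺ (1 &- 2) (3 & 0) (3 -& 1) 1O) ∷ into17-8 e₁ (at (1 &- 1) 1O 0O) (at⁺ (5 -& 0) (4 -& 3) (3 &- 1) 1O) ∷ into17-9 e₁ (at⁺ (2 &- 1) 1O (2 -& 0) (0 & 1)) (at⁺ (4 & 0) (1 &- 1) (3 -& 0) (0 & 1)) ∷ into17-9 e₁ (at⁺ (2 -&- 2) (1 & 2) (2 & 1) (0 & 1)) (at⁺ (0 &- 1) (1 & 1) (1 & 1) (0 & 1)) ∷ into17-9 e₁ (at⁺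 (2 &- 1) 1O (2 & 1) (0 & 1)) (at⁺ (4 & 0) (1 &- 1) (1 & 1) (0 & 1)) ∷ into17-9 e₁ (at⁺ (6 & 0) (1 &- 2) (2 -& 0) (0 & 1)) (at⁺ (8 & 1) (1 &- 3) (3 -& 0) (0 & 1)) ∷ into17-2 (at⁺ (1 -&- 1) (2 & 0) 0O 1O) (at⁺ (5 -&- 4) (3 & 2) -1O (1 & 1)) (at (0 &- 1) 1O 0O) ∷ into17-2 (at⁺ (1 -&- 1) (2 & 0) 0O 1O) (at⁺ (7 -&- 4) (2 & 3) 1O (1 & 1)) (at (0 &- 1) 1O 0O) ∷ into17-2 (at⁺ (1 -& 1) (2 -& 0) 1O 1O) (at⁺ (3 & 0) (1 -&- 2) (0 & 1) (1 & 1)) (at (0 &- 1) 1O 0O) ∷ into17-2 (at⁺ (1 & 1) (1 -&- 1) -1O 1O) (at⁺ (3 & 2) (5 -&- 2) (0 &- 1) (1 & 1)) (at (0 &- 1) 1O 0O) ∷ []) ∷ leaf (6 & 3) ∷ into17-9 e₁ (at (6 & 4) (5 -&- 3) (2 & 1)) (at (2 & 2) (2 -&- 1) 1O) ∷ target (9 &- 3) (into17-4 e₁ (at⁺ (2 -&- 2) (1 & 1) (2 -& 0) (0 & 1)) (at (0 & 1) -1O -1O) ∷ into17-4 e₁ (at⁺ (2 &- 1) (1 &- 1) (2 &- 1) (0 & 1)) (at (0 & 1) -1O -1O) ∷ []) ∷ leaf (6 & 0) ∷ []) ∷ target₂ (3 & 0) (into17-2 (at (2 -& 0) (1 &- 1)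 1O) (at (0 &- 2) (3 -& 0) (0 & 1)) (at (3 -& 0) (2 &- 1) 1O) ∷ into17-2 (at (2 -& 1) (1 &- 1) -1O) (at (4 &- 1) (3 -& 0) (0 &- 1)) (at (3 -& 1) (2 &- 1) -1O) ∷ target (6 & 3) (into17-7 e₁ (at 1O -1O 0O) (at⁺ (3 &- 1) (0 & 1) 0O 1O) ∷ into17-7 e₁ (at 1O -1O 0O) (at⁺ (1 &- 2) (0 & 1) (1 & 1) 1O) ∷ into17-7 e₁ (at 1O -1O 0O) (at⁺ (3 & 0) (0 & 1) -1O 1O) ∷ into17-7 e₁ (at 1O -1O 0O) (at⁺ (0 &- 1) (2 & 1) (2 & 1) 1O) ∷ into17-7 e₁ (at 1O -1O 0O) (at⁺ (4 &- 1) (2 -& 1) -1O 1O) ∷ into17-7 e₁ (at 1O -1O 0O) (at⁺ (1 &- 2) (0 & 1) (2 & 1) 1O) ∷ into17-2 (at⁺ (1 -&- 1) (1 -&- 1) 0O 1O) (at 1O -1O -1O) (at⁺ (2 -&- 1) (0 &- 1) 0O 1O) ∷ into17-2 (at⁺ (2 & 1) (5 & 1) (1 &- 1) (3 & 0)) (at 1O -1O -1O) (at⁺ (1 & 1) (6 & 1) (1 &- 1) (3 & 0)) ∷ into17-2 (at⁺ (0 & 1) (1 &- 1) (1 -&- 1) 1O) (at 1O -1O -1O) (at⁺ (1 -& 1) (2 &- 1) (1 -&- 1) 1O) ∷ into17-2 (at⁺ (1 -&- 5) (1 -& 1) (4 & 2) (3 & 0)) (at 1O -1O -1O) (at⁺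 (2 -&- 5) (0 & 1) (4 & 2) (3 & 0)) ∷ into17-7 e₁ (at 1O -1O 0O) (at⁺ (2 & 1) (2 & 1) 0O 1O) ∷ into17-7 e₁ (at 1O -1O 0O) (at⁺ (2 &- 2) (2 -& 1) (1 & 1) 1O) ∷ []) ∷ leaf (5 & 1) ∷ target (6 & 3) (into17-7 e₁ (at 1O -1O 0O) (at⁺ (3 &- 1) (0 & 1) 0O 1O) ∷ into17-7 e₁ (at 1O -1O 0O) (at⁺ (5 & 0) (0 & 1) (1 -&- 1) 1O) ∷ into17-7 e₁ (at 1O -1O 0O) (at⁺ (4 & 2) (2 & 1) (2 -&- 1) 1O) ∷ into17-7 e₁ (at 1O -1O 0O) (at⁺ (3 &- 1) (0 & 1) 1O 1O) ∷ into17-7 e₁ (at 1O -1O 0O) (at⁺ (5 & 1) (0 & 1) (2 -&- 1) 1O) ∷ into17-7 e₁ (at 1O -1O 0O) (at⁺ (4 &- 2) (2 -& 1) 1O 1O) ∷ into17-2 (at⁺ (1 -&- 1) (1 -&- 1) 0O 1O) (at (1 &- 1) -1O 1O) (at⁺ (2 -&- 1) (0 &- 1) 0O 1O) ∷ into17-2 (at⁺ (2 -& 1) (5 & 1) (1 -& 1) (3 & 0)) (at (1 &- 1) -1O 1O) (at⁺ (3 -& 1) (6 & 1) (1 -& 1) (3 & 0)) ∷ into17-2 (at⁺ (4 -&- 1) (1 &- 1) (1 & 1) 1O) (at (1 &- 1) -1O 1O) (at⁺ (5 -&- 1) (2 &- 1) (1 & 1) 1O) ∷ into17-2 (at⁺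 (7 & 1) (1 -& 1) (4 -&- 2) (3 & 0)) (at (1 &- 1) -1O 1O) (at⁺ (6 & 1) (0 & 1) (4 -&- 2) (3 & 0)) ∷ into17-7 e₁ (at 1O -1O 0O) (at⁺ (2 & 1) (2 & 1) 0O 1O) ∷ into17-7 e₁ (at 1O -1O 0O) (at⁺ (6 & 0) (2 -& 1) (1 -&- 1) 1O) ∷ []) ∷ into17-10 e₁ (at (3 &- 1) (5 -& 2) (3 &- 1)) e₃ ∷ leaf (9 &- 3) ∷ into17-6 (at (1 -& 1) 1O 1O) e₁ (at (1 &- 1) -1O 0O) ∷ into17-6 (at 0O -1O 1O) e₁ (at (1 &- 1) -1O 0O) ∷ leaf (9 &- 3) ∷ into17-10 e₁ (at (10 -& 4) (5 &- 2) (3 &- 1)) (at (3 -& 1) (2 &- 1) 1O) ∷ into17-2 (at -1O 0O 1O) (at (0 &- 1) 1O (0 & 1)) (at (2 -& 0) 1O 1O) ∷ into17-2 (at (2 & 0) 0O -1O) (at (0 & 2) 1O (0 &- 1)) (at 1O 1O -1O) ∷ into17-1 (at (2 -& 1) (2 &- 1) -1O) e₁ (at -1O (1 &- 1) -1O) ∷ leaf (9 &- 3) ∷ target (9 &- 3) (into17-1 (at⁺ 0O (2 &- 1) 1O (0 & 1)) e₁ (at⁺ (1 &- 1) (1 &- 1) 1O (0 & 1)) ∷ into17-1 (at⁺ (2 & 0) (2 &- 1) -1O (0 & 1)) e₁ (at⁺ (3 &- 1) (1 &- 1) -1O (0 & 1)) ∷ into17-1 (at⁺ (14 &- 5) (2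 -& 2) (3 & 1) (0 & 3)) e₁ (at⁺ (15 &- 6) (3 -& 2) (3 & 1) (0 & 3)) ∷ into17-1 (at⁺ (20 &- 3) (2 -& 2) (3 -&- 1) (0 & 3)) e₁ (at⁺ (21 &- 4) (3 -& 2) (3 -&- 1) (0 & 3)) ∷ into17-1 (at⁺ (6 -& 1) (6 &- 2) (1 -& 1) (0 & 1)) e₁ (at⁺ (5 -& 0) (5 &- 2) (1 -& 1) (0 & 1)) ∷ into17-1 (at⁺ (8 -& 3) (6 &- 2) (1 &- 1) (0 & 1)) e₁ (at⁺ (7 -& 2) (5 &- 2) (1 &- 1) (0 & 1)) ∷ into17-1 (at⁺ (20 &- 12) (14 -& 5) (3 -& 2) (0 & 3)) e₁ (at⁺ (21 &- 13) (15 -& 5) (3 -& 2) (0 & 3)) ∷ into17-1 (at⁺ (14 &- 8) (14 -& 5) (3 &- 2) (0 & 3)) e₁ (at⁺ (15 &- 9) (15 -& 5) (3 &- 2) (0 & 3)) ∷ []) ∷ leaf (9 &- 3) ∷ into17-1 (at (4 -& 1) (2 &- 1) 1O) e₁ (at (3 -& 0) (1 &- 1) 1O) ∷ into17-2 (at (2 &- 1) (2 -& 0) -1O) (at (4 -& 1) (1 &- 2) (0 &- 1)) (at (1 &- 1) -1O -1O) ∷ leaf (5 & 1) ∷ leaf (5 & 1) ∷ leaf (7 &- 2) ∷ into17-2 (at (1 &- 1) (2 -& 0) 1O) (at (4 -& 0) (1 &- 2) (0 & 1)) (at (0 &- 1) -1O 1O) ∷ leaf (5 & 1) ∷ leaf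 (7 &- 2) ∷ leaf (5 & 1) ∷ target (5 & 0) (into17-2 (at⁺ (0 & 1) 0O 0O 1O) (at⁺ (4 & 1) 1O 0O (0 & 1)) (at⁺ (1 -& 1) 1O 0O 1O) ∷ into17-2 (at⁺ (0 & 1) 0O 0O 1O) (at⁺ (4 & 1) 1O 0O (0 & 1)) (at⁺ (1 -& 1) 1O 0O 1O) ∷ into17-2 (at⁺ (2 -& 1) (0 &- 1) 1O 1O) (at⁺ (4 &- 1) (3 -&- 1) (0 & 1) (0 & 1)) (at⁺ (3 -& 1) (1 &- 1) 1O 1O) ∷ into17-2 (at⁺ (0 & 1) 0O -1O 1O) (at⁺ (4 & 1) 1O (0 &- 1) (0 & 1)) (at⁺ (1 -& 1) 1O -1O 1O) ∷ into17-10 e₁ (at⁺ -1O 1O 0O 1O) (at⁺ -1O (2 & 0) -1O 1O) ∷ into17-10 e₁ (at⁺ (2 -& 1) (3 & 0) (1 &- 1) 1O) (at⁺ (2 -& 1) (4 & 0) (0 &- 1) 1O) ∷ into17-10 e₁ (at⁺ -1O 1O (1 &- 1) 1O) (at⁺ -1O (2 & 0) (0 &- 1) 1O) ∷ into17-10 e₁ (at⁺ (0 &- 1) -1O 0O 1O) (at⁺ (0 &- 1) 0O -1O 1O) ∷ into17-7 e₁ (at 1O -1O 0O) (at⁺ (0 &- 1) (1 -&- 2) (3 & 2) (0 & 1)) ∷ into17-7 e₁ (at 1O -1O 0O) (at⁺ (6 & 3) (7 & 3) (3 -&- 2) (0 & 1)) ∷ into17-7 e₁ (at 1O -1O 0O)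 (at⁺ (4 &- 1) -1O (3 & 1) (0 & 1)) ∷ into17-7 e₁ (at 1O -1O 0O) (at⁺ (10 & 1) (3 & 4) (3 -&- 1) (0 & 1)) ∷ into17-7 e₁ (at 1O -1O 0O) (at⁺ (4 &- 1) -1O -1O (0 & 1)) ∷ into17-7 e₁ (at 1O -1O 0O) (at⁺ (2 &- 1) (1 -&- 1) 1O (0 & 1)) ∷ into17-7 e₁ (at 1O -1O 0O) (at⁺ (8 &- 1) (1 -& 2) (1 -&- 1) (0 & 1)) ∷ into17-7 e₁ (at 1O -1O 0O) (at⁺ (6 &- 3) (5 -& 0) (1 & 1) (0 & 1)) ∷ into17-2 (at⁺ (2 -& 1) (2 & 0) -1O 1O) (at⁺ (4 &- 1) (1 & 2) (0 &- 1) (0 & 1)) (at⁺ (3 -& 1) (3 & 0) -1O 1O) ∷ into17-2 (at⁺ (4 -& 1) (2 &- 1) 1O 1O) (at⁺ (4 &- 3) (3 -& 1) (0 & 1) (0 & 1)) (at⁺ (5 -& 1) (3 &- 1) 1O 1O) ∷ into17-2 (at⁺ (0 &- 1) (2 -& 0) 0O 1O) (at⁺ (4 -&- 1) (1 &- 2) 0O (0 & 1)) (at⁺ (1 -&- 1) -1O 0O 1O) ∷ into17-2 (at⁺ (0 &- 1) (2 -& 0) 0O 1O) (at⁺ (4 -&- 1) (1 &- 2) 0O (0 & 1)) (at⁺ (1 -&- 1) -1O 0O 1O) ∷ []) ∷ leaf (9 &- 3) ∷ into17-10 e₁ (at (10 &- 4) (8 -& 3) (3 &- 1)) (at (1 &-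 1) -1O 1O) ∷ target (6 & 3) (into17-3 e₁ (at⁺ (2 -& 1) (2 & 0) (0 & 1) 1O) (at (1 &- 1) -1O -1O) ∷ into17-3 e₁ (at⁺ -1O 0O -1O 1O) (at (1 &- 1) -1O -1O) ∷ []) ∷ leaf (6 & 0) ∷ []) ∷ target₂ (3 &- 1) (into17-0 (at -1O 1O 0O) e₁ (at 0O 1O -1O) ∷ into17-5 (at -1O 1O 0O) e₁ (at (1 -& 1) 0O 1O) ∷ into17-0 (at -1O 1O 0O) e₁ (at 1O 0O -1O) ∷ into17-0 e₁ (at -1O 1O 0O) (at (2 &- 1) (1 -& 1) -1O) ∷ into17-0 e₁ (at -1O 1O 0O) (at 0O 1O -1O) ∷ leaf (2 & 1) ∷ into17-5 e₁ (at -1O 1O 0O) (at (1 &- 1) (1 -& 1) 1O) ∷ leaf (2 & 1) ∷ target (2 & 1) (into17-6 (at -1O 1O 0O) e₁ (at⁺ (0 &- 1) 0O (1 -&- 1) 1O) ∷ into17-6 (at -1O 1O 0O) e₁ (at⁺ (0 &- 1) 0O 0O 1O) ∷ into17-6 e₁ (at -1O 1O 0O) (at⁺ (0 & 1) (0 &- 1) (1 -&- 1) 1O) ∷ into17-6 e₁ (at -1O 1O 0O) (at⁺ (0 & 1) (0 &- 1) 0O 1O) ∷ []) ∷ []) ∷ target₂ (3 &- 1) (leaf (3 & 0) ∷ target (9 &- 3) (into17-8 e₁ e₃ (at⁺ (9 &- 2) 1O (2 -& 1) (0 & 1)) ∷ into17-8 e₁ e₃ (at⁺ (5 & 0) (3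 -& 1) (2 & 0) (0 & 1)) ∷ into17-8 e₁ e₃ (at⁺ (5 &- 1) (1 &- 1) (2 -& 0) (0 & 1)) ∷ into17-8 e₁ e₃ (at⁺ (5 &- 1) (3 -& 2) (2 & 1) (0 & 1)) ∷ into17-8 e₁ e₃ (at⁺ (9 &- 2) (1 &- 1) (2 -& 2) (0 & 1)) ∷ into17-8 e₁ e₃ (at⁺ 1O (3 -& 2) (2 &- 1) (0 & 1)) ∷ into17-2 (at⁺ (15 &- 2) (9 &- 4) (3 -& 5) (0 & 3)) (at 1O -1O 0O) (at -1O 0O 1O) ∷ into17-2 (at⁺ (1 -& 1) (3 -& 1) (1 &- 2) (0 & 1)) (at 1O -1O 0O) (at -1O 0O 1O) ∷ into17-2 (at⁺ (9 -& 7) (3 -&- 1) (9 &- 4) (0 & 3)) (at 1O -1O 0O) (at -1O 0O 1O) ∷ into17-2 (at⁺ (7 &- 2) 1O (3 -& 1) (0 & 1)) (at 1O -1O 0O) (at -1O 0O 1O) ∷ into17-8 e₁ e₃ (at⁺ (3 -& 1) (3 -& 1) (2 &- 2) (0 & 1)) ∷ into17-8 e₁ e₃ (at⁺ (9 &- 3) 1O (2 -& 3) (0 & 1)) ∷ []) ∷ target (3 & 0) (into17-1 e₁ (at⁺ (0 &- 1) (2 -&- 1) (3 -&- 1) (0 & 1)) (at 1O 1O (1 & 1)) ∷ into17-1 e₁ (at⁺ (4 -& 0) (2 -&- 1) (3 -&- 3) (0 & 1)) (at 1O 1O (1 & 1)) ∷ into17-1 e₁ (at⁺ (4 -& 0)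 (2 & 0) 1O (0 & 1)) (at 1O 1O (1 & 1)) ∷ into17-1 e₁ (at⁺ (0 &- 1) (2 & 0) (1 & 2) (0 & 1)) (at 1O 1O (1 & 1)) ∷ []) ∷ target (3 & 0) (into17-1 e₁ (at⁺ (2 -& 1) (2 -&- 1) (3 & 1) (0 & 1)) (at -1O 1O (1 -&- 1)) ∷ into17-1 e₁ (at⁺ (2 & 0) (2 -&- 1) (3 & 3) (0 & 1)) (at -1O 1O (1 -&- 1)) ∷ into17-1 e₁ (at⁺ (2 -&- 1) (2 & 0) -1O (0 & 1)) (at -1O 1O (1 -&- 1)) ∷ into17-1 e₁ (at⁺ (6 -& 0) (2 & 0) (1 -&- 2) (0 & 1)) (at -1O 1O (1 -&- 1)) ∷ []) ∷ leaf (3 & 0) ∷ target (9 &- 3) (into17-8 e₁ (at (2 &- 1) 0O -1O) (at⁺ (1 & 1) 1O (2 &- 1) (0 & 1)) ∷ into17-8 e₁ (at (2 &- 1) 0O -1O) (at⁺ (9 &- 2) (3 -& 1) (2 -& 0) (0 & 1)) ∷ into17-8 e₁ (at (2 &- 1) 0O -1O) (at⁺ (1 & 1) (1 &- 1) (2 & 0) (0 & 1)) ∷ into17-8 e₁ (at (2 &- 1) 0O -1O) (at⁺ (5 &- 2) (3 -& 2) (2 -&- 1) (0 & 1)) ∷ into17-8 e₁ (at (2 &- 1) 0O -1O) (at⁺ (3 -& 2) (1 &- 1) (2 &- 2) (0 & 1)) ∷ into17-8 e₁ (at (2 &- 1) 0O -1O) (at⁺ (9 &- 3) (3 -& 2)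 (2 -& 1) (0 & 1)) ∷ into17-2 (at⁺ (11 -& 6) (9 &- 4) (3 &- 5) (0 & 3)) (at 1O -1O 0O) (at (1 &- 1) 0O -1O) ∷ into17-2 (at⁺ (9 &- 2) (3 -& 1) (1 -& 2) (0 & 1)) (at 1O -1O 0O) (at (1 &- 1) 0O -1O) ∷ into17-2 (at⁺ (25 &- 6) (3 -&- 1) (9 -& 4) (0 & 3)) (at 1O -1O 0O) (at (1 &- 1) 0O -1O) ∷ into17-2 (at⁺ (3 -& 2) 1O (3 &- 1) (0 & 1)) (at 1O -1O 0O) (at (1 &- 1) 0O -1O) ∷ into17-8 e₁ (at (2 &- 1) 0O -1O) (at⁺ (9 &- 3) (3 -& 1) (2 -& 2) (0 & 1)) ∷ into17-8 e₁ (at (2 &- 1) 0O -1O) (at⁺ (7 -& 2) 1O (2 &- 3) (0 & 1)) ∷ []) ∷ into17-0 e₁ (at -1O 1O 1O) e₂ ∷ leaf (2 & 1) ∷ into17-8 e₁ (at 1O 1O (1 -&- 1)) (at (3 & 0) (1 -& 1) (2 -&- 1)) ∷ into17-0 e₁ (at 0O 1O -1O) e₂ ∷ leaf (2 & 1) ∷ into17-8 e₁ (at (0 &- 1) 1O (1 & 1)) (at (1 &- 1) (1 -& 1) (2 & 1)) ∷ target (2 & 1) (into17-0 e₁ (at⁺ (3 -&- 2) -1O (3 & 2) (0 & 1)) e₂ ∷ into17-0 e₁ (at⁺ (3 -&- 1) (3 & 1) (9 -&- 5) (0 & 3)) e₂ ∷ []) ∷ target (2 & 1) (into17-0 e₁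 (at⁺ 0O -1O (3 -&- 2) (0 & 1)) e₂ ∷ into17-0 e₁ (at⁺ (12 -&- 6) (3 & 1) (9 & 5) (0 & 3)) e₂ ∷ []) ∷ into17-2 (at 1O -1O 1O) (at 1O -1O 0O) (at (1 &- 1) (2 -& 1) (1 &- 1)) ∷ target (3 & 0) (into17-0 e₁ (at⁺ 0O (1 -& 1) 1O 1O) e₂ ∷ into17-0 e₁ (at⁺ (2 -& 2) (1 &- 1) (2 -&- 1) (3 & 0)) e₂ ∷ into17-0 e₁ (at⁺ 0O (1 -& 1) (0 &- 1) 1O) e₂ ∷ into17-0 e₁ (at⁺ (2 -& 2) (1 &- 1) (1 & 2) (3 & 0)) e₂ ∷ []) ∷ leaf (2 & 1) ∷ leaf (3 & 0) ∷ target (2 & 1) (target (6 & 3) (into17-7 e₁ (combo (tri 0O 0O (1 -&- 1)) (0 & 0 ∷ 1 & 0 ∷ [])) (combo (tri (1 &- 1) 0O (2 & 1)) (1 & 0 ∷ 0 & 0 ∷ [])) ∷ into17-7 e₁ (combo (tri 0O 0O (1 -&- 1)) (0 & 0 ∷ 1 & 0 ∷ [])) (combo (tri (0 &- 2) (1 & 1) (1 -&- 1)) (1 & 0 ∷ 1 & 0 ∷ [])) ∷ into17-7 e₁ (combo (tri 0O 0O (1 -&- 1)) (0 & 0 ∷ 1 & 0 ∷ [])) (combo (tri (1 &- 1) -1O 1O) (1 & 0 ∷ 1 & 0 ∷ [])) ∷ into17-7 e₁ (combo (tri 0O 0O (1 -&- 1)) (0 & 0 ∷ 1 & 0 ∷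 [])) (combo (tri (1 &- 1) -1O (2 & 1)) (1 & 0 ∷ 1 & 0 ∷ [])) ∷ into17-7 e₁ (combo (tri 0O 0O (1 -&- 1)) (0 & 0 ∷ 1 & 0 ∷ [])) (combo (tri (0 &- 1) (2 & 1) 0O) (1 & 0 ∷ 0 & 0 ∷ [])) ∷ into17-7 e₁ (combo (tri 0O 0O (1 -&- 1)) (0 & 0 ∷ 1 & 0 ∷ [])) (combo (tri (0 &- 1) (2 & 1) (1 -&- 1)) (1 & 0 ∷ 0 & 0 ∷ [])) ∷ into17-2 (combo (tri 1O (1 -&- 1) (1 & 1)) (1 & 0 ∷ 0 & 0 ∷ [])) (at 1O -1O 0O) (combo (tri (0 &- 1) (1 -&- 1) (1 & 1)) (1 & 0 ∷ 1 & 0 ∷ [])) ∷ into17-2 (combo (tri (0 &- 1) 0O (3 -&- 2)) (1 & 0 ∷ 1 & 0 ∷ [])) (at 1O -1O 0O) (combo (tri (0 &- 1) 0O (2 -&- 1)) (1 & 0 ∷ 0 & 0 ∷ [])) ∷ into17-2 (combo (tri (2 -&- 3) (4 & 2) (5 -&- 4)) (3 & 0 ∷ 1 & 0 ∷ [])) (at 1O -1O 0O) (combo (tri (2 -&- 3) (4 & 2) (4 -&- 3)) (3 & 0 ∷ 0 & 0 ∷ [])) ∷ into17-2 (combo (tri (0 &- 1) (1 &- 1) (6 & 4)) (3 & 0 ∷ 0 & 0 ∷ [])) (at 1O -1O 0O) (combo (tri (1 -&- 2) (1 &- 1) (6 & 4)) (3 & 0 ∷ 1 & 0 ∷ [])) ∷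 into17-7 e₁ (combo (tri 0O 0O (1 -&- 1)) (0 & 0 ∷ 1 & 0 ∷ [])) (combo (tri (0 &- 1) (1 & 1) (2 -&- 2)) (1 & 0 ∷ 1 & 0 ∷ [])) ∷ into17-7 e₁ (combo (tri 0O 0O (1 -&- 1)) (0 & 0 ∷ 1 & 0 ∷ [])) (combo (tri 1O 0O (3 & 2)) (1 & 0 ∷ 0 & 0 ∷ [])) ∷ []) ∷ target (6 & 3) (into17-7 e₁ (combo (tri 0O 0O 0O) (0 & 0 ∷ 1 & 0 ∷ [])) (combo (tri (1 &- 1) 0O (2 & 1)) (1 & 0 ∷ 0 & 0 ∷ [])) ∷ into17-7 e₁ (combo (tri 0O 0O 0O) (0 & 0 ∷ 1 & 0 ∷ [])) (combo (tri (0 &- 2) (1 & 1) 0O) (1 & 0 ∷ 1 & 0 ∷ [])) ∷ into17-7 e₁ (combo (tri 0O 0O 0O) (0 & 0 ∷ 1 & 0 ∷ [])) (combo (tri (1 &- 1) -1O (2 & 1)) (1 & 0 ∷ 1 & 0 ∷ [])) ∷ into17-7 e₁ (combo (tri 0O 0O 0O) (0 & 0 ∷ 1 & 0 ∷ [])) (combo (tri (1 &- 1) -1O (3 & 2)) (1 & 0 ∷ 1 & 0 ∷ [])) ∷ into17-7 e₁ (combo (tri 0O 0O 0O) (0 & 0 ∷ 1 & 0 ∷ [])) (combo (tri (0 &- 1) (2 & 1) 0O) (1 & 0 ∷ 0 & 0 ∷ [])) ∷ into17-7 e₁ (combo (tri 0O 0O 0O) (0 & 0 ∷ 1 & 0 ∷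 [])) (combo (tri (0 &- 1) (2 & 1) (1 -&- 1)) (1 & 0 ∷ 0 & 0 ∷ [])) ∷ into17-2 (combo (tri 1O (1 -&- 1) (1 & 1)) (1 & 0 ∷ 0 & 0 ∷ [])) (at 1O -1O 0O) (combo (tri (0 &- 1) (1 -&- 1) (2 & 2)) (1 & 0 ∷ 1 & 0 ∷ [])) ∷ into17-2 (combo (tri (0 &- 1) 0O (2 -&- 1)) (1 & 0 ∷ 1 & 0 ∷ [])) (at 1O -1O 0O) (combo (tri (0 &- 1) 0O (2 -&- 1)) (1 & 0 ∷ 0 & 0 ∷ [])) ∷ into17-2 (combo (tri (2 -&- 3) (4 & 2) (4 -&- 3)) (3 & 0 ∷ 1 & 0 ∷ [])) (at 1O -1O 0O) (combo (tri (2 -&- 3) (4 & 2) (4 -&- 3)) (3 & 0 ∷ 0 & 0 ∷ [])) ∷ into17-2 (combo (tri (0 &- 1) (1 &- 1) (6 & 4)) (3 & 0 ∷ 0 & 0 ∷ [])) (at 1O -1O 0O) (combo (tri (1 -&- 2) (1 &- 1) (7 & 5)) (3 & 0 ∷ 1 & 0 ∷ [])) ∷ into17-7 e₁ (combo (tri 0O 0O 0O) (0 & 0 ∷ 1 & 0 ∷ [])) (combo (tri (0 &- 1) (1 & 1) (1 -&- 1)) (1 & 0 ∷ 1 & 0 ∷ [])) ∷ into17-7 e₁ (combo (tri 0O 0O 0O) (0 & 0 ∷ 1 & 0 ∷ [])) (combo (tri 1O 0O (3 & 2)) (1 & 0 ∷ 0 & 0 ∷ [])) ∷ []) ∷ into17-7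 e₁ (at⁺ (0 & 1) (1 -&- 1) (2 & 1) (2 & 0)) (at⁺ 1O 0O (2 & 1) 1O) ∷ into17-7 e₁ (at⁺ -1O (1 & 1) (3 -&- 2) (2 & 0)) (at⁺ (1 -&- 1) (2 & 2) (3 -&- 2) (3 & 0)) ∷ into17-2 (at⁺ (2 & 1) (3 -&- 2) (2 -&- 1) (3 & 1)) (at 1O -1O 0O) (at⁺ 1O (2 -&- 1) -1O (3 & 0)) ∷ into17-2 (at⁺ (2 & 1) (3 -&- 2) (8 & 5) (3 & 1)) (at 1O -1O 0O) (at⁺ 1O (2 -&- 1) (5 & 3) (3 & 0)) ∷ []) ∷ leaf (2 & 1) ∷ []) ∷ target₂ (3 &- 1) (into17-0 (at -1O 1O (1 -&- 1)) e₁ (at 1O 0O -1O) ∷ into17-0 (at 1O 1O (1 & 1)) e₁ (at (1 -& 1) 0O 1O) ∷ leaf (6 & 3) ∷ leaf (6 & 3) ∷ target (6 & 3) (into17-0 (at⁺ (4 -&- 2) (1 &- 1) (3 & 1) (3 & 0)) e₁ (at⁺ (3 -&- 2) (1 &- 1) (2 & 1) (3 & 0)) ∷ into17-0 (at⁺ (2 -&- 4) (1 &- 1) (3 -&- 1) (3 & 0)) e₁ (at⁺ (3 -&- 3) (1 &- 1) (2 -&- 1) (3 & 0)) ∷ into17-0 (at⁺ (1 -&- 1) 0O 0O 1O) e₁ (at⁺ (2 -& 0) 0O 1O 1O) ∷ into17-0 (at⁺ (1 -&- 1) 0O 0O 1O) e₁ (at⁺ (0 &- 1) 0O -1O 1O)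 ∷ into17-0 (at⁺ (1 -& 1) (2 -&- 1) (6 & 4) (3 & 0)) e₁ (at⁺ (0 & 1) (2 -&- 1) (5 & 4) (3 & 0)) ∷ into17-0 (at⁺ (5 -&- 1) (2 -&- 1) (6 -&- 4) (3 & 0)) e₁ (at⁺ (6 -& 0) (2 -&- 1) (5 -&- 4) (3 & 0)) ∷ into17-0 (at⁺ 0O 1O (1 & 1) 1O) e₁ (at⁺ (1 -& 1) 1O (2 & 1) 1O) ∷ into17-0 (at⁺ (2 -& 0) 1O (1 -&- 1) 1O) e₁ (at⁺ -1O 1O (2 -&- 1) 1O) ∷ []) ∷ leaf (2 & 1) ∷ leaf (2 & 1) ∷ leaf (2 & 1) ∷ leaf (2 & 1) ∷ leaf (2 & 1) ∷ leaf (2 & 1) ∷ leaf (2 & 1) ∷ into17-5 e₁ (at 0O 1O -1O) e₂ ∷ leaf (2 & 1) ∷ target (2 & 1) (leaf (9 &- 3) ∷ leaf (9 &- 3) ∷ []) ∷ target (2 & 1) (into17-6 e₁ (at⁺ 0O (2 -&- 2) (3 -&- 2) (0 & 1)) (at 0O 1O (1 & 1)) ∷ into17-6 e₁ (at⁺ 0O (2 & 1) (5 & 3) (0 & 1)) (at 0O 1O (1 & 1)) ∷ []) ∷ leaf (2 & 1) ∷ target (9 &- 3) (into17-5 e₁ (at⁺ (4 &- 1) -1O -1O (0 & 1)) e₂ ∷ into17-5 e₁ (at⁺ (4 &- 1) -1O 1O (0 & 1)) e₂ ∷ into17-5 e₁ (at⁺ (12 &- 3) (3 & 1) (3 -&-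 1) (0 & 3)) e₂ ∷ into17-5 e₁ (at⁺ (12 &- 3) (3 & 1) (3 & 1) (0 & 3)) e₂ ∷ into17-5 e₁ (at⁺ (0 &- 1) (1 -& 1) (1 -& 1) (0 & 1)) e₂ ∷ into17-5 e₁ (at⁺ (0 &- 1) (1 -& 1) (1 &- 1) (0 & 1)) e₂ ∷ into17-5 e₁ (at⁺ (0 &- 3) (3 &- 2) (3 -& 2) (0 & 3)) e₂ ∷ into17-5 e₁ (at⁺ (0 &- 3) (3 &- 2) (3 &- 2) (0 & 3)) e₂ ∷ []) ∷ []) ∷ [])

 grams17 : List Gram
 grams17 = g17-0 ∷ g17-1 ∷ g17-2 ∷ g17-3 ∷ g17-4 ∷ g17-5 ∷ g17-6 ∷ g17-7 ∷ g17-8 ∷ g17-9 ∷ g17-10 ∷ []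

 g21-0 : Gram
 g21-0 = gram 1O 1O (2 & 1) 0O 0O (1 -&- 1)

 g21-1 : Gram
 g21-1 = gram (2 & 1) (2 & 1) (9 & 5) 0O 0O (7 -&- 4)

 f21-1 : Cert
 f21-1 = final 1 (part (tri 1O 0O 0O) (tri 1O 0O 0O) (residue 2 2 (+ 0)) ∷ []) ([])

 into21-1 : Combo → Combo → Combo → Cert
 into21-1 u v w = rebase u v w [] g21-1 [] f21-1

 f21-0 : Cert
 f21-0 = final 0 (part (tri (0 & 1) 0O 0O) (tri 1O 0O 0O) (residue 2 2 (+ 0)) ∷ []) ([])

 into21-0 : Combo → Combo → Combo → Cert
 into21-0 u v w = rebase u v w [] g21-0 [] f21-0

 c21 : Cert₁
 c21 = target₁ (5 &- 1) (target₂ (3 &- 1) (into21-1 (at (2 -&- 1) (2 & 1) (2 & 1)) (at (1 -&- 1) 0O (4 -&- 2)) (at (4 & 2) 0O (7 & 4)) ∷ into21-1 (at (3 -&- 2) (2 & 1) (2 -&- 1)) (at (1 & 1) 0O (4 & 2)) (at (2 -&- 1) 0O (7 -&- 4)) ∷ into21-1 (at 0O 0O (2 & 1)) (at (5 -&- 3) (4 & 2) (4 -&- 2)) (at (11 & 6) (7 -&- 4) (7 & 4)) ∷ target (2 & 0) (into21-1 (at⁺ (5 -&- 2) (2 & 1) -1O (0 & 1)) (at 0O 0O (2 & 1)) (at⁺ 1O 0O (3 -&- 2) 1O) ∷ into21-1 (at⁺ (5 -&- 2) (2 & 1) (1 -&- 1) (0 & 1)) (at 0O 0O (2 & 1)) (at⁺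 1O 0O (4 -&- 2) 1O) ∷ into21-1 (at⁺ (3 -&- 1) (2 & 1) 0O 1O) (at 0O 0O (2 & 1)) (at⁺ (3 & 1) 0O 0O (1 & 1)) ∷ into21-1 (at⁺ (3 -&- 1) (2 & 1) (2 -&- 1) 1O) (at 0O 0O (2 & 1)) (at⁺ (3 & 1) 0O (7 -&- 4) (1 & 1)) ∷ into21-1 (at⁺ (3 -&- 2) (2 & 1) (3 & 2) (1 & 1)) (at 0O 0O (2 & 1)) (at⁺ 1O 0O -1O (0 & 1)) ∷ into21-1 (at⁺ (3 -&- 2) (2 & 1) (5 -&- 3) (1 & 1)) (at 0O 0O (2 & 1)) (at⁺ 1O 0O (6 -&- 4) (0 & 1)) ∷ []) ∷ leaf (2 & 0) ∷ []) ∷ target₂ (3 &- 1) (into21-0 (at (2 -& 0) 1O (2 -&- 1)) (at -1O 0O (1 -&- 1)) (at (1 & 1) 0O (4 & 2)) ∷ into21-0 (at (1 -& 1) 1O (2 & 1)) (at (2 & 0) 0O (1 & 1)) (at (1 -&- 1) 0O (4 -&- 2)) ∷ leaf (2 & 0) ∷ target (6 &- 2) (into21-0 (at⁺ (1 &- 1) 1O (1 -&- 1) (0 & 1)) (at⁺ (1 &- 1) 0O (1 -&- 1) (1 & 1)) (at 0O 0O (2 & 1)) ∷ into21-0 (at⁺ (1 &- 1) 1O -1O (0 & 1)) (at⁺ (1 &- 1) 0O 0O (1 & 1)) (at 0O 0O (2 & 1)) ∷ into21-0 (at⁺ (3 -& 1) 1O -1O 1O) (at⁺ (3 &- 1) 0O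 (2 & 0) (0 & 1)) (at 0O 0O (2 & 1)) ∷ into21-0 (at⁺ (3 -& 1) 1O (1 -&- 1) 1O) (at⁺ (3 &- 1) 0O (3 -&- 1) (0 & 1)) (at 0O 0O (2 & 1)) ∷ into21-0 (at⁺ (2 -& 0) 1O 1O (1 & 1)) (at⁺ 0O 0O -1O 1O) (at 0O 0O (2 & 1)) ∷ into21-0 (at⁺ (2 -& 0) 1O (3 -&- 1) (1 & 1)) (at⁺ 0O 0O (0 &- 1) 1O) (at 0O 0O (2 & 1)) ∷ []) ∷ leaf (2 & 0) ∷ []) ∷ target₂ (3 &- 1) (leaves (7 &- 2 ∷ 7 &- 2 ∷ 2 & 0 ∷ 7 &- 2 ∷ 2 & 0 ∷ 2 & 0 ∷ 2 & 0 ∷ [])) ∷ target₂ (3 &- 1) (into21-0 (at (2 & 0) 1O (0 & 1)) (at -1O 0O (1 -&- 1)) (at (1 & 1) 0O (4 & 2)) ∷ into21-1 (at (2 -&- 1) (2 & 1) (9 -&- 5)) (at (1 & 1) 0O (4 & 2)) (at (2 -&- 1) 0O (7 -&- 4)) ∷ into21-1 (at (5 & 3) (2 & 1) (9 & 5)) (at (1 -&- 1) 0O (4 -&- 2)) (at (4 & 2) 0O (7 & 4)) ∷ into21-0 (at (3 -& 1) 1O (0 &- 1)) (at (2 & 0) 0O (1 & 1)) (at (1 -&- 1) 0O (4 -&- 2)) ∷ into21-1 (at 0O 0O (2 & 1)) (at (1 -& 1) (2 & 0) (2 -& 0)) (at -1O (1 -&- 1) (1 & 1)) ∷ target (6 &-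 2) (into21-0 (at⁺ (2 &- 1) 1O 0O (0 & 1)) (at⁺ (1 &- 1) 0O (1 -&- 1) (1 & 1)) (at 0O 0O (2 & 1)) ∷ into21-0 (at⁺ (2 &- 1) 1O (0 & 1) (0 & 1)) (at⁺ (1 &- 1) 0O 0O (1 & 1)) (at 0O 0O (2 & 1)) ∷ into21-0 (at⁺ (2 -& 1) 1O (0 & 1) 1O) (at⁺ (3 &- 1) 0O (2 & 0) (0 & 1)) (at 0O 0O (2 & 1)) ∷ into21-0 (at⁺ (2 -& 1) 1O 0O 1O) (at⁺ (3 &- 1) 0O (3 -&- 1) (0 & 1)) (at 0O 0O (2 & 1)) ∷ into21-0 (at⁺ -1O 1O (2 & 1) (1 & 1)) (at⁺ 0O 0O -1O 1O) (at 0O 0O (2 & 1)) ∷ into21-0 (at⁺ -1O 1O (2 -& 0) (1 & 1)) (at⁺ 0O 0O (0 &- 1) 1O) (at 0O 0O (2 & 1)) ∷ []) ∷ leaf (2 & 0) ∷ leaf (2 & 0) ∷ target (2 & 0) (into21-1 (at⁺ -1O (2 & 1) (4 -&- 2) (1 & 1)) (at 0O 0O (2 & 1)) (at⁺ 1O 0O (3 -&- 2) 1O) ∷ into21-1 (at⁺ -1O (2 & 1) (5 -&- 3) (1 & 1)) (at 0O 0O (2 & 1)) (at⁺ 1O 0O (4 -&- 2) 1O) ∷ into21-1 (at⁺ (4 & 1) (2 & 1) (2 -&- 1) (0 & 1)) (at 0O 0O (2 & 1)) (at⁺ (3 & 1) 0O 0O (1 & 1)) ∷ into21-1 (at⁺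 (4 & 1) (2 & 1) (7 -&- 4) (0 & 1)) (at 0O 0O (2 & 1)) (at⁺ (3 & 1) 0O (7 -&- 4) (1 & 1)) ∷ into21-1 (at⁺ (1 & 1) (2 & 1) (3 -&- 2) 1O) (at 0O 0O (2 & 1)) (at⁺ 1O 0O -1O (0 & 1)) ∷ into21-1 (at⁺ (1 & 1) (2 & 1) (6 -&- 3) 1O) (at 0O 0O (2 & 1)) (at⁺ 1O 0O (6 -&- 4) (0 & 1)) ∷ []) ∷ leaf (2 & 0) ∷ []) ∷ target₂ (3 &- 1) (into21-0 (at (1 &- 1) 1O (2 -& 0)) (at -1O 0O (1 -&- 1)) (at (1 & 1) 0O (4 & 2)) ∷ leaf (4 & 1) ∷ into21-0 (at (3 -& 1) 1O (2 & 0)) (at (2 & 0) 0O (1 & 1)) (at (1 -&- 1) 0O (4 -&- 2)) ∷ target (6 &- 2) (into21-0 (at -1O 1O -1O) (at⁺ (1 &- 1) 0O (1 -&- 1) (1 & 1)) (at 0O 0O (2 & 1)) ∷ into21-0 (at -1O 1O -1O) (at⁺ (1 &- 1) 0O 0O (1 & 1)) (at 0O 0O (2 & 1)) ∷ into21-0 (at -1O 1O -1O) (at⁺ (3 &- 1) 0O (2 & 0) (0 & 1)) (at 0O 0O (2 & 1)) ∷ into21-0 (at -1O 1O -1O) (at⁺ (3 &- 1) 0O (3 -&- 1) (0 & 1)) (at 0O 0O (2 & 1)) ∷ into21-0 (at -1O 1O -1O) (at⁺ 0O 0O (0 &- 1) 1O) (at 0O 0O (2 & 1)) ∷ into21-0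 (at -1O 1O -1O) (at⁺ 0O 0O -1O 1O) (at 0O 0O (2 & 1)) ∷ into21-0 e₁ (at⁺ 1O -1O 0O 1O) (at 0O 0O (2 & 1)) ∷ into21-0 e₁ (at⁺ (2 -& 1) (2 &- 1) (0 & 1) (0 & 1)) (at 0O 0O (2 & 1)) ∷ into21-0 e₁ (at⁺ 0O 0O -1O 1O) (at 0O 0O (2 & 1)) ∷ into21-0 e₁ (at⁺ (0 & 1) (0 &- 1) -1O (1 & 1)) (at 0O 0O (2 & 1)) ∷ into21-0 e₁ (at⁺ (3 &- 1) (3 -& 1) (5 &- 1) (0 & 1)) (at 0O 0O (2 & 1)) ∷ into21-0 e₁ (at⁺ (0 & 1) (0 &- 1) (0 & 1) (1 & 1)) (at 0O 0O (2 & 1)) ∷ []) ∷ target (6 &- 2) (into21-0 e₁ (at⁺ (2 -& 1) (2 &- 1) (0 & 1) (0 & 1)) (at⁺ (9 -& 2) (9 &- 2) (6 & 6) (0 & 4)) ∷ into21-0 e₁ (at⁺ (2 -& 0) (2 & 0) (5 & 1) (0 & 2)) (at⁺ (4 -&- 1) (4 & 1) (11 & 3) (0 & 3)) ∷ into21-0 e₁ (at⁺ (12 -& 2) (12 &- 2) (5 -& 3) (0 & 4)) (at⁺ (4 -& 0) (4 & 0) (1 & 2) (0 & 1)) ∷ into21-0 e₁ (at⁺ (3 & 1) (3 -&- 1) (5 &- 2) (0 & 3)) (at⁺ 1O -1O (6 & 0) (0 & 2)) ∷ into21-0 e₁ (at⁺ (12 -& 2) (12 &- 2) (5 -& 7)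 (0 & 4)) (at⁺ (4 -& 0) (4 & 0) (1 & 3) (0 & 1)) ∷ into21-0 e₁ (at⁺ (8 &- 2) (8 -& 2) (15 &- 1) (0 & 4)) (at⁺ (1 &- 1) (1 -& 1) (6 & 1) (0 & 1)) ∷ []) ∷ leaf (2 & 0) ∷ leaf (2 & 0) ∷ into21-0 e₁ (at (2 -&- 1) (2 & 1) (5 -&- 3)) (at (7 & 4) (7 -&- 4) (18 & 10)) ∷ target (4 & 1) (leaf (2 & 0) ∷ leaf (2 & 0) ∷ leaf (2 & 0) ∷ leaf (2 & 0) ∷ []) ∷ []) ∷ target₂ (3 &- 1) (into21-1 (at (5 -&- 3) (2 & 1) (11 -&- 6)) (at (1 & 1) 0O (4 & 2)) (at (2 -&- 1) 0O (7 -&- 4)) ∷ leaf (4 & 1) ∷ into21-1 (at (3 & 2) (2 & 1) (11 & 6)) (at (1 -&- 1) 0O (4 -&- 2)) (at (4 & 2) 0O (7 & 4)) ∷ leaf (4 & 1) ∷ target (6 &- 2) (into21-1 (at 0O 0O (2 & 1)) (at⁺ (6 &- 4) (3 &- 1) (3 -& 1) (0 & 3)) (at⁺ (8 &- 3) (1 &- 2) (1 -& 2) (0 & 3)) ∷ into21-1 (at 0O 0O (2 & 1)) (at⁺ (11 &- 7) (2 -& 2) (2 &- 2) (0 & 4)) (at⁺ (13 &- 6) (4 -& 1) (4 &- 1) (0 & 4)) ∷ into21-1 (at 0O 0O (2 & 1)) (at⁺ (1 &- 1) (3 & 0) (3 -& 0) (0 & 1)) (at⁺ (3 & 0) (1 &-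 1) (1 -& 1) (0 & 1)) ∷ into21-1 (at 0O 0O (2 & 1)) (at⁺ (21 &- 7) (12 -& 2) (12 &- 2) (0 & 6)) (at⁺ (23 &- 6) (14 -& 1) (14 &- 1) (0 & 6)) ∷ into21-1 (at 0O 0O (2 & 1)) (at⁺ (6 &- 1) (3 &- 1) (3 -&- 2) (0 & 3)) (at⁺ (8 & 0) (1 &- 2) (1 -&- 1) (0 & 3)) ∷ into21-1 (at 0O 0O (2 & 1)) (at⁺ (11 &- 3) (2 -& 2) (2 & 2) (0 & 4)) (at⁺ (13 &- 2) (4 -& 1) (4 & 3) (0 & 4)) ∷ into21-1 (at 0O 0O (2 & 1)) (at⁺ (11 &- 3) (2 -& 2) (2 &- 6) (0 & 4)) (at⁺ (13 &- 2) (4 -& 1) (4 &- 5) (0 & 4)) ∷ into21-1 (at 0O 0O (2 & 1)) (at⁺ (6 &- 1) (3 &- 1) (3 -& 4) (0 & 3)) (at⁺ (8 & 0) (1 &- 2) (1 -& 5) (0 & 3)) ∷ into21-1 (at 0O 0O (2 & 1)) (at⁺ (1 &- 1) (2 -& 1) (2 &- 1) (0 & 1)) (at⁺ (3 & 0) (4 -& 0) (4 & 0) (0 & 1)) ∷ into21-1 (at 0O 0O (2 & 1)) (at⁺ (9 -&- 1) (18 &- 4) (18 -& 4) (0 & 6)) (at⁺ (7 -& 0) (16 &- 5) (16 -& 5) (0 & 6)) ∷ into21-1 (at 0O 0O (2 & 1)) (at⁺ (4 -& 2) (8 &- 4) (8 -&- 1) (0 & 5)) (at⁺ (2 -& 3)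 (6 &- 5) (6 -& 0) (0 & 5)) ∷ into21-1 (at 0O 0O (2 & 1)) (at⁺ (1 &- 1) (2 -& 2) (2 &- 4) (0 & 2)) (at⁺ (3 & 0) (4 -& 1) (4 &- 3) (0 & 2)) ∷ []) ∷ leaf (2 & 0) ∷ target (2 & 0) (into21-1 (at⁺ (1 -&- 1) (2 & 1) (5 -&- 3) 1O) (at 0O 0O (2 & 1)) (at⁺ 1O 0O (3 -&- 2) 1O) ∷ into21-1 (at⁺ (1 -&- 1) (2 & 1) (6 -&- 3) 1O) (at 0O 0O (2 & 1)) (at⁺ 1O 0O (4 -&- 2) 1O) ∷ into21-1 (at⁺ 1O (2 & 1) (2 -&- 1) (1 & 1)) (at 0O 0O (2 & 1)) (at⁺ (3 & 1) 0O 0O (1 & 1)) ∷ into21-1 (at⁺ 1O (2 & 1) (9 -&- 5) (1 & 1)) (at 0O 0O (2 & 1)) (at⁺ (3 & 1) 0O (7 -&- 4) (1 & 1)) ∷ into21-1 (at⁺ (1 -&- 1) (2 & 1) (8 -&- 5) (0 & 1)) (at 0O 0O (2 & 1)) (at⁺ 1O 0O (6 -&- 4) (0 & 1)) ∷ into21-1 (at⁺ (1 -&- 1) (2 & 1) (3 -&- 1) (0 & 1)) (at 0O 0O (2 & 1)) (at⁺ 1O 0O -1O (0 & 1)) ∷ []) ∷ leaf (2 & 0) ∷ leaf (4 & 1) ∷ leaf (2 & 0) ∷ leaf (2 & 0) ∷ []) ∷ target₂ (3 &- 1) (leaves (7 &- 2 ∷ 7 &- 2 ∷ 4 & 1 ∷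 7 &- 2 ∷ 2 & 0 ∷ 2 & 0 ∷ 2 & 0 ∷ 2 & 0 ∷ 2 & 0 ∷ 4 & 1 ∷ [])) ∷ [])

 grams21 : List Gram
 grams21 = g21-0 ∷ g21-1 ∷ []

 g33-0 : Gram
 g33-0 = gram 1O 1O (38 & 16) 0O (7 & 3) (2 & 1)

 g33-1 : Gram
 g33-1 = gram (19 & 8) (19 & 8) (1746 & 736) 0O (325 & 137) (102 & 43)

 f33-0 : Cert
 f33-0 = final 0 (part (tri (0 & 1) (1 & 1) 0O) (tri (0 & 1) (1 & 1) 0O) (residue 2 2 (+ 0)) ∷ []) ([])

 into33-0 : Combo → Combo → Combo → Cert
 into33-0 u v w = rebase u v w [] g33-0 [] f33-0

 f33-1 : Cert
 f33-1 = final 1 (part (tri (0 & 1) (1 & 1) 0O) (tri (0 & 1) (1 & 1) 0O) (residue 2 2 (+ 0)) ∷ []) ([])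

 into33-1 : Combo → Combo → Combo → Cert
 into33-1 u v w = rebase u v w [] g33-1 [] f33-1

 c33 : Cert₁
 c33 = target₁ (2 & 0) (target₂ (4 &- 1) (target (7 &- 1) (into33-0 (at -1O 1O 0O) e₁ (at⁺ (8 -&- 2) (5 & 1) (4 -&- 2) 1O) ∷ into33-0 (at -1O 1O 0O) e₁ (at⁺ (5 -&- 2) (5 & 1) (3 -&- 1) 1O) ∷ into33-0 (at -1O 1O 0O) e₁ (at⁺ (5 -&- 3) (2 & 2) (4 -&- 2) 1O) ∷ into33-0 (at -1O 1O 0O) e₁ (at⁺ (2 -&- 3) (2 & 2) (3 -&- 1) 1O) ∷ []) ∷ leaf (3 & 0) ∷ leaf (3 & 0) ∷ leaf (3 & 0) ∷ target (7 &- 1) (into33-0 e₁ (at -1O 1O 0O) (at⁺ (2 & 2) 0O (3 -&- 1) 1O) ∷ into33-0 e₁ (at -1O 1O 0O) (at⁺ (5 & 2) (3 -& 0) (4 -&- 2) 1O) ∷ into33-0 e₁ (at -1O 1O 0O) (at⁺ (5 & 3) (3 -&- 1) (4 -&- 2) 1O) ∷ into33-0 e₁ (at -1O 1O 0O) (at⁺ (2 & 3) (0 &- 1) (3 -&- 1) 1O) ∷ []) ∷ leaf (3 & 0) ∷ target (7 &- 1) (into33-0 (at -1O 1O 0O) e₁ (at⁺ (7 -&- 1) (8 & 0) 1O (3 & 0)) ∷ into33-0 (at -1O 1O 0O) e₁ (at⁺ (4 -&- 1) (5 & 1) (2 & 1) 1O) ∷ into33-0 (at -1O 1O 0O) e₁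 (at⁺ (2 &- 4) (1 -& 3) 1O (3 & 0)) ∷ into33-0 (at -1O 1O 0O) e₁ (at⁺ (1 -&- 2) (2 & 2) (2 & 1) 1O) ∷ into33-0 e₁ (at -1O 1O 0O) (at⁺ (2 -& 1) (1 & 2) 1O (3 & 0)) ∷ into33-0 e₁ (at -1O 1O 0O) (at⁺ (1 & 1) (1 & 1) (2 & 1) 1O) ∷ into33-0 e₁ (at -1O 1O 0O) (at⁺ (2 -& 4) (1 &- 1) 1O (3 & 0)) ∷ into33-0 e₁ (at -1O 1O 0O) (at⁺ (1 & 2) 1O (2 & 1) 1O) ∷ []) ∷ []) ∷ target₂ (7 &- 2) (into33-1 (at -1O (2 & 1) (2 -&- 1)) (at (2 -&- 1) 0O (7 & 3)) (at 0O (19 & 8) 0O) ∷ leaf (7 &- 1) ∷ leaf (7 &- 1) ∷ into33-1 (at (1 -&- 1) (2 & 1) (2 & 1)) (at (2 & 1) 0O (7 -&- 3)) (at 0O (19 & 8) 0O) ∷ leaf (7 &- 1) ∷ leaf (3 & 0) ∷ target (6 &- 1) (into33-1 (at⁺ (3 &- 3) (0 & 1) (2 -& 0) (0 & 1)) (at 0O (7 & 3) (19 & 8)) (at 0O (19 & 8) 0O) ∷ into33-1 (at⁺ (5 -&- 1) (0 &- 1) (10 -&- 5) (0 & 1)) (at 0O (7 & 3) (19 & 8)) (at 0O (19 & 8) 0O) ∷ into33-1 (at⁺ (3 &- 3) (0 &- 1) (10 -&- 3) (0 & 1)) (at 0O (7 & 3) (19 & 8)) (at 0O (19 & 8) 0O)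 ∷ into33-1 (at⁺ (5 -&- 1) (0 & 1) (2 -&- 2) (0 & 1)) (at 0O (7 & 3) (19 & 8)) (at 0O (19 & 8) 0O) ∷ []) ∷ target (6 &- 1) (into33-1 (at⁺ (3 -&- 1) (0 & 1) (2 & 0) (0 & 1)) (at (7 -&- 3) (7 & 3) (19 -&- 8)) (at 0O (19 & 8) 0O) ∷ into33-1 (at⁺ (5 &- 1) (0 &- 1) (10 & 5) (0 & 1)) (at (7 -&- 3) (7 & 3) (19 -&- 8)) (at 0O (19 & 8) 0O) ∷ into33-1 (at⁺ (3 -& 1) (0 &- 1) (10 & 3) (0 & 1)) (at (7 -&- 3) (7 & 3) (19 -&- 8)) (at 0O (19 & 8) 0O) ∷ into33-1 (at⁺ (5 &- 3) (0 & 1) (2 & 2) (0 & 1)) (at (7 -&- 3) (7 & 3) (19 -&- 8)) (at 0O (19 & 8) 0O) ∷ []) ∷ leaf (7 &- 1) ∷ leaf (3 & 0) ∷ leaf (7 &- 1) ∷ leaf (7 &- 1) ∷ leaf (3 & 0) ∷ leaf (3 & 0) ∷ leaf (3 & 0) ∷ leaf (3 & 0) ∷ []) ∷ target₂ (7 &- 2) (leaf (18 &- 5) ∷ leaf (18 &- 5) ∷ leaf (8 &- 2) ∷ target (4 &- 1) (leaf (13 & 5) ∷ leaf (5 & 2) ∷ []) ∷ target (4 &- 1) (leaf (13 & 5) ∷ leaf (5 & 2) ∷ []) ∷ leaf (5 & 2) ∷ leaf (5 & 2) ∷ leaf (8 &- 2) ∷ leaf (8 &- 2) ∷ leaf (4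 &- 1) ∷ leaf (4 &- 1) ∷ target (5 & 2) (leaf (13 & 5) ∷ leaf (13 & 5) ∷ []) ∷ leaf (4 &- 1) ∷ leaf (4 &- 1) ∷ []) ∷ [])

 grams33 : List Gram
 grams33 = g33-0 ∷ g33-1 ∷ []

 g41-0 : Gram
 g41-0 = gram 1O (4 & 0) (15 &- 4) (3 & 0) (4 &- 1) 0O

 f41-0 : Cert
 f41-0 = final 0 (part (tri 0O (0 & 1) 1O) (tri 0O (0 & 1) 1O) (residue 2 2 (+ 0)) ∷ []) ([])

 into41-0 : Combo → Combo → Combo → Cert
 into41-0 u v w = rebase u v w [] g41-0 [] f41-0

 c41 : Cert₁
 c41 = target₁ (4 &- 1) (target₂ (3 & 1) (into41-0 e₁ (at (1 & 1) (3 -&- 1) (4 &- 1)) (at (7 &- 2) 1O (11 -& 3)) ∷ into41-0 e₁ (at (5 & 0) (3 -&- 1) (4 -& 1)) (at (4 -& 1) 1O (11 &- 3)) ∷ leaf (5 &- 1) ∷ leaf (2 & 0) ∷ []) ∷ target₂ (3 & 1) (leaves (4 & 1 ∷ 4 & 1 ∷ 2 & 0 ∷ 2 & 0 ∷ 2 & 0 ∷ 3 & 0 ∷ [])) ∷ [])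

 grams41 : List Gram
 grams41 = g41-0 ∷ []

 g65-0 : Gram
 g65-0 = gram 1O (2 & 0) (4 & 0) 1O (2 & 0) (2 &- 1)

 f65-0 : Cert
 f65-0 = final 0 (part (tri (2 & 1) (6 & 0) (7 & 0)) (tri (6 & 1) (2 & 0) 1O) (residue 8 2 (+ 0)) ∷ []) ([])

 -- The extra vector of each `rebase` is (1 + ω)/2 times the third basis vector, with products 1 +
 -- ω, -7 and 4 + 4ω.
 c65 : Cert₁
 c65 = target₁ (5 &- 1) (target₂ (2 & 0) (leaf (3 & 0) ∷ target (4 & 1) (rebase e₁ (at 1O 0O -1O) (at⁺ (2 &- 1) (6 & 2) (8 -&- 1) (0 & 1)) ((at⁺ 1O (3 & 1) (4 -&- 1) (0 & 1)) ∷ []) g65-0 ((tri (1 & 1) (7 -& 0) (4 & 4)) ∷ []) f65-0 ∷ rebase e₁ (at 1O 0O -1O) (at⁺ (2 & 0) (10 -&- 3) (8 & 2) (0 & 1)) ((at⁺ (1 & 1) (13 -&- 4) (12 & 2) (0 & 1)) ∷ []) g65-0 ((tri (1 & 1) (7 -& 0) (4 & 4)) ∷ []) f65-0 ∷ []) ∷ target (4 & 1) (rebase e₁ e₃ (at⁺ (6 -&- 2) (6 & 2) (8 & 1) (0 & 1)) ((at⁺ (3 -&- 1) (3 & 1) (4 & 1) (0 & 1)) ∷ []) g65-0 ((tri (1 & 1) (7 -& 0) (4 & 4)) ∷ []) f65-0 ∷ rebase e₁ e₃ (at⁺ (10 & 2) (10 -&- 3) (8 -&- 2) (0 & 1)) ((at⁺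 (13 & 3) (13 -&- 4) (12 -&- 2) (0 & 1)) ∷ []) g65-0 ((tri (1 & 1) (7 -& 0) (4 & 4)) ∷ []) f65-0 ∷ []) ∷ leaf (3 & 0) ∷ leaf (3 & 0) ∷ leaf (4 & 1) ∷ target (4 & 1) (rebase e₁ (at⁺ (47 & 11) (93 -&- 27) (23 & 8) (0 & 5)) (at⁺ (18 & 4) (34 -&- 10) (8 & 3) (0 & 2)) ((at⁺ (25 & 6) (49 -&- 14) (12 & 4) (0 & 3)) ∷ []) g65-0 ((tri (1 & 1) (7 -& 0) (4 & 4)) ∷ []) f65-0 ∷ rebase e₁ (at⁺ (17 -&- 6) (35 & 10) (9 -&- 3) (0 & 2)) (at⁺ (46 -&- 16) (94 & 27) (24 -&- 8) (0 & 5)) ((at⁺ (39 -&- 13) (79 & 23) (20 -&- 7) (0 & 4)) ∷ []) g65-0 ((tri (1 & 1) (7 -& 0) (4 & 4)) ∷ []) f65-0 ∷ []) ∷ leaf (4 & 1) ∷ []) ∷ target₂ (2 & 0) (leaves (3 & 0 ∷ 3 & 0 ∷ 3 & 0 ∷ 6 & 0 ∷ 10 &- 1 ∷ 6 & 0 ∷ 10 &- 1 ∷ 3 & 0 ∷ 3 & 0 ∷ 3 & 0 ∷ 4 & 1 ∷ 7 &- 1 ∷ 4 & 1 ∷ 10 &- 1 ∷ [])) ∷ [])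

 g77-0 : Gram
 g77-0 = gram 1O 1O (8 & 2) 0O 0O (3 & 1)

 g77-1 : Gram
 g77-1 = gram (4 & 1) (4 & 1) (70 & 18) 0O 0O (31 & 8)

 f77-1 : Cert
 f77-1 = final 1 (part (tri 1O 0O 0O) (tri 1O 0O 0O) (residue 2 2 (+ 0)) ∷ []) ([])

 into77-1 : Combo → Combo → Combo → Cert
 into77-1 u v w = rebase u v w [] g77-1 [] f77-1

 f77-0 : Cert
 f77-0 = final 0 (part (tri (0 & 1) 0O 0O) (tri 1O 0O 0O) (residue 2 2 (+ 0)) ∷ []) ([])

 into77-0 : Combo → Combo → Combo → Cert
 into77-0 u v w = rebase u v w [] g77-0 [] f77-0

 c77 : Cert₁
 c77 = target₁ (10 &- 2) (target₂ (11 &- 1) (into77-1 (at (8 -&- 2) (4 & 1) (4 & 1)) (at (3 & 1) (8 & 2) 0O) (at (16 & 4) (31 & 8) 0O) ∷ into77-1 (at (11 -&- 3) (4 -&- 1) (4 & 1)) (at (3 & 1) (8 & 2) 0O) (at (16 & 4) (31 & 8) 0O) ∷ leaf (31 &- 6) ∷ leaf (31 &- 6) ∷ target (31 &- 6) (into77-0 (at⁺ (7 &- 1) (0 & 1) 0O 1O) e₁ (at 0O (4 -&- 1) 0O) ∷ into77-0 (at⁺ (8 &- 1) (1 -& 1) 1O 1O) e₁ (at 0O (4 -&- 1) 0O) ∷ into77-0 (at⁺ (12 -& 2) (0 &- 1) 0O 1O) e₁ (at 0O (4 -&- 1) 0O) ∷ into77-0 (at⁺ (11 -& 2) (1 -&-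 1) 1O 1O) e₁ (at 0O (4 -&- 1) 0O) ∷ into77-0 (at⁺ (11 &- 2) (1 -& 1) 0O 1O) e₁ (at 0O (4 -&- 1) 0O) ∷ into77-0 (at⁺ (12 &- 2) (2 -& 1) 1O 1O) e₁ (at 0O (4 -&- 1) 0O) ∷ into77-0 (at⁺ (11 -& 2) (0 &- 1) 1O 1O) e₁ (at 0O (4 -&- 1) 0O) ∷ into77-0 (at⁺ (12 -& 2) (1 &- 1) 0O 1O) e₁ (at 0O (4 -&- 1) 0O) ∷ []) ∷ target (31 &- 6) (into77-0 (at⁺ (7 &- 1) (0 & 1) 0O 1O) e₁ (at 0O (4 -&- 1) 0O) ∷ into77-0 (at⁺ (4 & 0) (1 & 1) 1O 1O) e₁ (at 0O (4 -&- 1) 0O) ∷ into77-0 (at⁺ (12 -& 2) (0 &- 1) 0O 1O) e₁ (at 0O (4 -&- 1) 0O) ∷ into77-0 (at⁺ (15 -& 3) (1 &- 1) 1O 1O) e₁ (at 0O (4 -&- 1) 0O) ∷ into77-0 (at⁺ (8 &- 1) (0 & 1) 1O 1O) e₁ (at 0O (4 -&- 1) 0O) ∷ into77-0 (at⁺ (11 &- 2) (1 -& 1) 0O 1O) e₁ (at 0O (4 -&- 1) 0O) ∷ into77-0 (at⁺ (12 -& 2) (1 &- 1) 0O 1O) e₁ (at 0O (4 -&- 1) 0O) ∷ into77-0 (at⁺ (15 -& 3) (2 &- 1) 1O 1O) e₁ (at 0O (4 -&- 1) 0O) ∷ []) ∷ into77-0 (at (5 & 0) (2 & 1) 1O) e₁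 (at 0O (4 -&- 1) 0O) ∷ into77-1 (at (8 -&- 2) (35 -&- 9) (4 & 1)) (at (3 & 1) (8 & 2) 0O) (at (16 & 4) (31 & 8) 0O) ∷ into77-1 (at (23 & 6) (35 & 9) (4 & 1)) (at (3 & 1) (8 & 2) 0O) (at (16 & 4) (31 & 8) 0O) ∷ into77-0 (at (6 -& 1) (2 -&- 1) 1O) e₁ (at 0O (4 -&- 1) 0O) ∷ leaf (31 &- 6) ∷ leaf (10 & 1) ∷ leaf (31 &- 6) ∷ leaf (10 & 1) ∷ leaf (10 & 1) ∷ leaf (10 & 1) ∷ leaf (10 & 1) ∷ leaf (16 &- 1) ∷ leaf (10 & 1) ∷ leaf (16 &- 1) ∷ leaf (10 & 1) ∷ leaf (10 & 1) ∷ leaf (10 & 1) ∷ leaf (10 & 1) ∷ leaf (15 &- 2) ∷ leaf (10 & 1) ∷ []) ∷ target₂ (5 &- 1) (target (2 & 0) (into77-1 (at 0O (4 & 1) (4 -&- 1)) (at 0O 0O (4 & 1)) (at⁺ (2 & 0) 0O (6 & 2) (0 & 1)) ∷ into77-1 (at 0O 0O (4 & 1)) (at 0O (4 & 1) (4 -&- 1)) (at⁺ (2 & 0) (6 & 2) (6 -&- 2) (0 & 1)) ∷ into77-1 (at 0O (4 & 1) (4 -&- 1)) (at 0O 0O (4 & 1)) (at⁺ (2 & 0) 0O (25 & 6) (0 & 1)) ∷ into77-1 (at 0O 0O (4 & 1)) (at 0O (4 & 1) (4 -&- 1)) (at⁺ (2 & 0) (25 & 6) (25 -&- 6) (0 &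 1)) ∷ []) ∷ target (15 &- 3) (into77-0 e₁ (at⁺ 0O (10 & 0) (5 -&- 1) (0 & 2)) (at 0O (4 -&- 1) (4 & 1)) ∷ into77-0 e₁ (at⁺ 0O (10 & 0) (5 -& 1) (0 & 2)) (at 0O (4 -&- 1) (4 & 1)) ∷ []) ∷ leaf (11 &- 1) ∷ []) ∷ [])

 grams77 : List Gram
 grams77 = g77-0 ∷ g77-1 ∷ []

-- Evaluation of the tables and coverage of small D.

module Tables where
 open Certificates
 open Refutation
 open CertificateData
 open import Data.Nat using (_≡ᵇ_; _≤ᵇ_)
 open import Data.Bool using (false; _∨_)
 open import Data.Bool.ListAction using (all; any)
 open import Data.List using ([]; _∷_)
 open import Data.List.Relation.Unary.All using ([]; _∷_)

 valid : ℕ × Cert₁ → Bool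
 valid (D , cert) = checkBy D (D ℕ.% 4 ℕ.≟ 1) cert

 tables : List (List (ℕ × Cert₁))
 tables = table0 ∷ table1 ∷ table2 ∷ table3 ∷ table4 ∷ table5 ∷ table6 ∷ table7 ∷ table8 ∷ []

 -- The type checker runs the verified checker here. Cutting the data into several tables keeps the
 -- evaluations separate.
 valid0 : all valid table0 ≡ true
 valid0 = refl
 valid1 : all valid table1 ≡ true
 valid1 = refl
 valid2 : all valid table2 ≡ true
 valid2 = refl
 valid3 : all valid table3 ≡ true
 valid3 = refl
 valid4 : all valid table4 ≡ true
 valid4 = refl
 valid5 : all valid table5 ≡ true
 valid5 = refl
 valid6 : all valid table6 ≡ true
 valid6 = refl
 valid7 : all valid table7 ≡ true
 valid7 = refl
 valid8 : all valid table8 ≡ true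
 valid8 = refl

 tables-valid : All (λ l → all valid l ≡ true) tables
 tables-valid = valid0 ∷ valid1 ∷ valid2 ∷ valid3 ∷ valid4 ∷ valid5 ∷ valid6 ∷ valid7 ∷ valid8 ∷ []

 tabulated : ℕ → List (ℕ × Cert₁) → Bool
 tabulated D []            = false
 tabulated D ((E , _) ∷ l) = (D ≡ᵇ E) ∨ tabulated D l

 -- The first five entries are removed by the assumptions on D; the other ten are the fields of the
 -- classification.
 exceptions : List ℕ
 exceptions = 0 ∷ 1 ∷ 2 ∷ 3 ∷ 5 ∷ 6 ∷ 7 ∷ 10 ∷ 13 ∷ 17 ∷ 21 ∷ 33 ∷ 41 ∷ 65 ∷ 77 ∷ []

 -- Square divisors are sought for roots from 2 to 31, which is enough below 961 = 31². `sparse`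
 -- collects the D with discriminant 4D already beyond the bound.
 exceptional squareful sparse listed covered : ℕ → Bool
 exceptional D = any (D ≡ᵇ_) exceptions
 squareful D = any (λ n → D ℕ.% ((2 ℕ.+ n) ℕ.* (2 ℕ.+ n)) ≡ᵇ 0) (upTo 30)
 sparse D = not (D ℕ.% 4 ≡ᵇ 1) ∧ (241 ≤ᵇ D)
 listed D = any (tabulated D) tables
 covered D = exceptional D ∨ (squareful D ∨ (sparse D ∨ listed D))

 coverage : all covered (upTo 961) ≡ true
 coverage = refl

-- The fields with free universal lattices.

module FreeCases where
 open import Defs
 open QuadraticSpaces
 open SealedField
 open Certificates
 open IntegralDivision
 open Parity
 open FieldInstance
 open QuadraticIntegers
 open Correspondences
 open Discriminants
 open Refutation
 open CertificateData
 open CertificateSoundness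
 open LatticeInstances

 Claim : ℕ → Set
 Claim D = ∀ Q k (g : Fin k → V) → IntegralLat D Q k g → Universal D Q k g → Classification D Q k g

 disc6 : Discriminant 6
 disc6 = discriminant₀ 6 (s≤s z≤n) λ ()
 disc7 : Discriminant 7
 disc7 = discriminant₀ 7 (s≤s z≤n) λ ()
 disc10 : Discriminant 10
 disc10 = discriminant₀ 10 (s≤s z≤n) λ ()
 disc13 : Discriminant 13
 disc13 = discriminant₁ 13 refl
 disc17 : Discriminant 17
 disc17 = discriminant₁ 17 refl
 disc21 : Discriminant 21
 disc21 = discriminant₁ 21 refl
 disc33 : Discriminant 33
 disc33 = discriminant₁ 33 refl
 disc41 : Discriminant 41
 disc41 = discriminant₁ 41 refl
 disc65 : Discriminant 65
 disc65 = discriminant₁ 65 refl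
 disc77 : Discriminant 77
 disc77 = discriminant₁ 77 refl

 Accepted : ∀ {D} → Discriminant D → (ℕ → Gram × Kind) → Cert₁ → Set
 Accepted disc forms cert = Checker.check₁ (Discriminant.s disc) (Discriminant.p disc) (Discriminant.Δ disc) forms cert ≡ true

 accepted6 : Accepted disc6 (select grams6) c6
 accepted6 = refl
 accepted7 : Accepted disc7 (select grams7) c7
 accepted7 = refl
 accepted13 : Accepted disc13 (select grams13) c13
 accepted13 = refl
 accepted17 : Accepted disc17 (select grams17) c17
 accepted17 = refl
 accepted21 : Accepted disc21 (select grams21) c21
 accepted21 = refl
 accepted33 : Accepted disc33 (select grams33) c33
 accepted33 = refl
 accepted41 : Accepted disc41 (select grams41) c41
 accepted41 = refl
 accepted77 : Accepted disc77 (select grams77) c77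
 accepted77 = refl

 -- The Gram data, turned into forms, evaluate to the forms named in the statement; hence the
 -- disjunction has the required type by computation.
 claim6 : Claim 6
 claim6 Q k g i u = inj₁ (refl , FreeForms.chosen disc6 grams6 c6 accepted6 Q k g i u)
 claim7 : Claim 7
 claim7 Q k g i u = inj₂ (inj₁ (refl , FreeForms.chosen disc7 grams7 c7 accepted7 Q k g i u))
 claim13 : Claim 13
 claim13 Q k g i u = inj₂ (inj₂ (inj₂ (inj₁ (refl , FreeForms.chosen disc13 grams13 c13 accepted13 Q k g i u))))
 claim17 : Claim 17
 claim17 Q k g i u = inj₂ (inj₂ (inj₂ (inj₂ (inj₁ (refl , FreeForms.chosen disc17 grams17 c17 accepted17 Q k g i u)))))
 claim21 : Claim 21
 claim21 Q k g i u = inj₂ (inj₂ (inj₂ (inj₂ (inj₂ (inj₁ (refl , FreeForms.chosen disc21 grams21 c21 accepted21 Q k g i u))))))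
 claim33 : Claim 33
 claim33 Q k g i u = inj₂ (inj₂ (inj₂ (inj₂ (inj₂ (inj₂ (inj₁ (refl , FreeForms.chosen disc33 grams33 c33 accepted33 Q k g i u)))))))
 claim41 : Claim 41
 claim41 Q k g i u = inj₂ (inj₂ (inj₂ (inj₂ (inj₂ (inj₂ (inj₂ (inj₁ (refl , FreeForms.chosen disc41 grams41 c41 accepted41 Q k g i u))))))))
 claim77 : Claim 77
 claim77 Q k g i u = inj₂ (inj₂ (inj₂ (inj₂ (inj₂ (inj₂ (inj₂ (inj₂ (inj₂ (refl , FreeForms.chosen disc77 grams77 c77 accepted77 Q k g i u)))))))))

-- The two fields with non-free lattices.

module NonFreeCases where
 open import Defs
 open QuadraticSpaces
 open SealedField
 open Certificates
 open IntegralDivision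
 open Lattices
 open TraceOrder using (ℤ-scalars)
 open Parity
 open FieldInstance
 open QuadraticIntegers
 open LatticeInstances
 open CertificateSoundness
 open Correspondences
 open Discriminants
 open Refutation
 open CertificateData
 open FreeCases
 open import Data.Nat using (zero; suc)
 open import Data.Integer using (ℤ; +_)
 open import Data.Rational using (½)
 open import Relation.Nullary using (¬_)

 module HalfCoordinates (S : Scalars) where
   open Scalars S
   open ScalarSolver S

   split₁₀ : ∀ k l w γ → ⟦ + 2 ⟧ * γ ≡ ⟦ + 0 ⟧ + ⟦ + 1 ⟧ * w → ⟦ + 2 ℤ.* k ⟧ + ⟦ l ⟧ * w ≡ ⟦ + 2 ⟧ * (⟦ k ⟧ + ⟦ l ⟧ * γ)
   split₁₀ k l w γ e = trans (cong (_+ ⟦ l ⟧ * w) (⟦⟧-* (+ 2) k))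
     (trans (solve 3 (λ k l w → con (+ 2) :* k :+ l :* w := con (+ 2) :* k :+ l :* (con (+ 0) :+ con (+ 1) :* w)) refl ⟦ k ⟧ ⟦ l ⟧ w)
     (trans (cong (λ z → ⟦ + 2 ⟧ * ⟦ k ⟧ + ⟦ l ⟧ * z) (sym e))
       (solve 3 (λ k l γ → con (+ 2) :* k :+ l :* (con (+ 2) :* γ) := con (+ 2) :* (k :+ l :* γ)) refl ⟦ k ⟧ ⟦ l ⟧ γ)))

   -- With 2γ = 1 + ω, an element (2k + l) + lω of the ideal is twice k + lγ.
   split₆₅ : ∀ k l w γ → ⟦ + 2 ⟧ * γ ≡ ⟦ + 1 ⟧ + ⟦ + 1 ⟧ * w → ⟦ + 2 ℤ.* k ℤ.+ l ⟧ + ⟦ l ⟧ * w ≡ ⟦ + 2 ⟧ * (⟦ k ⟧ + ⟦ l ⟧ * γ)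
   split₆₅ k l w γ e = trans (cong (_+ ⟦ l ⟧ * w) (trans (⟦⟧-+ (+ 2 ℤ.* k) l) (cong (_+ ⟦ l ⟧) (⟦⟧-* (+ 2) k))))
     (trans (solve 3 (λ k l w → con (+ 2) :* k :+ l :+ l :* w := con (+ 2) :* k :+ l :* (con (+ 1) :+ con (+ 1) :* w)) refl ⟦ k ⟧ ⟦ l ⟧ w)
     (trans (cong (λ z → ⟦ + 2 ⟧ * ⟦ k ⟧ + ⟦ l ⟧ * z) (sym e))
       (solve 3 (λ k l γ → con (+ 2) :* k :+ l :* (con (+ 2) :* γ) := con (+ 2) :* (k :+ l :* γ)) refl ⟦ k ⟧ ⟦ l ⟧ γ)))

   parity₁₀ : ∀ a c q → ⟦ + 2 ⟧ * q ≡ a → a + ⟦ + 2 ⟧ * c ≡ ⟦ + 2 ⟧ * (q + c)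
   parity₁₀ _ c q refl = solve 2 (λ c q → con (+ 2) :* q :+ con (+ 2) :* c := con (+ 2) :* (q :+ c)) refl c q

   parity₆₅ : ∀ a b c d q → ⟦ + 2 ⟧ * q ≡ a + - b → (a + ⟦ + 2 ⟧ * c) + - (b + ⟦ + 2 ⟧ * d) ≡ ⟦ + 2 ⟧ * (q + (c + - d))
   parity₆₅ a b c d q e = trans (solve 4 (λ a b c d → (a :+ con (+ 2) :* c) :- (b :+ con (+ 2) :* d) := (a :- b) :+ con (+ 2) :* (c :- d)) refl a b c d)
     (parity₁₀ (a + - b) (c + - d) q e)

 module DoubledGenerator {D : ℕ} (disc : Discriminant D) (γ : F) (h : O) where
   open Instance disc
   open Ambient ambient

   doubled : mulF D (ιℤ (+ 2)) γ ≡ ιO h → ⟦ + 2 ⟧ * γ ≡ ι h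
   doubled e = trans (trans (cong (_* γ) (sym (int≡ (+ 2)))) (sym (mul≡ D (ιℤ (+ 2)) γ))) (trans e (sym (sealed-ι h)))

 private module I = HalfCoordinates ℤ-scalars

 -- A list with one half-integral form; every other index is contradictory.
 alone : Gram × Kind → ℕ → Gram × Kind
 alone φ zero    = φ
 alone φ (suc _) = noForm

 alone-closed : ∀ {G h mem} → (∀ t u → mem t ≡ true → mem (t ⊕ 2 · u) ≡ true) → Closed (alone (G , half h mem))
 alone-closed c zero    refl = c
 alone-closed c (suc i) refl t u ()

 mem₁₀-closed : ∀ t u → mem₁₀ t ≡ true → mem₁₀ (t ⊕ 2 · u) ≡ true
 mem₁₀-closed (a ∶ b) (c ∶ d) h = trans (cong (divℤ 2) (I.parity₁₀ a c (quotℤ 2 a) (divℤ-sound 2 a (s≤s z≤n) h)))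
   (divℤ-complete 2 (quotℤ 2 a ℤ.+ c))

 mem₆₅-closed : ∀ t u → mem₆₅ t ≡ true → mem₆₅ (t ⊕ 2 · u) ≡ true
 mem₆₅-closed (a ∶ b) (c ∶ d) h =
   trans (cong (divℤ 2) (I.parity₆₅ a b c d (quotℤ 2 (a ℤ.- b)) (divℤ-sound 2 (a ℤ.- b) (s≤s z≤n) h)))
     (divℤ-complete 2 (quotℤ 2 (a ℤ.- b) ℤ.+ (c ℤ.- d)))

 γ₁₀ γ₆₅ : F
 γ₁₀ = el (+ 0) (+ 1) 2
 γ₆₅ = mulF 65 (ιℚ ½) (n 1 +F ω 65)

 forms10 forms65 : ℕ → Gram × Kind
 forms10 = alone (g10-0 , half (0 & 1) mem₁₀)
 forms65 = alone (g65-0 , half (1 & 1) mem₆₅)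

 accepted10 : Accepted disc10 forms10 c10
 accepted10 = refl
 accepted65 : Accepted disc65 forms65 c65
 accepted65 = refl

 Splits : ∀ {D} → Discriminant D → F → O → (O → Bool) → Set
 Splits disc γ h mem = ∀ t → mem t ≡ true → ⟦ + 2 ⟧ * γ ≡ ι h → ∃ λ m → ∃ λ n → ι t ≡ ⟦ + 2 ⟧ * (⟦ m ⟧ + ⟦ n ⟧ * γ)
   where open Ambient (Instance.ambient disc)

 -- A combination σ of ideal elements and an integral τ with hτ divisible by 2 would satisfy στ = 2,
 -- which would make the fractional ideal principal.
 NotPrincipal : ∀ {D} → Discriminant D → O → (O → Bool) → Set
 NotPrincipal disc h mem = ∀ c₁ c₂ c₃ t₁ t₂ t₃ τ τ′ → mem t₁ ≡ true → mem t₂ ≡ true → mem t₃ ≡ true →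
     (c₁ ⊗ t₁ ⊕ c₂ ⊗ t₂ ⊕ c₃ ⊗ t₃) ⊗ τ ≡ (+ 2 ∶ + 0) → h ⊗ τ ≡ 2 · τ′ → ⊥
   where open Arithmetic (Discriminant.s disc) (Discriminant.p disc) (Discriminant.Δ disc)

 module NonFree {D : ℕ} (disc : Discriminant D) (γ : F) (h : O) (mem : O → Bool) (G : Gram)
   (closed : ∀ t u → mem t ≡ true → mem (t ⊕ 2 · u) ≡ true) (cert : Cert₁) (ok : Accepted disc (alone (G , half h mem)) cert)
   (2γ : mulF D (ιℤ (+ 2)) γ ≡ Instance.ιO disc h)
   (split : Splits disc γ h mem) (impossible : NotPrincipal disc h mem)
   (Q : Form) (k : ℕ) (g : Fin k → V) (integral : IntegralLat D Q k g) (univ : Universal D Q k g) where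
   open Classify disc (alone (G , half h mem)) (alone-closed {G} {h} {mem} closed) cert ok Q k g integral univ

   corresponds : ∀ G i → Corresponds (alone (G , half h mem) i) → ¬ Free D k g × CorrWith D (InZSpan D γ) Q k g (formOf G)
   corresponds (gram _ _ _ _ _ _) zero (base , basis) = not-free impossible , corresponds-half (λ t m → split t m 2γ′)
     where
     2γ′ = DoubledGenerator.doubled disc γ h 2γ
     open HalfIdeal γ h mem 2γ′ base basis
   corresponds G (suc i) c = ⊥-elim (noForm-absurd c)

   conclusion : ¬ Free D k g × CorrWith D (InZSpan D γ) Q k g (formOf G)
   conclusion = corresponds G (proj₁ classified) (proj₂ classified)

 split-at₁₀ : let open Ambient (Instance.ambient disc10) in
   ∀ t → mem₁₀ t ≡ true → ⟦ + 2 ⟧ * γ₁₀ ≡ ι (0 & 1) → ∃ λ m → ∃ λ n → ι t ≡ ⟦ + 2 ⟧ * (⟦ m ⟧ + ⟦ n ⟧ * γ₁₀)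
 split-at₁₀ t h e = go (Sqrt10.mem-sound t h)
   where
   open Ambient (Instance.ambient disc10)
   go : ∀ {t} → Sqrt10.Even t → ∃ λ m → ∃ λ n → ι t ≡ ⟦ + 2 ⟧ * (⟦ m ⟧ + ⟦ n ⟧ * γ₁₀)
   go (k , l , refl) = k , l , HalfCoordinates.split₁₀ (F-scalars 10) k l w γ₁₀ e

 split-at₆₅ : let open Ambient (Instance.ambient disc65) in
   ∀ t → mem₆₅ t ≡ true → ⟦ + 2 ⟧ * γ₆₅ ≡ ι (1 & 1) → ∃ λ m → ∃ λ n → ι t ≡ ⟦ + 2 ⟧ * (⟦ m ⟧ + ⟦ n ⟧ * γ₆₅)
 split-at₆₅ t h e = go (Sqrt65.mem-sound t h)
   where
   open Ambient (Instance.ambient disc65)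
   go : ∀ {t} → Sqrt65.Even t → ∃ λ m → ∃ λ n → ι t ≡ ⟦ + 2 ⟧ * (⟦ m ⟧ + ⟦ n ⟧ * γ₆₅)
   go (k , l , refl) = k , l , HalfCoordinates.split₆₅ (F-scalars 65) k l w γ₆₅ e

 claim10 : Claim 10
 -- The `refl` after `accepted10` is the evaluated equation 2γ = √10 in F.
 claim10 Q k g i u = inj₂ (inj₂ (inj₁ (refl , NonFree.conclusion disc10 γ₁₀ (0 & 1) mem₁₀ g10-0 mem₁₀-closed c10 accepted10 refl
   split-at₁₀ Sqrt10.impossible Q k g i u)))

 claim65 : Claim 65
 claim65 Q k g i u = inj₂ (inj₂ (inj₂ (inj₂ (inj₂ (inj₂ (inj₂ (inj₂ (inj₁ (refl , NonFree.conclusion disc65 γ₆₅ (1 & 1) mem₆₅ g65-0 mem₆₅-closed c65 accepted65 refl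
   split-at₆₅ Sqrt65.impossible Q k g i u)))))))))

open import Defs
open import Data.Nat using (ℕ; _<_)
open import Data.Fin using (Fin)
open import Relation.Binary.PropositionalEquality using (_≢_)
open Certificates using (Cert₁)
open Refutation
open Tables
open Completeness using (∧-true)
open FreeCases
open NonFreeCases
open import Data.Nat using (_≤_; _<_; _≡ᵇ_; _≤ᵇ_)
open import Data.Bool using (false; _∨_)
open import Data.Bool.ListAction using (all; any)
open import Data.List using ([]; _∷_)
open import Data.List.Membership.Propositional.Properties using (∈-upTo⁺)
open import Data.List.Relation.Unary.All using ([]; _∷_)

-- Assembly over all D.

∨-true : ∀ {a b} → a ∨ b ≡ true → a ≡ true ⊎ b ≡ true
∨-true {true}  _ = inj₁ refl
∨-true {false} h = inj₂ h

∨-cases : ∀ a b c d → a ∨ (b ∨ (c ∨ d)) ≡ true → a ≡ true ⊎ b ≡ true ⊎ c ≡ true ⊎ d ≡ true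
∨-cases true  _     _     _ _ = inj₁ refl
∨-cases false true  _     _ _ = inj₂ (inj₁ refl)
∨-cases false false true  _ _ = inj₂ (inj₂ (inj₁ refl))
∨-cases false false false _ h = inj₂ (inj₂ (inj₂ h))

all-∈ : ∀ {A : Set} (f : A → Bool) {xs x} → all f xs ≡ true → x ∈ xs → f x ≡ true
all-∈ f {y ∷ xs} h (here refl) = proj₁ (∧-true {f y} h)
all-∈ f {y ∷ xs} h (there i)   = all-∈ f (proj₂ (∧-true {f y} h)) i

any-∈ : ∀ {A : Set} (f : A → Bool) xs → any f xs ≡ true → ∃ λ x → x ∈ xs × f x ≡ true
any-∈ f (y ∷ xs) h with ∨-true {f y} h
... | inj₁ e = y , here refl , e
... | inj₂ r with any-∈ f xs r
...   | x , i , e = x , there i , e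

≡ᵇ-sound : ∀ m n → (m ≡ᵇ n) ≡ true → m ≡ n
≡ᵇ-sound m n h = ℕ.≡ᵇ⇒≡ m n (Equivalence.from T-≡ h)

covered-below : ∀ n → all covered (upTo n) ≡ true → ∀ D → D < n → covered D ≡ true
covered-below n h D lt = all-∈ covered h (∈-upTo⁺ lt)

tabulated-valid : ∀ D l → all valid l ≡ true → tabulated D l ≡ true → ∃ λ cert → valid (D , cert) ≡ true
tabulated-valid D ((E , cert) ∷ l) h t = go (∨-true {D ≡ᵇ E} t)
  where
  v = ∧-true {valid (E , cert)} h
  go : (D ≡ᵇ E) ≡ true ⊎ tabulated D l ≡ true → ∃ λ cert → valid (D , cert) ≡ true
  go (inj₁ e) = cert , subst (λ D → valid (D , cert) ≡ true) (sym (≡ᵇ-sound D E e)) (proj₁ v)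
  go (inj₂ r) = tabulated-valid D l (proj₂ v) r

module _ (D : ℕ) (1<D : 1 < D) (squareFree : SquareFree D) (Q : Form) (k : ℕ) (g : Fin k → V)
  (integral : IntegralLat D Q k g) (univ : Universal D Q k g) where
  open Excluded D (ℕ.<⇒≤ 1<D) Q k g integral univ

  squareful-absurd : squareful D ≡ true → ⊥
  squareful-absurd h = go (any-∈ (λ n → D ℕ.% ((2 ℕ.+ n) ℕ.* (2 ℕ.+ n)) ≡ᵇ 0) (upTo 30) h)
    where
    2+m≢1 : ∀ {m} → 2 ℕ.+ m ≢ 1
    2+m≢1 ()
    go : (∃ λ m → m ∈ upTo 30 × (D ℕ.% ((2 ℕ.+ m) ℕ.* (2 ℕ.+ m)) ≡ᵇ 0) ≡ true) → ⊥
    go (m , _ , e) = 2+m≢1 (squareFree (2 ℕ.+ m) (ℕ.m%n≡0⇒n∣m D ((2 ℕ.+ m) ℕ.* (2 ℕ.+ m)) (≡ᵇ-sound (D ℕ.% ((2 ℕ.+ m) ℕ.* (2 ℕ.+ m))) 0 e)))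

  sparse-absurd : sparse D ≡ true → ⊥
  sparse-absurd = go (D ℕ.% 4) refl
    where
    false≢true : false ≢ true
    false≢true ()
    go : ∀ r → D ℕ.% 4 ≡ r → not (r ≡ᵇ 1) ∧ (241 ≤ᵇ D) ≡ true → ⊥
    go r e h = large₀ (λ e′ → false≢true (subst (λ r → not (r ≡ᵇ 1) ≡ true) (trans (sym e) e′) (proj₁ (∧-true {not (r ≡ᵇ 1)} h))))
      (ℕ.≤ᵇ⇒≤ 241 D (Equivalence.from T-≡ (proj₂ (∧-true {not (r ≡ᵇ 1)} h))))

  listed-absurd : listed D ≡ true → ⊥
  listed-absurd h = go (any-∈ (tabulated D) tables h)
    where
    go : (∃ λ l → l ∈ tables × tabulated D l ≡ true) → ⊥
    go (l , i , t) = refuted (proj₁ found) (proj₂ found)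
      where found = tabulated-valid D l (All.lookup tables-valid i) t

  -- Of the four reasons for being covered, a square factor contradicts squarefreeness, and the
  -- other two non-exceptional ones contradict the existence of L.
  unexceptional : covered D ≡ true → D ∈ exceptions
  unexceptional h = cases (∨-cases (exceptional D) (squareful D) (sparse D) (listed D) h)
    where
    cases : exceptional D ≡ true ⊎ squareful D ≡ true ⊎ sparse D ≡ true ⊎ listed D ≡ true → D ∈ exceptions
    cases (inj₁ e) = let (E , i , e′) = any-∈ (D ≡ᵇ_) exceptions e in subst (_∈ exceptions) (sym (≡ᵇ-sound D E e′)) i
    cases (inj₂ (inj₁ h))        = ⊥-elim (squareful-absurd h)
    cases (inj₂ (inj₂ (inj₁ h))) = ⊥-elim (sparse-absurd h)
    cases (inj₂ (inj₂ (inj₂ h))) = ⊥-elim (listed-absurd h)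

-- The values 0 and 1 contradict 1 < D, the values 2, 3, 5 are excluded by assumption, and the
-- remaining positions match the ten classified fields in order.
claim : ∀ D → D ∈ exceptions → 1 < D → D ≢ 2 → D ≢ 3 → D ≢ 5 → Claim D
claim _ (here refl) () _ _ _
claim _ (there (here refl)) (s≤s ()) _ _ _
claim _ (there (there (here refl))) _ ne _ _ = ⊥-elim (ne refl)
claim _ (there (there (there (here refl)))) _ _ ne _ = ⊥-elim (ne refl)
claim _ (there (there (there (there (here refl))))) _ _ _ ne = ⊥-elim (ne refl)
claim _ (there (there (there (there (there i))))) _ _ _ _ = All.lookup {P = Claim}
  (claim6 ∷ claim7 ∷ claim10 ∷ claim13 ∷ claim17 ∷ claim21 ∷ claim33 ∷ claim41 ∷ claim65 ∷ claim77 ∷ []) i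

theorem7p6 : (D : ℕ) → 1 < D → SquareFree D → D ≢ 2 → D ≢ 3 → D ≢ 5 →
    (Q : Form) (k : ℕ) (g : Fin k → V) →
    SpansV D k g → IntegralLat D Q k g → Universal D Q k g →
    Classification D Q k g
theorem7p6 D 1<D sf ne₂ ne₃ ne₅ Q k g _ integral univ = decide (961 ℕ.≤? D)
  where
  decide : Dec (961 ≤ D) → Classification D Q k g
  decide (yes large) = ⊥-elim (Excluded.large D (ℕ.<⇒≤ 1<D) Q k g integral univ large)
  decide (no ¬large) = claim D (unexceptional D 1<D sf Q k g integral univ (covered-below 961 coverage D (ℕ.≰⇒> ¬large)))
    1<D ne₂ ne₃ ne₅ Q k g integral univ
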